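{- The $Z$-polynomials of fan graphs, wheel graphs and whirl matroids are \[ Z_{F_n}(t)=\sum _{k = 0}^{n}\frac{1}{n+1} \binom {n + 1} {k+1}\binom {n + 1} {k} t^k \quad (n\ge 1), \] \[ Z_{W_n}(t)= \sum _{k = 0}^n \left(\binom {n} {k}^2 - \frac {2}{n} \binom {n} {k +1}\binom {n} {k - 1}\right)t^k \quad (n\ge 3), \] \[ Z_{W^n}(t)=\sum _{k = 0}^n \binom {n} {k}^2 t^k \quad (n\ge 3), \] with the convention $\binom{n}{j}=0$ for $j<0$ or $j>n$.
   Context: For a matroid $M$ let $L(M)$ be its lattice of flats, $\mathrm{rk}\, M$ its rank, $\chi_M(t)$ its characteristic polynomial; for a flat $F$, $M_F$ is the localization (restriction to $F$) and $M^F$ the contraction at $F$. The Kazhdan–Lusztig polynomial is the unique assignment of $P_M(t)\in\mathbb{Z}[t]$ to each loopless matroid $M$ with: $P_M=1$ if $\mathrm{rk}\, M=0$; $\deg P_M<\frac12\mathrm{rk}\, M$ if $\mathrm{rk}\, M>0$; $t^{\mathrm{rk}\, M}P_M(t^{ -1})=\sum_{F\in L(M)}\chi_{M_F}(t)P_{M^F}(t)$. The $Z$-polynomial of $M$ is $Z_M(t)=\sum_{F\in L(M)}t^{\mathrm{rk}\, M_F}P_{M^F}(t)$; for a graph $G$, $Z_G=Z_{M(G)}$ for its graphic matroid. The fan graph $F_n$ has vertices $0,1,\dots,n$, edges $\{i,i+1\}$ ($1\le i<n$) and $\{0,i\}$ ($1\le i\le n$). The wheel $W_n$ ($n\ge3$)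 has vertices $0,\dots,n$, the edges of the cycle $1,2,\dots,n,1$ (edge set $O_n$) and edges $\{0,i\}$ ($1\le i\le n$). The whirl matroid $W^n$ is the matroid on $E(W_n)$ whose independent sets are the edge sets of forests of $W_n$ together with $O_n$. -}

module Defs where

open import Data.Bool using (Bool; true; false; _∧_; _∨_; not; if_then_else_)
open import Data.Nat as ℕ using (ℕ; zero; suc; _≤_; _<_; _∸_; _≤ᵇ_; _<ᵇ_; _≡ᵇ_)
open import Data.Integer as ℤ using (ℤ; +_; -[1+_])
open import Data.Nat.Combinatorics using (_C_)
open import Data.List using (List; []; _∷_; _++_; map; foldr; filterᵇ; upTo; allFin; length; lookup; [_])
open import Data.Bool.ListAction using (all; any)
open import Data.Vec using (Vec; []; _∷_; tabulate)
open import Data.Fin using (Fin; toℕ)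
open import Data.Fin.Subset as S using (Subset; _∈_; _∉_; _⊆_; _∪_; _∩_; ∁; ⁅_⁆; ∣_∣; _-_)
open import Data.Fin.Subset.Properties using (_⊆?_)
open import Data.Product using (_×_; _,_; proj₁; proj₂)
open import Relation.Binary.PropositionalEquality using (_≡_)
open import Relation.Nullary using (does)

subsets : (m : ℕ) → List (Subset m)
subsets zero    = [] ∷ []
subsets (suc m) = map (true ∷_) (subsets m) ++ map (false ∷_) (subsets m)

_⊆ᵇ_ : {m : ℕ} → Subset m → Subset m → Bool
A ⊆ᵇ B = does (A ⊆? B)

_==ˢ_ : {m : ℕ} → Subset m → Subset m → Bool
A ==ˢ B = (A ⊆ᵇ B) ∧ (B ⊆ᵇ A)

sumℤ : List ℤ → ℤ
sumℤ = foldr ℤ._+_ (+ 0)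

maxℕ : List ℕ → ℕ
maxℕ = foldr ℕ._⊔_ 0

-- Matroids, given by their rank function.
-- A matroid has ground set E ⊆ Fin m and a rank function rk; only the
-- values of rk on subsets of E are meaningful.

record Matroid : Set where
  constructor mkMatroid
  field
    m  : ℕ
    E  : Subset m
    rk : Subset m → ℕ

open Matroid public

record IsMatroid (M : Matroid) : Set where
  field
    rk-bound : ∀ A → A ⊆ E M → rk M A ≤ ∣ A ∣
    rk-mono  : ∀ A B → B ⊆ E M → A ⊆ B → rk M A ≤ rk M B
    rk-submod : ∀ A B → A ⊆ E M → B ⊆ E M →
                rk M (A ∪ B) ℕ.+ rk M (A ∩ B) ≤ rk M A ℕ.+ rk M B

Loopless : Matroid → Set
Loopless M = ∀ e → e ∈ E M → rk M ⁅ e ⁆ ≡ 1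

rank : Matroid → ℕ
rank M = rk M (E M)

isFlat : (M : Matroid) → Subset (m M) → Bool
isFlat M F = (F ⊆ᵇ E M) ∧
  all (λ e → not (Data.Vec.lookup (E M) e ∧ not (Data.Vec.lookup F e))
             ∨ (rk M F <ᵇ rk M (F ∪ ⁅ e ⁆)))
      (allFin (m M))
  where import Data.Vec

flats : (M : Matroid) → List (Subset (m M))
flats M = filterᵇ (isFlat M) (subsets (m M))

loc : (M : Matroid) → Subset (m M) → Matroid
loc M F = mkMatroid (m M) F (rk M)

con : (M : Matroid) → Subset (m M) → Matroid
con M F = mkMatroid (m M) (E M ∩ ∁ F) (λ A → rk M (A ∪ F) ∸ rk M F)

-- Polynomials over ℤ as coefficient functions (k ↦ coefficient of t^k)

Poly : Set
Poly = ℕ → ℤ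

_⊛_ : Poly → Poly → Poly
(p ⊛ q) k = sumℤ (map (λ i → p i ℤ.* q (k ∸ i)) (upTo (suc k)))

-- t^r p(t⁻¹), for p of degree ≤ r
rev : ℕ → Poly → Poly
rev r p k = if k ≤ᵇ r then p (r ∸ k) else + 0

signℤ : ℕ → ℤ
signℤ n = if (n ℕ.% 2) ≡ᵇ 0 then + 1 else -[1+ 0 ]

χ : Matroid → Poly
χ M i = sumℤ (map (λ A → if (A ⊆ᵇ E M) ∧ ((rank M ∸ rk M A) ≡ᵇ i)
                          then signℤ ∣ A ∣ else + 0)
                   (subsets (m M)))

record IsKL (P : Matroid → Poly) : Set where
  field
    rank-zero : ∀ M → IsMatroid M → Loopless M → rank M ≡ 0 →
                ∀ k → P M k ≡ (if k ≡ᵇ 0 then + 1 else + 0)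
    degree    : ∀ M → IsMatroid M → Loopless M → 0 < rank M →
                ∀ k → rank M ≤ 2 ℕ.* k → P M k ≡ + 0
    equation  : ∀ M → IsMatroid M → Loopless M →
                ∀ k → rev (rank M) (P M) k
                      ≡ sumℤ (map (λ F → (χ (loc M F) ⊛ P (con M F)) k) (flats M))

Z : (Matroid → Poly) → Matroid → Poly
Z P M k = sumℤ (map (λ F → if rk M F ≤ᵇ k then P (con M F) (k ∸ rk M F) else + 0)
                    (flats M))

-- Graphs: vertices 0..nv-1, edges a list of (unordered) pairs of vertices

record Graph : Set where
  constructor mkGraph
  field
    nv    : ℕ
    edges : List (ℕ × ℕ)

open Graph public

nE : Graph → ℕ
nE G = length (edges G)

edge : (G : Graph) → Fin (nE G) → ℕ × ℕ
edge G e = lookup (edges G) e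

step : (G : Graph) → Subset (nE G) → (ℕ → Bool) → (ℕ → Bool)
step G A R w = R w ∨ any (λ e → Data.Vec.lookup A e ∧
                          (  (R (proj₁ (edge G e)) ∧ (proj₂ (edge G e) ≡ᵇ w))
                           ∨ (R (proj₂ (edge G e)) ∧ (proj₁ (edge G e) ≡ᵇ w))))
                         (allFin (nE G))
  where import Data.Vec

iter : ℕ → ((ℕ → Bool) → (ℕ → Bool)) → (ℕ → Bool) → (ℕ → Bool)
iter zero    f R = R
iter (suc n) f R = f (iter n f R)

connected : (G : Graph) → Subset (nE G) → ℕ → ℕ → Bool
connected G A u v = iter (nv G) (step G A) (λ w → u ≡ᵇ w) v

isForest : (G : Graph) → Subset (nE G) → Bool
isForest G A = all (λ e → not (Data.Vec.lookup A e) ∨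
                          not (connected G (A - e) (proj₁ (edge G e)) (proj₂ (edge G e))))
                   (allFin (nE G))
  where import Data.Vec

rkFromIndep : {m : ℕ} → (Subset m → Bool) → Subset m → ℕ
rkFromIndep {m} ind A = maxℕ (map (λ B → if (B ⊆ᵇ A) ∧ ind B then ∣ B ∣ else 0) (subsets m))

graphic : Graph → Matroid
graphic G = mkMatroid (nE G) S.⊤ (rkFromIndep (isForest G))

fan : ℕ → Graph
fan n = mkGraph (suc n)
  (map (λ i → (0 , suc i)) (upTo n) ++ map (λ i → (suc i , suc (suc i))) (upTo (n ∸ 1)))

wheel : ℕ → Graph
wheel n = mkGraph (suc n)
  (map (λ i → (suc i , suc (suc i))) (upTo (n ∸ 1)) ++ [ (n , 1) ] ++
   map (λ i → (0 , suc i)) (upTo n))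

rim : (n : ℕ) → Subset (nE (wheel n))
rim n = tabulate (λ e → not (proj₁ (edge (wheel n) e) ≡ᵇ 0) ∧
                        not (proj₂ (edge (wheel n) e) ≡ᵇ 0))

whirl : ℕ → Matroid
whirl n = mkMatroid (nE (wheel n)) S.⊤
  (rkFromIndep (λ A → isForest (wheel n) A ∨ (A ==ˢ rim n)))

choose : ℕ → ℤ → ℤ
choose n (+ j)    = + (n C j)
choose n -[1+ j ] = + 0

{-# OPTIONS --safe #-}
module Submission where

open import Defs
open import Data.Nat using (ℕ; zero; suc; _+_; _∸_; _≤_; _<_; z≤n; s≤s; _≤ᵇ_; _<ᵇ_; _≡ᵇ_; _⊔_) renaming (_*_ to _*ℕ_)
open import Data.Nat.Combinatorics using (_C_)
open import Data.Integer using (ℤ; +_; -[1+_]; _*_; _-_; -_) renaming (_+_ to _+ᶻ_; pred to predᶻ; _≤_ to _≤ᶻ_; _<_ to _<ᶻ_)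
open import Data.Product using (_×_; _,_; proj₁; proj₂; ∃)
open import Data.Sum using (_⊎_; inj₁; inj₂)
open import Data.Empty using (⊥-elim) renaming (⊥ to Empty)
open import Data.Bool using (Bool; true; false; _∧_; _∨_; not; if_then_else_; T)
open import Data.Bool.ListAction using (all; any)
open import Data.List using (List; []; _∷_; map; _++_; filterᵇ; upTo; applyUpTo; allFin; tabulate; length)
open import Data.Vec using (Vec; []; _∷_; here; there; lookup; replicate; take; drop; _∷ʳ_) renaming (_++_ to _++ⱽ_)
open import Data.Fin using (Fin; zero; suc; toℕ; fromℕ<; _↑ˡ_; _↑ʳ_)
open import Data.Fin.Subset using (Subset; _∈_; _∉_; _⊆_; _∪_; _∩_; ∁; ⁅_⁆; ∣_∣; ⊤; ⊥) renaming (_-_ to _∖_)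
open import Function using (_∘_; id; case_of_)
open import Relation.Nullary using (¬_; yes; no)
open import Relation.Nullary.Decidable using (_×-dec_; ¬?)
open import Relation.Binary.Definitions using (Tri; tri<; tri≈; tri>)
open import Relation.Binary.PropositionalEquality using (_≡_; _≢_; refl; sym; trans; cong; cong₂; subst; subst₂)
open import Data.Integer.Tactic.RingSolver using (solve-∀)
open import Data.Nat.Tactic.RingSolver using () renaming (solve-∀ to solveℕ-∀)
import Data.Nat
import Data.Sum
import Data.List
import Data.Vec
import Data.Unit
import Data.Integer
import Data.Nat.Combinatorics as Comb
import Data.Nat.Properties as ℕₚ
import Data.Integer.Properties as ℤₚ
import Data.Bool.Properties as 𝔹ₚ
import Data.Fin.Properties as Finₚ
import Data.Fin.Subset.Properties as Sₚ
import Data.Vec.Properties as Vₚ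
import Data.List.Properties as Lₚ

-- The Kazhdan–Lusztig polynomials of all contractions of a matroid are determined by
-- their degree bounds and the palindromicity of the sums Σ t^(rk F - rk G) q_F over the
-- flats F above each flat G: an alternating sum over subsets turns palindromicity into
-- the defining recursion.  A flat of a fan, wheel or whirl is a word of rim and spoke
-- bits in which no triangle contains exactly two edges, and q_F counts weighted Motzkin
-- paths along the rim between consecutive positions joined to the hub.  Homogenised in
-- two variables α and β with t = α/β, the sum over the flats above G is a product of
-- transfer operators, and eliminating the hub leaves walks on ℕ whose weights are
-- symmetric in α and β; this is the palindromicity.  For G = ∅ the walks are counted by
-- binom(n,i) binom(n,j), corrected by the reflection principle for fans and wheels.

-- Height 0 of a walk stands for the hub, and a spoke bit confines the walk to height 0 or to
-- positive heights. A triangle with exactly two edges then asks for an impossible step, so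
-- non-flats get weight 0 by themselves, and a sum over flats becomes a sum over all bit vectors,
-- which factors letter by letter. Only the sets consisting of all rim edges, or of all but one,
-- need separate care. The step weights 1 (up), β (level) and αβ (down) never contain more α than β;
-- an excess of α can come only from rim edges of the flat, and this yields the degree bound. The
-- main obstacle is the flats without spokes: their closed walks avoid the hub and may start at any
-- height, so two divergent traces have to be compared. Wheel and whirl differ exactly there,
-- because the rim is a circuit and a hyperplane of the wheel that the whirl makes independent;
-- hence the same walks serve both, up to the correction `κ`.

-- Indicators and sums over subsets

ind : Bool → ℤ → ℤ
ind b x = if b then x else + 0

ind-zero : ∀ b → ind b (+ 0) ≡ + 0
ind-zero true  = refl
ind-zero false = refl

ind-+ : ∀ b x y → ind b (x +ᶻ y) ≡ ind b x +ᶻ ind b y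
ind-+ true  x y = refl
ind-+ false x y = refl

ind-∧ : ∀ a b x → ind (a ∧ b) x ≡ ind a (ind b x)
ind-∧ true  b x = refl
ind-∧ false b x = refl

ind-*ˡ : ∀ b x y → ind b x * y ≡ ind b (x * y)
ind-*ˡ true  x y = refl
ind-*ˡ false x y = refl

ind-*ʳ : ∀ b x y → x * ind b y ≡ ind b (x * y)
ind-*ʳ true  x y = refl
ind-*ʳ false x y = ℤₚ.*-zeroʳ x

ind-cong : ∀ b {x y} → (b ≡ true → x ≡ y) → ind b x ≡ ind b y
ind-cong true  h = h refl
ind-cong false h = refl

+-interchange : ∀ a b c d → (a +ᶻ b) +ᶻ (c +ᶻ d) ≡ (a +ᶻ c) +ᶻ (b +ᶻ d)
+-interchange = solve-∀

ΣS : ∀ {m} → (Subset m → ℤ) → ℤ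
ΣS {zero}  f = f []
ΣS {suc m} f = ΣS (f ∘ (true ∷_)) +ᶻ ΣS (f ∘ (false ∷_))

ΣS-cong : ∀ {m} {f g : Subset m → ℤ} → (∀ A → f A ≡ g A) → ΣS f ≡ ΣS g
ΣS-cong {zero}  h = h []
ΣS-cong {suc m} h = cong₂ _+ᶻ_ (ΣS-cong (h ∘ (true ∷_))) (ΣS-cong (h ∘ (false ∷_)))

ΣS-zero : ∀ {m} {f : Subset m → ℤ} → (∀ A → f A ≡ + 0) → ΣS f ≡ + 0
ΣS-zero {zero}  h = h []
ΣS-zero {suc m} h = cong₂ _+ᶻ_ (ΣS-zero (h ∘ (true ∷_))) (ΣS-zero (h ∘ (false ∷_)))

ΣS-+ : ∀ {m} (f g : Subset m → ℤ) → ΣS (λ A → f A +ᶻ g A) ≡ ΣS f +ᶻ ΣS g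
ΣS-+ {zero}  f g = refl
ΣS-+ {suc m} f g =
  trans (cong₂ _+ᶻ_ (ΣS-+ (f ∘ (true ∷_)) (g ∘ (true ∷_))) (ΣS-+ (f ∘ (false ∷_)) (g ∘ (false ∷_))))
        (+-interchange (ΣS (f ∘ (true ∷_))) (ΣS (g ∘ (true ∷_))) (ΣS (f ∘ (false ∷_))) (ΣS (g ∘ (false ∷_))))

ΣS-swap : ∀ {m n} (f : Subset m → Subset n → ℤ) → ΣS (λ A → ΣS (f A)) ≡ ΣS (λ B → ΣS (λ A → f A B))
ΣS-swap {zero}  f = refl
ΣS-swap {suc m} f =
  trans (cong₂ _+ᶻ_ (ΣS-swap (f ∘ (true ∷_))) (ΣS-swap (f ∘ (false ∷_))))
        (sym (ΣS-+ (λ B → ΣS (λ A → f (true ∷ A) B)) (λ B → ΣS (λ A → f (false ∷ A) B))))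

ΣS-ind : ∀ {m} b (f : Subset m → ℤ) → ΣS (λ A → ind b (f A)) ≡ ind b (ΣS f)
ΣS-ind true  f = refl
ΣS-ind {m} false f = ΣS-zero {m} (λ _ → refl)

ΣS-*ˡ : ∀ {m} c (f : Subset m → ℤ) → ΣS (λ A → c * f A) ≡ c * ΣS f
ΣS-*ˡ {zero}  c f = refl
ΣS-*ˡ {suc m} c f =
  trans (cong₂ _+ᶻ_ (ΣS-*ˡ c (f ∘ (true ∷_))) (ΣS-*ˡ c (f ∘ (false ∷_))))
        (sym (ℤₚ.*-distribˡ-+ c (ΣS (f ∘ (true ∷_))) (ΣS (f ∘ (false ∷_)))))

ΣS-*ʳ : ∀ {m} c (f : Subset m → ℤ) → ΣS (λ A → f A * c) ≡ ΣS f * c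
ΣS-*ʳ c f = trans (ΣS-cong (λ A → ℤₚ.*-comm (f A) c)) (trans (ΣS-*ˡ c f) (ℤₚ.*-comm c (ΣS f)))

sumℤ-++ : ∀ xs ys → sumℤ (xs ++ ys) ≡ sumℤ xs +ᶻ sumℤ ys
sumℤ-++ []       ys = sym (ℤₚ.+-identityˡ _)
sumℤ-++ (x ∷ xs) ys = trans (cong (x +ᶻ_) (sumℤ-++ xs ys)) (sym (ℤₚ.+-assoc x (sumℤ xs) (sumℤ ys)))

sumℤ-subsets : ∀ m (f : Subset m → ℤ) → sumℤ (map f (subsets m)) ≡ ΣS f
sumℤ-subsets zero    f = ℤₚ.+-identityʳ _
sumℤ-subsets (suc m) f =
  trans (cong sumℤ (Lₚ.map-++ f (map (true ∷_) (subsets m)) (map (false ∷_) (subsets m))))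
  (trans (sumℤ-++ (map f (map (true ∷_) (subsets m))) (map f (map (false ∷_) (subsets m))))
  (cong₂ _+ᶻ_ (half true) (half false)))
  where
  half : ∀ b → sumℤ (map f (map (b ∷_) (subsets m))) ≡ ΣS (f ∘ (b ∷_))
  half b = trans (cong sumℤ (sym (Lₚ.map-∘ (subsets m)))) (sumℤ-subsets m (f ∘ (b ∷_)))

sumℤ-filter : ∀ {A : Set} (p : A → Bool) (f : A → ℤ) xs →
              sumℤ (map f (filterᵇ p xs)) ≡ sumℤ (map (λ x → ind (p x) (f x)) xs)
sumℤ-filter p f []       = refl
sumℤ-filter p f (x ∷ xs) with p x
... | true  = cong (f x +ᶻ_) (sumℤ-filter p f xs)
... | false = trans (sumℤ-filter p f xs) (sym (ℤₚ.+-identityˡ _))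

sumℤ-flats : ∀ M (f : Subset (m M) → ℤ) → sumℤ (map f (flats M)) ≡ ΣS (λ F → ind (isFlat M F) (f F))
sumℤ-flats M f = trans (sumℤ-filter (isFlat M) f (subsets (m M))) (sumℤ-subsets (m M) _)

sumℤ-ΣS : ∀ {m} {X : Set} (g : X → Subset m → ℤ) xs →
          sumℤ (map (λ x → ΣS (g x)) xs) ≡ ΣS (λ A → sumℤ (map (λ x → g x A) xs))
sumℤ-ΣS {m} g [] = sym (ΣS-zero {m} (λ _ → refl))
sumℤ-ΣS g (x ∷ xs) = trans (cong (ΣS (g x) +ᶻ_) (sumℤ-ΣS g xs)) (sym (ΣS-+ (g x) _))

sumℤ-applyUpTo : ∀ n (g : ℕ → ℕ) (f : ℕ → ℤ) → sumℤ (map f (applyUpTo g n)) ≡ sumℤ (map (f ∘ g) (upTo n))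
sumℤ-applyUpTo n g f =
  cong sumℤ (trans (Lₚ.map-applyUpTo g f n) (sym (Lₚ.map-applyUpTo id (f ∘ g) n)))

sumℤ-zero : ∀ {X : Set} (xs : List X) → sumℤ (map (λ _ → + 0) xs) ≡ + 0
sumℤ-zero []       = refl
sumℤ-zero (x ∷ xs) = trans (ℤₚ.+-identityˡ _) (sumℤ-zero xs)

sumℤ-delta : ∀ d n (x : ℕ → ℤ) →
             sumℤ (map (λ i → ind (d ≡ᵇ i) (x i)) (upTo n)) ≡ ind (d <ᵇ n) (x d)
sumℤ-delta d       zero    x = sym (ind-zero (d <ᵇ 0))
sumℤ-delta zero    (suc n) x =
  trans (cong (x 0 +ᶻ_) (trans (sumℤ-applyUpTo n suc (λ i → ind (0 ≡ᵇ i) (x i))) (sumℤ-zero (upTo n))))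
        (ℤₚ.+-identityʳ _)
sumℤ-delta (suc d) (suc n) x =
  trans (ℤₚ.+-identityˡ _)
        (trans (sumℤ-applyUpTo n suc (λ i → ind (suc d ≡ᵇ i) (x i))) (sumℤ-delta d n (x ∘ suc)))

-- Subsets as Boolean vectors, and flats

true⇔⇒≡ : ∀ {a b} → (a ≡ true → b ≡ true) → (b ≡ true → a ≡ true) → a ≡ b
true⇔⇒≡ {true}  {true}  f g = refl
true⇔⇒≡ {true}  {false} f g = sym (f refl)
true⇔⇒≡ {false} {true}  f g = g refl
true⇔⇒≡ {false} {false} f g = refl

∧-trueˡ : ∀ {a b} → a ∧ b ≡ true → a ≡ true
∧-trueˡ {true} h = refl

∧-trueʳ : ∀ {a b} → a ∧ b ≡ true → b ≡ true
∧-trueʳ {true} h = h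

∧-true : ∀ {a b} → a ≡ true → b ≡ true → a ∧ b ≡ true
∧-true refl h = h

true≢false : ∀ {b} {X : Set} → b ≡ true → b ≡ false → X
true≢false refl ()

≢true⇒≡false : ∀ {b} → ¬ b ≡ true → b ≡ false
≢true⇒≡false {true}  h = ⊥-elim (h refl)
≢true⇒≡false {false} h = refl

T⇒≡ : ∀ {b} → T b → b ≡ true
T⇒≡ {true} _ = refl

≡⇒T : ∀ {b} → b ≡ true → T b
≡⇒T refl = _

infix 5 _⊑_
_⊑_ : ∀ {m} → Subset m → Subset m → Bool
[]      ⊑ []      = true
(a ∷ A) ⊑ (b ∷ B) = (not a ∨ b) ∧ (A ⊑ B)

⊑⇒⊆ : ∀ {m} {A B : Subset m} → A ⊑ B ≡ true → A ⊆ B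
⊑⇒⊆ {A = []}        {[]}       h ()
⊑⇒⊆ {A = true ∷ A}  {true ∷ B} h here      = here
⊑⇒⊆ {A = a ∷ A}     {b ∷ B}    h (there x) = there (⊑⇒⊆ (∧-trueʳ {not a ∨ b} h) x)

⊆⇒⊑ : ∀ {m} {A B : Subset m} → A ⊆ B → A ⊑ B ≡ true
⊆⇒⊑ {A = []}        {[]}        h = refl
⊆⇒⊑ {A = false ∷ A} {b ∷ B}     h = ⊆⇒⊑ (Sₚ.drop-∷-⊆ h)
⊆⇒⊑ {A = true ∷ A}  {true ∷ B}  h = ⊆⇒⊑ (Sₚ.drop-∷-⊆ h)
⊆⇒⊑ {A = true ∷ A}  {false ∷ B} h with h here
... | ()

⊆ᵇ⇒⊆ : ∀ {m} {A B : Subset m} → A ⊆ᵇ B ≡ true → A ⊆ B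
⊆ᵇ⇒⊆ {A = A} {B} h with A Sₚ.⊆? B
... | yes p = p
... | no  _ = case h of λ ()

⊆⇒⊆ᵇ : ∀ {m} {A B : Subset m} → A ⊆ B → A ⊆ᵇ B ≡ true
⊆⇒⊆ᵇ {A = A} {B} h with A Sₚ.⊆? B
... | yes _ = refl
... | no ¬p = ⊥-elim (¬p h)

⊆ᵇ≡⊑ : ∀ {m} (A B : Subset m) → (A ⊆ᵇ B) ≡ (A ⊑ B)
⊆ᵇ≡⊑ A B = true⇔⇒≡ (λ h → ⊆⇒⊑ (⊆ᵇ⇒⊆ {A = A} {B} h)) (λ h → ⊆⇒⊆ᵇ (⊑⇒⊆ {A = A} {B} h))

∈⇒lookup : ∀ {m} {A : Subset m} {e} → e ∈ A → lookup A e ≡ true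
∈⇒lookup = Vₚ.[]=⇒lookup

lookup⇒∈ : ∀ {m} {A : Subset m} {e} → lookup A e ≡ true → e ∈ A
lookup⇒∈ {A = A} {e} = Vₚ.lookup⇒[]= e A

∉⇒lookup : ∀ {m} {A : Subset m} {e} → e ∉ A → lookup A e ≡ false
∉⇒lookup h = ≢true⇒≡false (λ p → h (lookup⇒∈ p))

lookup⇒∉ : ∀ {m} {A : Subset m} {e} → lookup A e ≡ false → e ∉ A
lookup⇒∉ h p = true≢false (∈⇒lookup p) h

all-tabulate⁻ : ∀ {X : Set} {n} (p : X → Bool) (f : Fin n → X) → all p (tabulate f) ≡ true → ∀ i → p
    (f i) ≡ true
all-tabulate⁻ p f h zero    = ∧-trueˡ h
all-tabulate⁻ p f h (suc i) = all-tabulate⁻ p (f ∘ suc) (∧-trueʳ {p (f zero)} h) i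

all-tabulate⁺ : ∀ {X : Set} {n} (p : X → Bool) (f : Fin n → X) → (∀ i → p (f i) ≡ true) → all p
    (tabulate f) ≡ true
all-tabulate⁺ {n = zero}  p f h = refl
all-tabulate⁺ {n = suc n} p f h = ∧-true (h zero) (all-tabulate⁺ p (f ∘ suc) (h ∘ suc))

all-tabulate-false : ∀ {X : Set} {n} (p : X → Bool) (f : Fin n → X) → all p (tabulate f) ≡ false → ∃ λ i → p
    (f i) ≡ false
all-tabulate-false {n = zero}  p f ()
all-tabulate-false {n = suc n} p f h with p (f zero) in eq
... | false = zero , eq
... | true  with all-tabulate-false p (f ∘ suc) h
...   | i , q = suc i , q

any-tabulate⁻ : ∀ {X : Set} {n} (p : X → Bool) (f : Fin n → X) → any p (tabulate f) ≡ true → ∃ λ i → p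
    (f i) ≡ true
any-tabulate⁻ {n = zero}  p f ()
any-tabulate⁻ {n = suc n} p f h with p (f zero) in eq
... | true  = zero , eq
... | false with any-tabulate⁻ p (f ∘ suc) h
...   | i , q = suc i , q

any-tabulate⁺ : ∀ {X : Set} {n} (p : X → Bool) (f : Fin n → X) i → p (f i) ≡ true → any p (tabulate f) ≡ true
any-tabulate⁺ p f zero    h rewrite h = refl
any-tabulate⁺ p f (suc i) h rewrite any-tabulate⁺ p (f ∘ suc) i h = 𝔹ₚ.∨-zeroʳ _

isFlat⁻ : ∀ M F → isFlat M F ≡ true → F ⊆ E M × (∀ e → e ∈ E M → e ∉ F → rk M F < rk M (F ∪ ⁅ e ⁆))
isFlat⁻ M F h = ⊆ᵇ⇒⊆ (∧-trueˡ h) , λ e e∈E e∉F → ℕₚ.<ᵇ⇒< _ _ (≡⇒T (use e e∈E e∉F))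
  where
  use : ∀ e → e ∈ E M → e ∉ F → (rk M F <ᵇ rk M (F ∪ ⁅ e ⁆)) ≡ true
  use e e∈E e∉F with all-tabulate⁻ _ id (∧-trueʳ {F ⊆ᵇ E M} h) e
  ... | t rewrite ∈⇒lookup e∈E | ∉⇒lookup e∉F = t

isFlat⁺ : ∀ M F → F ⊆ E M → (∀ e → e ∈ E M → e ∉ F → rk M F < rk M (F ∪ ⁅ e ⁆)) → isFlat M F ≡ true
isFlat⁺ M F F⊆E h = ∧-true (⊆⇒⊆ᵇ F⊆E) (all-tabulate⁺ _ id use)
  where
  use : ∀ e → not (lookup (E M) e ∧ not (lookup F e)) ∨ (rk M F <ᵇ rk M (F ∪ ⁅ e ⁆)) ≡ true
  use e with lookup (E M) e in p | lookup F e in q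
  ... | false | _     = refl
  ... | true  | true  = refl
  ... | true  | false = T⇒≡ (ℕₚ.<⇒<ᵇ (h e (lookup⇒∈ p) (lookup⇒∉ q)))

isFlat-false : ∀ M F → F ⊆ E M → isFlat M F ≡ false →
               ∃ λ e → e ∈ E M × e ∉ F × rk M (F ∪ ⁅ e ⁆) ≤ rk M F
isFlat-false M F F⊆E h rewrite ⊆⇒⊆ᵇ F⊆E with all-tabulate-false _ id h
... | e , q with lookup (E M) e in p | lookup F e in r
...   | false | _     = case q of λ ()
...   | true  | true  = case q of λ ()
...   | true  | false = e , lookup⇒∈ p , lookup⇒∉ r , ℕₚ.≮⇒≥ (λ lt → true≢false (T⇒≡ (ℕₚ.<⇒<ᵇ lt)) q)

-- Rank functions and convolution with characteristic polynomials

record RankFunction {m} (r : Subset m → ℕ) : Set where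
  field
    bound  : ∀ A → r A ≤ ∣ A ∣
    mono   : ∀ {A B} → A ⊆ B → r A ≤ r B
    submod : ∀ A B → r (A ∪ B) + r (A ∩ B) ≤ r A + r B

shift : ℕ → Poly → Poly
shift d p k = if d ≤ᵇ k then p (k ∸ d) else + 0

sg : ∀ {m} → Subset m → ℤ
sg A = signℤ ∣ A ∣

sign-suc : ∀ n → signℤ (suc n) ≡ - signℤ n
sign-suc zero          = refl
sign-suc (suc zero)    = refl
sign-suc (suc (suc n)) = sign-suc n

-- Toggling one element of `F` pairs its subsets with opposite signs, so only the empty `F`
-- survives. This is what isolates a single flat in `q-equation`.
alternating-sum : ∀ {m} (F : Subset m) → ΣS (λ A → ind (A ⊑ F) (sg A)) ≡ ind (F ⊑ ⊥) (+ 1)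
alternating-sum []          = refl
alternating-sum {suc m} (false ∷ F) =
  trans (cong₂ _+ᶻ_ (ΣS-zero {m} (λ _ → refl)) (alternating-sum F)) (ℤₚ.+-identityˡ _)
alternating-sum (true ∷ F)  =
  trans (sym (ΣS-+ (λ A → ind (A ⊑ F) (sg (true ∷ A))) (λ A → ind (A ⊑ F) (sg A))))
        (ΣS-zero (λ A → trans (sym (ind-+ (A ⊑ F) (sg (true ∷ A)) (sg A)))
                        (trans (cong (ind (A ⊑ F)) (trans (cong (_+ᶻ sg A) (sign-suc ∣ A ∣))
                            (ℤₚ.+-inverseˡ (sg A))))
                               (ind-zero (A ⊑ F)))))

-- The map `F ↦ F ∪ G` is a bijection from the sets that contain `A` and avoid `G` onto the sets
-- that contain `A ∪ G`; there are none of the former unless `A` avoids `G`. It carries flats of the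
-- contraction at `G` to flats above `G`.
ΣS-above : ∀ {m} (A G : Subset m) (h : Subset m → ℤ) →
  ΣS (λ F → ind ((A ⊑ F) ∧ (F ⊑ ∁ G)) (h (F ∪ G))) ≡ ind (A ⊑ ∁ G) (ΣS (λ F → ind (A ∪ G ⊑ F) (h F)))
ΣS-above [] [] h = refl
ΣS-above {suc m} (true ∷ A) (true ∷ G) h =
  cong₂ _+ᶻ_ (ΣS-zero (λ F → cong (λ b → ind b (h (true ∷ (F ∪ G)))) (𝔹ₚ.∧-zeroʳ (A ⊑ F))))
      (ΣS-zero {m} (λ _ → refl))
ΣS-above {suc m} (true ∷ A) (false ∷ G) h =
  trans (cong₂ _+ᶻ_ (ΣS-above A G (h ∘ (true ∷_))) (ΣS-zero {m} (λ _ → refl)))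
  (trans (ℤₚ.+-identityʳ _) (cong (ind (A ⊑ ∁ G))
    (sym (trans (cong (ΣS (λ F → ind (A ∪ G ⊑ F) (h (true ∷ F))) +ᶻ_) (ΣS-zero {m} (λ _ → refl)))
        (ℤₚ.+-identityʳ _)))))
ΣS-above {suc m} (false ∷ A) (true ∷ G) h =
  trans (cong₂ _+ᶻ_ (ΣS-zero (λ F → cong (λ b → ind b (h (true ∷ (F ∪ G)))) (𝔹ₚ.∧-zeroʳ (A ⊑ F))))
      (ΣS-above A G (h ∘ (true ∷_))))
  (trans (ℤₚ.+-identityˡ _) (cong (ind (A ⊑ ∁ G))
    (sym (trans (cong (ΣS (λ F → ind (A ∪ G ⊑ F) (h (true ∷ F))) +ᶻ_) (ΣS-zero {m} (λ _ → refl)))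
        (ℤₚ.+-identityʳ _)))))
ΣS-above (false ∷ A) (false ∷ G) h =
  trans (cong₂ _+ᶻ_ (ΣS-above A G (h ∘ (true ∷_))) (ΣS-above A G (h ∘ (false ∷_))))
        (sym (ind-+ (A ⊑ ∁ G) (ΣS (λ F → ind (A ∪ G ⊑ F) (h (true ∷ F))))
            (ΣS (λ F → ind (A ∪ G ⊑ F) (h (false ∷ F))))))

-- χ is a signed sum of monomials over subsets, and multiplying by a monomial only shifts
-- coefficients. In the convolution a single index `i` survives for each subset.
χ-⊛ : ∀ M (p : Poly) k →
      (χ M ⊛ p) k ≡ ΣS (λ A → ind (A ⊑ E M) (sg A * shift (rank M ∸ rk M A) p k))
χ-⊛ M p k =
  trans (cong sumℤ (Lₚ.map-cong (λ i → trans (cong (_* p (k ∸ i)) (sumℤ-subsets (m M) (c i)))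
      (sym (ΣS-*ʳ (p (k ∸ i)) (c i)))) (upTo (suc k))))
  (trans (sumℤ-ΣS (λ i A → c i A * p (k ∸ i)) (upTo (suc k)))
  (ΣS-cong term))
  where
  d : Subset (m M) → ℕ
  d A = rank M ∸ rk M A
  c : ℕ → Subset (m M) → ℤ
  c i A = ind ((A ⊆ᵇ E M) ∧ (d A ≡ᵇ i)) (sg A)
  <ᵇ-suc : ∀ a b → (a <ᵇ suc b) ≡ (a ≤ᵇ b)
  <ᵇ-suc zero    b = refl
  <ᵇ-suc (suc a) b = refl
  swap : ∀ a b s x → ind (a ∧ b) s * x ≡ ind b (ind a (s * x))
  swap true  b s x = ind-*ˡ b s x
  swap false b s x = sym (ind-zero b)
  push : ∀ a b s x → ind b (ind a (s * x)) ≡ ind a (s * ind b x)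
  push true  b s x = sym (ind-*ʳ b s x)
  push false b s x = ind-zero b
  term : ∀ A → sumℤ (map (λ i → c i A * p (k ∸ i)) (upTo (suc k)))
               ≡ ind (A ⊑ E M) (sg A * shift (d A) p k)
  term A =
    trans (cong sumℤ (Lₚ.map-cong (λ i → swap (A ⊆ᵇ E M) (d A ≡ᵇ i) (sg A) (p (k ∸ i))) (upTo (suc k))))
    (trans (sumℤ-delta (d A) (suc k) (λ i → ind (A ⊆ᵇ E M) (sg A * p (k ∸ i))))
    (trans (cong (λ b → ind b (ind (A ⊆ᵇ E M) (sg A * p (k ∸ d A)))) (<ᵇ-suc (d A) k))
    (trans (push (A ⊆ᵇ E M) (d A ≤ᵇ k) (sg A) (p (k ∸ d A)))
           (cong (λ b → ind b (sg A * shift (d A) p k)) (⊆ᵇ≡⊑ A (E M))))))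

∸-cancel-∸ : ∀ a {b g} → g ≤ b → (a ∸ g) ∸ (b ∸ g) ≡ a ∸ b
∸-cancel-∸ a {b} {g} g≤b = trans (ℕₚ.∸-+-assoc a g (b ∸ g)) (cong (a ∸_) (ℕₚ.m+[n∸m]≡n g≤b))

≤ᵇ-true : ∀ {a b} → a ≤ b → (a ≤ᵇ b) ≡ true
≤ᵇ-true h = T⇒≡ (ℕₚ.≤⇒≤ᵇ h)

≤ᵇ-false : ∀ {a b} → b < a → (a ≤ᵇ b) ≡ false
≤ᵇ-false {a} {b} h = ≢true⇒≡false (λ t → ℕₚ.<⇒≱ h (ℕₚ.≤ᵇ⇒≤ a b (≡⇒T t)))

rev-≤ : ∀ {r k} p → k ≤ r → rev r p k ≡ p (r ∸ k)
rev-≤ p h rewrite ≤ᵇ-true h = refl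

rev-> : ∀ {r k} p → r < k → rev r p k ≡ + 0
rev-> p h rewrite ≤ᵇ-false h = refl

shift-≤ : ∀ {d k} p → d ≤ k → shift d p k ≡ p (k ∸ d)
shift-≤ p h rewrite ≤ᵇ-true h = refl

shift-> : ∀ {d k} p → k < d → shift d p k ≡ + 0
shift-> p h rewrite ≤ᵇ-false h = refl

shift-cong : ∀ d {p p′ : Poly} k → (∀ i → p i ≡ p′ i) → shift d p k ≡ shift d p′ k
shift-cong d k h with d ≤ᵇ k
... | true  = h (k ∸ d)
... | false = refl

-- Contractions, and uniqueness of their Kazhdan-Lusztig polynomials

module Contractions {m} (r : Subset m → ℕ) (R : RankFunction r) (loopless : ∀ e → r ⁅ e ⁆ ≡ 1) where
  open RankFunction R

  M₀ : Matroid
  M₀ = mkMatroid m ⊤ r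

  Flat : Subset m → Set
  Flat F = ∀ e → e ∉ F → r F < r (F ∪ ⁅ e ⁆)

  fl : Subset m → Bool
  fl = isFlat M₀

  fl⇒Flat : ∀ {F} → fl F ≡ true → Flat F
  fl⇒Flat {F} h e = proj₂ (isFlat⁻ M₀ F h) e Sₚ.∈⊤

  Flat⇒fl : ∀ {F} → Flat F → fl F ≡ true
  Flat⇒fl {F} h = isFlat⁺ M₀ F Sₚ.⊆⊤ (λ e _ → h e)

  r-⊥ : r ⊥ ≡ 0
  r-⊥ = ℕₚ.n≤0⇒n≡0 (subst (r ⊥ ≤_) (Sₚ.∣⊥∣≡0 m) (bound ⊥))

  co : Subset m → ℕ
  co F = r ⊤ ∸ r F

  r≤r⊤ : ∀ F → r F ≤ r ⊤
  r≤r⊤ F = mono Sₚ.⊆⊤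

  Flat-full : ∀ {F} → Flat F → co F ≡ 0 → F ≡ ⊤
  Flat-full {F} f h = Sₚ.⊆-antisym Sₚ.⊆⊤ λ {e} _ → case e Sₚ.∈? F of λ
    { (yes p) → p
    ; (no ¬p) → ⊥-elim (ℕₚ.<⇒≱ (f e ¬p) (ℕₚ.≤-trans (r≤r⊤ (F ∪ ⁅ e ⁆)) (ℕₚ.m∸n≡0⇒m≤n h))) }

  -- A rank function ρ on the ground set Eᴺ presents the contraction of M₀ at G.
  -- Working with all presentations is needed since P need not respect pointwise equality.
  record Presents (G Eᴺ : Subset m) (ρ : Subset m → ℕ) : Set where
    field
      ground : Eᴺ ≡ ∁ G
      ranks  : ∀ A → A ⊆ ∁ G → ρ A ≡ r (A ∪ G) ∸ r G

  module _ {G Eᴺ ρ} (N : Presents G Eᴺ ρ) where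
    open Presents N

    private
      ⊆∁ : ∀ {A} → A ⊆ Eᴺ → A ⊆ ∁ G
      ⊆∁ h rewrite ground = h
      rG≤ : ∀ A → r G ≤ r (A ∪ G)
      rG≤ A = mono (Sₚ.q⊆p∪q A G)

    contraction-isMatroid : IsMatroid (mkMatroid m Eᴺ ρ)
    contraction-isMatroid = record
      { rk-bound = λ A h → subst (_≤ ∣ A ∣) (sym (ranks A (⊆∁ h)))
          (ℕₚ.m≤n+o⇒m∸n≤o (r (A ∪ G)) (r G) (ℕₚ.≤-trans (ℕₚ.m≤m+n _ (r (A ∩ G)))
            (ℕₚ.≤-trans (submod A G) (ℕₚ.≤-trans (ℕₚ.≤-reflexive (ℕₚ.+-comm (r A) (r G)))
                (ℕₚ.+-monoʳ-≤ (r G) (bound A))))))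
      ; rk-mono = λ A B hB h → subst (_≤ ρ B) (sym (ranks A (⊆∁ (Sₚ.⊆-trans h hB))))
          (subst (r (A ∪ G) ∸ r G ≤_) (sym (ranks B (⊆∁ hB)))
            (ℕₚ.∸-monoˡ-≤ (r G) (mono (λ x → Sₚ.x∈p∪q⁺ (Data.Sum.map₁ h (Sₚ.x∈p∪q⁻ A G x))))))
      ; rk-submod = λ A B hA hB →
          subst (λ z → z + ρ (A ∩ B) ≤ ρ A + ρ B) (sym
              (ranks (A ∪ B) (λ x → Data.Sum.[ ⊆∁ hA , ⊆∁ hB ]′ (Sₚ.x∈p∪q⁻ A B x))))
          (subst (λ z → _ + z ≤ ρ A + ρ B) (sym (ranks (A ∩ B) (λ x → ⊆∁ hA (proj₁ (Sₚ.x∈p∩q⁻ A B x)))))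
          (subst (λ z → _ ≤ z + ρ B) (sym (ranks A (⊆∁ hA)))
          (subst (λ z → _ ≤ _ + z) (sym (ranks B (⊆∁ hB)))
          (drop-both (rG≤ (A ∪ B)) (rG≤ (A ∩ B)) (rG≤ A) (rG≤ B) (sub A B)))))
      }
      where
      drop-both : ∀ {a b c d g} → g ≤ a → g ≤ b → g ≤ c → g ≤ d → a + b ≤ c + d → (a ∸ g) + (b ∸ g) ≤ (c ∸ g) +
          (d ∸ g)
      drop-both {a} {b} {c} {d} {g} ga gb gc gd h = ℕₚ.+-cancelˡ-≤ (g + g) _ _
        (subst₂ _≤_ (sym (re ga gb)) (sym (re gc gd)) h)
        where
        re : ∀ {x y} → g ≤ x → g ≤ y → g + g + ((x ∸ g) + (y ∸ g)) ≡ x + y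
        re {x} {y} gx gy = trans (regroup g (x ∸ g) (y ∸ g)) (cong₂ _+_ (ℕₚ.m+[n∸m]≡n gx) (ℕₚ.m+[n∸m]≡n gy))
          where
          regroup : ∀ g x y → g + g + (x + y) ≡ (g + x) + (g + y)
          regroup = solveℕ-∀
      sub : ∀ A B → r ((A ∪ B) ∪ G) + r ((A ∩ B) ∪ G) ≤ r (A ∪ G) + r (B ∪ G)
      sub A B = subst₂′ (cong r (Sₚ.⊆-antisym (λ x → merge x) (λ x → split x)))
          (cong r (sym (Sₚ.∪-distribʳ-∩ G A B))) (submod (A ∪ G) (B ∪ G))
        where
        subst₂′ : ∀ {a a′ b b′ c} → a ≡ a′ → b ≡ b′ → a + b ≤ c → a′ + b′ ≤ c
        subst₂′ refl refl h = h
        merge : ∀ {x} → x ∈ (A ∪ G) ∪ (B ∪ G) → x ∈ (A ∪ B) ∪ G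
        merge x with Sₚ.x∈p∪q⁻ (A ∪ G) (B ∪ G) x
        ... | inj₁ y with Sₚ.x∈p∪q⁻ A G y
        ...   | inj₁ z = Sₚ.p⊆p∪q G (Sₚ.p⊆p∪q B z)
        ...   | inj₂ z = Sₚ.q⊆p∪q (A ∪ B) G z
        merge x | inj₂ y with Sₚ.x∈p∪q⁻ B G y
        ...   | inj₁ z = Sₚ.p⊆p∪q G (Sₚ.q⊆p∪q A B z)
        ...   | inj₂ z = Sₚ.q⊆p∪q (A ∪ B) G z
        split : ∀ {x} → x ∈ (A ∪ B) ∪ G → x ∈ (A ∪ G) ∪ (B ∪ G)
        split x with Sₚ.x∈p∪q⁻ (A ∪ B) G x
        ... | inj₂ y = Sₚ.p⊆p∪q (B ∪ G) (Sₚ.q⊆p∪q A G y)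
        ... | inj₁ y with Sₚ.x∈p∪q⁻ A B y
        ...   | inj₁ z = Sₚ.p⊆p∪q (B ∪ G) (Sₚ.p⊆p∪q G z)
        ...   | inj₂ z = Sₚ.q⊆p∪q (A ∪ G) (B ∪ G) (Sₚ.p⊆p∪q G z)

    ⁅⁆⊆∁ : ∀ {e} → e ∈ ∁ G → ⁅ e ⁆ ⊆ ∁ G
    ⁅⁆⊆∁ {e} h x rewrite Sₚ.x∈⁅y⁆⇒x≡y e x = h

    contraction-loopless : Flat G → Loopless (mkMatroid m Eᴺ ρ)
    contraction-loopless f e e∈ = ℕₚ.≤-antisym
      (subst (ρ ⁅ e ⁆ ≤_) (Sₚ.∣⁅x⁆∣≡1 e) (IsMatroid.rk-bound contraction-isMatroid ⁅ e ⁆ λ x → subst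
          (λ z → _ ∈ z) (sym ground) (⁅⁆⊆∁ e∈′ x)))
      (subst (1 ≤_) (sym (ranks ⁅ e ⁆ (⁅⁆⊆∁ e∈′))) (ℕₚ.m<n⇒0<n∸m
          (subst (λ z → r G < r z) (Sₚ.∪-comm G ⁅ e ⁆) (f e (Sₚ.x∈∁p⇒x∉p e∈′)))))
      where
      e∈′ : e ∈ ∁ G
      e∈′ = subst (e ∈_) ground e∈

    contraction-rank : ρ Eᴺ ≡ co G
    contraction-rank rewrite ground =
      trans (ranks (∁ G) id) (cong (λ z → r z ∸ r G) (Sₚ.∪-inverseˡ G))

    -- Contraction is transitive, so the induction in `unique` stays among presentations of
    -- contractions of the one matroid `M₀`.
    contraction-again : ∀ {F} → F ⊆ ∁ G → Presents (F ∪ G) (Eᴺ ∩ ∁ F) (λ A → ρ (A ∪ F) ∸ ρ F)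
    contraction-again {F} F⊆ = record
      { ground = trans (cong (_∩ ∁ F) ground) (demorgan F G)
      ; ranks  = λ A h → trans
          (cong₂ _∸_ (trans (ranks (A ∪ F) (λ x → joined A h x)) (cong (λ z → r z ∸ r G) (Sₚ.∪-assoc A F G)))
              (ranks F F⊆))
          (∸-cancel-∸ (r (A ∪ (F ∪ G))) (rG≤ F)) }
      where
      demorgan : ∀ {m} (F G : Subset m) → ∁ G ∩ ∁ F ≡ ∁ (F ∪ G)
      demorgan []          []      = refl
      demorgan (false ∷ F) (g ∷ G) = cong₂ _∷_ (𝔹ₚ.∧-identityʳ (not g)) (demorgan F G)
      demorgan (true ∷ F)  (g ∷ G) = cong₂ _∷_ (𝔹ₚ.∧-zeroʳ (not g)) (demorgan F G)
      joined : ∀ A → A ⊆ ∁ (F ∪ G) → A ∪ F ⊆ ∁ G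
      joined A h x = Data.Sum.[ (λ y → Sₚ.x∉p⇒x∈∁p λ z → Sₚ.x∈∁p⇒x∉p (h y) (Sₚ.q⊆p∪q F G z)) , F⊆ ]′
          (Sₚ.x∈p∪q⁻ A F x)

    contraction-flat : ∀ F → isFlat (mkMatroid m Eᴺ ρ) F ≡ (F ⊑ ∁ G) ∧ fl (F ∪ G)
    contraction-flat F = true⇔⇒≡ to from
      where
      N′ = mkMatroid m Eᴺ ρ
      F+e : ∀ {e} → F ⊆ ∁ G → e ∈ ∁ G → F ∪ ⁅ e ⁆ ⊆ ∁ G
      F+e {e} F⊆ e∈ x = Data.Sum.[ F⊆ , ⁅⁆⊆∁ e∈ ]′ (Sₚ.x∈p∪q⁻ F ⁅ e ⁆ x)
      re : ∀ e → (F ∪ ⁅ e ⁆) ∪ G ≡ (F ∪ G) ∪ ⁅ e ⁆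
      re e = trans (Sₚ.∪-assoc F ⁅ e ⁆ G) (trans (cong (F ∪_) (Sₚ.∪-comm ⁅ e ⁆ G)) (sym (Sₚ.∪-assoc F G ⁅ e ⁆)))
      lhs : ∀ {e} (F⊆ : F ⊆ ∁ G) → e ∈ ∁ G → ρ (F ∪ ⁅ e ⁆) ≡ r ((F ∪ G) ∪ ⁅ e ⁆) ∸ r G
      lhs {e} F⊆ e∈ = trans (ranks (F ∪ ⁅ e ⁆) (F+e F⊆ e∈)) (cong (λ z → r z ∸ r G) (re e))
      to : isFlat N′ F ≡ true → (F ⊑ ∁ G) ∧ fl (F ∪ G) ≡ true
      to h = ∧-true (⊆⇒⊑ F⊆) (Flat⇒fl λ e e∉ →
          ∸-cancel-< (r G) (subst₂ _<_ (ranks F F⊆) (lhs F⊆ (e∈∁ e∉))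
              (proj₂ (isFlat⁻ N′ F h) e (subst (e ∈_) (sym ground) (e∈∁ e∉)) (λ z → e∉ (Sₚ.p⊆p∪q G z)))))
        where
        ∸-cancel-< : ∀ g {a b} → a ∸ g < b ∸ g → a < b
        ∸-cancel-< g {a} {b} h = ℕₚ.≰⇒> (λ b≤a → ℕₚ.<⇒≱ h (ℕₚ.∸-monoˡ-≤ g b≤a))
        F⊆ : F ⊆ ∁ G
        F⊆ = ⊆∁ (proj₁ (isFlat⁻ N′ F h))
        e∈∁ : ∀ {e} → e ∉ F ∪ G → e ∈ ∁ G
        e∈∁ e∉ = Sₚ.x∉p⇒x∈∁p (λ z → e∉ (Sₚ.q⊆p∪q F G z))
      from : (F ⊑ ∁ G) ∧ fl (F ∪ G) ≡ true → isFlat N′ F ≡ true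
      from h = isFlat⁺ N′ F (λ x → subst (_ ∈_) (sym ground) (F⊆ x)) λ e e∈ e∉ →
          let e∈′ = subst (e ∈_) ground e∈ in
          subst₂ _<_ (sym (ranks F F⊆)) (sym (lhs F⊆ e∈′))
            (ℕₚ.∸-monoˡ-< (fl⇒Flat (∧-trueʳ {F ⊑ ∁ G} h) e
                (λ z → Data.Sum.[ e∉ , Sₚ.x∈∁p⇒x∉p e∈′ ]′ (Sₚ.x∈p∪q⁻ F G z))) (rG≤ F))
        where
        F⊆ : F ⊆ ∁ G
        F⊆ = ⊑⇒⊆ {A = F} {∁ G} (∧-trueˡ h)

  module Uniqueness (P : Matroid → Poly) (kl : IsKL P) (q : Subset m → Poly)
    (q-degree : ∀ F → Flat F → 0 < co F → ∀ k → co F ≤ 2 *ℕ k → q F k ≡ + 0)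
    (q-⊤ : ∀ k → q ⊤ k ≡ (if k ≡ᵇ 0 then + 1 else + 0)) where

    -- For a flat `B`, `Zq B` is the candidate for the Z-polynomial of the contraction at `B`, and
    -- `Yq B` is its reversal with respect to `co B`, taken term by term. Both are defined for every
    -- subset, because the alternating sums below run over subsets and not only over flats.
    Zq Yq : Subset m → Poly
    Zq B k = ΣS (λ F → ind ((B ⊑ F) ∧ fl F) (shift (r F ∸ r B) (q F) k))
    Yq B k = ΣS (λ F → ind ((B ⊑ F) ∧ fl F) (rev (co F) (q F) k))

    module _ (palindromic : ∀ G → Flat G → ∀ k → k ≤ co G → Zq G k ≡ Zq G (co G ∸ k)) where

      q-vanishes : ∀ F → Flat F → ∀ k → co F < k → q F k ≡ + 0
      q-vanishes F f (suc k) h with co F in eq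
      ... | zero  rewrite Flat-full f eq = q-⊤ (suc k)
      ... | suc c = q-degree F f (subst (0 <_) (sym eq) (s≤s z≤n)) (suc k)
                      (subst (_≤ 2 *ℕ suc k) (sym eq) (ℕₚ.≤-trans (ℕₚ.<⇒≤ h) (ℕₚ.m≤m+n (suc k) _)))

      co-split : ∀ {B F} → B ⊆ F → co B ≡ (r F ∸ r B) + co F
      co-split {B} {F} h = ℕₚ.+-cancelˡ-≡ (r B) _ _
        (trans (ℕₚ.m+[n∸m]≡n (r≤r⊤ B))
        (sym (trans (sym (ℕₚ.+-assoc (r B) (r F ∸ r B) (co F)))
             (trans (cong (_+ co F) (ℕₚ.m+[n∸m]≡n (mono h))) (ℕₚ.m+[n∸m]≡n (r≤r⊤ F))))))

      shift-rev : ∀ {B F} k → B ⊆ F → k ≤ co B → shift (r F ∸ r B) (q F) (co B ∸ k) ≡ rev (co F) (q F) k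
      shift-rev {B} {F} k B⊆F k≤ rewrite co-split B⊆F = go (r F ∸ r B) (co F) k≤
        where
        go : ∀ d c → k ≤ d + c → shift d (q F) (d + c ∸ k) ≡ rev c (q F) k
        go d c h with k Data.Nat.≤? c
        ... | yes p = trans (shift-≤ (q F) (subst (d ≤_) (sym (ℕₚ.+-∸-assoc d p)) (ℕₚ.m≤m+n d _)))
                     (trans (cong (q F) (trans (cong (_∸ d) (ℕₚ.+-∸-assoc d p)) (ℕₚ.m+n∸m≡n d (c ∸ k))))
                            (sym (rev-≤ (q F) p)))
        ... | no ¬p = trans (shift-> (q F) (ℕₚ.+-cancelʳ-< k (d + c ∸ k) d
                              (subst (_< d + k) (sym (ℕₚ.m∸n+n≡m h)) (ℕₚ.+-monoʳ-< d (ℕₚ.≰⇒> ¬p)))))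
                            (sym (rev-> (q F) (ℕₚ.≰⇒> ¬p)))

      -- Up to degree `co B` this is palindromicity. Beyond it both sides vanish by the degree bound
      -- on `q`.
      Z≡Y-flat : ∀ {B} → Flat B → ∀ k → Zq B k ≡ Yq B k
      Z≡Y-flat {B} f k with k Data.Nat.≤? co B
      ... | yes k≤ = trans (palindromic B f k k≤) (ΣS-cong λ F → ind-cong ((B ⊑ F) ∧ fl F) λ h →
                       shift-rev k (⊑⇒⊆ {A = B} (∧-trueˡ h)) k≤)
      ... | no ¬k≤ = ΣS-cong λ F → ind-cong ((B ⊑ F) ∧ fl F) λ h →
                       let eq = co-split (⊑⇒⊆ {A = B} (∧-trueˡ h))
                           k> = subst (_< k) eq (ℕₚ.≰⇒> ¬k≤)
                           d≤k = ℕₚ.≤-trans (ℕₚ.m≤m+n (r F ∸ r B) (co F)) (ℕₚ.<⇒≤ k>)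
                       in trans (shift-≤ (q F) d≤k)
                         (trans (q-vanishes F (fl⇒Flat (∧-trueʳ {B ⊑ F} h)) (k ∸ (r F ∸ r B))
                             (ℕₚ.+-cancelˡ-< (r F ∸ r B) _ _ (subst (_ <_) (sym (ℕₚ.m+[n∸m]≡n d≤k)) k>)))
                                (sym (rev-> (q F) (ℕₚ.≤-trans (s≤s (ℕₚ.m≤n+m (co F) (r F ∸ r B))) k>))))

      -- Submodularity for `F` and `B ∪ ⁅ e ⁆`: an element spanned by a part of `F` is spanned by
      -- `F`.
      flat-closed : ∀ {B F e} → Flat F → B ⊆ F → r (B ∪ ⁅ e ⁆) ≤ r B → e ∈ F
      flat-closed {B} {F} {e} f B⊆F h with e Sₚ.∈? F
      ... | yes p = p
      ... | no ¬p = ⊥-elim (ℕₚ.<⇒≱ (f e ¬p) (ℕₚ.+-cancelʳ-≤ (r B) _ _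
              (ℕₚ.≤-trans (ℕₚ.+-mono-≤ (mono up) (mono dn))
                  (ℕₚ.≤-trans (submod F (B ∪ ⁅ e ⁆)) (ℕₚ.+-monoʳ-≤ (r F) h)))))
        where
        up : F ∪ ⁅ e ⁆ ⊆ F ∪ (B ∪ ⁅ e ⁆)
        up x with Sₚ.x∈p∪q⁻ F ⁅ e ⁆ x
        ... | inj₁ y = Sₚ.p⊆p∪q _ y
        ... | inj₂ y = Sₚ.q⊆p∪q F _ (Sₚ.q⊆p∪q B _ y)
        dn : B ⊆ F ∩ (B ∪ ⁅ e ⁆)
        dn x = Sₚ.x∈p∩q⁺ (B⊆F x , Sₚ.p⊆p∪q _ x)

      -- Adding to a non-flat an element of its span changes neither its rank nor the flats above
      -- it, so `B` can be enlarged to its closure; `n` bounds the number of elements still missing.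
      Z≡Y : ∀ n B → ∣ ∁ B ∣ ≤ n → ∀ k → Zq B k ≡ Yq B k
      Z≡Y n B size k with fl B in eq
      ... | true  = Z≡Y-flat (fl⇒Flat eq) k
      ... | false with isFlat-false M₀ B Sₚ.⊆⊤ eq
      ...   | e , _ , e∉B , h = go n size
        where
        B⁺ = B ∪ ⁅ e ⁆
        rk≡ : r B ≡ r B⁺
        rk≡ = ℕₚ.≤-antisym (mono (Sₚ.p⊆p∪q _)) h
        same : ∀ F → ((B ⊑ F) ∧ fl F) ≡ ((B⁺ ⊑ F) ∧ fl F)
        same F = true⇔⇒≡
          (λ t → ∧-true (⊆⇒⊑ (λ x → case Sₚ.x∈p∪q⁻ B ⁅ e ⁆ x of λ
             { (inj₁ y) → ⊑⇒⊆ {A = B} (∧-trueˡ t) y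
             ; (inj₂ y) → subst (_∈ F) (sym (Sₚ.x∈⁅y⁆⇒x≡y e y))
                            (flat-closed (fl⇒Flat (∧-trueʳ {B ⊑ F} t)) (⊑⇒⊆ {A = B} (∧-trueˡ t)) h) }))
             (∧-trueʳ {B ⊑ F} t))
          (λ t → ∧-true (⊆⇒⊑ (λ x → ⊑⇒⊆ {A = B⁺} (∧-trueˡ t) (Sₚ.p⊆p∪q _ x))) (∧-trueʳ {B⁺ ⊑ F} t))
        smaller : ∣ ∁ B⁺ ∣ < ∣ ∁ B ∣
        smaller = Sₚ.p⊂q⇒∣p∣<∣q∣ (Sₚ.p⊂q⇒∁p⊃∁q (Sₚ.p⊆p∪q _ , e , Sₚ.q⊆p∪q B _ (Sₚ.x∈⁅x⁆ e) , e∉B))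
        go : ∀ n → ∣ ∁ B ∣ ≤ n → Zq B k ≡ Yq B k
        go zero    s = case ℕₚ.≤-trans smaller s of λ ()
        go (suc n) s =
          trans (ΣS-cong λ F → cong₂ ind (same F) (cong (λ z → shift (r F ∸ z) (q F) k) rk≡))
          (trans (Z≡Y n B⁺ (ℕₚ.≤-pred (ℕₚ.≤-trans smaller s)) k)
                 (ΣS-cong λ F → cong (λ b → ind b (rev (co F) (q F) k)) (sym (same F))))

      exchange-sums : ∀ G (h : Subset m → Subset m → ℤ) →
        ΣS (λ F → ind ((F ⊑ ∁ G) ∧ fl (F ∪ G)) (ΣS λ A → ind (A ⊑ F) (sg A * h (A ∪ G) (F ∪ G))))
        ≡ ΣS (λ A → sg A * ind (A ⊑ ∁ G) (ΣS λ F → ind ((A ∪ G ⊑ F) ∧ fl F) (h (A ∪ G) F)))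
      exchange-sums G h =
        trans (ΣS-cong λ F → sym (ΣS-ind ((F ⊑ ∁ G) ∧ fl (F ∪ G))
            (λ A → ind (A ⊑ F) (sg A * h (A ∪ G) (F ∪ G)))))
        (trans (ΣS-swap (λ F A → ind ((F ⊑ ∁ G) ∧ fl (F ∪ G)) (ind (A ⊑ F) (sg A * h (A ∪ G) (F ∪ G)))))
        (ΣS-cong λ A →
          trans (ΣS-cong λ F → pull (F ⊑ ∁ G) (fl (F ∪ G)) (A ⊑ F) (sg A) (h (A ∪ G) (F ∪ G)))
          (trans (ΣS-*ˡ (sg A) (λ F → ind ((A ⊑ F) ∧ (F ⊑ ∁ G)) (ind (fl (F ∪ G)) (h (A ∪ G) (F ∪ G)))))
          (cong (sg A *_) (trans (ΣS-above A G (λ F → ind (fl F) (h (A ∪ G) F)))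
            (cong (ind (A ⊑ ∁ G)) (ΣS-cong λ F → sym (ind-∧ (A ∪ G ⊑ F) (fl F) (h (A ∪ G) F)))))))))
        where
        pull : ∀ a b c s x → ind (a ∧ b) (ind c (s * x)) ≡ s * ind (c ∧ a) (ind b x)
        pull true  true  true  s x = refl
        pull true  true  false s x = sym (ℤₚ.*-zeroʳ s)
        pull true  false true  s x = sym (ℤₚ.*-zeroʳ s)
        pull true  false false s x = sym (ℤₚ.*-zeroʳ s)
        pull false b     true  s x = sym (ℤₚ.*-zeroʳ s)
        pull false b     false s x = sym (ℤₚ.*-zeroʳ s)

      ΣS-bottom : ∀ {m} (f : Subset m → ℤ) → ΣS (λ F → ind (F ⊑ ⊥) (f F)) ≡ f ⊥
      ΣS-bottom {zero}  f = refl
      ΣS-bottom {suc m} f = trans (cong (_+ᶻ ΣS (λ F → ind (F ⊑ ⊥) (f (false ∷ F)))) (ΣS-zero {m} (λ _ → refl)))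
                                  (trans (ℤₚ.+-identityˡ _) (ΣS-bottom (f ∘ (false ∷_))))

      -- Exchanging the two sums turns the left side into a signed sum of `Zq (A ∪ G)` over `A`.
      -- Once `Zq` is replaced by `Yq`, the summand for a given `F` no longer depends on `A`; after
      -- exchanging back, the alternating sum over `A ⊆ F` kills everything except the empty `F`.
      q-equation : ∀ {G} → Flat G → ∀ k →
        ΣS (λ F → ind ((F ⊑ ∁ G) ∧ fl (F ∪ G))
                      (ΣS λ A → ind (A ⊑ F) (sg A * shift (r (F ∪ G) ∸ r (A ∪ G)) (q (F ∪ G)) k)))
        ≡ rev (co G) (q G) k
      q-equation {G} f k =
        trans (exchange-sums G (λ B F → shift (r F ∸ r B) (q F) k))
        (trans (ΣS-cong λ A → cong (λ z → sg A * ind (A ⊑ ∁ G) z) (Z≡Y ∣ ∁ (A ∪ G) ∣ (A ∪ G) ℕₚ.≤-refl k))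
        (trans (sym (exchange-sums G (λ B F → rev (co F) (q F) k)))
        (trans (ΣS-cong single)
        (trans (ΣS-bottom (λ F → ind (fl (F ∪ G)) (rev (co (F ∪ G)) (q (F ∪ G)) k)))
        (trans (cong (λ H → ind (fl H) (rev (co H) (q H) k)) (Sₚ.∪-identityˡ G))
               (cong (λ b → ind b (rev (co G) (q G) k)) (Flat⇒fl f)))))))
        where
        single : ∀ F → ind ((F ⊑ ∁ G) ∧ fl (F ∪ G))
            (ΣS λ A → ind (A ⊑ F) (sg A * rev (co (F ∪ G)) (q (F ∪ G)) k))
                       ≡ ind (F ⊑ ⊥) (ind (fl (F ∪ G)) (rev (co (F ∪ G)) (q (F ∪ G)) k))
        single F = trans (cong (ind _) inner) (fin (F ⊑ ∁ G) (fl (F ∪ G)) (F ⊑ ⊥) x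
                     (λ t → ⊆⇒⊑ λ {e} y → ⊥-elim (Sₚ.∉⊥ (⊑⇒⊆ {A = F} t y))))
          where
          x = rev (co (F ∪ G)) (q (F ∪ G)) k
          inner : ΣS (λ A → ind (A ⊑ F) (sg A * x)) ≡ ind (F ⊑ ⊥) (+ 1) * x
          inner = trans (ΣS-cong λ A → sym (ind-*ˡ (A ⊑ F) (sg A) x))
                 (trans (ΣS-*ʳ x (λ A → ind (A ⊑ F) (sg A))) (cong (_* x) (alternating-sum F)))
          fin : ∀ a b c x → (c ≡ true → a ≡ true) → ind (a ∧ b) (ind c (+ 1) * x) ≡ ind c (ind b x)
          fin a b true  x h rewrite h refl = cong (ind b) (ℤₚ.*-identityˡ x)
          fin a b false x h = ind-zero (a ∧ b)

      -- Induction on the corank. A coefficient `k` with `2k < co G` reappears in the recursion as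
      -- the coefficient `k′ = co G ∸ k` of the reversed polynomial, so comparing the recursions for
      -- `P` and `q` at `k′` determines it.
      unique : ∀ c {G Eᴺ ρ} → Flat G → co G ≤ c → Presents G Eᴺ ρ → ∀ k → P (mkMatroid m Eᴺ ρ) k ≡ q G k
      unique c {G} {Eᴺ} {ρ} f coG≤c N k with co G in eq
      ... | zero = trans (IsKL.rank-zero kl _ (contraction-isMatroid N) (contraction-loopless N f)
          (trans (contraction-rank N) eq) k)
                         (sym (trans (cong (λ H → q H k) (Flat-full f eq)) (q-⊤ k)))
      unique (suc c) {G} {Eᴺ} {ρ} f coG≤c N k | suc c′ with suc c′ Data.Nat.≤? 2 *ℕ k
      ... | yes d = trans (IsKL.degree kl _ isM lpl (subst (0 <_) (sym rk≡) (s≤s z≤n)) k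
          (subst (_≤ 2 *ℕ k) (sym rk≡) d))
                          (sym (q-degree G f (subst (0 <_) (sym eq) (s≤s z≤n)) k
                              (subst (_≤ 2 *ℕ k) (sym eq) d)))
        where
        isM = contraction-isMatroid N
        lpl = contraction-loopless N f
        rk≡ : ρ Eᴺ ≡ suc c′
        rk≡ = trans (contraction-rank N) eq
      ... | no ¬d = trans (sym (trans (rev-≤ (P N′) k′≤) (cong (P N′) r∸k′≡k)))
                   (trans (IsKL.equation kl N′ isM lpl k′)
                   (trans (sumℤ-flats N′ _)
                   (trans (ΣS-cong term)
                   (trans (q-equation f k′)
                   (trans (cong (λ z → rev z (q G) k′) (trans eq (sym rk≡)))
                          (trans (rev-≤ (q G) k′≤) (cong (q G) r∸k′≡k)))))))
        where
        N′ = mkMatroid m Eᴺ ρ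
        isM = contraction-isMatroid N
        lpl = contraction-loopless N f
        rk≡ : ρ Eᴺ ≡ suc c′
        rk≡ = trans (contraction-rank N) eq
        k′ = suc c′ ∸ k
        2k< : k + k < suc c′
        2k< = subst (_< suc c′) (cong (_+_ k) (ℕₚ.+-identityʳ k)) (ℕₚ.≰⇒> ¬d)
        k≤ : k ≤ suc c′
        k≤ = ℕₚ.≤-trans (ℕₚ.m≤m+n k k) (ℕₚ.<⇒≤ 2k<)
        k′≤ : k′ ≤ ρ Eᴺ
        k′≤ = subst (k′ ≤_) (sym rk≡) (ℕₚ.m∸n≤m (suc c′) k)
        r∸k′≡k : ρ Eᴺ ∸ k′ ≡ k
        r∸k′≡k = trans (cong (_∸ k′) rk≡) (ℕₚ.m∸[m∸n]≡n k≤)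
        half : suc c′ ≤ 2 *ℕ k′
        half = subst₂ _≤_ (ℕₚ.m+[n∸m]≡n k≤) (cong (_+_ k′) (sym (ℕₚ.+-identityʳ k′)))
                 (ℕₚ.+-monoˡ-≤ k′ (ℕₚ.<⇒≤ (ℕₚ.+-cancelˡ-< k _ _
                     (subst (k + k <_) (sym (ℕₚ.m+[n∸m]≡n k≤)) 2k<))))
        open Presents N
        inner : ∀ F → F ⊑ ∁ G ≡ true → fl (F ∪ G) ≡ true → ∀ A → A ⊑ F ≡ true →
                shift (ρ F ∸ ρ A) (P (con N′ F)) k′ ≡ shift (r (F ∪ G) ∸ r (A ∪ G)) (q (F ∪ G)) k′
        inner F F⊑ flF A A⊑ = by-bottom
          where
          F⊆ = ⊑⇒⊆ {A = F} {∁ G} F⊑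
          A⊆ = ⊑⇒⊆ {A = A} {F} A⊑
          fF = fl⇒Flat flF
          amount : ρ F ∸ ρ A ≡ r (F ∪ G) ∸ r (A ∪ G)
          amount = trans (cong₂ _∸_ (ranks F F⊆) (ranks A (λ x → F⊆ (A⊆ x))))
                         (∸-cancel-∸ (r (F ∪ G)) (mono (Sₚ.q⊆p∪q A G)))
          N″ = contraction-again N F⊆
          descend : ∀ {e} → e ∈ F → co (F ∪ G) < co G
          descend {e} e∈F = ℕₚ.∸-monoʳ-< (ℕₚ.<-≤-trans (f e (Sₚ.x∈∁p⇒x∉p (F⊆ e∈F))) (mono below)) (r≤r⊤ (F ∪ G))
            where
            below : G ∪ ⁅ e ⁆ ⊆ F ∪ G
            below x with Sₚ.x∈p∪q⁻ G ⁅ e ⁆ x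
            ... | inj₁ y = Sₚ.q⊆p∪q F G y
            ... | inj₂ y = Sₚ.p⊆p∪q G (subst (_∈ F) (sym (Sₚ.x∈⁅y⁆⇒x≡y e y)) e∈F)
          by-bottom : shift (ρ F ∸ ρ A) (P (con N′ F)) k′ ≡ shift (r (F ∪ G) ∸ r (A ∪ G)) (q (F ∪ G)) k′
          by-bottom with Sₚ.nonempty? F
          ... | yes (e , e∈F) = trans (shift-cong (ρ F ∸ ρ A) k′
                  (unique c fF (ℕₚ.≤-pred (ℕₚ.≤-trans (descend e∈F) (subst (_≤ suc c) (sym eq) coG≤c))) N″))
                  (cong (λ d → shift d (q (F ∪ G)) k′) amount)
          ... | no empty = trans (zero-at (P (con N′ F)) P0)
              (sym (trans (cong (λ d → shift d (q (F ∪ G)) k′) (sym amount)) (zero-at (q (F ∪ G)) q0)))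
            where
            F≡⊥ : F ≡ ⊥
            F≡⊥ = Sₚ.Empty-unique empty
            A≡F : A ≡ F
            A≡F = Sₚ.⊆-antisym A⊆ (λ x → ⊥-elim (empty (_ , x)))
            co≡ : co (F ∪ G) ≡ suc c′
            co≡ = trans (cong co (trans (cong (_∪ G) F≡⊥) (Sₚ.∪-identityˡ G))) eq
            zero-at : ∀ p → p k′ ≡ + 0 → shift (ρ F ∸ ρ A) p k′ ≡ + 0
            zero-at p h rewrite A≡F | ℕₚ.n∸n≡0 (ρ F) = h
            P0 : P (con N′ F) k′ ≡ + 0
            P0 = IsKL.degree kl _ (contraction-isMatroid N″) (contraction-loopless N″ fF)
                   (subst (0 <_) (sym (trans (contraction-rank N″) co≡)) (s≤s z≤n)) k′
                   (subst (_≤ 2 *ℕ k′) (sym (trans (contraction-rank N″) co≡)) half)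
            q0 : q (F ∪ G) k′ ≡ + 0
            q0 = q-degree (F ∪ G) fF (subst (0 <_) (sym co≡) (s≤s z≤n)) k′ (subst (_≤ 2 *ℕ k′) (sym co≡) half)
        term : ∀ F → ind (isFlat N′ F) ((χ (loc N′ F) ⊛ P (con N′ F)) k′) ≡
                     ind ((F ⊑ ∁ G) ∧ fl (F ∪ G)) (ΣS λ A → ind (A ⊑ F)
                         (sg A * shift (r (F ∪ G) ∸ r (A ∪ G)) (q (F ∪ G)) k′))
        term F rewrite contraction-flat N F = ind-cong ((F ⊑ ∁ G) ∧ fl (F ∪ G)) λ h →
          trans (χ-⊛ (loc N′ F) (P (con N′ F)) k′)
                (ΣS-cong λ A → ind-cong (A ⊑ F) λ A⊑ → cong (sg A *_)
                    (inner F (∧-trueˡ h) (∧-trueʳ {F ⊑ ∁ G} h) A A⊑))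

      Z≡Zq : ∀ k → Z P M₀ k ≡ Zq ⊥ k
      Z≡Zq k = trans (sumℤ-flats M₀ _) (ΣS-cong λ F →
        trans (ind-cong (fl F) λ h → trans (shift-cong (r F) k (unique (co F) (fl⇒Flat h) ℕₚ.≤-refl (whole F)))
                                           (cong (λ z → shift (r F ∸ z) (q F) k) (sym r-⊥)))
              (cong (λ b → ind (b ∧ fl F) (shift (r F ∸ r ⊥) (q F) k)) (sym (⊆⇒⊑ {A = ⊥} {F} Sₚ.⊥⊆))))
        where
        whole : ∀ F → Presents F (⊤ ∩ ∁ F) (λ A → r (A ∪ F) ∸ r F)
        whole F = record { ground = Sₚ.∩-identityˡ (∁ F) ; ranks = λ A _ → refl }

-- Matroid rank functions

maxℕ-++ : ∀ xs ys → maxℕ (xs ++ ys) ≡ maxℕ xs ⊔ maxℕ ys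
maxℕ-++ []       ys = refl
maxℕ-++ (x ∷ xs) ys = trans (cong (x ⊔_) (maxℕ-++ xs ys)) (sym (ℕₚ.⊔-assoc x (maxℕ xs) (maxℕ ys)))

maxℕ-subsets : ∀ m (f : Subset (suc m) → ℕ) →
  maxℕ (map f (subsets (suc m))) ≡ maxℕ (map (f ∘ (true ∷_)) (subsets m)) ⊔ maxℕ
      (map (f ∘ (false ∷_)) (subsets m))
maxℕ-subsets m f =
  trans (cong maxℕ (Lₚ.map-++ f (map (true ∷_) (subsets m)) (map (false ∷_) (subsets m))))
  (trans (maxℕ-++ (map f (map (true ∷_) (subsets m))) _)
         (cong₂ _⊔_ (cong maxℕ (sym (Lₚ.map-∘ (subsets m)))) (cong maxℕ (sym (Lₚ.map-∘ (subsets m))))))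

maxℕ-≥ : ∀ {m} (f : Subset m → ℕ) B → f B ≤ maxℕ (map f (subsets m))
maxℕ-≥ f [] = ℕₚ.m≤m⊔n (f []) 0
maxℕ-≥ {suc m} f (b ∷ B) = subst (f (b ∷ B) ≤_) (sym (maxℕ-subsets m f)) (side b (maxℕ-≥ (f ∘ (b ∷_)) B))
  where
  side : ∀ b {x} → x ≤ maxℕ (map (f ∘ (b ∷_)) (subsets m)) →
         x ≤ maxℕ (map (f ∘ (true ∷_)) (subsets m)) ⊔ maxℕ (map (f ∘ (false ∷_)) (subsets m))
  side true  h = ℕₚ.≤-trans h (ℕₚ.m≤m⊔n _ _)
  side false h = ℕₚ.≤-trans h (ℕₚ.m≤n⊔m _ _)

maxℕ-≤ : ∀ {m} (f : Subset m → ℕ) {k} → (∀ B → f B ≤ k) → maxℕ (map f (subsets m)) ≤ k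
maxℕ-≤ {zero}  f {k} h = ℕₚ.⊔-lub (h []) z≤n
maxℕ-≤ {suc m} f {k} h = subst (_≤ k) (sym (maxℕ-subsets m f))
    (ℕₚ.⊔-lub (maxℕ-≤ _ (h ∘ (true ∷_))) (maxℕ-≤ _ (h ∘ (false ∷_))))

rkFromIndep-unique : ∀ {m} (I : Subset m → Bool) A {k} →
  (∀ B → B ⊆ A → I B ≡ true → ∣ B ∣ ≤ k) → (∃ λ B → B ⊆ A × I B ≡ true × ∣ B ∣ ≡ k) → rkFromIndep I A ≡ k
rkFromIndep-unique I A {k} up (B , B⊆A , iB , refl) = ℕₚ.≤-antisym (maxℕ-≤ _ small)
  (subst (_≤ rkFromIndep I A) here≡ (maxℕ-≥ size B))
  where
  size : Subset _ → ℕ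
  size B = if (B ⊆ᵇ A) ∧ I B then ∣ B ∣ else 0
  here≡ : size B ≡ ∣ B ∣
  here≡ = cong (λ b → if b then ∣ B ∣ else 0) (∧-true (⊆⇒⊆ᵇ B⊆A) iB)
  small : ∀ B → size B ≤ k
  small B with (B ⊆ᵇ A) ∧ I B in eq
  ... | true  = up B (⊆ᵇ⇒⊆ (∧-trueˡ eq)) (∧-trueʳ {B ⊆ᵇ A} eq)
  ... | false = z≤n

-- The rank function of a closure operator

elements : ∀ {m} → Subset m → List (Fin m)
elements []          = []
elements (true ∷ A)  = zero ∷ map suc (elements A)
elements (false ∷ A) = map suc (elements A)

adds : ∀ {m} → Subset m → List (Fin m) → Subset m
adds A []      = A
adds A (e ∷ l) = adds (A ∪ ⁅ e ⁆) l

adds-suc : ∀ {m} a (A : Subset m) l → adds (a ∷ A) (map suc l) ≡ a ∷ adds A l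
adds-suc a A []      = refl
adds-suc a A (e ∷ l) = trans (cong (λ b → adds (b ∷ (A ∪ ⁅ e ⁆)) (map suc l)) (𝔹ₚ.∨-identityʳ a))
    (adds-suc a (A ∪ ⁅ e ⁆) l)

adds-elements : ∀ {m} (A B : Subset m) → adds A (elements B) ≡ A ∪ B
adds-elements []      []          = refl
adds-elements (a ∷ A) (true ∷ B)  =
  trans (adds-suc (a ∨ true) (A ∪ ⊥) (elements B)) (cong ((a ∨ true) ∷_)
      (trans (cong (λ Z → adds Z (elements B)) (Sₚ.∪-identityʳ A)) (adds-elements A B)))
adds-elements (a ∷ A) (false ∷ B) =
  trans (adds-suc a A (elements B)) (cong₂ _∷_ (sym (𝔹ₚ.∨-identityʳ a)) (adds-elements A B))

elements-insert : ∀ {m} (A : Subset m) e → e ∉ A →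
  ∃ λ l₁ → ∃ λ l₂ → elements (A ∪ ⁅ e ⁆) ≡ l₁ ++ e ∷ l₂ × elements A ≡ l₁ ++ l₂
elements-insert (true ∷ A)  zero e∉A = ⊥-elim (e∉A here)
elements-insert (false ∷ A) zero e∉A = [] , map suc (elements A) , cong (λ Z → zero ∷ map suc (elements Z))
    (Sₚ.∪-identityʳ A) , refl
elements-insert (a ∷ A) (suc e) e∉A with elements-insert A e (λ p → e∉A (there p))
elements-insert (true ∷ A) (suc e) e∉A | l₁ , l₂ , p , q =
  zero ∷ map suc l₁ , map suc l₂ , cong (zero ∷_) (trans (cong (map suc) p) (Lₚ.map-++ suc l₁ (e ∷ l₂))) , cong
      (zero ∷_) (trans (cong (map suc) q) (Lₚ.map-++ suc l₁ l₂))
elements-insert (false ∷ A) (suc e) e∉A | l₁ , l₂ , p , q =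
  map suc l₁ , map suc l₂ , trans (cong (map suc) p) (Lₚ.map-++ suc l₁ (e ∷ l₂)) , trans (cong (map suc) q)
      (Lₚ.map-++ suc l₁ l₂)

length-elements : ∀ {m} (A : Subset m) → Data.List.length (elements A) ≡ ∣ A ∣
length-elements []          = refl
length-elements (true ∷ A)  = cong suc (trans (Lₚ.length-map suc (elements A)) (length-elements A))
length-elements (false ∷ A) = trans (Lₚ.length-map suc (elements A)) (length-elements A)

∪⁅⁆-absorb : ∀ {m} {A : Subset m} {e} → e ∈ A → A ∪ ⁅ e ⁆ ≡ A
∪⁅⁆-absorb {A = A} {e} h = Sₚ.⊆-antisym
  (λ x → Data.Sum.[ id , (λ y → subst (_∈ A) (sym (Sₚ.x∈⁅y⁆⇒x≡y e y)) h) ]′ (Sₚ.x∈p∪q⁻ A ⁅ e ⁆ x)) (Sₚ.p⊆p∪q _)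

∖-restore : ∀ {m} {A : Subset m} {e} → e ∈ A → (A ∖ e) ∪ ⁅ e ⁆ ≡ A
∖-restore {A = A} {e} h = Sₚ.⊆-antisym
  (λ x → Data.Sum.[ Sₚ.p─q⊆p A ⁅ e ⁆ , (λ y → subst (_∈ A) (sym (Sₚ.x∈⁅y⁆⇒x≡y e y)) h) ]′
      (Sₚ.x∈p∪q⁻ (A ∖ e) ⁅ e ⁆ x))
  (λ {x} x∈A → case x Finₚ.≟ e of λ
    { (yes refl) → Sₚ.q⊆p∪q (A ∖ e) _ (Sₚ.x∈⁅x⁆ e)
    ; (no  x≢e)  → Sₚ.p⊆p∪q _ (Sₚ.x∈p∧x≢y⇒x∈p-y x∈A x≢e) })

∉∖ : ∀ {m} (A : Subset m) e → e ∉ A ∖ e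
∉∖ (a ∷ A) zero    h = case h of λ { () }
∉∖ (a ∷ A) (suc e) (there h) = ∉∖ A e h

∣∪⁅⁆∣ : ∀ {m} (A : Subset m) e → e ∉ A → ∣ A ∪ ⁅ e ⁆ ∣ ≡ suc ∣ A ∣
∣∪⁅⁆∣ (true ∷ A)  zero    h = ⊥-elim (h here)
∣∪⁅⁆∣ (false ∷ A) zero    h = cong (λ Z → suc ∣ Z ∣) (Sₚ.∪-identityʳ A)
∣∪⁅⁆∣ (true ∷ A)  (suc e) h = cong suc (∣∪⁅⁆∣ A e (λ p → h (there p)))
∣∪⁅⁆∣ (false ∷ A) (suc e) h = ∣∪⁅⁆∣ A e (λ p → h (there p))

∪-monoˡ : ∀ {m} {A B : Subset m} D → A ⊆ B → A ∪ D ⊆ B ∪ D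
∪-monoˡ {A = A} D h x = Sₚ.x∈p∪q⁺ (Data.Sum.map₁ h (Sₚ.x∈p∪q⁻ A D x))

record Closure {m} (K : Subset m → Fin m → Bool) : Set where
  field
    K-mono     : ∀ {A B e} → A ⊆ B → K A e ≡ true → K B e ≡ true
    K-∈        : ∀ {A e} → e ∈ A → K A e ≡ true
    K-trans    : ∀ {A e f} → K A f ≡ true → K (A ∪ ⁅ f ⁆) e ≡ true → K A e ≡ true
    K-exchange : ∀ {A e f} → K A e ≡ false → K (A ∪ ⁅ f ⁆) e ≡ true → K (A ∪ ⁅ e ⁆) f ≡ true

gain : ∀ {m} → (Subset m → Fin m → Bool) → Subset m → Fin m → ℕ
gain K A e = if K A e then 0 else 1

module FromClosure {m} (K : Subset m → Fin m → Bool) (cl : Closure K) where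
  open Closure cl

  gain-true : ∀ {A e} → K A e ≡ true → gain K A e ≡ 0
  gain-true h rewrite h = refl

  gain-≤1 : ∀ A e → gain K A e ≤ 1
  gain-≤1 A e with K A e
  ... | true  = z≤n
  ... | false = s≤s z≤n

  gain-anti : ∀ {A B} e → A ⊆ B → gain K B e ≤ gain K A e
  gain-anti {A} {B} e h with K A e in p
  ... | true rewrite K-mono h p = z≤n
  ... | false = gain-≤1 B e

  -- The exchange property makes the total gain of two elements independent of the order in which
  -- they are added.
  gain-swap : ∀ A p i → gain K A p + gain K (A ∪ ⁅ p ⁆) i ≡ gain K A i + gain K (A ∪ ⁅ i ⁆) p
  gain-swap A p i with K A p in a | K A i in b
  ... | true  | true  rewrite K-mono (Sₚ.p⊆p∪q {p = A} ⁅ p ⁆) b | K-mono (Sₚ.p⊆p∪q {p = A} ⁅ i ⁆) a = refl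
  ... | true  | false rewrite K-mono (Sₚ.p⊆p∪q {p = A} ⁅ i ⁆) a with K (A ∪ ⁅ p ⁆) i in c
  ...   | true  = true≢false (K-trans a c) b
  ...   | false = refl
  gain-swap A p i | false | true rewrite K-mono (Sₚ.p⊆p∪q {p = A} ⁅ p ⁆) b with K (A ∪ ⁅ i ⁆) p in c
  ...   | true  = true≢false (K-trans b c) a
  ...   | false = refl
  gain-swap A p i | false | false with K (A ∪ ⁅ p ⁆) i in c | K (A ∪ ⁅ i ⁆) p in d
  ...   | true  | true  = refl
  ...   | false | false = refl
  ...   | true  | false = true≢false (K-exchange b c) d
  ...   | false | true  = true≢false (K-exchange a d) c

  -- Greedy rank: the number of list elements not spanned by `A` together with their predecessors.
  scan : List (Fin m) → Subset m → ℕ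
  scan []      A = 0
  scan (e ∷ l) A = gain K A e + scan l (A ∪ ⁅ e ⁆)

  scan-last : ∀ i l A → scan (i ∷ l) A ≡ scan l A + gain K (adds A l) i
  scan-last i []      A = ℕₚ.+-identityʳ _
  scan-last i (j ∷ l) A =
    trans (sym (ℕₚ.+-assoc (gain K A i) _ _))
    (trans (cong₂ _+_ (gain-swap A i j) (cong (scan l) (∪-swap A i j)))
    (trans (ℕₚ.+-assoc (gain K A j) _ _)
    (trans (cong (_+_ (gain K A j)) (scan-last i l (A ∪ ⁅ j ⁆))) (sym (ℕₚ.+-assoc (gain K A j) _ _)))))
    where
    ∪-swap : ∀ (A : Subset m) i j → (A ∪ ⁅ i ⁆) ∪ ⁅ j ⁆ ≡ (A ∪ ⁅ j ⁆) ∪ ⁅ i ⁆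
    ∪-swap A i j = trans (Sₚ.∪-assoc A _ _) (trans (cong (A ∪_) (Sₚ.∪-comm ⁅ i ⁆ ⁅ j ⁆))
        (sym (Sₚ.∪-assoc A _ _)))

  scan-middle : ∀ l₁ e l₂ A → scan (l₁ ++ e ∷ l₂) A ≡ scan (l₁ ++ l₂) A + gain K (adds A (l₁ ++ l₂)) e
  scan-middle []       e l₂ A = scan-last e l₂ A
  scan-middle (i ∷ l₁) e l₂ A = trans (cong (_+_ (gain K A i)) (scan-middle l₁ e l₂ (A ∪ ⁅ i ⁆)))
      (sym (ℕₚ.+-assoc (gain K A i) _ _))

  ρ : Subset m → ℕ
  ρ A = scan (elements A) ⊥

  ρ-⊥ : ρ ⊥ ≡ 0
  ρ-⊥ = cong (λ l → scan l ⊥) (none m)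
    where
    none : ∀ m → elements (⊥ {m}) ≡ []
    none zero    = refl
    none (suc m) = cong (map suc) (none m)

  ρ-add : ∀ A e → ρ (A ∪ ⁅ e ⁆) ≡ ρ A + gain K A e
  ρ-add A e with e Sₚ.∈? A
  ... | yes p = trans (cong ρ (∪⁅⁆-absorb p)) (sym (trans (cong (_+_ (ρ A)) (gain-true (K-∈ p)))
      (ℕₚ.+-identityʳ _)))
  ... | no ¬p with elements-insert A e ¬p
  ...   | l₁ , l₂ , p , q = trans (cong (λ l → scan l ⊥) p) (trans (scan-middle l₁ e l₂ ⊥)
            (cong₂ _+_ (cong (λ l → scan l ⊥) (sym q))
              (cong (λ Z → gain K Z e) (trans (cong (adds ⊥) (sym q))
                  (trans (adds-elements ⊥ A) (Sₚ.∪-identityˡ A))))))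

  ρ-adds-≥ : ∀ l A → ρ A ≤ ρ (adds A l)
  ρ-adds-≥ []      A = ℕₚ.≤-refl
  ρ-adds-≥ (e ∷ l) A = ℕₚ.≤-trans (subst (ρ A ≤_) (sym (ρ-add A e)) (ℕₚ.m≤m+n _ _)) (ρ-adds-≥ l (A ∪ ⁅ e ⁆))

  ρ-adds-≤ : ∀ l A → ρ (adds A l) ≤ ρ A + Data.List.length l
  ρ-adds-≤ []      A = ℕₚ.m≤m+n _ _
  ρ-adds-≤ (e ∷ l) A = ℕₚ.≤-trans (ρ-adds-≤ l (A ∪ ⁅ e ⁆))
      (subst (ρ (A ∪ ⁅ e ⁆) + Data.List.length l ≤_) (ℕₚ.+-assoc (ρ A) 1 _)
    (ℕₚ.+-monoˡ-≤ _ (subst (_≤ ρ A + 1) (sym (ρ-add A e)) (ℕₚ.+-monoʳ-≤ (ρ A) (gain-≤1 A e)))))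

  -- Gains decrease as the set grows; adding the elements of `l` one by one accumulates this.
  -- Submodularity is the case where `X` is `A ∩ B`, `Y` is `A` and `l` lists `B`.
  ρ-adds-sub : ∀ l {X Y} → X ⊆ Y → ρ (adds Y l) + ρ X ≤ ρ Y + ρ (adds X l)
  ρ-adds-sub []      {X} {Y} h = ℕₚ.≤-refl
  ρ-adds-sub (e ∷ l) {X} {Y} h = ℕₚ.+-cancelʳ-≤ (ρ X⁺) _ _ (begin
    ρ (adds Y⁺ l) + ρ X + ρ X⁺         ≡⟨ shuffle (ρ (adds Y⁺ l)) (ρ X) (ρ X⁺) ⟩
    (ρ (adds Y⁺ l) + ρ X⁺) + ρ X       ≤⟨ ℕₚ.+-monoˡ-≤ (ρ X) (ρ-adds-sub l (∪-monoˡ ⁅ e ⁆ h)) ⟩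
    (ρ Y⁺ + ρ (adds X⁺ l)) + ρ X       ≡⟨ cong (λ z → (z + ρ (adds X⁺ l)) + ρ X) (ρ-add Y e) ⟩
    ((ρ Y + gain K Y e) + ρ (adds X⁺ l)) + ρ X ≤⟨ ℕₚ.+-monoˡ-≤ (ρ X)
        (ℕₚ.+-monoˡ-≤ _ (ℕₚ.+-monoʳ-≤ (ρ Y) (gain-anti e h))) ⟩
    ((ρ Y + gain K X e) + ρ (adds X⁺ l)) + ρ X ≡⟨ shuffle′ (ρ Y) (gain K X e) (ρ (adds X⁺ l)) (ρ X) ⟩
    (ρ Y + ρ (adds X⁺ l)) + (ρ X + gain K X e) ≡⟨ cong (_+_ ((ρ Y + ρ (adds X⁺ l)))) (sym (ρ-add X e)) ⟩
    (ρ Y + ρ (adds X⁺ l)) + ρ X⁺ ∎)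
    where
    open ℕₚ.≤-Reasoning
    X⁺ = X ∪ ⁅ e ⁆
    Y⁺ = Y ∪ ⁅ e ⁆
    shuffle : ∀ a b c → a + b + c ≡ (a + c) + b
    shuffle = solveℕ-∀
    shuffle′ : ∀ a b c d → ((a + b) + c) + d ≡ (a + c) + (d + b)
    shuffle′ = solveℕ-∀

  ρ-rankFunction : RankFunction ρ
  ρ-rankFunction = record
    { bound  = λ A → subst₂ _≤_ (cong ρ (trans (adds-elements ⊥ A) (Sₚ.∪-identityˡ A)))
        (cong₂ _+_ ρ-⊥ (length-elements A)) (ρ-adds-≤ (elements A) ⊥)
    ; mono   = λ {A} {B} h → subst (λ Z → ρ A ≤ ρ Z)
        (trans (adds-elements A B) (Sₚ.⊆-antisym (λ x → Data.Sum.[ h , id ]′ (Sₚ.x∈p∪q⁻ A B x)) (Sₚ.q⊆p∪q A B)))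
        (ρ-adds-≥ (elements B) A)
    ; submod = λ A B → subst₂ (λ X Y → ρ X + ρ (A ∩ B) ≤ ρ A + ρ Y) (adds-elements A B)
                 (trans (adds-elements (A ∩ B) B) (Sₚ.⊆-antisym
                     (λ x → Data.Sum.[ Sₚ.p∩q⊆q A B , id ]′ (Sₚ.x∈p∪q⁻ (A ∩ B) B x)) (Sₚ.q⊆p∪q (A ∩ B) B)))
                 (ρ-adds-sub (elements B) (Sₚ.p∩q⊆p A B))
    }

  Independent : Subset m → Set
  Independent A = ∀ e → e ∈ A → K (A ∖ e) e ≡ false

  ρ-independent : ∀ n A → ∣ A ∣ ≤ n → Independent A → ρ A ≡ ∣ A ∣
  ρ-independent n A size I with Sₚ.nonempty? A
  ... | no empty rewrite Sₚ.Empty-unique empty = trans ρ-⊥ (sym (Sₚ.∣⊥∣≡0 m))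
  ... | yes (e , e∈A) = go n size
    where
    card : ∣ A ∣ ≡ suc ∣ A ∖ e ∣
    card = trans (cong ∣_∣ (sym (∖-restore e∈A))) (∣∪⁅⁆∣ (A ∖ e) e (∉∖ A e))
    sub : Independent (A ∖ e)
    sub f f∈ = ≢true⇒≡false λ t → true≢false (K-mono
        (λ {x} x∈ → Sₚ.x∈p∧x≢y⇒x∈p-y (Sₚ.p─q⊆p A ⁅ e ⁆ (Sₚ.p─q⊆p (A ∖ e) ⁅ f ⁆ x∈))
        (λ { refl → ∉∖ (A ∖ e) f x∈ })) t) (I f (Sₚ.p─q⊆p A ⁅ e ⁆ f∈))
    go : ∀ n → ∣ A ∣ ≤ n → ρ A ≡ ∣ A ∣
    go zero    s = case subst (_≤ 0) card s of λ ()
    go (suc n) s = trans (cong ρ (sym (∖-restore e∈A))) (trans (ρ-add (A ∖ e) e)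
      (trans (cong₂ _+_ (ρ-independent n (A ∖ e) (ℕₚ.≤-pred (subst (_≤ suc n) card s)) sub)
          (cong (λ b → if b then 0 else 1) (I e e∈A)))
      (trans (ℕₚ.+-comm _ 1) (sym card))))

  -- Deleting an element spanned by the rest keeps `ρ`, so repeated deletion ends in an independent
  -- subset of the same rank.
  ρ-basis : ∀ (I : Subset m → Bool) → (∀ A → I A ≡ false → ∃ λ e → e ∈ A × K (A ∖ e) e ≡ true) →
      (∀ A → I A ≡ true → Independent A) →
            ∀ n A → ∣ A ∣ ≤ n → ∃ λ B → B ⊆ A × I B ≡ true × ∣ B ∣ ≡ ρ A
  ρ-basis I dep indep n A size with I A in eq
  ... | true  = A , id , eq , sym (ρ-independent ∣ A ∣ A ℕₚ.≤-refl (indep A eq))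
  ... | false with dep A eq
  ...   | e , e∈A , k = go n size
    where
    go : ∀ n → ∣ A ∣ ≤ n → ∃ λ B → B ⊆ A × I B ≡ true × ∣ B ∣ ≡ ρ A
    go zero    s = case ℕₚ.≤-trans (Sₚ.x∈p⇒∣p-x∣<∣p∣ e∈A) s of λ ()
    go (suc n) s with ρ-basis I dep indep n (A ∖ e) (ℕₚ.≤-pred (ℕₚ.≤-trans (Sₚ.x∈p⇒∣p-x∣<∣p∣ e∈A) s))
    ... | B , B⊆ , iB , c = B , (λ x → Sₚ.p─q⊆p A ⁅ e ⁆ (B⊆ x)) , iB ,
            trans c (sym (trans (cong ρ (sym (∖-restore e∈A)))
                (trans (ρ-add (A ∖ e) e) (trans (cong (_+_ (ρ (A ∖ e))) (gain-true k)) (ℕₚ.+-identityʳ _)))))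

  rkFromIndep≡ρ : ∀ (I : Subset m → Bool) → (∀ A → I A ≡ false → ∃ λ e → e ∈ A × K (A ∖ e) e ≡ true) →
      (∀ A → I A ≡ true → Independent A) →
                  ∀ A → rkFromIndep I A ≡ ρ A
  rkFromIndep≡ρ I dep indep A = rkFromIndep-unique I A
    (λ B B⊆A iB → subst (_≤ ρ A) (ρ-independent ∣ B ∣ B ℕₚ.≤-refl (indep B iB))
        (RankFunction.mono ρ-rankFunction B⊆A))
    (ρ-basis I dep indep ∣ A ∣ A ℕₚ.≤-refl)

-- Connectivity in graphs and the graphic rank function

count : (ℕ → Bool) → ℕ → ℕ
count f zero    = 0
count f (suc n) = (if f n then 1 else 0) + count f n

count-≤ : ∀ f n → count f n ≤ n
count-≤ f zero    = z≤n
count-≤ f (suc n) with f n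
... | true  = s≤s (count-≤ f n)
... | false = ℕₚ.m≤n⇒m≤1+n (count-≤ f n)

count-mono : ∀ {f g} n → (∀ w → f w ≡ true → g w ≡ true) → count f n ≤ count g n
count-mono zero h = z≤n
count-mono {f} {g} (suc n) h with f n in p
... | true rewrite h n p = s≤s (count-mono n h)
... | false = ℕₚ.≤-trans (count-mono n h) (ℕₚ.m≤n+m _ (if g n then 1 else 0))

count-strict : ∀ {f g} n → (∀ w → f w ≡ true → g w ≡ true) → ∀ w → w < n → f w ≡ false → g w ≡ true → count f n
    < count g n
count-strict {f} {g} (suc n) h w w< fw gw with w Data.Nat.≟ n
... | yes refl rewrite fw | gw = s≤s (count-mono n h)
... | no w≢n with f n in p
...   | true rewrite h n p = s≤s (count-strict n h w (ℕₚ.≤∧≢⇒< (ℕₚ.≤-pred w<) w≢n) fw gw)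
...   | false = ℕₚ.≤-trans (count-strict n h w (ℕₚ.≤∧≢⇒< (ℕₚ.≤-pred w<) w≢n) fw gw)
    (ℕₚ.m≤n+m _ (if g n then 1 else 0))

search : ∀ (f g : ℕ → Bool) n → (∀ w → w < n → g w ≡ true → f w ≡ true) ⊎
    (∃ λ w → w < n × f w ≡ false × g w ≡ true)
search f g zero = inj₁ (λ w ())
search f g (suc n) with search f g n
... | inj₂ (w , w< , p , q) = inj₂ (w , ℕₚ.m≤n⇒m≤1+n w< , p , q)
... | inj₁ h with f n in p | g n in q
...   | false | true  = inj₂ (n , ℕₚ.≤-refl , p , q)
...   | true  | _     = inj₁ λ w w< gw → case w Data.Nat.≟ n of λ
    { (yes refl) → p ; (no w≢n) → h w (ℕₚ.≤∧≢⇒< (ℕₚ.≤-pred w<) w≢n) gw }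
...   | false | false = inj₁ λ w w< gw → case w Data.Nat.≟ n of λ
    { (yes refl) → true≢false gw q ; (no w≢n) → h w (ℕₚ.≤∧≢⇒< (ℕₚ.≤-pred w<) w≢n) gw }

≡ᵇ-refl : ∀ n → (n ≡ᵇ n) ≡ true
≡ᵇ-refl n = T⇒≡ (ℕₚ.≡⇒≡ᵇ n n refl)

≡ᵇ⇒≡ : ∀ {a b} → (a ≡ᵇ b) ≡ true → a ≡ b
≡ᵇ⇒≡ {a} {b} h = ℕₚ.≡ᵇ⇒≡ a b (≡⇒T h)

module Edges {m} (nv : ℕ) (ed : Fin m → ℕ × ℕ) where

  src tgt : Fin m → ℕ
  src e = proj₁ (ed e)
  tgt e = proj₂ (ed e)

  stepᴱ : Subset m → (ℕ → Bool) → (ℕ → Bool)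
  stepᴱ A R w = R w ∨ any (λ e → lookup A e ∧ ((R (proj₁ (ed e)) ∧ (proj₂ (ed e) ≡ᵇ w)) ∨
      (R (proj₂ (ed e)) ∧ (proj₁ (ed e) ≡ᵇ w)))) (allFin m)

  connectedᴱ : Subset m → ℕ → ℕ → Bool
  connectedᴱ A u v = iter nv (stepᴱ A) (λ w → u ≡ᵇ w) v

  forest : Subset m → Bool
  forest A = all (λ e → not (lookup A e) ∨ not (connectedᴱ (A ∖ e) (proj₁ (ed e)) (proj₂ (ed e)))) (allFin m)

  data Conn (A : Subset m) (u : ℕ) : ℕ → Set where
    stop : Conn A u u
    fwd  : ∀ e → e ∈ A → Conn A u (src e) → Conn A u (tgt e)
    bwd  : ∀ e → e ∈ A → Conn A u (tgt e) → Conn A u (src e)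

  Conn-trans : ∀ {A u v w} → Conn A u v → Conn A v w → Conn A u w
  Conn-trans p stop        = p
  Conn-trans p (fwd e h q) = fwd e h (Conn-trans p q)
  Conn-trans p (bwd e h q) = bwd e h (Conn-trans p q)

  Conn-sym : ∀ {A u v} → Conn A u v → Conn A v u
  Conn-sym stop        = stop
  Conn-sym (fwd e h q) = Conn-trans (bwd e h stop) (Conn-sym q)
  Conn-sym (bwd e h q) = Conn-trans (fwd e h stop) (Conn-sym q)

  Conn-mono : ∀ {A B u v} → A ⊆ B → Conn A u v → Conn B u v
  Conn-mono h stop        = stop
  Conn-mono h (fwd e p q) = fwd e (h p) (Conn-mono h q)
  Conn-mono h (bwd e p q) = bwd e (h p) (Conn-mono h q)

  -- Used contrapositively: every later proof that two vertices are not connected exhibits a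
  -- labelling that is constant along the edges of `A` and differs at the two vertices.
  Conn-label : ∀ {A u v} {X : Set} (ℓ : ℕ → X) → (∀ e → e ∈ A → ℓ (src e) ≡ ℓ (tgt e)) → Conn A u v → ℓ u ≡ ℓ v
  Conn-label ℓ h stop        = refl
  Conn-label ℓ h (fwd e p q) = trans (Conn-label ℓ h q) (h e p)
  Conn-label ℓ h (bwd e p q) = trans (Conn-label ℓ h q) (sym (h e p))

  -- A walk can be shortened so that it crosses `f` at most once: a crossing in the direction
  -- opposite to an earlier one returns to a vertex already reached without `f`.
  Conn-split : ∀ {A f u v} → Conn (A ∪ ⁅ f ⁆) u v →
    Conn A u v ⊎ (Conn A u (src f) × Conn A (tgt f) v) ⊎ (Conn A u (tgt f) × Conn A (src f) v)
  Conn-split stop = inj₁ stop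
  Conn-split {A} {f} (fwd e h q) with Conn-split q | Sₚ.x∈p∪q⁻ A ⁅ f ⁆ h
  ... | inj₁ c               | inj₁ e∈A = inj₁ (fwd e e∈A c)
  ... | inj₂ (inj₁ (c , d))  | inj₁ e∈A = inj₂ (inj₁ (c , fwd e e∈A d))
  ... | inj₂ (inj₂ (c , d))  | inj₁ e∈A = inj₂ (inj₂ (c , fwd e e∈A d))
  ... | r                    | inj₂ e∈f with Sₚ.x∈⁅y⁆⇒x≡y f e∈f
  Conn-split (fwd e h q) | inj₁ c              | inj₂ e∈f | refl = inj₂ (inj₁ (c , stop))
  Conn-split (fwd e h q) | inj₂ (inj₁ (c , d)) | inj₂ e∈f | refl = inj₂ (inj₁ (c , stop))
  Conn-split (fwd e h q) | inj₂ (inj₂ (c , d)) | inj₂ e∈f | refl = inj₁ c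
  Conn-split {A} {f} (bwd e h q) with Conn-split q | Sₚ.x∈p∪q⁻ A ⁅ f ⁆ h
  ... | inj₁ c               | inj₁ e∈A = inj₁ (bwd e e∈A c)
  ... | inj₂ (inj₁ (c , d))  | inj₁ e∈A = inj₂ (inj₁ (c , bwd e e∈A d))
  ... | inj₂ (inj₂ (c , d))  | inj₁ e∈A = inj₂ (inj₂ (c , bwd e e∈A d))
  ... | r                    | inj₂ e∈f with Sₚ.x∈⁅y⁆⇒x≡y f e∈f
  Conn-split (bwd e h q) | inj₁ c              | inj₂ e∈f | refl = inj₂ (inj₂ (c , stop))
  Conn-split (bwd e h q) | inj₂ (inj₁ (c , d)) | inj₂ e∈f | refl = inj₁ c
  Conn-split (bwd e h q) | inj₂ (inj₂ (c , d)) | inj₂ e∈f | refl = inj₂ (inj₂ (c , stop))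

  module _ (A : Subset m) (u : ℕ) where

    reach : ℕ → ℕ → Bool
    reach k = iter k (stepᴱ A) (λ w → u ≡ᵇ w)

    reach⇒Conn : ∀ k {w} → reach k w ≡ true → Conn A u w
    reach⇒Conn zero h rewrite ≡ᵇ⇒≡ {u} h = stop
    reach⇒Conn (suc k) {w} h with reach k w in p
    ... | true  = reach⇒Conn k p
    ... | false with any-tabulate⁻ _ id h
    ...   | e , q with reach k (src e) ∧ (tgt e ≡ᵇ w) in a
    ...     | true  = subst (Conn A u) (≡ᵇ⇒≡ {tgt e} {w} (∧-trueʳ {reach k (src e)} a))
        (fwd e (lookup⇒∈ (∧-trueˡ q)) (reach⇒Conn k (∧-trueˡ a)))
    ...     | false = let b = ∧-trueʳ {lookup A e} q in
                      subst (Conn A u) (≡ᵇ⇒≡ {src e} {w} (∧-trueʳ {reach k (tgt e)} b))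
                          (bwd e (lookup⇒∈ (∧-trueˡ q)) (reach⇒Conn k (∧-trueˡ b)))

    reach-suc : ∀ k w → reach k w ≡ true → reach (suc k) w ≡ true
    reach-suc k w h rewrite h = refl

    reach-fwd : ∀ k e → e ∈ A → reach k (src e) ≡ true → reach (suc k) (tgt e) ≡ true
    reach-fwd k e e∈A h = trans (cong (reach k (tgt e) ∨_) (any-tabulate⁺ _ id e hit)) (𝔹ₚ.∨-zeroʳ _)
      where
      hit : lookup A e ∧ ((reach k (src e) ∧ (tgt e ≡ᵇ tgt e)) ∨ (reach k (tgt e) ∧ (src e ≡ᵇ tgt e))) ≡ true
      hit rewrite ∈⇒lookup e∈A | h | ≡ᵇ-refl (tgt e) = refl

    reach-bwd : ∀ k e → e ∈ A → reach k (tgt e) ≡ true → reach (suc k) (src e) ≡ true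
    reach-bwd k e e∈A h = trans (cong (reach k (src e) ∨_) (any-tabulate⁺ _ id e hit)) (𝔹ₚ.∨-zeroʳ _)
      where
      hit : lookup A e ∧ ((reach k (src e) ∧ (tgt e ≡ᵇ src e)) ∨ (reach k (tgt e) ∧ (src e ≡ᵇ src e))) ≡ true
      hit rewrite ∈⇒lookup e∈A | h | ≡ᵇ-refl (src e) = 𝔹ₚ.∨-zeroʳ _

    reach-≤ : ∀ {j k} w → j ≤ k → reach j w ≡ true → reach k w ≡ true
    reach-≤ {j} {k} w h p with ℕₚ.m≤n⇒∃[o]m+o≡n h
    ... | o , refl = go o
      where
      go : ∀ o → reach (j + o) w ≡ true
      go zero    = subst (λ z → reach z w ≡ true) (sym (ℕₚ.+-identityʳ j)) p
      go (suc o) = subst (λ z → reach z w ≡ true) (sym (ℕₚ.+-suc j o)) (reach-suc (j + o) w (go o))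

    reach-start : reach 0 u ≡ true
    reach-start = ≡ᵇ-refl u

    Stable : ℕ → Set
    Stable k = ∀ w → w < nv → reach (suc k) w ≡ true → reach k w ≡ true

    -- As long as every round reaches a new vertex, the number of reached vertices exceeds the
    -- number of rounds. There are only `nv` vertices, so the `nv` rounds of `connectedᴱ` suffice.
    stabilises : u < nv → ∀ k → (∃ λ j → j ≤ k × Stable j) ⊎ (k < count (reach k) nv)
    stabilises u< zero = inj₂ (ℕₚ.≤-trans (s≤s z≤n)
        (count-strict {λ _ → false} nv (λ _ ()) u u< refl reach-start))
    stabilises u< (suc k) with stabilises u< k
    ... | inj₁ (j , j≤ , s) = inj₁ (j , ℕₚ.m≤n⇒m≤1+n j≤ , s)
    ... | inj₂ big with search (reach k) (reach (suc k)) nv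
    ...   | inj₁ s = inj₁ (k , ℕₚ.n≤1+n k , s)
    ...   | inj₂ (w , w< , p , q) = inj₂ (ℕₚ.≤-<-trans big (count-strict nv (reach-suc k) w w< p q))

    module _ (src< : ∀ e → src e < nv) (tgt< : ∀ e → tgt e < nv) where

      Conn⇒connected : u < nv → ∀ {v} → Conn A u v → connectedᴱ A u v ≡ true
      Conn⇒connected u< {v} c with stabilises u< nv
      ... | inj₂ big = ⊥-elim (ℕₚ.<⇒≱ big (count-≤ (reach nv) nv))
      ... | inj₁ (j , j≤ , s) = reach-≤ v j≤ (go c)
        where
        go : ∀ {v} → Conn A u v → reach j v ≡ true
        go stop        = reach-≤ {0} {j} u z≤n reach-start
        go (fwd e h q) = s (tgt e) (tgt< e) (reach-fwd j e h (go q))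
        go (bwd e h q) = s (src e) (src< e) (reach-bwd j e h (go q))

  module Rank (src< : ∀ e → src e < nv) (tgt< : ∀ e → tgt e < nv) (src≢tgt : ∀ e → src e ≢ tgt e) where

    K : Subset m → Fin m → Bool
    K A e = connectedᴱ A (src e) (tgt e)

    K⇒Conn : ∀ {A} e → K A e ≡ true → Conn A (src e) (tgt e)
    K⇒Conn {A} e = reach⇒Conn A (src e) nv

    Conn⇒K : ∀ {A} e → Conn A (src e) (tgt e) → K A e ≡ true
    Conn⇒K {A} e = Conn⇒connected A (src e) src< tgt< (src< e)

    K-closure : Closure K
    K-closure = record
      { K-mono = λ {A} {B} {e} h k → Conn⇒K e (Conn-mono h (K⇒Conn e k))
      ; K-∈ = λ {A} {e} h → Conn⇒K e (fwd e h stop)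
      ; K-trans = λ {A} {e} {f} kf ke → Conn⇒K {A} e (case Conn-split {A} (K⇒Conn e ke) of λ
          { (inj₁ c) → c
          ; (inj₂ (inj₁ (c , d))) → Conn-trans c (Conn-trans (K⇒Conn {A} f kf) d)
          ; (inj₂ (inj₂ (c , d))) → Conn-trans c (Conn-trans (Conn-sym (K⇒Conn {A} f kf)) d) })
      ; K-exchange = λ {A} {e} {f} ¬ke ke → Conn⇒K {A ∪ ⁅ e ⁆} f (case Conn-split {A} (K⇒Conn e ke) of λ
          { (inj₁ c) → true≢false (Conn⇒K {A} e c) ¬ke
          ; (inj₂ (inj₁ (c , d))) → Conn-trans (Conn-sym (up c)) (Conn-trans (self A e) (Conn-sym (up d)))
          ; (inj₂ (inj₂ (c , d))) → Conn-trans (up d) (Conn-trans (Conn-sym (self A e)) (up c)) })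
      }
      where
      up : ∀ {A e u v} → Conn A u v → Conn (A ∪ ⁅ e ⁆) u v
      up = Conn-mono (Sₚ.p⊆p∪q _)
      self : ∀ A e → Conn (A ∪ ⁅ e ⁆) (src e) (tgt e)
      self A e = fwd e (Sₚ.q⊆p∪q A _ (Sₚ.x∈⁅x⁆ e)) stop

    open FromClosure K K-closure public

    forest-dependent : ∀ A → forest A ≡ false → ∃ λ e → e ∈ A × K (A ∖ e) e ≡ true
    forest-dependent A h with all-tabulate-false _ id h
    ... | e , q with lookup A e in p | K (A ∖ e) e in k
    ...   | true  | true  = e , lookup⇒∈ p , k
    ...   | true  | false = case q of λ ()
    ...   | false | _     = case q of λ ()

    forest-independent : ∀ A → forest A ≡ true → Independent A
    forest-independent A h e e∈A with all-tabulate⁻ _ id h e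
    ... | t rewrite ∈⇒lookup e∈A with K (A ∖ e) e
    ...   | false = refl

    rank≡ρ : ∀ A → rkFromIndep forest A ≡ ρ A
    rank≡ρ = rkFromIndep≡ρ forest forest-dependent forest-independent

    ρ-loopless : ∀ e → ρ ⁅ e ⁆ ≡ 1
    ρ-loopless e = trans (cong ρ (sym (Sₚ.∪-identityˡ ⁅ e ⁆)))
        (trans (ρ-add ⊥ e) (cong₂ _+_ ρ-⊥ (cong (λ b → if b then 0 else 1)
      (≢true⇒≡false λ k → src≢tgt e (Conn-label id (λ f f∈ → ⊥-elim (Sₚ.∉⊥ f∈)) (K⇒Conn e k))))))

    gain-no : ∀ {A e} → ¬ Conn A (src e) (tgt e) → gain K A e ≡ 1
    gain-no {A} {e} h = cong (λ b → if b then 0 else 1) (≢true⇒≡false λ k → h (K⇒Conn e k))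

    gain-yes : ∀ {A e} → Conn A (src e) (tgt e) → gain K A e ≡ 0
    gain-yes {A} {e} h = cong (λ b → if b then 0 else 1) (Conn⇒K e h)

-- Polynomials in two variables α and β, as coefficient functions

Bi : Set
Bi = ℤ → ℤ → ℤ

infix 4 _≈_
_≈_ : Bi → Bi → Set
f ≈ g = ∀ i j → f i j ≡ g i j

infixl 6 _⊕_
_⊕_ : Bi → Bi → Bi
(f ⊕ g) i j = f i j +ᶻ g i j

𝟎 𝟏 : Bi
𝟎 i j = + 0
𝟏 (+ 0) (+ 0) = + 1
𝟏 _     _     = + 0

-- Multiplication by the variables. With exponents in ℤ these are plain index shifts without a
-- boundary case.
α β : Bi → Bi
α f i j = f (predᶻ i) j
β f i j = f i (predᶻ j)

-- Weighted walks on ℕ: J true is the Motzkin step operator with level weight β, and J false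
-- has no level step at 0.  In the fan and wheel words the height 0 of J false is the hub.

St : Set
St = ℕ → Bi

infix 4 _≋_
_≋_ : St → St → Set
x ≋ y = ∀ h → x h ≈ y h

infixl 6 _⊞_
_⊞_ : St → St → St
(x ⊞ y) h = x h ⊕ y h

J : Bool → St → St
J true  x zero    = β (x 0) ⊕ α (β (x 1))
J false x zero    = α (β (x 1))
J b     x (suc h) = x h ⊕ β (x (suc h)) ⊕ α (β (x (suc (suc h))))

αˢ : St → St
αˢ x h = α (x h)

-- Transfer operators of one rim position. A rim edge in the flat keeps the height and costs α; a
-- missing one is a step of `J`. `U` sums `L` over the letters allowed above a given letter.
L U : Bool → Bool → St → St
L b true  x = αˢ x
L b false x = J b x
U b true  x = αˢ x
U b false x = J b x ⊞ αˢ x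

-- A joined position confines the walk to height 0, any other position to positive heights; `Π` sums
-- `π` over the spoke bits above a given one.
π Π : Bool → St → St
π true  x zero    = x zero
π true  x (suc h) = 𝟎
π false x zero    = 𝟎
π false x (suc h) = x (suc h)
Π true  x = π true x
Π false x = x

at : ℕ → Bi → St
at zero    p zero    = p
at zero    p (suc h) = 𝟎
at (suc k) p zero    = 𝟎
at (suc k) p (suc h) = at k p h

runL runU : ∀ {n} → Bool → Vec Bool n → St → St
runL b []       x = x
runL b (e ∷ es) x = runL b es (L b e x)
runU b []       x = x
runU b (g ∷ gs) x = runU b gs (U b g x)

-- A word lists the pairs (e , s) of a rim bit and the spoke bit at its first endpoint.

Word : Set
Word = List (Bool × Bool)

run runG : Word → St → St
run  []            x = x
run  ((e , s) ∷ w) x = run w (L false e (π s x))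
runG []            x = x
runG ((e , s) ∷ w) x = runG w (U false e (Π s x))

word : ∀ {n} → Vec Bool n → Vec Bool n → Word
word []       []       = []
word (e ∷ es) (s ∷ ss) = (e , s) ∷ word es ss

-- Abstract multiplication by a polynomial. Operators linear over all of these commute with each
-- other's matrix entries, which `rotate` exploits.
record Scalar (φ : Bi → Bi) : Set where
  field
    φ-cong : ∀ {f g} → f ≈ g → φ f ≈ φ g
    φ-𝟎    : φ 𝟎 ≈ 𝟎
    φ-⊕    : ∀ f g → φ (f ⊕ g) ≈ φ f ⊕ φ g
    φ-α    : ∀ f → φ (α f) ≈ α (φ f)
    φ-β    : ∀ f → φ (β f) ≈ β (φ f)

α-scalar : Scalar α
α-scalar = record { φ-cong = λ h i j → h (predᶻ i) j ; φ-𝟎 = λ i j → refl ; φ-⊕ = λ f g i j → refl ; φ-α = λ f i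
    j → refl ; φ-β = λ f i j → refl }

β-scalar : Scalar β
β-scalar = record { φ-cong = λ h i j → h i (predᶻ j) ; φ-𝟎 = λ i j → refl ; φ-⊕ = λ f g i j → refl ; φ-α = λ f i
    j → refl ; φ-β = λ f i j → refl }

record Linear (F : St → St) : Set where
  field
    cong≋  : ∀ {x y} → x ≋ y → F x ≋ F y
    ⊞-hom  : ∀ x y → F (x ⊞ y) ≋ F x ⊞ F y
    𝟎-hom  : F (λ _ → 𝟎) ≋ (λ _ → 𝟎)
    scalar : ∀ {φ} → Scalar φ → ∀ x → F (λ h → φ (x h)) ≋ (λ h → φ (F x h))

open Linear

≋-refl : ∀ {x} → x ≋ x
≋-refl h i j = refl

≋-sym : ∀ {x y} → x ≋ y → y ≋ x
≋-sym p h i j = sym (p h i j)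

≋-trans : ∀ {x y z} → x ≋ y → y ≋ z → x ≋ z
≋-trans p q h i j = trans (p h i j) (q h i j)

id-linear : Linear (λ x → x)
id-linear = record { cong≋ = id ; ⊞-hom = λ x y h i j → refl ; 𝟎-hom = λ h i j → refl ; scalar = λ s x h i j →
    refl }

∘-linear : ∀ {F G} → Linear F → Linear G → Linear (λ x → F (G x))
∘-linear f g = record
  { cong≋  = λ p → cong≋ f (cong≋ g p)
  ; ⊞-hom  = λ x y → ≋-trans (cong≋ f (⊞-hom g x y)) (⊞-hom f _ _)
  ; 𝟎-hom  = ≋-trans (cong≋ f (𝟎-hom g)) (𝟎-hom f)
  ; scalar = λ s x → ≋-trans (cong≋ f (scalar g s x)) (scalar f s _) }

⊞-linear : ∀ {F G} → Linear F → Linear G → Linear (λ x → F x ⊞ G x)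
⊞-linear {F} {G} f g = record
  { cong≋  = λ p h i j → cong₂ _+ᶻ_ (cong≋ f p h i j) (cong≋ g p h i j)
  ; ⊞-hom  = λ x y h i j → trans (cong₂ _+ᶻ_ (⊞-hom f x y h i j) (⊞-hom g x y h i j))
      (+-interchange (F x h i j) (F y h i j) (G x h i j) (G y h i j))
  ; 𝟎-hom  = λ h i j → cong₂ _+ᶻ_ (𝟎-hom f h i j) (𝟎-hom g h i j)
  ; scalar = λ s x h i j → trans (cong₂ _+ᶻ_ (scalar f s x h i j) (scalar g s x h i j))
      (sym (Scalar.φ-⊕ s _ _ i j)) }

αˢ-linear : Linear αˢ
αˢ-linear = record { cong≋ = λ p h i j → p h (predᶻ i) j ; ⊞-hom = λ x y h i j → refl ; 𝟎-hom = λ h i j → refl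
                   ; scalar = λ s x h i j → sym (Scalar.φ-α s (x h) i j) }

J-linear : ∀ b → Linear (J b)
J-linear b = record { cong≋ = co b ; ⊞-hom = ad b ; 𝟎-hom = ze b ; scalar = λ s → sc s b }
  where
  co : ∀ b {x y} → x ≋ y → J b x ≋ J b y
  co true  p zero    i j = cong₂ _+ᶻ_ (p 0 i (predᶻ j)) (p 1 (predᶻ i) (predᶻ j))
  co false p zero    i j = p 1 (predᶻ i) (predᶻ j)
  co true  p (suc h) i j = cong₂ _+ᶻ_ (cong₂ _+ᶻ_ (p h i j) (p (suc h) i (predᶻ j)))
      (p (suc (suc h)) (predᶻ i) (predᶻ j))
  co false p (suc h) i j = cong₂ _+ᶻ_ (cong₂ _+ᶻ_ (p h i j) (p (suc h) i (predᶻ j)))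
      (p (suc (suc h)) (predᶻ i) (predᶻ j))
  three : ∀ a a′ b b′ c c′ → ((a +ᶻ a′) +ᶻ (b +ᶻ b′)) +ᶻ (c +ᶻ c′) ≡ ((a +ᶻ b) +ᶻ c) +ᶻ ((a′ +ᶻ b′) +ᶻ c′)
  three = solve-∀
  ad : ∀ b x y → J b (x ⊞ y) ≋ J b x ⊞ J b y
  ad true  x y zero    i j = +-interchange (x 0 i (predᶻ j)) (y 0 i (predᶻ j)) (x 1 (predᶻ i) (predᶻ j))
      (y 1 (predᶻ i) (predᶻ j))
  ad false x y zero    i j = refl
  ad true  x y (suc h) i j = three (x h i j) (y h i j) (x (suc h) i (predᶻ j)) (y (suc h) i (predᶻ j))
      (x (suc (suc h)) (predᶻ i) (predᶻ j)) (y (suc (suc h)) (predᶻ i) (predᶻ j))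
  ad false x y (suc h) i j = three (x h i j) (y h i j) (x (suc h) i (predᶻ j)) (y (suc h) i (predᶻ j))
      (x (suc (suc h)) (predᶻ i) (predᶻ j)) (y (suc (suc h)) (predᶻ i) (predᶻ j))
  ze : ∀ b → J b (λ _ → 𝟎) ≋ (λ _ → 𝟎)
  ze true  zero    i j = refl
  ze false zero    i j = refl
  ze true  (suc h) i j = refl
  ze false (suc h) i j = refl
  module _ {φ} (s : Scalar φ) where
    open Scalar s
    αβ : ∀ f → φ (α (β f)) ≈ α (β (φ f))
    αβ f i j = trans (φ-α (β f) i j) (φ-β f (predᶻ i) j)
    stp : ∀ (x : St) h i j → ((φ (x h) ⊕ β (φ (x (suc h)))) ⊕ α (β (φ (x (suc (suc h)))))) i j ≡ φ
        (x h ⊕ β (x (suc h)) ⊕ α (β (x (suc (suc h))))) i j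
    stp x h i j = sym (trans (φ-⊕ (x h ⊕ β (x (suc h))) (α (β (x (suc (suc h))))) i j)
      (cong₂ _+ᶻ_ (trans (φ-⊕ (x h) (β (x (suc h))) i j) (cong (φ (x h) i j +ᶻ_) (φ-β (x (suc h)) i j)))
          (αβ (x (suc (suc h))) i j)))
    sc : ∀ b x → J b (λ h → φ (x h)) ≋ (λ h → φ (J b x h))
    sc true  x zero    i j = sym (trans (φ-⊕ (β (x 0)) (α (β (x 1))) i j)
        (cong₂ _+ᶻ_ (φ-β (x 0) i j) (αβ (x 1) i j)))
    sc false x zero    i j = sym (αβ (x 1) i j)
    sc true  x (suc h) i j = stp x h i j
    sc false x (suc h) i j = stp x h i j

π-linear : ∀ b → Linear (π b)
π-linear b = record { cong≋ = co b ; ⊞-hom = ad b ; 𝟎-hom = ze b ; scalar = sc b }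
  where
  co : ∀ b {x y} → x ≋ y → π b x ≋ π b y
  co true  p zero    i j = p 0 i j
  co true  p (suc h) i j = refl
  co false p zero    i j = refl
  co false p (suc h) i j = p (suc h) i j
  ad : ∀ b x y → π b (x ⊞ y) ≋ π b x ⊞ π b y
  ad true  x y zero    i j = refl
  ad true  x y (suc h) i j = refl
  ad false x y zero    i j = refl
  ad false x y (suc h) i j = refl
  ze : ∀ b → π b (λ _ → 𝟎) ≋ (λ _ → 𝟎)
  ze true  zero    i j = refl
  ze true  (suc h) i j = refl
  ze false zero    i j = refl
  ze false (suc h) i j = refl
  sc : ∀ b {φ} → Scalar φ → ∀ x → π b (λ h → φ (x h)) ≋ (λ h → φ (π b x h))
  sc true  s x zero    i j = refl
  sc true  s x (suc h) i j = sym (Scalar.φ-𝟎 s i j)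
  sc false s x zero    i j = sym (Scalar.φ-𝟎 s i j)
  sc false s x (suc h) i j = refl

L-linear : ∀ b e → Linear (L b e)
L-linear b true  = αˢ-linear
L-linear b false = J-linear b

U-linear : ∀ b e → Linear (U b e)
U-linear b true  = αˢ-linear
U-linear b false = ⊞-linear (J-linear b) αˢ-linear

Π-linear : ∀ s → Linear (Π s)
Π-linear true  = π-linear true
Π-linear false = id-linear

runL-linear : ∀ {n} b (es : Vec Bool n) → Linear (runL b es)
runL-linear b []       = id-linear
runL-linear b (e ∷ es) = ∘-linear (runL-linear b es) (L-linear b e)

runU-linear : ∀ {n} b (es : Vec Bool n) → Linear (runU b es)
runU-linear b []       = id-linear
runU-linear b (e ∷ es) = ∘-linear (runU-linear b es) (U-linear b e)

run-linear : ∀ w → Linear (run w)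
run-linear []            = id-linear
run-linear ((e , s) ∷ w) = ∘-linear (run-linear w) (∘-linear (L-linear false e) (π-linear s))

runG-linear : ∀ w → Linear (runG w)
runG-linear []            = id-linear
runG-linear ((e , s) ∷ w) = ∘-linear (runG-linear w) (∘-linear (U-linear false e) (Π-linear s))

-- Sums over all words above a given word

SupB : Bool → (Bool → ℤ) → ℤ
SupB true  f = f true
SupB false f = f true +ᶻ f false

Sup : ∀ {n} → Vec Bool n → (Vec Bool n → ℤ) → ℤ
Sup []       f = f []
Sup (g ∷ gs) f = SupB g (λ b → Sup gs (f ∘ (b ∷_)))

SupB-cong : ∀ g {f f′ : Bool → ℤ} → (∀ b → f b ≡ f′ b) → SupB g f ≡ SupB g f′
SupB-cong true  h = h true
SupB-cong false h = cong₂ _+ᶻ_ (h true) (h false)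

Sup-cong : ∀ {n} (g : Vec Bool n) {f f′ : Vec Bool n → ℤ} → (∀ e → f e ≡ f′ e) → Sup g f ≡ Sup g f′
Sup-cong []       h = h []
Sup-cong (g ∷ gs) h = SupB-cong g (λ b → Sup-cong gs (h ∘ (b ∷_)))

SupB-+ : ∀ g (f f′ : Bool → ℤ) → SupB g (λ b → f b +ᶻ f′ b) ≡ SupB g f +ᶻ SupB g f′
SupB-+ true  f f′ = refl
SupB-+ false f f′ = +-interchange (f true) (f′ true) (f false) (f′ false)

Sup-+ : ∀ {n} (g : Vec Bool n) (f f′ : Vec Bool n → ℤ) → Sup g (λ e → f e +ᶻ f′ e) ≡ Sup g f +ᶻ Sup g f′
Sup-+ []       f f′ = refl
Sup-+ (g ∷ gs) f f′ = trans (SupB-cong g (λ b → Sup-+ gs (f ∘ (b ∷_)) (f′ ∘ (b ∷_))))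
                            (SupB-+ g (λ b → Sup gs (f ∘ (b ∷_))) (λ b → Sup gs (f′ ∘ (b ∷_))))

Sup-SupB : ∀ {n} (g : Vec Bool n) c (f : Vec Bool n → Bool → ℤ) → Sup g (λ e → SupB c (f e)) ≡ SupB c
    (λ b → Sup g (λ e → f e b))
Sup-SupB g true  f = refl
Sup-SupB g false f = Sup-+ g (λ e → f e true) (λ e → f e false)

Sup-zero : ∀ {n} (g : Vec Bool n) {f : Vec Bool n → ℤ} → (∀ e → f e ≡ + 0) → Sup g f ≡ + 0
Sup-zero []           h = h []
Sup-zero (true ∷ gs)  h = Sup-zero gs (h ∘ (true ∷_))
Sup-zero (false ∷ gs) h = cong₂ _+ᶻ_ (Sup-zero gs (h ∘ (true ∷_))) (Sup-zero gs (h ∘ (false ∷_)))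

Sup-neg : ∀ {n} (g : Vec Bool n) (f : Vec Bool n → ℤ) → Sup g (λ e → - f e) ≡ - Sup g f
Sup-neg []           f = refl
Sup-neg (true ∷ gs)  f = Sup-neg gs (f ∘ (true ∷_))
Sup-neg (false ∷ gs) f = trans (cong₂ _+ᶻ_ (Sup-neg gs (f ∘ (true ∷_))) (Sup-neg gs (f ∘ (false ∷_))))
    (sym (ℤₚ.neg-distrib-+ (Sup gs (f ∘ (true ∷_))) _))

Sup-ΣS : ∀ {n} (g : Subset n) (f : Subset n → ℤ) → ΣS (λ F → ind (g ⊑ F) (f F)) ≡ Sup g f
Sup-ΣS []                  f = refl
Sup-ΣS {suc n} (true ∷ g)  f = trans (cong₂ _+ᶻ_ (Sup-ΣS g (f ∘ (true ∷_))) (ΣS-zero {n} (λ _ → refl)))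
    (ℤₚ.+-identityʳ _)
Sup-ΣS (false ∷ g) f = cong₂ _+ᶻ_ (Sup-ΣS g (f ∘ (true ∷_))) (Sup-ΣS g (f ∘ (false ∷_)))

Sup-++ : ∀ {a b} (g : Subset a) (g′ : Subset b) (f : Subset (a + b) → ℤ) → Sup (g Data.Vec.++ g′) f ≡ Sup g
    (λ e → Sup g′ (λ s → f (e Data.Vec.++ s)))
Sup-++ []      g′ f = refl
Sup-++ (b ∷ g) g′ f = SupB-cong b (λ c → Sup-++ g g′ (f ∘ (c ∷_)))

L-sum : ∀ b g x → ∀ h i j → SupB g (λ e → L b e x h i j) ≡ U b g x h i j
L-sum b true  x h i j = refl
L-sum b false x h i j = ℤₚ.+-comm (x h (predᶻ i) j) _

π-sum : ∀ c x → ∀ h i j → SupB c (λ s → π s x h i j) ≡ Π c x h i j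
π-sum true  x h       i j = refl
π-sum false x zero    i j = ℤₚ.+-identityʳ _
π-sum false x (suc h) i j = ℤₚ.+-identityˡ _

linear-SupB : ∀ {F} → Linear F → ∀ c (f : Bool → St) x → (∀ h i j → SupB c (λ s → f s h i j) ≡ x h i j) →
              ∀ h i j → SupB c (λ s → F (f s) h i j) ≡ F x h i j
linear-SupB l true  f x p h i j = cong≋ l p h i j
linear-SupB l false f x p h i j = trans (sym (⊞-hom l (f true) (f false) h i j)) (cong≋ l p h i j)

-- By linearity the sum over words can be taken one letter at a time, which makes it a product of
-- the operators `U`.
Sup-runL : ∀ {n} b (g : Vec Bool n) x h i j → Sup g (λ e → runL b e x h i j) ≡ runU b g x h i j
Sup-runL b []       x h i j = refl
Sup-runL b (g ∷ gs) x h i j =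
  trans (SupB-cong g (λ e → Sup-runL b gs (L b e x) h i j))
        (linear-SupB (runU-linear b gs) g (λ e → L b e x) (U b g x) (L-sum b g x) h i j)

Sup-run : ∀ {n} (ge gs : Vec Bool n) x h i j → Sup ge (λ e → Sup gs (λ s → run (word e s) x h i j)) ≡ runG
    (word ge gs) x h i j
Sup-run []       []       x h i j = refl
Sup-run (g ∷ ge) (c ∷ gs) x h i j =
  trans (SupB-cong g (λ b → trans (Sup-SupB ge c (λ e d → Sup gs
      (λ s → run (word e s) (L false b (π d x)) h i j)))
                                  (trans (SupB-cong c (λ d → Sup-run ge gs (L false b (π d x)) h i j))
                                         (linear-SupB (∘-linear (runG-linear (word ge gs)) (L-linear false b)) c
                                             (λ d → π d x) (Π c x) (π-sum c x) h i j))))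
        (linear-SupB (runG-linear (word ge gs)) g (λ b → L false b (Π c x)) (U false g (Π c x))
            (L-sum false g (Π c x)) h i j)

-- Elimination of the hub, and symmetry in α and β

pow : (St → St) → ℕ → St → St
pow F zero    x = x
pow F (suc n) x = F (pow F n x)

pow-linear : ∀ {F} → Linear F → ∀ n → Linear (pow F n)
pow-linear l zero    = id-linear
pow-linear l (suc n) = ∘-linear l (pow-linear l n)

𝐓 𝐒 : St → St
𝐓 = U false false
𝐒 = U true false

-- Let X send y to the sequence α y₀, y₀ + α y₁, y₁ + α y₂, and so on. Then 𝐓 X = X 𝐒, and 𝐓 agrees
-- with X on `at 0 p`, so m + 1 powers of 𝐓 equal X after m powers of 𝐒. The entry at height 0,
-- which is `hub₀`, trades the asymmetric 𝐓 for α times an entry of the symmetric 𝐒.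
hub : ∀ m p h → pow 𝐓 (suc m) (at 0 p) (suc h) ≈ pow 𝐒 m (at 0 p) h ⊕ α (pow 𝐒 m (at 0 p) (suc h))
hub₀ : ∀ m p → pow 𝐓 (suc m) (at 0 p) 0 ≈ α (pow 𝐒 m (at 0 p) 0)

private
  hubX : ℕ → Bi → St
  hubX m p zero    = α (pow 𝐒 m (at 0 p) 0)
  hubX m p (suc h) = pow 𝐒 m (at 0 p) h ⊕ α (pow 𝐒 m (at 0 p) (suc h))

  hub≋ : ∀ m p → pow 𝐓 (suc m) (at 0 p) ≋ hubX m p
  hub≋ m p zero    = hub₀ m p
  hub≋ m p (suc h) = hub m p h

hub₀ zero    p i j = ℤₚ.+-identityˡ _
hub₀ (suc m) p i j = cong≋ (U-linear false false) (hub≋ m p) 0 i j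

hub zero p zero    i j = alg (p i j)
  where
  alg : ∀ a → ((a +ᶻ + 0) +ᶻ + 0) +ᶻ + 0 ≡ a +ᶻ + 0
  alg = solve-∀
hub zero p (suc zero)    i j = refl
hub zero p (suc (suc h)) i j = refl
hub (suc m) p zero i j = trans (cong≋ (U-linear false false) (hub≋ m p) 1 i j)
  (alg (w 0 (predᶻ i) j) (w 0 i (predᶻ j)) (w 1 (predᶻ i) (predᶻ j)) (w 2 (predᶻ (predᶻ i)) (predᶻ j))
      (w 1 (predᶻ (predᶻ i)) j))
  where
  w = pow 𝐒 m (at 0 p)
  alg : ∀ a b c e f → ((a +ᶻ (b +ᶻ c)) +ᶻ (c +ᶻ e)) +ᶻ (a +ᶻ f) ≡ ((b +ᶻ c) +ᶻ a) +ᶻ (((a +ᶻ c) +ᶻ e) +ᶻ f)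
  alg = solve-∀
hub (suc m) p (suc h) i j = trans (cong≋ (U-linear false false) (hub≋ m p) (suc (suc h)) i j)
  (alg (w h i j) (w (suc h) (predᶻ i) j) (w (suc h) i (predᶻ j)) (w (suc (suc h)) (predᶻ i) (predᶻ j))
       (w (suc (suc (suc h))) (predᶻ (predᶻ i)) (predᶻ j)) (w (suc (suc h)) (predᶻ (predᶻ i)) j))
  where
  w = pow 𝐒 m (at 0 p)
  alg : ∀ a b c d e f → (((a +ᶻ b) +ᶻ (c +ᶻ d)) +ᶻ (d +ᶻ e)) +ᶻ (b +ᶻ f) ≡ (((a +ᶻ c) +ᶻ d) +ᶻ b) +ᶻ
      (((b +ᶻ d) +ᶻ e) +ᶻ f)
  alg = solve-∀

Symmetric : Bi → Set
Symmetric f = ∀ i j → f i j ≡ f j i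

𝟏-symmetric : Symmetric 𝟏
𝟏-symmetric (+ 0)          (+ 0)          = refl
𝟏-symmetric (+ 0)          (+ suc _)      = refl
𝟏-symmetric (+ 0)          -[1+ _ ]       = refl
𝟏-symmetric (+ suc _)      (+ 0)          = refl
𝟏-symmetric (+ suc _)      (+ suc _)      = refl
𝟏-symmetric (+ suc _)      -[1+ _ ]       = refl
𝟏-symmetric -[1+ _ ]       (+ 0)          = refl
𝟏-symmetric -[1+ _ ]       (+ suc _)      = refl
𝟏-symmetric -[1+ _ ]       -[1+ _ ]       = refl

at-symmetric : ∀ k {p} → Symmetric p → ∀ h → Symmetric (at k p h)
at-symmetric zero    s zero    = s
at-symmetric zero    s (suc h) = λ i j → refl
at-symmetric (suc k) s zero    = λ i j → refl
at-symmetric (suc k) s (suc h) = at-symmetric k s h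

-- The steps of 𝐒 have weights 1, α + β and αβ at every height. 𝐓 fails this only at height 0, where
-- its level weight is α.
𝐒-symmetric : ∀ {x} → (∀ h → Symmetric (x h)) → ∀ h → Symmetric (𝐒 x h)
𝐒-symmetric {x} s zero i j =
  trans (cong₂ _+ᶻ_ (cong₂ _+ᶻ_ (s 0 i (predᶻ j)) (s 1 (predᶻ i) (predᶻ j))) (s 0 (predᶻ i) j))
        (flip (x 0 (predᶻ j) i) (x 1 (predᶻ j) (predᶻ i)) (x 0 j (predᶻ i)))
  where
  flip : ∀ a b c → (a +ᶻ b) +ᶻ c ≡ (c +ᶻ b) +ᶻ a
  flip = solve-∀
𝐒-symmetric {x} s (suc h) i j =
  trans (cong₂ _+ᶻ_ (cong₂ _+ᶻ_ (cong₂ _+ᶻ_ (s h i j) (s (suc h) i (predᶻ j)))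
      (s (suc (suc h)) (predᶻ i) (predᶻ j))) (s (suc h) (predᶻ i) j))
        (flip (x h j i) (x (suc h) (predᶻ j) i) (x (suc (suc h)) (predᶻ j) (predᶻ i)) (x (suc h) j (predᶻ i)))
  where
  flip : ∀ d a b c → ((d +ᶻ a) +ᶻ b) +ᶻ c ≡ ((d +ᶻ c) +ᶻ b) +ᶻ a
  flip = solve-∀

pow-𝐒-symmetric : ∀ m {x} → (∀ h → Symmetric (x h)) → ∀ h → Symmetric (pow 𝐒 m x h)
pow-𝐒-symmetric zero    s = s
pow-𝐒-symmetric (suc m) s = 𝐒-symmetric (pow-𝐒-symmetric m s)

αs : ℕ → Bi → Bi
αs zero    f = f
αs (suc n) f = α (αs n f)

αs-neg : ∀ o f i j → αs o (λ i j → - f i j) i j ≡ - αs o f i j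
αs-neg zero    f i j = refl
αs-neg (suc o) f i j = αs-neg o f (predᶻ i) j

αs-index : ∀ n f k j → αs n f (+ (n + k)) j ≡ f (+ k) j
αs-index zero    f k j = refl
αs-index (suc n) f k j = αs-index n f k j

αs-scalar : ∀ n → Scalar (αs n)
αs-scalar zero = record { φ-cong = id ; φ-𝟎 = λ i j → refl ; φ-⊕ = λ f g i j → refl ; φ-α = λ f i j → refl ; φ-β
    = λ f i j → refl }
αs-scalar (suc n) = record
  { φ-cong = λ h i j → φ-cong h (predᶻ i) j
  ; φ-𝟎    = λ i j → φ-𝟎 (predᶻ i) j
  ; φ-⊕    = λ f g i j → φ-⊕ f g (predᶻ i) j
  ; φ-α    = λ f i j → φ-α f (predᶻ i) j
  ; φ-β    = λ f i j → φ-β f (predᶻ i) j }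
  where open Scalar (αs-scalar n)

-- Words read from hub to hub

bit : Bool → ℕ
bit b = if b then 1 else 0

nxt : Word → Bool → Bool
nxt []            fin = fin
nxt ((e , s) ∷ w) fin = s

-- The rank of the flat, the rim of a wheel excepted: a letter counts if its rim edge is present or
-- its far end is joined to the hub. Spokes are thus charged to the preceding letter, and `fin` is
-- the spoke bit following the last one.
cnt : Word → Bool → ℕ
cnt []            fin = 0
cnt ((e , s) ∷ w) fin = bit (e ∨ nxt w fin) + cnt w fin

Admissible : Word → Bool → Set
Admissible []            fin = Data.Unit.⊤
Admissible ((e , s) ∷ w) fin = (e ≡ true → nxt w fin ≡ true → s ≡ true) × Admissible w fin

private
  Π-idem : ∀ s x → Π s (Π s x) ≋ Π s x
  Π-idem false x = ≋-refl
  Π-idem true  x = λ { zero i j → refl ; (suc h) i j → refl }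

  Π-hub : ∀ s m p → (s ≡ true → m ≡ 0) → Π s (pow 𝐓 m (at 0 p)) ≋ pow 𝐓 m (at 0 p)
  Π-hub false m p m0 = ≋-refl
  Π-hub true  m p m0 rewrite m0 refl = λ { zero i j → refl ; (suc h) i j → refl }

-- A word that is read from hub to hub: each visit of the hub turns the part since the
-- previous visit into a power of α times a polynomial symmetric in α and β.
hub-to-hub : ∀ w fin → Admissible w fin → fin ≡ true → ∀ m p → Symmetric p → (nxt w fin ≡ true → m ≡ 0) →
  ∃ λ p′ → Symmetric p′ × (runG w (Π (nxt w fin) (pow 𝐓 m (at 0 p))) 0 ≈ αs (cnt w fin) p′)
hub-to-hub [] true _ _ m p sp m0 rewrite m0 refl = p , sp , λ i j → refl
hub-to-hub ((e , s) ∷ w) fin (ad , adw) f m p sp m0 = step-e e refl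
  where
  y = Π s (pow 𝐓 m (at 0 p))
  s′ = nxt w fin
  -- Π s′ may be inserted before the next letter since runG starts with it (or w is empty).
  insert : ∀ z → runG w z 0 ≈ runG w (Π s′ z) 0
  insert z = go w f z
    where
    go : ∀ w → fin ≡ true → ∀ z → runG w z 0 ≈ runG w (Π (nxt w fin) z) 0
    go []             refl z i j = refl
    go ((e , true) ∷ w)  _ z i j = cong≋ (runG-linear w)
        (cong≋ (U-linear false e) (λ { zero i j → refl ; (suc h) i j → refl })) 0 i j
    go ((e , false) ∷ w) _ z i j = refl
  Goal : Bool → Set
  Goal e = ∃ λ p′ → Symmetric p′ × (runG w (U false e (Π s y)) 0 ≈ αs (bit (e ∨ s′) + cnt w fin) p′)
  to-s′ : ∀ e → runG w (U false e (Π s y)) 0 ≈ runG w (Π s′ (U false e (pow 𝐓 m (at 0 p)))) 0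
  to-s′ e i j = trans (insert _ i j) (cong≋ (runG-linear w)
      (cong≋ (Π-linear s′) (cong≋ (U-linear false e) (≋-trans (Π-idem s (pow 𝐓 m (at 0 p))) (Π-hub s m p m0))))
      0 i j)
  αout : ∀ z → runG w (αˢ z) 0 ≈ α (runG w z 0)
  αout z = scalar (runG-linear w) α-scalar z 0
  step-e : ∀ b → e ≡ b → Goal b
  step-e false _ = by s′ refl
    where
    by : ∀ b → s′ ≡ b → Goal false
    by false eq with hub-to-hub w fin adw f (suc m) p sp (λ t → true≢false t eq)
    ... | p′ , sp′ , h = p′ , sp′ , λ i j → trans (to-s′ false i j)
        (trans (h i j) (cong (λ b → αs (bit b + cnt w fin) p′ i j) (sym eq)))
    -- The walk returns to the hub after `m + 1` applications of 𝐓. By `hub₀` this is α times a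
    -- symmetric polynomial, with which the count of steps restarts at 0.
    by true eq with hub-to-hub w fin adw f 0 (pow 𝐒 m (at 0 p) 0) (pow-𝐒-symmetric m (at-symmetric 0 sp) 0)
        (λ _ → refl)
    ... | p′ , sp′ , h = p′ , sp′ , λ i j →
        trans (to-s′ false i j)
        (trans (cong≋ (runG-linear w) proj 0 i j)
        (trans (αout _ i j)
        (trans (h (predᶻ i) j) (cong (λ b → αs (bit b + cnt w fin) p′ i j) (sym eq)))))
      where
      q = pow 𝐒 m (at 0 p) 0
      proj : Π s′ (𝐓 (pow 𝐓 m (at 0 p))) ≋ αˢ (Π s′ (at 0 q))
      proj rewrite eq = λ { zero i j → hub₀ m p i j ; (suc h) i j → refl }
  step-e true eqe = by s′ refl
    where
    by : ∀ b → s′ ≡ b → Goal true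
    by false eq with hub-to-hub w fin adw f m p sp (λ t → true≢false t eq)
    ... | p′ , sp′ , h = p′ , sp′ , λ i j → trans (to-s′ true i j)
        (trans (cong≋ (runG-linear w) comm 0 i j) (trans (αout _ i j) (h (predᶻ i) j)))
      where
      comm : Π s′ (αˢ (pow 𝐓 m (at 0 p))) ≋ αˢ (Π s′ (pow 𝐓 m (at 0 p)))
      comm = scalar (Π-linear s′) α-scalar _
    -- The edge leads into a joined position, so by admissibility it also starts at one; hence `m`
    -- is 0 and stays 0.
    by true eq with hub-to-hub w fin adw f m p sp (λ _ → m0 (ad eqe eq))
    ... | p′ , sp′ , h = p′ , sp′ , λ i j → trans (to-s′ true i j)
        (trans (cong≋ (runG-linear w) comm 0 i j) (trans (αout _ i j) (h (predᶻ i) j)))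
      where
      comm : Π s′ (αˢ (pow 𝐓 m (at 0 p))) ≋ αˢ (Π s′ (pow 𝐓 m (at 0 p)))
      comm = scalar (Π-linear s′) α-scalar _

-- Truncated traces and rotation of words

Σ≤ : ℕ → (ℕ → Bi) → Bi
Σ≤ zero    f = f 0
Σ≤ (suc H) f = Σ≤ H f ⊕ f (suc H)

tr : ℕ → (St → St) → Bi
tr H F = Σ≤ H (λ h → F (at h 𝟏) h)

Σ≤-cong : ∀ H {f g : ℕ → Bi} i j → (∀ h → f h i j ≡ g h i j) → Σ≤ H f i j ≡ Σ≤ H g i j
Σ≤-cong zero    i j p = p 0
Σ≤-cong (suc H) i j p = cong₂ _+ᶻ_ (Σ≤-cong H i j p) (p (suc H))

Σ≤-zero : ∀ H {f : ℕ → Bi} i j → (∀ h → f h i j ≡ + 0) → Σ≤ H f i j ≡ + 0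
Σ≤-zero zero    i j p = p 0
Σ≤-zero (suc H) i j p = cong₂ _+ᶻ_ (Σ≤-zero H i j p) (p (suc H))

at-diag : ∀ k p → at k p k ≈ p
at-diag zero    p i j = refl
at-diag (suc k) p i j = at-diag k p i j

at-off : ∀ k p h → h ≢ k → at k p h ≈ 𝟎
at-off zero    p zero    n i j = ⊥-elim (n refl)
at-off zero    p (suc h) n i j = refl
at-off (suc k) p zero    n i j = refl
at-off (suc k) p (suc h) n i j = at-off k p h (λ e → n (cong suc e)) i j

at-φ : ∀ {φ} → Scalar φ → ∀ k p → (λ h → φ (at k p h)) ≋ at k (φ p)
at-φ s zero    p zero    i j = refl
at-φ s zero    p (suc h) i j = Scalar.φ-𝟎 s i j
at-φ s (suc k) p zero    i j = Scalar.φ-𝟎 s i j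
at-φ s (suc k) p (suc h) i j = at-φ s k p h i j

at-cong : ∀ k {p q} → p ≈ q → at k p ≋ at k q
at-cong zero    e zero    = e
at-cong zero    e (suc h) i j = refl
at-cong (suc k) e zero    i j = refl
at-cong (suc k) e (suc h) = at-cong k e h

at0-⊕ : ∀ f g → at 0 (f ⊕ g) ≋ at 0 f ⊞ at 0 g
at0-⊕ f g zero    i j = refl
at0-⊕ f g (suc h) i j = refl

at0-𝟎 : at 0 𝟎 ≋ (λ _ → 𝟎)
at0-𝟎 zero    i j = refl
at0-𝟎 (suc h) i j = refl

-- Going from height 0 to height `h` is multiplication by a matrix entry of `F`. Treating it as a
-- `Scalar` makes a product of polynomials dispensable.
entry-scalar : ∀ {F} → Linear F → ∀ h → Scalar (λ p → F (at 0 p) h)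
entry-scalar l h = record
  { φ-cong = λ e → cong≋ l (at-cong 0 e) h
  ; φ-𝟎    = λ i j → trans (cong≋ l at0-𝟎 h i j) (𝟎-hom l h i j)
  ; φ-⊕    = λ f g i j → trans (cong≋ l (at0-⊕ f g) h i j) (⊞-hom l (at 0 f) (at 0 g) h i j)
  ; φ-α    = λ f i j → trans (cong≋ l (≋-sym (at-φ α-scalar 0 f)) h i j) (scalar l α-scalar (at 0 f) h i j)
  ; φ-β    = λ f i j → trans (cong≋ l (≋-sym (at-φ β-scalar 0 f)) h i j) (scalar l β-scalar (at 0 f) h i j) }

-- `y` cut off above height `H`, written as a sum of point states so that linear operators can be
-- applied term by term.
diagonal : ℕ → St → St
diagonal zero    y = at 0 (y 0)
diagonal (suc H) y = diagonal H y ⊞ at (suc H) (y (suc H))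

diagonal-> : ∀ H y h → H < h → diagonal H y h ≈ 𝟎
diagonal-> zero    y h lt i j = at-off 0 (y 0) h (λ { refl → ℕₚ.<-irrefl refl lt }) i j
diagonal-> (suc H) y h lt i j = cong₂ _+ᶻ_ (diagonal-> H y h (ℕₚ.<-trans ℕₚ.≤-refl lt) i j)
    (at-off (suc H) (y (suc H)) h (λ { refl → ℕₚ.<-irrefl refl lt }) i j)

diagonal-≤ : ∀ H y h → h ≤ H → diagonal H y h ≈ y h
diagonal-≤ zero    y zero z≤n i j = refl
diagonal-≤ (suc H) y h le i j with h Data.Nat.≟ suc H
... | yes refl = trans (cong₂ _+ᶻ_ (diagonal-> H y (suc H) ℕₚ.≤-refl i j) (at-diag (suc H) (y (suc H)) i j))
    (ℤₚ.+-identityˡ _)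
... | no  h≢   = trans (cong₂ _+ᶻ_ (diagonal-≤ H y h (ℕₚ.≤-pred (ℕₚ.≤∧≢⇒< le h≢)) i j)
    (at-off (suc H) (y (suc H)) h h≢ i j)) (ℤₚ.+-identityʳ _)

Support : ℕ → St → Set
Support d x = ∀ h → d < h → x h ≈ 𝟎

diagonal-id : ∀ H y → Support H y → diagonal H y ≋ y
diagonal-id H y s h i j with h Data.Nat.≤? H
... | yes p = diagonal-≤ H y h p i j
... | no ¬p = trans (diagonal-> H y h (ℕₚ.≰⇒> ¬p) i j) (sym (s h (ℕₚ.≰⇒> ¬p) i j))

J-support : ∀ b {d x} → Support d x → Support (suc d) (J b x)
J-support true  s (suc h) (s≤s lt) i j = cong₂ _+ᶻ_
    (cong₂ _+ᶻ_ (s h lt i j) (s (suc h) (ℕₚ.m≤n⇒m≤1+n lt) i (predᶻ j)))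
    (s (suc (suc h)) (ℕₚ.m≤n⇒m≤1+n (ℕₚ.m≤n⇒m≤1+n lt)) (predᶻ i) (predᶻ j))
J-support false s (suc h) (s≤s lt) i j = cong₂ _+ᶻ_
    (cong₂ _+ᶻ_ (s h lt i j) (s (suc h) (ℕₚ.m≤n⇒m≤1+n lt) i (predᶻ j)))
    (s (suc (suc h)) (ℕₚ.m≤n⇒m≤1+n (ℕₚ.m≤n⇒m≤1+n lt)) (predᶻ i) (predᶻ j))

U-support : ∀ b e {d x} → Support d x → Support (suc d) (U b e x)
U-support b true  s h lt i j = s h (ℕₚ.<-trans ℕₚ.≤-refl lt) (predᶻ i) j
U-support b false s h lt i j = cong₂ _+ᶻ_ (J-support b s h lt i j) (s h (ℕₚ.<-trans ℕₚ.≤-refl lt) (predᶻ i) j)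

Π-support : ∀ b {d x} → Support d x → Support d (Π b x)
Π-support true  s (suc h) lt i j = refl
Π-support false s = s

runG-support : ∀ w {d x} → Support d x → Support (Data.List.length w + d) (runG w x)
runG-support []            s = s
runG-support ((e , b) ∷ w) {d} {x} s = subst (λ z → Support z (runG w (U false e (Π b x))))
    (ℕₚ.+-suc (Data.List.length w) d) (runG-support w (U-support false e (Π-support b s)))

runG-++ : ∀ u v x → runG (u ++ v) x ≋ runG v (runG u x)
runG-++ []            v x = ≋-refl
runG-++ ((e , s) ∷ u) v x = runG-++ u v (U false e (Π s x))

-- The trace of a word passing through the hub may be read off starting at the hub,
-- because the matrix entries of words are scalar operators and hence commute.
rotate : ∀ H u e v → Data.List.length ((e , true) ∷ v) ≤ H →
  tr H (runG (u ++ (e , true) ∷ v)) ≈ runG (((e , true) ∷ v) ++ u) (at 0 𝟏) 0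
rotate H u e v len i j =
  trans (Σ≤-cong H i j (λ h → entry h i j))
  (trans (collect H i j)
  (trans (cong≋ (runG-linear u) (diagonal-id H y supp) 0 i j) (sym (runG-++ v′ u (at 0 𝟏) 0 i j))))
  where
  v′ = (e , true) ∷ v
  y = runG v′ (at 0 𝟏)
  supp : Support H y
  supp h lt = runG-support v′ {0} {at 0 𝟏} (λ { (suc h) _ i j → refl }) h
      (ℕₚ.≤-trans (s≤s (subst (_≤ H) (sym (ℕₚ.+-identityʳ _)) len)) lt)
  from-hub : ∀ x → runG v′ x ≋ runG v′ (at 0 (x 0))
  from-hub x = cong≋ (runG-linear v) (cong≋ (U-linear false e) (λ { zero i j → refl ; (suc h) i j → refl }))
  entry : ∀ h → runG (u ++ v′) (at h 𝟏) h ≈ runG u (at h (y h)) 0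
  entry h i j =
    trans (runG-++ u v′ (at h 𝟏) h i j)
    (trans (from-hub (runG u (at h 𝟏)) h i j)
    (trans (sym (scalar (runG-linear u) sc (at h 𝟏) 0 i j))
           (cong≋ (runG-linear u) (at-φ sc h 𝟏) 0 i j)))
    where
    sc = entry-scalar (runG-linear v′) h
  collect : ∀ H → Σ≤ H (λ h → runG u (at h (y h)) 0) ≈ runG u (diagonal H y) 0
  collect zero    i j = refl
  collect (suc H) i j = trans (cong (_+ᶻ runG u (at (suc H) (y (suc H))) 0 i j) (collect H i j))
      (sym (⊞-hom (runG-linear u) (diagonal H y) (at (suc H) (y (suc H))) 0 i j))

-- Words with a forbidden triangle

ok : Bool → Bool → Bool → Bool
ok true  true  s′    = s′
ok true  false s′    = not s′
ok false true  s′    = not s′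
ok false false s′    = true

okc : Word → Bool → Bool
okc []            fin = true
okc ((e , s) ∷ w) fin = ok s e (nxt w fin) ∧ okc w fin

ones : Word → ℕ
ones []            = 0
ones ((e , s) ∷ w) = bit e + ones w

dead : ∀ w fin x → π (nxt w fin) x ≋ (λ _ → 𝟎) → π fin (run w x) ≋ (λ _ → 𝟎)
dead []            fin x z = z
dead ((e , s) ∷ w) fin x z =
  ≋-trans (cong≋ (∘-linear (π-linear fin) (∘-linear (run-linear w) (L-linear false e))) z)
          (𝟎-hom (∘-linear (π-linear fin) (∘-linear (run-linear w) (L-linear false e))))

-- A present edge keeps the height, so it cannot link the hub to a positive height; a missing one
-- cannot link the hub to itself, because `J false` has no level step at 0.
not-ok : ∀ s e s′ x → ok s e s′ ≡ false → π s′ (L false e (π s x)) ≋ (λ _ → 𝟎)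
not-ok true  true  false x _ zero    i j = refl
not-ok true  true  false x _ (suc h) i j = refl
not-ok true  false true  x _ zero    i j = refl
not-ok true  false true  x _ (suc h) i j = refl
not-ok false true  true  x _ zero    i j = refl
not-ok false true  true  x _ (suc h) i j = refl

run-bad : ∀ w fin x → okc w fin ≡ false → π fin (run w x) ≋ (λ _ → 𝟎)
run-bad ((e , s) ∷ w) fin x h with ok s e (nxt w fin) in eq
... | true  = run-bad w fin (L false e (π s x)) h
... | false = dead w fin (L false e (π s x)) (not-ok s e (nxt w fin) x eq)

-- The first letter kills a start at a height that its spoke bit forbids, so a closed walk may be
-- projected at its end as well. This closes the word cyclically, with `fin = s`.
run-read : ∀ e s w h → run ((e , s) ∷ w) (at h 𝟏) h ≈ π s (run ((e , s) ∷ w) (at h 𝟏)) h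
run-read e true  w zero    i j = refl
run-read e true  w (suc h) i j = trans (cong≋ l (λ { zero i j → refl ; (suc k) i j → refl }) (suc h) i j)
    (𝟎-hom l (suc h) i j)
  where l = ∘-linear (run-linear w) (L-linear false e)
run-read e false w zero    i j = trans (cong≋ l (λ { zero i j → refl ; (suc k) i j → refl }) zero i j)
    (𝟎-hom l zero i j)
  where l = ∘-linear (run-linear w) (L-linear false e)
run-read e false w (suc h) i j = refl

tr-bad : ∀ H e s w → okc ((e , s) ∷ w) s ≡ false → tr H (run ((e , s) ∷ w)) ≈ 𝟎
tr-bad H e s w bad i j = Σ≤-zero H i j (λ h → trans (run-read e s w h i j)
    (run-bad ((e , s) ∷ w) s (at h 𝟏) bad h i j))

-- Order in α and degree bounds

Low : ℕ → Bi → Set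
Low c f = ∀ i j → i <ᶻ + c → f i j ≡ + 0

predᶻ-< : ∀ {i c} → i <ᶻ + suc c → predᶻ i <ᶻ + c
predᶻ-< = ℤₚ.+-monoʳ-< (- + 1)

Low-α : ∀ {c f} → Low c f → Low (suc c) (α f)
Low-α l i j lt = l (predᶻ i) j (predᶻ-< lt)

Low-weaken : ∀ {c f} → Low (suc c) f → Low c f
Low-weaken l i j lt = l i j (ℤₚ.<-trans lt (Data.Integer.+<+ ℕₚ.≤-refl))

Low-𝟏 : Low 0 𝟏
Low-𝟏 (+ n)    j (Data.Integer.+<+ ())
Low-𝟏 -[1+ n ] j lt = refl

-- Every counted letter brings one α: a present edge directly, and a missing edge into a joined
-- position through the down step of weight αβ.
run-low : ∀ w fin c x → (∀ h → Low c (π (nxt w fin) x h)) → ∀ h → Low (c + cnt w fin) (π fin (run w x) h)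
run-low [] fin c x l h rewrite ℕₚ.+-identityʳ c = l h
run-low ((e , s) ∷ w) fin c x l h =
  subst (λ z → Low z (π fin (run w (L false e (π s x))) h)) (ℕₚ.+-assoc c (bit (e ∨ nxt w fin)) (cnt w fin))
    (run-low w fin (c + bit (e ∨ nxt w fin)) (L false e (π s x)) (letter e (nxt w fin)) h)
  where
  y = π s x
  J-low : ∀ h → Low c (J false y (suc h))
  J-low h i j lt = cong₂ _+ᶻ_ (cong₂ _+ᶻ_ (l h i j lt) (l (suc h) i (predᶻ j) lt))
      (Low-weaken (Low-α (l (suc (suc h)))) i (predᶻ j) lt)
  letter : ∀ e s′ h → Low (c + bit (e ∨ s′)) (π s′ (L false e y) h)
  letter true  true  zero    rewrite ℕₚ.+-comm c 1 = Low-α (l 0)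
  letter true  true  (suc h) = λ i j _ → refl
  letter true  false zero    = λ i j _ → refl
  letter true  false (suc h) rewrite ℕₚ.+-comm c 1 = Low-α (l (suc h))
  letter false true  zero    rewrite ℕₚ.+-comm c 1 = λ i j lt → Low-α (l 1) i (predᶻ j) lt
  letter false true  (suc h) = λ i j _ → refl
  letter false false zero    = λ i j _ → refl
  letter false false (suc h) rewrite ℕₚ.+-identityʳ c = J-low h

at-low : ∀ k h → Low 0 (at k 𝟏 h)
at-low zero    zero    = Low-𝟏
at-low zero    (suc h) = λ i j _ → refl
at-low (suc k) zero    = λ i j _ → refl
at-low (suc k) (suc h) = at-low k h

Low-at : ∀ s h k → Low 0 (π s (at k 𝟏) h)
Low-at true  zero    k = at-low k 0
Low-at true  (suc h) k = λ i j _ → refl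
Low-at false zero    k = λ i j _ → refl
Low-at false (suc h) k = at-low k (suc h)

tr-low : ∀ H e s w → Low (cnt ((e , s) ∷ w) s) (tr H (run ((e , s) ∷ w)))
tr-low H e s w i j lt = Σ≤-zero H i j (λ h → trans (run-read e s w h i j)
    (run-low ((e , s) ∷ w) s 0 (at h 𝟏) (λ k → Low-at s k h) h i j lt))

-- The exponent of α exceeds that of β by at most `d`. Steps of `J` do not increase this excess, and
-- a present rim edge increases it by 1.
Bnd : ℕ → Bi → Set
Bnd d f = ∀ i j → j +ᶻ + d <ᶻ i → f i j ≡ + 0

Bnd-α : ∀ {d f} → Bnd d f → Bnd (suc d) (α f)
Bnd-α {d} b i j lt = b (predᶻ i) j (subst (_<ᶻ predᶻ i) (eq j (+ d)) (ℤₚ.+-monoʳ-< (- + 1) lt))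
  where
  eq : ∀ j d → (- + 1) +ᶻ (j +ᶻ (+ 1 +ᶻ d)) ≡ j +ᶻ d
  eq = solve-∀

Bnd-β : ∀ {d f} → Bnd d f → Bnd d (β f)
Bnd-β {d} b i j lt = b i (predᶻ j) (ℤₚ.≤-<-trans (ℤₚ.+-monoˡ-≤ (+ d) (ℤₚ.i≤j⇒pred[i]≤j (ℤₚ.≤-refl {j}))) lt)

Bnd-αβ : ∀ {d f} → Bnd d f → Bnd d (α (β f))
Bnd-αβ {d} b i j lt = b (predᶻ i) (predᶻ j) (subst (_<ᶻ predᶻ i) (eq j (+ d)) (ℤₚ.+-monoʳ-< (- + 1) lt))
  where
  eq : ∀ j d → (- + 1) +ᶻ (j +ᶻ d) ≡ ((- + 1) +ᶻ j) +ᶻ d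
  eq = solve-∀

Bnd-⊕ : ∀ {d f g} → Bnd d f → Bnd d g → Bnd d (f ⊕ g)
Bnd-⊕ a b i j lt = cong₂ _+ᶻ_ (a i j lt) (b i j lt)

BndS : ℕ → St → Set
BndS d x = ∀ h → Bnd d (x h)

J-bnd : ∀ b {d x} → BndS d x → BndS d (J b x)
J-bnd true  {x = x} p zero    = Bnd-⊕ {f = β (x 0)} (Bnd-β (p 0)) (Bnd-αβ (p 1))
J-bnd false p zero    = Bnd-αβ (p 1)
J-bnd true  {x = x} p (suc h) = Bnd-⊕ {f = x h ⊕ β (x (suc h))} (Bnd-⊕ {f = x h} (p h) (Bnd-β (p (suc h))))
    (Bnd-αβ (p (suc (suc h))))
J-bnd false {x = x} p (suc h) = Bnd-⊕ {f = x h ⊕ β (x (suc h))} (Bnd-⊕ {f = x h} (p h) (Bnd-β (p (suc h))))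
    (Bnd-αβ (p (suc (suc h))))

L-bnd : ∀ b e {d x} → BndS d x → BndS (bit e + d) (L b e x)
L-bnd b true  p h = Bnd-α (p h)
L-bnd b false p = J-bnd b p

π-bnd : ∀ s {d x} → BndS d x → BndS d (π s x)
π-bnd true  p zero    = p 0
π-bnd true  p (suc h) = λ i j _ → refl
π-bnd false p zero    = λ i j _ → refl
π-bnd false p (suc h) = p (suc h)

private
  move-ones : ∀ o b d → o + (b + d) ≡ b + o + d
  move-ones = solveℕ-∀

run-bnd : ∀ w {d x} → BndS d x → BndS (ones w + d) (run w x)
run-bnd []            p = p
run-bnd ((e , s) ∷ w) {d} {x} p = subst (λ z → BndS z (run w (L false e (π s x))))
    (move-ones (ones w) (bit e) d) (run-bnd w (L-bnd false e (π-bnd s p)))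

𝟏-bnd : Bnd 0 𝟏
𝟏-bnd (+ 0)     (+ 0)     (Data.Integer.+<+ ())
𝟏-bnd (+ 0)     (+ suc n) lt = refl
𝟏-bnd (+ 0)     -[1+ n ]  lt = refl
𝟏-bnd (+ suc n) j         lt = refl
𝟏-bnd -[1+ n ]  j         lt = refl

at-bnd : ∀ k → BndS 0 (at k 𝟏)
at-bnd zero    zero    = 𝟏-bnd
at-bnd zero    (suc h) = λ i j _ → refl
at-bnd (suc k) zero    = λ i j _ → refl
at-bnd (suc k) (suc h) = at-bnd k h

tr-bnd : ∀ H w → Bnd (ones w) (tr H (run w))
tr-bnd H w i j lt = Σ≤-zero H i j (λ h → subst (λ z → BndS z (run w (at h 𝟏))) (ℕₚ.+-identityʳ (ones w))
    (run-bnd w (at-bnd h)) h i j lt)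

ones≤cnt : ∀ w fin → ones w ≤ cnt w fin
ones≤cnt []               fin = z≤n
ones≤cnt ((true , s) ∷ w) fin = s≤s (ones≤cnt w fin)
ones≤cnt ((false , s) ∷ w) fin = ℕₚ.≤-trans (ones≤cnt w fin) (ℕₚ.m≤n+m _ (bit (nxt w fin)))

anyS allS : Word → Bool
anyS []            = false
anyS ((e , s) ∷ w) = s ∨ anyS w
allS []            = true
allS ((e , s) ∷ w) = s ∧ allS w

private
  tight : ∀ e s w fin → cnt ((e , s) ∷ w) fin ≤ ones ((e , s) ∷ w) → (nxt w fin ≡ true → e ≡ true) ×
      (cnt w fin ≤ ones w)
  tight true  s w fin h = (λ _ → refl) , ℕₚ.≤-pred h
  tight false s w fin h with nxt w fin
  ... | true  = ⊥-elim (ℕₚ.<⇒≱ h (ones≤cnt w fin))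
  ... | false = (λ ()) , h

  ok-back : ∀ s {e s′} → e ≡ true → s′ ≡ true → ok s e s′ ≡ true → s ≡ true
  ok-back true  refl refl _ = refl
  ok-back false refl refl ()

-- If `cnt` is no larger than `ones`, every letter leading to a joined position has its rim edge,
-- and the triangle condition carries joinedness backwards from any joined position to the head.
tight⇒head : ∀ w fin → okc w fin ≡ true → cnt w fin ≤ ones w → anyS w ≡ true → nxt w fin ≡ true
tight⇒head ((e , true) ∷ w)  fin o c a = refl
tight⇒head ((e , false) ∷ w) fin o c a with tight e false w fin c
... | e≡ , c′ = ok-back false (e≡ n) n (∧-trueˡ o)
  where n = tight⇒head w fin (∧-trueʳ {ok false e (nxt w fin)} o) c′ a

tight⇒all : ∀ w fin → okc w fin ≡ true → cnt w fin ≤ ones w → fin ≡ true → allS w ≡ true × (nxt w fin ≡ true)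
tight⇒all []            fin o c f = refl , f
tight⇒all ((e , s) ∷ w) fin o c f with tight e s w fin c
... | e≡ , c′ with tight⇒all w fin (∧-trueʳ {ok s e (nxt w fin)} o) c′ f
...   | al , n = ∧-true s≡ al , s≡
  where s≡ = ok-back s (e≡ n) n (∧-trueˡ o)

cnt-all : ∀ w fin → okc w fin ≡ true → fin ≡ true → allS w ≡ true → cnt w fin ≡ Data.List.length w
cnt-all []               fin o f a = refl
cnt-all ((e , s) ∷ w) fin o f a = cong₂ _+_ (cong bit
    (trans (cong (e ∨_) (n w (∧-trueʳ {s} a))) (𝔹ₚ.∨-zeroʳ e)))
    (cnt-all w fin (∧-trueʳ {ok s e (nxt w fin)} o) f (∧-trueʳ {s} a))
  where
  n : ∀ w → allS w ≡ true → nxt w fin ≡ true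
  n []            _ = f
  n ((e , s) ∷ w) a = ∧-trueˡ a

-- In the case of equality, joinedness would travel backwards around the whole cycle and `cnt` would
-- be the length of the word. The strict inequality turns the bound on the excess into the bound on
-- the degree by less than half of the corank.
cyclic-strict : ∀ e s w → okc ((e , s) ∷ w) s ≡ true → anyS ((e , s) ∷ w) ≡ true →
  cnt ((e , s) ∷ w) s < Data.List.length ((e , s) ∷ w) → ones ((e , s) ∷ w) < cnt ((e , s) ∷ w) s
cyclic-strict e s w o a lt with cnt ((e , s) ∷ w) s Data.Nat.≤? ones ((e , s) ∷ w)
... | no ¬p = ℕₚ.≰⇒> ¬p
... | yes p = ⊥-elim (ℕₚ.<-irrefl (cnt-all ((e , s) ∷ w) s o s≡ (proj₁ (tight⇒all ((e , s) ∷ w) s o p s≡))) lt)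
  where
  s≡ = tight⇒head ((e , s) ∷ w) s o p a

-- Words without spokes

Σ≤-shift : ∀ H f → Σ≤ (suc H) f ≈ f 0 ⊕ Σ≤ H (f ∘ suc)
Σ≤-shift zero    f i j = refl
Σ≤-shift (suc H) f i j = trans (cong (_+ᶻ f (suc (suc H)) i j) (Σ≤-shift H f i j)) (ℤₚ.+-assoc (f 0 i j) _ _)

-- Without spokes the walk lives on positive heights, where `J false` acts as `J true` does one
-- height lower; a walk that steps down to 0 is lost at the next projection.
run-rim : ∀ {n} (es : Vec Bool n) x h → run (word es ⊥) x (suc h) ≈ runL true es (x ∘ suc) h
run-rim []       x h i j = refl
run-rim (e ∷ es) x h i j = trans (run-rim es (L false e (π false x)) h i j)
    (cong≋ (runL-linear true es) (letter e) h i j)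
  where
  letter : ∀ e → (L false e (π false x) ∘ suc) ≋ L true e (x ∘ suc)
  letter true  h       i j = refl
  letter false zero    i j = cong (_+ᶻ x 2 (predᶻ i) (predᶻ j)) (ℤₚ.+-identityˡ (x 1 i (predᶻ j)))
  letter false (suc h) i j = refl

tr-rim : ∀ {n} H e (es : Vec Bool n) → tr (suc H) (run (word (e ∷ es) ⊥)) ≈ tr H (runL true (e ∷ es))
tr-rim H e es i j = trans (Σ≤-shift H (λ h → run w (at h 𝟏) h) i j)
  (trans (cong₂ _+ᶻ_ (run-read e false (word es ⊥) 0 i j)
     (Σ≤-cong H i j (λ h → trans (run-rim (e ∷ es) (at (suc h) 𝟏) h i j)
         (cong≋ (runL-linear true (e ∷ es)) (λ k i j → refl) h i j))))
     (ℤₚ.+-identityˡ _))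
  where w = word (e ∷ es) ⊥

onesV zerosV : ∀ {n} → Vec Bool n → ℕ
onesV  []       = 0
onesV  (e ∷ es) = bit e + onesV es
zerosV []       = 0
zerosV (e ∷ es) = bit (not e) + zerosV es

ones+zeros : ∀ {n} (es : Vec Bool n) → onesV es + zerosV es ≡ n
ones+zeros []           = refl
ones+zeros (true ∷ es)  = cong suc (ones+zeros es)
ones+zeros (false ∷ es) = trans (ℕₚ.+-suc (onesV es) (zerosV es)) (cong suc (ones+zeros es))

nxt-rim : ∀ {n} (es : Vec Bool n) → nxt (word es ⊥) false ≡ false
nxt-rim []       = refl
nxt-rim (e ∷ es) = refl

cnt-rim : ∀ {n} (es : Vec Bool n) → cnt (word es ⊥) false ≡ onesV es
cnt-rim []       = refl
cnt-rim (e ∷ es) = cong₂ _+_ (cong bit (trans (cong (e ∨_) (nxt-rim es)) (𝔹ₚ.∨-identityʳ e))) (cnt-rim es)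

okc-rim : ∀ {n} (es : Vec Bool n) → okc (word es ⊥) false ≡ true
okc-rim []       = refl
okc-rim (e ∷ es) = ∧-true (trans (cong (ok false e) (nxt-rim es)) (ok-false e)) (okc-rim es)
  where
  ok-false : ∀ e → ok false e false ≡ true
  ok-false true  = refl
  ok-false false = refl

Agree : ℕ → St → St → Set
Agree d x y = ∀ h i j → j +ᶻ + d ≤ᶻ i → x h i j ≡ y h i j

private
  pred-< : ∀ i j d → j +ᶻ + d ≤ᶻ i → predᶻ j +ᶻ + d <ᶻ i
  pred-< i j d le = ℤₚ.<-≤-trans (ℤₚ.+-monoˡ-< (+ d) (ℤₚ.i≤pred[j]⇒i<j {predᶻ j} {j} ℤₚ.≤-refl)) le

  pred-≤ : ∀ i j d → j +ᶻ + d ≤ᶻ i → predᶻ j +ᶻ + d ≤ᶻ predᶻ i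
  pred-≤ i j d le = subst (_≤ᶻ predᶻ i) (eq j (+ d)) (ℤₚ.+-monoʳ-≤ (- + 1) le)
    where
    eq : ∀ j d → (- + 1) +ᶻ (j +ᶻ d) ≡ ((- + 1) +ᶻ j) +ᶻ d
    eq = solve-∀

-- The operators differ only by the level step at 0. Its weight β lowers the excess of α over β, so
-- it is invisible in the coefficients of extreme excess.
J-agree : ∀ {d x y} → BndS d x → BndS d y → Agree d x y → Agree d (J true x) (J false y)
J-agree {d} bx by a zero    i j le = trans (cong₂ _+ᶻ_ (bx 0 i (predᶻ j) (pred-< i j d le))
    (a 1 (predᶻ i) (predᶻ j) (pred-≤ i j d le))) (ℤₚ.+-identityˡ _)
J-agree {d} bx by a (suc h) i j le = cong₂ _+ᶻ_ (cong₂ _+ᶻ_ (a h i j le)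
    (trans (bx (suc h) i (predᶻ j) (pred-< i j d le)) (sym (by (suc h) i (predᶻ j) (pred-< i j d le)))))
    (a (suc (suc h)) (predᶻ i) (predᶻ j) (pred-≤ i j d le))

L-agree : ∀ e {d x y} → BndS d x → BndS d y → Agree d x y → Agree (bit e + d) (L true e x) (L false e y)
L-agree true  {d} bx by a h i j le = a h (predᶻ i) j
    (subst (_≤ᶻ predᶻ i) (eq j (+ d)) (ℤₚ.+-monoʳ-≤ (- + 1) le))
  where
  eq : ∀ j d → (- + 1) +ᶻ (j +ᶻ (+ 1 +ᶻ d)) ≡ j +ᶻ d
  eq = solve-∀
L-agree false bx by a = J-agree bx by a

runL-agree : ∀ {n} (es : Vec Bool n) {d x y} → BndS d x → BndS d y → Agree d x y → Agree (onesV es + d)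
    (runL true es x) (runL false es y)
runL-agree []       bx by a = a
runL-agree (e ∷ es) {d} {x} {y} bx by a = subst (λ z → Agree z (runL true es (L true e x))
    (runL false es (L false e y))) (move-ones (onesV es) (bit e) d)
  (runL-agree es (L-bnd true e bx) (L-bnd false e by) (L-agree e bx by a))

LowS : ℕ → St → Set
LowS c x = ∀ h → Low c (x h)

J-lowS : ∀ b {c x} → LowS c x → LowS c (J b x)
J-lowS true  l zero    i j lt = cong₂ _+ᶻ_ (l 0 i (predᶻ j) lt) (Low-weaken (Low-α (l 1)) i (predᶻ j) lt)
J-lowS false l zero    i j lt = Low-weaken (Low-α (l 1)) i (predᶻ j) lt
J-lowS true  l (suc h) i j lt = cong₂ _+ᶻ_ (cong₂ _+ᶻ_ (l h i j lt) (l (suc h) i (predᶻ j) lt))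
    (Low-weaken (Low-α (l (suc (suc h)))) i (predᶻ j) lt)
J-lowS false l (suc h) i j lt = cong₂ _+ᶻ_ (cong₂ _+ᶻ_ (l h i j lt) (l (suc h) i (predᶻ j) lt))
    (Low-weaken (Low-α (l (suc (suc h)))) i (predᶻ j) lt)

runL-low : ∀ {n} b (es : Vec Bool n) {c x} → LowS c x → LowS (onesV es + c) (runL b es x)
runL-low b []           l = l
runL-low b (true ∷ es)  {c} {x} l = subst (λ z → LowS z (runL b es (αˢ x))) (ℕₚ.+-suc (onesV es) c)
    (runL-low b es (λ h → Low-α (l h)))
runL-low b (false ∷ es) l = runL-low b es (J-lowS b l)

-- Closed walks that never meet the hub have no distinguished height, so their trace is
-- infinite; D replaces its divergent part by one diagonal entry far from the boundary.
D : ∀ {n} → ℕ → Vec Bool n → Bi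
D H es i j = runL true es (at H 𝟏) H i j - tr H (runL false es) i j

-- The trace of the word reaches one height less after the shift in `tr-rim`, and the diagonal entry
-- in `D` supplies that height. The weight is therefore a difference of two traces over the same
-- heights: the closed walks that use a level step at 0.
rim-term : ∀ {n} H e (es : Vec Bool n) i j →
  tr (suc H) (run (word (e ∷ es) ⊥)) i j +ᶻ D (suc H) (e ∷ es) i j
  ≡ tr (suc H) (runL true (e ∷ es)) i j - tr (suc H) (runL false (e ∷ es)) i j
rim-term H e es i j = trans (cong (_+ᶻ D (suc H) (e ∷ es) i j) (tr-rim H e es i j))
    (sym (ℤₚ.+-assoc (tr H (runL true (e ∷ es)) i j) _ _))

rim-high : ∀ {n} H (es : Vec Bool n) i j → j +ᶻ + onesV es ≤ᶻ i → tr H (runL true es) i j - tr H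
    (runL false es) i j ≡ + 0
rim-high H es i j le = trans (cong (_- tr H (runL false es) i j) (Σ≤-cong H i j λ h →
    subst (λ z → Agree z (runL true es (at h 𝟏)) (runL false es (at h 𝟏))) (ℕₚ.+-identityʳ (onesV es))
        (runL-agree es (at-bnd h) (at-bnd h) (λ _ _ _ _ → refl)) h i j le))
  (ℤₚ.+-inverseʳ (tr H (runL false es) i j))

rim-low : ∀ {n} H (es : Vec Bool n) i j → i <ᶻ + onesV es → tr H (runL true es) i j - tr H
    (runL false es) i j ≡ + 0
rim-low H es i j lt = cong₂ _-_ (one true) (one false)
  where
  one : ∀ b → tr H (runL b es) i j ≡ + 0
  one b = Σ≤-zero H i j λ h → subst (λ z → LowS z (runL b es (at h 𝟏))) (ℕₚ.+-identityʳ (onesV es))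
      (runL-low b es (at-low h)) h i j lt

Sup-Σ≤ : ∀ {n} (g : Vec Bool n) H (f : Vec Bool n → ℕ → Bi) i j → Sup g (λ e → Σ≤ H (f e) i j) ≡ Σ≤ H
    (λ h i j → Sup g (λ e → f e h i j)) i j
Sup-Σ≤ g zero    f i j = refl
Sup-Σ≤ g (suc H) f i j = trans (Sup-+ g (λ e → Σ≤ H (f e) i j) (λ e → f e (suc H) i j))
    (cong (_+ᶻ Sup g (λ e → f e (suc H) i j)) (Sup-Σ≤ g H f i j))

Sup-tr-run : ∀ {n} H (ge gs : Vec Bool n) i j → Sup ge (λ e → Sup gs (λ s → tr H (run (word e s)) i j)) ≡ tr H
    (runG (word ge gs)) i j
Sup-tr-run H ge gs i j =
  trans (Sup-cong ge (λ e → Sup-Σ≤ gs H (λ s h → run (word e s) (at h 𝟏) h) i j))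
  (trans (Sup-Σ≤ ge H (λ e h i j → Sup gs (λ s → run (word e s) (at h 𝟏) h i j)) i j)
         (Σ≤-cong H i j (λ h → Sup-run ge gs (at h 𝟏) h i j)))

⊑⊥⇒≡ : ∀ {n} (s : Vec Bool n) → s ⊑ ⊥ ≡ true → s ≡ ⊥
⊑⊥⇒≡ []          _ = refl
⊑⊥⇒≡ (false ∷ s) h = cong (false ∷_) (⊑⊥⇒≡ s h)

Sup-⊥ : ∀ {n} (g : Vec Bool n) c → Sup g (λ s → ind (s ⊑ ⊥) c) ≡ ind (g ⊑ ⊥) c
Sup-⊥ []           c = refl
Sup-⊥ (true ∷ gs)  c = Sup-zero gs (λ _ → refl)
Sup-⊥ (false ∷ gs) c = trans (cong₂ _+ᶻ_ (Sup-zero gs (λ _ → refl)) (Sup-⊥ gs c)) (ℤₚ.+-identityˡ _)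

Sup-ind : ∀ {n} (g : Vec Bool n) b (f : Vec Bool n → ℤ) → Sup g (λ e → ind b (f e)) ≡ ind b (Sup g f)
Sup-ind g true  f = refl
Sup-ind g false f = Sup-zero g (λ _ → refl)

runG-rim : ∀ {n} (ge : Vec Bool n) x → runG (word ge ⊥) x ≋ runU false ge x
runG-rim []       x = ≋-refl
runG-rim (g ∷ ge) x = runG-rim ge (U false g x)

Sup-D : ∀ {n} H (ge : Vec Bool n) i j → Sup ge (λ e → D H e i j) ≡ runU true ge (at H 𝟏) H i j - tr H
    (runU false ge) i j
Sup-D H ge i j =
  trans (Sup-+ ge (λ e → runL true e (at H 𝟏) H i j) (λ e → - tr H (runL false e) i j))
  (cong₂ _+ᶻ_ (Sup-runL true ge (at H 𝟏) H i j)
    (trans (Sup-neg ge (λ e → tr H (runL false e) i j))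
        (cong -_ (trans (Sup-Σ≤ ge H (λ e h → runL false e (at h 𝟏) h) i j)
      (Σ≤-cong H i j (λ h → Sup-runL false ge (at h 𝟏) h i j))))))

pow-comm : ∀ F n x → pow F n (F x) ≡ F (pow F n x)
pow-comm F zero    x = refl
pow-comm F (suc n) x = cong F (pow-comm F n x)

runU-pow : ∀ {n} b (ge : Vec Bool n) x → runU b ge x ≋ (λ h → αs (onesV ge) (pow (U b false) (zerosV ge) x h))
runU-pow b []           x = ≋-refl
runU-pow b (true ∷ ge)  x = ≋-trans (scalar (runU-linear b ge) α-scalar x)
    (λ h i j → runU-pow b ge x h (predᶻ i) j)
runU-pow b (false ∷ ge) x h i j = trans (runU-pow b ge (U b false x) h i j)
    (cong (λ y → αs (onesV ge) (y h) i j) (pow-comm (U b false) (zerosV ge) x))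

-- For a flat F of rank r the weight is α^r times the Kazhdan–Lusztig polynomial of the
-- contraction at F, homogenised by t = α/β; words of non-flats have weight 0.
whirl-term wheel-term : ∀ {n} → Vec Bool (suc n) → Vec Bool (suc n) → Bi
whirl-term {n} es ss i j = tr (suc n) (run (word es ss)) i j +ᶻ ind (ss ⊑ ⊥) (D (suc n) es i j)

-- Above a set without spokes, the trace coming from the words cancels the one subtracted in `D`,
-- and only a diagonal entry of `runU true` far from the boundary remains.
Sup-whirl : ∀ {n} (ge gs : Vec Bool (suc n)) i j → Sup ge (λ e → Sup gs (λ s → whirl-term e s i j))
  ≡ (if gs ⊑ ⊥ then runU true ge (at (suc n) 𝟏) (suc n) i j else tr (suc n) (runG (word ge gs)) i j)
Sup-whirl {n} ge gs i j =
  trans (Sup-cong ge (λ e → Sup-+ gs (λ s → tr (suc n) (run (word e s)) i j)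
      (λ s → ind (s ⊑ ⊥) (D (suc n) e i j))))
  (trans (Sup-+ ge (λ e → Sup gs (λ s → tr (suc n) (run (word e s)) i j))
      (λ e → Sup gs (λ s → ind (s ⊑ ⊥) (D (suc n) e i j))))
  (trans (cong₂ _+ᶻ_ (Sup-tr-run (suc n) ge gs i j)
     (trans (Sup-cong ge (λ e → Sup-⊥ gs (D (suc n) e i j)))
         (trans (Sup-ind ge (gs ⊑ ⊥) (λ e → D (suc n) e i j)) (cong (ind (gs ⊑ ⊥)) (Sup-D (suc n) ge i j)))))
  (finish (gs ⊑ ⊥) refl)))
  where
  a = tr (suc n) (runG (word ge gs)) i j
  b = runU true ge (at (suc n) 𝟏) (suc n) i j
  c = tr (suc n) (runU false ge) i j
  cancel : ∀ b c → c +ᶻ (b - c) ≡ b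
  cancel = solve-∀
  finish : ∀ t → gs ⊑ ⊥ ≡ t → a +ᶻ ind t (b - c) ≡ (if t then b else a)
  finish false _ = ℤₚ.+-identityʳ a
  finish true  t = trans (cong (_+ᶻ (b - c)) (trans (cong (λ z → tr (suc n) (runG (word ge z)) i j) (⊑⊥⇒≡ gs t))
      (Σ≤-cong (suc n) i j λ h → runG-rim ge (at h 𝟏) h i j))) (cancel b c)

motzkin : Bool → ℕ → St
motzkin b k = pow (J b) k (at 0 𝟏)

-- For k ≥ 2, - κ k is the difference of the polynomials of the whirl and the wheel with
-- k spokes; the recursion makes the binomial transform of κ telescope in Ψ-κ.
κ : ℕ → Bi
κ zero    = 𝟎
κ (suc k) i j = - ((motzkin true k 1 (predᶻ i) (predᶻ j) +ᶻ ind (k ≡ᵇ 0) (𝟏 i (predᶻ j))) +ᶻ κ k (predᶻ i) j)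

-- The difference between the weights of wheel and whirl on sets without spokes. The full rim is a
-- wheel flat of rank `n` and corank 1 with polynomial 1, which is the separate summand α^n β; with
-- missing edges the difference depends only on their number.
Kterm : ∀ {n} → Vec Bool (suc n) → Bi
Kterm {n} es i j = αs (onesV es) (κ (zerosV es)) i j +ᶻ ind (zerosV es ≡ᵇ 0) (αs n (β 𝟏) i j)

wheel-term es ss i j = whirl-term es ss i j +ᶻ ind (ss ⊑ ⊥) (Kterm es i j)

-- The binomial transform and the correction for wheels

-- `Ψ K f` is the sum over j of binom(K,j) α^(K-j) `f j`; it groups the vectors above a given one by
-- their number of zeros.
Ψ : ℕ → (ℕ → Bi) → Bi
Ψ zero    f = f 0
Ψ (suc K) f = α (Ψ K f) ⊕ Ψ K (f ∘ suc)

Sup-Ψ : ∀ {n} (ge : Vec Bool n) f i j → Sup ge (λ e → αs (onesV e) (f (zerosV e)) i j) ≡ αs (onesV ge)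
    (Ψ (zerosV ge) f) i j
Sup-Ψ []           f i j = refl
Sup-Ψ (true ∷ ge)  f i j = Sup-Ψ ge f (predᶻ i) j
Sup-Ψ (false ∷ ge) f i j = trans (cong₂ _+ᶻ_ (Sup-Ψ ge f (predᶻ i) j) (Sup-Ψ ge (f ∘ suc) i j))
  (trans (cong (_+ᶻ αs (onesV ge) (Ψ (zerosV ge) (f ∘ suc)) i j)
      (sym (Scalar.φ-α (αs-scalar (onesV ge)) (Ψ (zerosV ge) f) i j)))
         (sym (Scalar.φ-⊕ (αs-scalar (onesV ge)) (α (Ψ (zerosV ge) f)) (Ψ (zerosV ge) (f ∘ suc)) i j)))

Ψ-cong : ∀ K {f g : ℕ → Bi} → (∀ k → f k ≈ g k) → Ψ K f ≈ Ψ K g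
Ψ-cong zero    p = p 0
Ψ-cong (suc K) p i j = cong₂ _+ᶻ_ (Ψ-cong K p (predᶻ i) j) (Ψ-cong K (p ∘ suc) i j)

Ψ-⊕ : ∀ K f g → Ψ K (λ k → f k ⊕ g k) ≈ Ψ K f ⊕ Ψ K g
Ψ-⊕ zero    f g i j = refl
Ψ-⊕ (suc K) f g i j = trans (cong₂ _+ᶻ_ (Ψ-⊕ K f g (predᶻ i) j) (Ψ-⊕ K (f ∘ suc) (g ∘ suc) i j))
    (+-interchange (Ψ K f (predᶻ i) j) _ _ _)

Ψ-scalar : ∀ {φ} → Scalar φ → ∀ K f → Ψ K (λ k → φ (f k)) ≈ φ (Ψ K f)
Ψ-scalar s zero    f i j = refl
Ψ-scalar s (suc K) f i j = trans (cong₂ _+ᶻ_ (trans (Ψ-scalar s K f (predᶻ i) j)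
    (sym (Scalar.φ-α s (Ψ K f) i j))) (Ψ-scalar s K (f ∘ suc) i j))
    (sym (Scalar.φ-⊕ s (α (Ψ K f)) (Ψ K (f ∘ suc)) i j))

-- The binomial theorem, since 𝐒 is `J true` plus the scalar α.
Ψ-pow : ∀ K x h → Ψ K (λ k → pow (J true) k x h) ≈ pow 𝐒 K x h
Ψ-pow zero    x h i j = refl
Ψ-pow (suc K) x h i j =
  trans (cong₂ _+ᶻ_ (Ψ-pow K x h (predᶻ i) j)
    (trans (Ψ-cong K (λ k i j → cong (λ y → y h i j) (sym (pow-comm (J true) k x))) i j)
        (Ψ-pow K (J true x) h i j)))
  (trans (ℤₚ.+-comm (pow 𝐒 K x h (predᶻ i) j) _)
  (trans (cong (pow 𝐒 K (J true x) h i j +ᶻ_) (sym (scalar l α-scalar x h i j)))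
  (trans (sym (⊞-hom l (J true x) (αˢ x) h i j)) (cong (λ y → y h i j) (pow-comm 𝐒 K x)))))
  where l = pow-linear (U-linear true false) K

Ψ-delta : ∀ K → Ψ K (λ k i j → ind (k ≡ᵇ 0) (𝟏 i (predᶻ j))) ≈ αs K (β 𝟏)
Ψ-delta zero    i j = refl
Ψ-delta (suc K) i j = trans (cong₂ _+ᶻ_ (Ψ-delta K (predᶻ i) j) (vanish K i j)) (ℤₚ.+-identityʳ _)
  where
  vanish : ∀ K → Ψ K (λ _ → 𝟎) ≈ 𝟎
  vanish zero    i j = refl
  vanish (suc K) i j = cong₂ _+ᶻ_ (vanish K (predᶻ i) j) (vanish K i j)

neg-scalar : Scalar (λ f i j → - f i j)
neg-scalar = record { φ-cong = λ h i j → cong -_ (h i j) ; φ-𝟎 = λ i j → refl ; φ-⊕ = λ f g i j →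
    ℤₚ.neg-distrib-+ (f i j) (g i j) ; φ-α = λ f i j → refl ; φ-β = λ f i j → refl }

-- One level of the transform combines α `κ k` with `κ (suc k)`, and by the recursion this sum no
-- longer contains `κ`.
Ψ-κ : ∀ K i j → Ψ (suc K) κ i j ≡ - (pow 𝐒 K (at 0 𝟏) 1 (predᶻ i) (predᶻ j) +ᶻ αs K (β 𝟏) i j)
Ψ-κ K i j =
  trans (cong (_+ᶻ Ψ K (κ ∘ suc) i j) (sym (Ψ-scalar α-scalar K κ i j)))
  (trans (sym (Ψ-⊕ K (λ k → α (κ k)) (κ ∘ suc) i j))
  (trans (Ψ-cong K (λ k i j → alg (κ k (predᶻ i) j) _) i j)
  (trans (Ψ-scalar neg-scalar K (λ k → g k ⊕ h k) i j)
  (cong -_ (trans (Ψ-⊕ K g h i j) (cong₂ _+ᶻ_ (trans (Ψ-scalar α-scalar K (λ k → β (motzkin true k 1)) i j)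
      (trans (Ψ-scalar β-scalar K (λ k → motzkin true k 1) (predᶻ i) j)
      (Ψ-pow K (at 0 𝟏) 1 (predᶻ i) (predᶻ j)))) (Ψ-delta K i j)))))))
  where
  g h : ℕ → Bi
  g k = α (β (motzkin true k 1))
  h k i j = ind (k ≡ᵇ 0) (𝟏 i (predᶻ j))
  alg : ∀ a b → a +ᶻ (- (b +ᶻ a)) ≡ - b
  alg = solve-∀

Sup-all : ∀ {n} (ge : Vec Bool n) c → Sup ge (λ e → ind (zerosV e ≡ᵇ 0) c) ≡ c
Sup-all []           c = refl
Sup-all (true ∷ ge)  c = Sup-all ge c
Sup-all (false ∷ ge) c = trans (cong₂ _+ᶻ_ (Sup-all ge c) (Sup-zero ge (λ _ → refl))) (ℤₚ.+-identityʳ c)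

-- The monomial α^n β from `Ψ-κ` cancels the separate summand for the full rim. What is left is
-- symmetric up to a power of α.
Sup-Kterm : ∀ {n} (ge : Vec Bool (suc n)) K → zerosV ge ≡ suc K → ∀ i j →
  Sup ge (λ e → Kterm e i j) ≡ - αs (onesV ge) (α (β (pow 𝐒 K (at 0 𝟏) 1))) i j
Sup-Kterm {n} ge K z i j =
  trans (Sup-+ ge (λ e → αs (onesV e) (κ (zerosV e)) i j) (λ e → ind (zerosV e ≡ᵇ 0) (αs n (β 𝟏) i j)))
  (trans (cong₂ _+ᶻ_ (trans (Sup-Ψ ge κ i j) (trans (cong (λ m → αs (onesV ge) (Ψ m κ) i j) z)
      (φ-cong (Ψ-κ K) i j))) (Sup-all ge (αs n (β 𝟏) i j)))
  (trans (cong₂ _+ᶻ_ (αs-neg (onesV ge) _ i j) (cong (λ m → αs m (β 𝟏) i j) n≡))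
  (trans (cong (λ y → - y +ᶻ αs (onesV ge + K) (β 𝟏) i j) (φ-⊕ (α (β (pow 𝐒 K (at 0 𝟏) 1))) (αs K (β 𝟏)) i j))
  (trans (cong (λ y → - (x +ᶻ αs (onesV ge) (αs K (β 𝟏)) i j) +ᶻ y) (αs-+ (onesV ge) K (β 𝟏) i j)) (alg x _)))))
  where
  open Scalar (αs-scalar (onesV ge))
  x = αs (onesV ge) (α (β (pow 𝐒 K (at 0 𝟏) 1))) i j
  n≡ : n ≡ onesV ge + K
  n≡ = ℕₚ.suc-injective (trans (sym (ones+zeros ge)) (trans (cong (_+_ (onesV ge)) z) (ℕₚ.+-suc (onesV ge) K)))
  αs-+ : ∀ a b f → αs (a + b) f ≈ αs a (αs b f)
  αs-+ zero    b f i j = refl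
  αs-+ (suc a) b f i j = αs-+ a b f (predᶻ i) j
  alg : ∀ x y → - (x +ᶻ y) +ᶻ y ≡ - x
  alg = solve-∀

Sup-Kterm-full : ∀ {n} (ge : Vec Bool (suc n)) → zerosV ge ≡ 0 → ∀ i j → Sup ge (λ e → Kterm e i j) ≡ αs n
    (β 𝟏) i j
Sup-Kterm-full {n} ge z i j =
  trans (Sup-+ ge (λ e → αs (onesV e) (κ (zerosV e)) i j) (λ e → ind (zerosV e ≡ᵇ 0) (αs n (β 𝟏) i j)))
  (trans (cong₂ _+ᶻ_ (trans (Sup-Ψ ge κ i j) (trans (cong (λ m → αs (onesV ge) (Ψ m κ) i j) z)
      (Scalar.φ-𝟎 (αs-scalar (onesV ge)) i j))) (Sup-all ge (αs n (β 𝟏) i j)))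
         (ℤₚ.+-identityˡ _))

-- V k counts walks with a level step at height 0, of which there are none of top degree.
-- J-hub expresses κ through V.

J-hub : ∀ k h → motzkin false (suc k) (suc h) ⊕ α (motzkin false k (suc h)) ≈ α
    (motzkin true k (suc h)) ⊕ motzkin true k h
J-hub₀ : ∀ k → motzkin false (suc k) 0 ⊕ α (motzkin false k 0) ≈ α (motzkin true k 0)

private
  -- `lhs k` is 𝐓 applied to `motzkin false k`, and `rhs k` is X applied to `motzkin true k`, with X
  -- as in `hub`. Removing the common scalar α from 𝐓 X = X 𝐒 leaves the intertwining relation for
  -- `J false` and `J true`.
  lhs rhs : ℕ → St
  lhs k = motzkin false (suc k) ⊞ αˢ (motzkin false k)
  rhs k zero    = α (motzkin true k 0)
  rhs k (suc h) = α (motzkin true k (suc h)) ⊕ motzkin true k h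

  lhs≋rhs : ∀ k → lhs k ≋ rhs k
  lhs≋rhs k zero    = J-hub₀ k
  lhs≋rhs k (suc h) = J-hub k h

  lhs-suc : ∀ k → lhs (suc k) ≋ J false (rhs k)
  lhs-suc k = ≋-trans (λ h i j → trans (cong (motzkin false (suc (suc k)) h i j +ᶻ_)
      (sym (scalar l α-scalar (motzkin false k) h i j)))
                                       (sym (⊞-hom l (motzkin false (suc k)) (αˢ (motzkin false k)) h i j)))
                      (cong≋ l (lhs≋rhs k))
    where l = J-linear false

J-hub₀ zero    i j = ℤₚ.+-identityˡ _
J-hub₀ (suc k) i j = trans (lhs-suc k 0 i j) (ℤₚ.+-comm (motzkin true k 1 (predᶻ (predᶻ i)) (predᶻ j)) _)

J-hub zero zero    i j = alg (𝟏 i j)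
  where
  alg : ∀ a → ((a +ᶻ + 0) +ᶻ + 0) +ᶻ + 0 ≡ + 0 +ᶻ a
  alg = solve-∀
J-hub zero (suc zero)    i j = refl
J-hub zero (suc (suc h)) i j = refl
J-hub (suc k) zero i j = trans (lhs-suc k 1 i j)
  (alg (a 0 (predᶻ i) j) (a 1 (predᶻ i) (predᶻ j)) (a 0 i (predᶻ j)) (a 2 (predᶻ (predᶻ i)) (predᶻ j)))
  where
  a = motzkin true k
  alg : ∀ p q r s → (p +ᶻ (q +ᶻ r)) +ᶻ (s +ᶻ q) ≡ ((p +ᶻ q) +ᶻ s) +ᶻ (r +ᶻ q)
  alg = solve-∀
J-hub (suc k) (suc h) i j = trans (lhs-suc k (suc (suc h)) i j)
  (alg (a (suc h) (predᶻ i) j) (a h i j) (a (suc (suc h)) (predᶻ i) (predᶻ j)) (a (suc h) i (predᶻ j))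
      (a (suc (suc (suc h))) (predᶻ (predᶻ i)) (predᶻ j)))
  where
  a = motzkin true k
  alg : ∀ p q r s t → ((p +ᶻ q) +ᶻ (r +ᶻ s)) +ᶻ (t +ᶻ r) ≡ ((p +ᶻ r) +ᶻ t) +ᶻ ((q +ᶻ s) +ᶻ r)
  alg = solve-∀

V : ℕ → St
V k h i j = motzkin true k h i j - motzkin false k h i j

-- The recursion hides the cancellation of the terms with the largest excess of α; as differences of
-- walk counts they visibly drop out, which gives `κ-high`.
κ-V : ∀ k i j → κ (suc (suc k)) i j ≡ - (V (suc k) 1 (predᶻ i) (predᶻ j) +ᶻ V k 0 (predᶻ i) (predᶻ j))
κ-V zero i j = alg (𝟏 (predᶻ i) (predᶻ j))
  where
  alg : ∀ a → - (((((a +ᶻ + 0) +ᶻ + 0)) +ᶻ + 0) +ᶻ - ((+ 0 +ᶻ a) +ᶻ + 0)) ≡ -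
      ((((a +ᶻ + 0) +ᶻ + 0) - ((a +ᶻ + 0) +ᶻ + 0)) +ᶻ (a - a))
  alg = solve-∀
κ-V (suc k) i j = trans (cong (λ z → - ((a₂ +ᶻ + 0) +ᶻ z)) (κ-V k (predᶻ i) j))
  (alg a₂ (motzkin true (suc k) 1 i″ j′) (motzkin false (suc k) 1 i″ j′) (motzkin true k 0 i″ j′)
      (motzkin false k 0 i″ j′)
       (motzkin false (suc (suc k)) 1 i′ j′) (motzkin true (suc k) 0 i′ j′) (motzkin false (suc k) 0 i′ j′)
       (J-hub (suc k) 0 i′ j′) (J-hub₀ k i′ j′))
  where
  i′ = predᶻ i
  i″ = predᶻ (predᶻ i)
  j′ = predᶻ j
  a₂ = motzkin true (suc (suc k)) 1 i′ j′
  alg : ∀ a₂ αa₁ αb₁ αa₀ αb₀ b₂ a₁0 b₁0 → b₂ +ᶻ αb₁ ≡ αa₁ +ᶻ a₁0 → b₁0 +ᶻ αb₀ ≡ αa₀ →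
        - ((a₂ +ᶻ + 0) +ᶻ - ((αa₁ - αb₁) +ᶻ (αa₀ - αb₀))) ≡ - ((a₂ - b₂) +ᶻ (a₁0 - b₁0))
  alg a₂ αa₁ αb₁ αa₀ αb₀ b₂ a₁0 b₁0 p refl = trans (e₁ a₂ αa₁ αb₁ αb₀ b₁0 b₂)
      (trans (cong (λ z → - ((a₂ +ᶻ z) - ((αa₁ +ᶻ b₁0) +ᶻ b₂))) p) (e₂ a₂ αa₁ a₁0 b₁0 b₂))
    where
    e₁ : ∀ a₂ αa₁ αb₁ αb₀ b₁0 b₂ → - ((a₂ +ᶻ + 0) +ᶻ - ((αa₁ - αb₁) +ᶻ ((b₁0 +ᶻ αb₀) - αb₀))) ≡ -
        ((a₂ +ᶻ (b₂ +ᶻ αb₁)) - ((αa₁ +ᶻ b₁0) +ᶻ b₂))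
    e₁ = solve-∀
    e₂ : ∀ a₂ αa₁ a₁0 b₁0 b₂ → - ((a₂ +ᶻ (αa₁ +ᶻ a₁0)) - ((αa₁ +ᶻ b₁0) +ᶻ b₂)) ≡ - ((a₂ - b₂) +ᶻ (a₁0 - b₁0))
    e₂ = solve-∀

motzkin-bnd : ∀ b k → BndS 0 (motzkin b k)
motzkin-bnd b zero    = at-bnd 0
motzkin-bnd b (suc k) = J-bnd b (motzkin-bnd b k)

motzkin-agree : ∀ k → Agree 0 (motzkin true k) (motzkin false k)
motzkin-agree zero    h i j le = refl
motzkin-agree (suc k) = J-agree (motzkin-bnd true k) (motzkin-bnd false k) (motzkin-agree k)

V-high : ∀ k h i j → j ≤ᶻ i → V k h i j ≡ + 0
V-high k h i j le = trans (cong (_- motzkin false k h i j)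
    (motzkin-agree k h i j (subst (_≤ᶻ i) (sym (ℤₚ.+-identityʳ j)) le))) (ℤₚ.+-inverseʳ (motzkin false k h i j))

κ-high : ∀ k i j → j ≤ᶻ i → κ (suc (suc k)) i j ≡ + 0
κ-high k i j le = trans (κ-V k i j) (cong -_ (cong₂ _+ᶻ_ (V-high (suc k) 1 _ _ le′) (V-high k 0 _ _ le′)))
  where le′ = ℤₚ.pred-mono le

motzkin-low : ∀ b k → LowS 0 (motzkin b k)
motzkin-low b zero    = at-low 0
motzkin-low b (suc k) = J-lowS b (motzkin-low b k)

κ-low : ∀ k → Low 0 (κ k)
κ-low zero    i j lt = refl
κ-low (suc k) i j lt = cong -_ (cong₂ _+ᶻ_ (cong₂ _+ᶻ_
    (Low-weaken (Low-α (motzkin-low true k 1)) i (predᶻ j) lt)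
    (trans (cong (ind (k ≡ᵇ 0)) (Low-𝟏 i (predᶻ j) lt)) (ind-zero (k ≡ᵇ 0))))
    (Low-weaken (Low-α (κ-low k)) i j lt))

αs-low : ∀ n {c f} → Low c f → Low (n + c) (αs n f)
αs-low zero    l = l
αs-low (suc n) l = Low-α (αs-low n l)

-- Closed forms

pascal : ∀ n i → choose (suc n) i ≡ choose n i +ᶻ choose n (predᶻ i)
pascal n (+ 0)     = refl
pascal n (+ suc k) = cong +_ (trans (sym (Comb.nCk+nC[k+1]≡[n+1]C[k+1] n k)) (ℕₚ.+-comm (n C k) (n C suc k)))
pascal n -[1+ k ]  = refl

choose-above : ∀ n i → + n <ᶻ i → choose n i ≡ + 0
choose-above n (+ k) (Data.Integer.+<+ lt) = cong +_ (Comb.k>n⇒nCk≡0 lt)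
choose-above n -[1+ k ] ()

choose-sym : ∀ n i j → i +ᶻ j ≡ + n → choose n i ≡ choose n j
choose-sym n (+ a) (+ b) e rewrite sym (ℤₚ.+-injective e) =
  cong +_ (trans (Comb.nCk≡nC[n∸k] (ℕₚ.m≤m+n a b)) (cong ((a + b) C_) (ℕₚ.m+n∸m≡n a b)))
choose-sym n (+ a) -[1+ b ] e = choose-above n (+ a)
    (ℤₚ.≤-<-trans (ℤₚ.≤-reflexive (sym e)) (subst (+ a +ᶻ -[1+ b ] <ᶻ_) (ℤₚ.+-identityʳ (+ a))
    (ℤₚ.+-monoʳ-< (+ a) Data.Integer.-<+)))
choose-sym n -[1+ a ] (+ b) e = sym (choose-sym n (+ b) -[1+ a ] (trans (ℤₚ.+-comm (+ b) -[1+ a ]) e))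
choose-sym n -[1+ a ] -[1+ b ] ()

-- Induction along Pascal's rule keeps the identity valid for every integer `i`, in range or not.
absorption : ∀ n i → i * choose n i ≡ (+ suc n - i) * choose n (predᶻ i)
absorption zero (+ 0)           = refl
absorption zero (+ 1)           = refl
absorption zero (+ suc (suc k)) = trans (ℤₚ.*-zeroʳ (+ suc (suc k))) (sym (ℤₚ.*-zeroʳ (+ 1 - + suc (suc k))))
absorption zero -[1+ k ]        = trans (ℤₚ.*-zeroʳ -[1+ k ]) (sym (ℤₚ.*-zeroʳ (+ 1 - -[1+ k ])))
absorption (suc n) i =
  trans (cong (i *_) (pascal n i))
  (trans (e₁ i (choose n i) b)
  (trans (cong (_+ᶻ i * b) (absorption n i))
  (trans (e₂ (+ suc n) i b)
  (trans (cong ((+ 1 +ᶻ + suc n - i) * b +ᶻ_) (absorption n (predᶻ i)))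
  (trans (e₃ (+ suc n) i b (choose n (predᶻ (predᶻ i))))
      (cong ((+ suc (suc n) - i) *_) (sym (pascal n (predᶻ i)))))))))
  where
  b = choose n (predᶻ i)
  e₁ : ∀ i a b → i * (a +ᶻ b) ≡ i * a +ᶻ i * b
  e₁ = solve-∀
  e₂ : ∀ n i b → (n - i) * b +ᶻ i * b ≡ (+ 1 +ᶻ n - i) * b +ᶻ (- + 1 +ᶻ i) * b
  e₂ = solve-∀
  e₃ : ∀ n i b c → (+ 1 +ᶻ n - i) * b +ᶻ (n - (- + 1 +ᶻ i)) * c ≡ (+ 1 +ᶻ n - i) * (b +ᶻ c)
  e₃ = solve-∀

+ᶻ-cancelʳ : ∀ k {x y} → x +ᶻ k ≡ y +ᶻ k → x ≡ y
+ᶻ-cancelʳ k {x} {y} e = trans (sym (undo x k)) (trans (cong (_- k) e) (undo y k))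
  where
  undo : ∀ x k → (x +ᶻ k) - k ≡ x
  undo = solve-∀

δ : ℤ → ℤ
δ (+ 0) = + 1
δ _     = + 0

δ-cases : ∀ z → (z ≡ + 0) ⊎ (z ≢ + 0 × δ z ≡ + 0)
δ-cases (+ 0)     = inj₁ refl
δ-cases (+ suc n) = inj₂ ((λ ()) , refl)
δ-cases -[1+ n ]  = inj₂ ((λ ()) , refl)

𝟏-cases : ∀ i j → (i ≡ + 0 × j ≡ + 0) ⊎ 𝟏 i j ≡ + 0
𝟏-cases (+ 0)     (+ 0)     = inj₁ (refl , refl)
𝟏-cases (+ 0)     (+ suc _) = inj₂ refl
𝟏-cases (+ 0)     -[1+ _ ]  = inj₂ refl
𝟏-cases (+ suc _) j         = inj₂ refl
𝟏-cases -[1+ _ ]  j         = inj₂ refl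

Γ : ℕ → Bi
Γ n i j = choose n i * choose n j

Γ-zero : ∀ i j → Γ 0 i j ≡ 𝟏 i j
Γ-zero (+ 0)     (+ 0)     = refl
Γ-zero (+ 0)     (+ suc _) = refl
Γ-zero (+ 0)     -[1+ _ ]  = refl
Γ-zero (+ suc _) (+ _)     = refl
Γ-zero (+ suc _) -[1+ _ ]  = refl
Γ-zero -[1+ _ ]  (+ _)     = refl
Γ-zero -[1+ _ ]  -[1+ _ ]  = refl

at-zero : ∀ k p h i j → p i j ≡ + 0 → at k p h i j ≡ + 0
at-zero zero    p zero    i j e = e
at-zero zero    p (suc h) i j e = refl
at-zero (suc k) p zero    i j e = refl
at-zero (suc k) p (suc h) i j e = at-zero k p h i j e

-- Each step of 𝐒 raises height plus degree by exactly 1: up by the height, level by the degree,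
-- down by degree 2 and height -1. `z` is the deviation from the resulting homogeneity, and `δ z`
-- forces it to be 0.
at-δ : ∀ H h i j z → (i +ᶻ j) +ᶻ + h ≡ z +ᶻ + H → at H 𝟏 h i j ≡ δ z * 𝟏 i j
at-δ H h i j z e with 𝟏-cases i j
... | inj₂ q = trans (at-zero H 𝟏 h i j q) (sym (trans (cong (δ z *_) q) (ℤₚ.*-zeroʳ (δ z))))
... | inj₁ (refl , refl) with δ-cases z
...   | inj₁ refl rewrite ℤₚ.+-injective e = at-diag H 𝟏 (+ 0) (+ 0)
...   | inj₂ (z≢0 , δz) rewrite δz = at-off H 𝟏 h (λ { refl → z≢0 (sym (+ᶻ-cancelʳ (+ H) e)) }) (+ 0) (+ 0)

private
  drop₁ : ∀ i j h z n → (i +ᶻ j) +ᶻ (+ 1 +ᶻ h) ≡ z +ᶻ (+ 1 +ᶻ n) → (i +ᶻ j) +ᶻ h ≡ z +ᶻ n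
  drop₁ i j h z n e = +ᶻ-cancelʳ (+ 1) (trans (a i j h) (trans e (b z n)))
    where
    a : ∀ i j h → ((i +ᶻ j) +ᶻ h) +ᶻ + 1 ≡ (i +ᶻ j) +ᶻ (+ 1 +ᶻ h)
    a = solve-∀
    b : ∀ z n → z +ᶻ (+ 1 +ᶻ n) ≡ (z +ᶻ n) +ᶻ + 1
    b = solve-∀

  dropʲ : ∀ i j h z n → (i +ᶻ j) +ᶻ h ≡ z +ᶻ (+ 1 +ᶻ n) → (i +ᶻ predᶻ j) +ᶻ h ≡ z +ᶻ n
  dropʲ i j h z n e = +ᶻ-cancelʳ (+ 1) (trans (a i j h) (trans e (b z n)))
    where
    a : ∀ i j h → ((i +ᶻ (- + 1 +ᶻ j)) +ᶻ h) +ᶻ + 1 ≡ (i +ᶻ j) +ᶻ h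
    a = solve-∀
    b : ∀ z n → z +ᶻ (+ 1 +ᶻ n) ≡ (z +ᶻ n) +ᶻ + 1
    b = solve-∀

  dropⁱ : ∀ i j h z n → (i +ᶻ j) +ᶻ h ≡ z +ᶻ (+ 1 +ᶻ n) → (predᶻ i +ᶻ j) +ᶻ h ≡ z +ᶻ n
  dropⁱ i j h z n e = +ᶻ-cancelʳ (+ 1) (trans (a i j h) (trans e (b z n)))
    where
    a : ∀ i j h → (((- + 1 +ᶻ i) +ᶻ j) +ᶻ h) +ᶻ + 1 ≡ (i +ᶻ j) +ᶻ h
    a = solve-∀
    b : ∀ z n → z +ᶻ (+ 1 +ᶻ n) ≡ (z +ᶻ n) +ᶻ + 1
    b = solve-∀

  dropⁱʲ : ∀ i j h z n → (i +ᶻ j) +ᶻ h ≡ z +ᶻ (+ 1 +ᶻ n) → (predᶻ i +ᶻ predᶻ j) +ᶻ (+ 1 +ᶻ h) ≡ z +ᶻ n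
  dropⁱʲ i j h z n e = trans (a i j h) (dropⁱ i j h z n e)
    where
    a : ∀ i j h → ((- + 1 +ᶻ i) +ᶻ (- + 1 +ᶻ j)) +ᶻ (+ 1 +ᶻ h) ≡ ((- + 1 +ᶻ i) +ᶻ j) +ᶻ h
    a = solve-∀

Γ-pascal : ∀ n i j → Γ (suc n) i j ≡ ((Γ n i j +ᶻ Γ n i (predᶻ j)) +ᶻ Γ n (predᶻ i) (predᶻ j)) +ᶻ Γ n
    (predᶻ i) j
Γ-pascal n i j = trans (cong₂ _*_ (pascal n i) (pascal n j))
    (alg (choose n i) (choose n (predᶻ i)) (choose n j) (choose n (predᶻ j)))
  where
  alg : ∀ a b c d → (a +ᶻ b) * (c +ᶻ d) ≡ ((a * c +ᶻ a * d) +ᶻ b * d) +ᶻ b * c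
  alg = solve-∀

-- A function satisfying the recurrence of Γ solves the walk recurrence at any height;
-- at height 0 the value it would take at height -1 has to vanish.
module Walk (x₀ : St) (c : ℕ) (f : ℕ → Bi) (N : ℕ)
  (rec : ∀ n i j → f (suc n) i j ≡ ((f n i j +ᶻ f n i (predᶻ j)) +ᶻ f n (predᶻ i) (predᶻ j)) +ᶻ f n (predᶻ i) j)
  (start : ∀ h i j z → (i +ᶻ j) +ᶻ + h ≡ z +ᶻ + c → x₀ h i j ≡ δ z * f 0 i j)
  (boundary : ∀ n i j → n < N → i +ᶻ j ≡ + suc (n + c) → f n i j ≡ + 0) where

  closed : ∀ n → n ≤ N → ∀ h i j z → (i +ᶻ j) +ᶻ + h ≡ z +ᶻ + (n + c) → pow 𝐒 n x₀ h i j ≡ δ z * f n i j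
  closed zero    _ = start
  closed (suc n) n<N (suc h) i j z e =
    trans (cong₂ _+ᶻ_ (cong₂ _+ᶻ_ (cong₂ _+ᶻ_
        (ih h i j z (drop₁ i j (+ h) z (+ (n + c)) e))
        (ih (suc h) i (predᶻ j) z (dropʲ i j (+ suc h) z (+ (n + c)) e)))
        (ih (suc (suc h)) (predᶻ i) (predᶻ j) z (dropⁱʲ i j (+ suc h) z (+ (n + c)) e)))
        (ih (suc h) (predᶻ i) j z (dropⁱ i j (+ suc h) z (+ (n + c)) e)))
    (trans (alg (δ z) (f n i j) (f n i (predᶻ j)) (f n (predᶻ i) (predᶻ j)) (f n (predᶻ i) j))
        (cong (δ z *_) (sym (rec n i j))))
    where
    ih = closed n (ℕₚ.<⇒≤ n<N)
    alg : ∀ d a b c e → ((d * a +ᶻ d * b) +ᶻ d * c) +ᶻ d * e ≡ d * (((a +ᶻ b) +ᶻ c) +ᶻ e)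
    alg = solve-∀
  closed (suc n) n<N zero i j z e =
    trans (cong₂ _+ᶻ_ (cong₂ _+ᶻ_
        (ih 0 i (predᶻ j) z (dropʲ i j (+ 0) z (+ (n + c)) e))
        (ih 1 (predᶻ i) (predᶻ j) z (dropⁱʲ i j (+ 0) z (+ (n + c)) e)))
        (ih 0 (predᶻ i) j z (dropⁱ i j (+ 0) z (+ (n + c)) e)))
    (trans (alg (δ z) (f n i j) (f n i (predᶻ j)) (f n (predᶻ i) (predᶻ j)) (f n (predᶻ i) j))
    (trans (cong₂ _-_ (cong (δ z *_) (sym (rec n i j))) missing) (ℤₚ.+-identityʳ _)))
    where
    ih = closed n (ℕₚ.<⇒≤ n<N)
    alg : ∀ d a b c e → (d * b +ᶻ d * c) +ᶻ d * e ≡ d * (((a +ᶻ b) +ᶻ c) +ᶻ e) - d * a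
    alg = solve-∀
    missing : δ z * f n i j ≡ + 0
    missing with δ-cases z
    ... | inj₁ refl = trans (ℤₚ.*-identityˡ _) (boundary n i j n<N
        (trans (sym (ℤₚ.+-identityʳ (i +ᶻ j))) (trans e (ℤₚ.+-identityˡ _))))
    ... | inj₂ (_ , δz) rewrite δz = refl

Λ : ℕ → Bi
Λ n i j = Γ n i j - Γ n (predᶻ i) (predᶻ j)

walk-from-0 : ∀ n h i j → (i +ᶻ j) +ᶻ + h ≡ + n → pow 𝐒 n (at 0 𝟏) h i j ≡ Λ n i j
walk-from-0 n h i j e = trans (closed n ℕₚ.≤-refl h i j (+ 0) (trans e (cong +_ (sym (ℕₚ.+-identityʳ n)))))
    (ℤₚ.*-identityˡ _)
  where
  rec : ∀ n i j → Λ (suc n) i j ≡ ((Λ n i j +ᶻ Λ n i (predᶻ j)) +ᶻ Λ n (predᶻ i) (predᶻ j)) +ᶻ Λ n (predᶻ i) j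
  rec n i j = trans (cong₂ _-_ (Γ-pascal n i j) (Γ-pascal n (predᶻ i) (predᶻ j)))
      (alg (Γ n i j) (Γ n i (predᶻ j)) (Γ n (predᶻ i) (predᶻ j)) (Γ n (predᶻ i) j) _ _ _)
    where
    alg : ∀ a b c d e f g → (((a +ᶻ b) +ᶻ c) +ᶻ d) - (((c +ᶻ e) +ᶻ f) +ᶻ g) ≡
        (((a - c) +ᶻ (b - e)) +ᶻ (c - f)) +ᶻ (d - g)
    alg = solve-∀
  start : ∀ h i j z → (i +ᶻ j) +ᶻ + h ≡ z +ᶻ + 0 → at 0 𝟏 h i j ≡ δ z * Λ 0 i j
  start h i j z e = trans (at-δ 0 h i j z e) (trans
      (sym (trans (cong (λ y → δ z * 𝟏 i j - y) vanish) (ℤₚ.+-identityʳ _)))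
      (trans (alg (δ z) (𝟏 i j) (𝟏 (predᶻ i) (predᶻ j)))
      (cong (δ z *_) (sym (cong₂ _-_ (Γ-zero i j) (Γ-zero (predᶻ i) (predᶻ j)))))))
    where
    alg : ∀ d a b → d * a - d * b ≡ d * (a - b)
    alg = solve-∀
    back : ∀ {i} → predᶻ i ≡ + 0 → i ≡ + 1
    back {i} p = trans (re i) (cong (+ 1 +ᶻ_) p)
      where
      re : ∀ i → i ≡ + 1 +ᶻ (- + 1 +ᶻ i)
      re = solve-∀
    -- The reflected source sits at `i = j = 1`, which homogeneity places at height -2, outside the
    -- range of `h`.
    vanish : δ z * 𝟏 (predᶻ i) (predᶻ j) ≡ + 0
    vanish with 𝟏-cases (predᶻ i) (predᶻ j)
    ... | inj₂ q = trans (cong (δ z *_) q) (ℤₚ.*-zeroʳ (δ z))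
    ... | inj₁ (p , q) with δ-cases z
    ...   | inj₂ (_ , δz) rewrite δz = refl
    ...   | inj₁ refl = case trans (cong₂ (λ a b → (a +ᶻ b) +ᶻ + h) (sym (back {i} p)) (sym (back {j} q))) e of
        λ ()
  -- At height -1, where `i + j = m + 1`, complementation of binomials exchanges the two products,
  -- so the difference vanishes.
  boundary : ∀ m i j → m < n → i +ᶻ j ≡ + suc (m + 0) → Λ m i j ≡ + 0
  boundary m i j _ e = trans (cong (_- Γ m (predᶻ i) (predᶻ j))
      (trans (cong₂ _*_ (choose-sym m i (predᶻ j) eⁱ) (choose-sym m j (predᶻ i) eʲ))
      (ℤₚ.*-comm (choose m (predᶻ j)) _))) (ℤₚ.+-inverseʳ (Γ m (predᶻ i) (predᶻ j)))
    where
    e′ : i +ᶻ j ≡ + 1 +ᶻ + m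
    e′ = trans e (cong (λ z → + suc z) (ℕₚ.+-identityʳ m))
    move : ∀ i j → i +ᶻ (- + 1 +ᶻ j) ≡ (i +ᶻ j) - + 1
    move = solve-∀
    one : ∀ m → (+ 1 +ᶻ m) - + 1 ≡ m
    one = solve-∀
    eⁱ : i +ᶻ predᶻ j ≡ + m
    eⁱ = trans (move i j) (trans (cong (_- + 1) e′) (one (+ m)))
    eʲ : j +ᶻ predᶻ i ≡ + m
    eʲ = trans (move j i) (trans (cong (_- + 1) (trans (ℤₚ.+-comm j i) e′)) (one (+ m)))
  open Walk (at 0 𝟏) 0 Λ n rec start boundary

-- From height `n`, fewer than `n + 1` steps cannot reach height -1, so no reflected term appears.
-- Algebraically, `i + j > 2m` makes one of the two binomials 0.
walk-high : ∀ n i j → i +ᶻ j ≡ + n → pow 𝐒 n (at n 𝟏) n i j ≡ Γ n i j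
walk-high n i j e = trans (closed n ℕₚ.≤-refl n i j (+ 0) (cong (_+ᶻ + n) e)) (ℤₚ.*-identityˡ _)
  where
  start : ∀ h i j z → (i +ᶻ j) +ᶻ + h ≡ z +ᶻ + n → at n 𝟏 h i j ≡ δ z * Γ 0 i j
  start h i j z e = trans (at-δ n h i j z e) (cong (δ z *_) (sym (Γ-zero i j)))
  boundary : ∀ m i j → m < n → i +ᶻ j ≡ + suc (m + n) → Γ m i j ≡ + 0
  boundary m i j m<n e with i Data.Integer.≤? + m | j Data.Integer.≤? + m
  ... | no ¬p | _     = cong (_* choose m j) (choose-above m i (ℤₚ.≰⇒> ¬p))
  ... | yes _ | no ¬q = trans (cong (choose m i *_) (choose-above m j (ℤₚ.≰⇒> ¬q))) (ℤₚ.*-zeroʳ (choose m i))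
  ... | yes p | yes q = ⊥-elim (ℤₚ.<⇒≱ (Data.Integer.+<+ (s≤s (ℕₚ.+-monoʳ-≤ m (ℕₚ.<⇒≤ m<n))))
      (subst (_≤ᶻ + (m + m)) e (ℤₚ.+-mono-≤ p q)))
  open Walk (at n 𝟏) n Γ n Γ-pascal start boundary

private
  complement : ∀ n k → + k +ᶻ (+ n - + k) ≡ + n
  complement n k = alg (+ n) (+ k)
    where
    alg : ∀ n k → k +ᶻ (n - k) ≡ n
    alg = solve-∀

Γ-square : ∀ n k → Γ n (+ k) (+ n - + k) ≡ choose n (+ k) * choose n (+ k)
Γ-square n k = cong (choose n (+ k) *_) (sym (choose-sym n (+ k) (+ n - + k) (complement n k)))

fan-closed : ∀ n k → + suc n * Λ n (+ k) (+ n - + k) ≡ + ((suc n C suc k) *ℕ (suc n C k))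
fan-closed n k =
  trans (cong (+ suc n *_) (cong₂ _-_ (Γ-square n k)
      (cong (a *_) (choose-sym n (predᶻ (+ n - + k)) (+ suc k) (s (+ n) (+ k))))))
  (trans (alg (+ n) (+ k) a b c (absorption n (+ suc k)) (absorption n (+ k)))
  (trans (sym (cong₂ _*_ (pascal n (+ suc k)) (pascal n (+ k)))) (sym (ℤₚ.pos-* (suc n C suc k) (suc n C k)))))
  where
  a = choose n (predᶻ (+ k))
  b = choose n (+ k)
  c = choose n (+ suc k)
  s : ∀ n k → (- + 1 +ᶻ (n - k)) +ᶻ (+ 1 +ᶻ k) ≡ n
  s = solve-∀
  -- The difference of the two sides is a combination of the two absorption relations, with
  -- multipliers `b + c` and `a + b`.
  alg : ∀ n k a b c → (+ 1 +ᶻ k) * c ≡ ((+ 1 +ᶻ n) - (+ 1 +ᶻ k)) * b → k * b ≡ ((+ 1 +ᶻ n) - k) * a →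
        (+ 1 +ᶻ n) * (b * b - a * c) ≡ (c +ᶻ b) * (b +ᶻ a)
  alg n k a b c p q = trans (e n k a b c) (trans (cong₂
      (λ x y → ((c +ᶻ b) * (b +ᶻ a) +ᶻ (x - ((+ 1 +ᶻ n) - k) * a) * (b +ᶻ c)) -
      (y - ((+ 1 +ᶻ n) - (+ 1 +ᶻ k)) * b) * (a +ᶻ b)) q p) (z n k a b c))
    where
    e : ∀ n k a b c → (+ 1 +ᶻ n) * (b * b - a * c) ≡
        ((c +ᶻ b) * (b +ᶻ a) +ᶻ (k * b - ((+ 1 +ᶻ n) - k) * a) * (b +ᶻ c)) -
        ((+ 1 +ᶻ k) * c - ((+ 1 +ᶻ n) - (+ 1 +ᶻ k)) * b) * (a +ᶻ b)
    e = solve-∀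
    z : ∀ n k a b c → ((c +ᶻ b) * (b +ᶻ a) +ᶻ (((+ 1 +ᶻ n) - k) * a - ((+ 1 +ᶻ n) - k) * a) * (b +ᶻ c)) -
        (((+ 1 +ᶻ n) - (+ 1 +ᶻ k)) * b - ((+ 1 +ᶻ n) - (+ 1 +ᶻ k)) * b) * (a +ᶻ b) ≡ (c +ᶻ b) * (b +ᶻ a)
    z = solve-∀

-- After one more multiplication by `n + 1`, absorption expresses `a` and `b` through
-- binom(n+1,k-1), and `c` and `d` through binom(n+1,k+1). A polynomial identity remains, and the
-- extra factor is cancelled.
rim-closed : ∀ n k → + suc n * Λ n (predᶻ (+ k)) (predᶻ (+ suc n - + k)) ≡ + 2 *
    (choose (suc n) (+ suc k) * choose (suc n) (predᶻ (+ k)))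
rim-closed n k = ℤₚ.*-cancelˡ-≡ (+ suc n) _ _
  (trans (cong (λ z → + suc n * (+ suc n * z)) (cong₂ _-_ (cong (b *_) (choose-sym n j′ (+ k) (s₁ (+ n) (+ k))))
      (cong (a *_) (choose-sym n (predᶻ j′) (+ suc k) (s₂ (+ n) (+ k))))))
  (trans (e₁ (+ suc n) a b c d)
  (trans (cong₂ _-_ (cong₂ _*_ nb nc) (cong₂ _*_ na nd))
  (trans (e₂ (+ n) (+ k) (b +ᶻ a) (d +ᶻ c))
         (cong (λ z → + suc n * (+ 2 * z)) (sym (cong₂ _*_ (pascal n (+ suc k)) (pascal n (predᶻ (+ k))))))))))
  where
  j′ = predᶻ (+ suc n - + k)
  a = choose n (predᶻ (predᶻ (+ k)))
  b = choose n (predᶻ (+ k))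
  c = choose n (+ k)
  d = choose n (+ suc k)
  s₁ : ∀ n k → (- + 1 +ᶻ ((+ 1 +ᶻ n) - k)) +ᶻ k ≡ n
  s₁ = solve-∀
  s₂ : ∀ n k → (- + 1 +ᶻ (- + 1 +ᶻ ((+ 1 +ᶻ n) - k))) +ᶻ (+ 1 +ᶻ k) ≡ n
  s₂ = solve-∀
  e₁ : ∀ n a b c d → n * (n * (b * c - a * d)) ≡ (n * b) * (n * c) - (n * a) * (n * d)
  e₁ = solve-∀
  e₂ : ∀ n k p q → (((+ 1 +ᶻ n) - (- + 1 +ᶻ k)) * p) * ((+ 1 +ᶻ k) * q) - ((- + 1 +ᶻ k) * p) *
      (((+ 1 +ᶻ n) - (+ 1 +ᶻ k)) * q) ≡ (+ 1 +ᶻ n) * (+ 2 * (q * p))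
  e₂ = solve-∀
  low : ∀ n i a b → i * b ≡ ((+ 1 +ᶻ n) - i) * a → (+ 1 +ᶻ n) * a ≡ i * (b +ᶻ a)
  low n i a b h = trans (u n i a) (trans (cong (_+ᶻ i * a) (sym h)) (sym (ℤₚ.*-distribˡ-+ i b a)))
    where
    u : ∀ n i a → (+ 1 +ᶻ n) * a ≡ ((+ 1 +ᶻ n) - i) * a +ᶻ i * a
    u = solve-∀
  high : ∀ n i a b → i * b ≡ ((+ 1 +ᶻ n) - i) * a → (+ 1 +ᶻ n) * b ≡ ((+ 1 +ᶻ n) - i) * (b +ᶻ a)
  high n i a b h = trans (u n i b) (trans (cong (((+ 1 +ᶻ n) - i) * b +ᶻ_) h)
      (sym (ℤₚ.*-distribˡ-+ ((+ 1 +ᶻ n) - i) b a)))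
    where
    u : ∀ n i b → (+ 1 +ᶻ n) * b ≡ ((+ 1 +ᶻ n) - i) * b +ᶻ i * b
    u = solve-∀
  na : + suc n * a ≡ predᶻ (+ k) * (b +ᶻ a)
  na = low (+ n) (predᶻ (+ k)) a b (absorption n (predᶻ (+ k)))
  nb : + suc n * b ≡ (+ suc n - predᶻ (+ k)) * (b +ᶻ a)
  nb = high (+ n) (predᶻ (+ k)) a b (absorption n (predᶻ (+ k)))
  nc : + suc n * c ≡ + suc k * (d +ᶻ c)
  nc = low (+ n) (+ suc k) c d (absorption n (+ suc k))
  nd : + suc n * d ≡ (+ suc n - + suc k) * (d +ᶻ c)
  nd = high (+ n) (+ suc k) c d (absorption n (+ suc k))

-- From weights of flats to Z-polynomials

module Assembly {m} (r : Subset m → ℕ) (R : RankFunction r) (loopless : ∀ e → r ⁅ e ⁆ ≡ 1)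
                (P : Matroid → Poly) (kl : IsKL P) (term : Subset m → Bi) where
  open RankFunction R
  open Contractions r R loopless

  module _ (t-bad  : ∀ F → fl F ≡ false → term F ≈ 𝟎)
           (t-low  : ∀ F → Flat F → Low (r F) (term F))
           (t-high : ∀ F → Flat F → 0 < co F → ∀ i j → j +ᶻ + r F ≤ᶻ i → term F i j ≡ + 0)
           (t-⊤    : term ⊤ ≈ αs (r ⊤) 𝟏)
           (t-sym  : ∀ G → Flat G → ∃ λ p → Symmetric p × (∀ i j → Sup G (λ F → term F i j) ≡ αs (r G) p i j)) where

    n : ℕ
    n = r ⊤

    -- Dehomogenisation: the factor α^(r F) is removed, and only total degree `n` is read.
    q : Subset m → Poly
    q F k = term F (+ (k + r F)) (+ n - + (k + r F))

    q-degree : ∀ F → Flat F → 0 < co F → ∀ k → co F ≤ 2 *ℕ k → q F k ≡ + 0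
    q-degree F f pos k h = t-high F f pos _ _ (ℤₚ.≤-trans (ℤₚ.≤-reflexive (e₁ (+ n) (+ k) (+ r F)))
        (ℤₚ.≤-trans (ℤₚ.+-monoˡ-≤ (- + k) (Data.Integer.+≤+ le)) (ℤₚ.≤-reflexive (e₃ (+ k) (+ r F)))))
      where
      le : n ≤ k + k + r F
      le = subst (_≤ k + k + r F) (ℕₚ.m∸n+n≡m (r≤r⊤ F))
          (ℕₚ.+-monoˡ-≤ (r F) (subst (co F ≤_) (cong (_+_ k) (ℕₚ.+-identityʳ k)) h))
      e₁ : ∀ n k r → (n - (k +ᶻ r)) +ᶻ r ≡ n - k
      e₁ = solve-∀
      e₃ : ∀ k r → ((k +ᶻ k) +ᶻ r) - k ≡ k +ᶻ r
      e₃ = solve-∀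

    q-⊤ : ∀ k → q ⊤ k ≡ (if k ≡ᵇ 0 then + 1 else + 0)
    q-⊤ k = trans (t-⊤ _ _) (trans (cong₂ (αs n 𝟏) (cong +_ (ℕₚ.+-comm k n)) (e (+ n) (+ k)))
        (trans (αs-index n 𝟏 k (- + k)) (at0 k)))
      where
      e : ∀ n k → n - (k +ᶻ n) ≡ - k
      e = solve-∀
      at0 : ∀ k → 𝟏 (+ k) (- + k) ≡ (if k ≡ᵇ 0 then + 1 else + 0)
      at0 zero    = refl
      at0 (suc k) = refl

    open Uniqueness P kl q q-degree q-⊤

    -- The shift in `Zq` compensates for the different powers of α removed from the weights, so all
    -- flats above `G` are read at one common bidegree. Non-flats may be included by `t-bad`, and
    -- the default 0 of `shift` is correct by `t-low`.
    Zq≡Sup : ∀ G k → Zq G k ≡ Sup G (λ F → term F (+ (k + r G)) (+ n - + (k + r G)))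
    Zq≡Sup G k = trans (ΣS-cong λ F → trans (ind-∧ (G ⊑ F) (fl F) _)
        (ind-cong (G ⊑ F) λ h → summand F (⊑⇒⊆ {A = G} h) (fl F) refl))
                       (Sup-ΣS G (λ F → term F (+ (k + r G)) (+ n - + (k + r G))))
      where
      summand : ∀ F → G ⊆ F → ∀ b → fl F ≡ b → ind b (shift (r F ∸ r G) (q F) k) ≡ term F (+ (k + r G))
          (+ n - + (k + r G))
      summand F G⊆F false h = sym (t-bad F h _ _)
      summand F G⊆F true  h with (r F ∸ r G) Data.Nat.≤? k
      ... | yes d≤k = trans (shift-≤ (q F) d≤k) (cong (λ z → term F (+ z) (+ n - + z)) arith)
        where
        d = r F ∸ r G
        arith : k ∸ d + r F ≡ k + r G
        arith = trans (cong (_+_ (k ∸ d)) (sym (ℕₚ.m∸n+n≡m (mono G⊆F))))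
            (trans (sym (ℕₚ.+-assoc (k ∸ d) d (r G))) (cong (_+ r G) (ℕₚ.m∸n+n≡m d≤k)))
      ... | no ¬d≤k = trans (shift-> (q F) (ℕₚ.≰⇒> ¬d≤k)) (sym (t-low F (fl⇒Flat h) _ _ (Data.Integer.+<+
                        (subst (k + r G <_) (ℕₚ.m∸n+n≡m (mono G⊆F)) (ℕₚ.+-monoˡ-< (r G) (ℕₚ.≰⇒> ¬d≤k))))))

    palindromic : ∀ G → Flat G → ∀ k → k ≤ co G → Zq G k ≡ Zq G (co G ∸ k)
    palindromic G f k h with t-sym G f
    ... | p , sp , e = trans (value k h) (trans (sp (+ k) (+ (co G ∸ k)))
        (sym (trans (value (co G ∸ k) (ℕₚ.m∸n≤m (co G) k))
        (cong (λ z → p (+ (co G ∸ k)) (+ z)) (ℕₚ.m∸[m∸n]≡n h)))))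
      where
      value : ∀ k → k ≤ co G → Zq G k ≡ p (+ k) (+ (co G ∸ k))
      value k h = trans (Zq≡Sup G k) (trans (e _ _)
          (trans (cong₂ (αs (r G) p) (cong +_ (ℕₚ.+-comm k (r G))) second) (αs-index (r G) p k _)))
        where
        n≡ : n ≡ (co G ∸ k) + (k + r G)
        n≡ = trans (sym (ℕₚ.m∸n+n≡m (r≤r⊤ G))) (trans (cong (_+ r G) (sym (ℕₚ.m∸n+n≡m h)))
            (ℕₚ.+-assoc (co G ∸ k) k (r G)))
        second : + n - + (k + r G) ≡ + (co G ∸ k)
        second = trans (cong (λ z → + z - + (k + r G)) n≡) (alg (+ (co G ∸ k)) (+ (k + r G)))
          where
          alg : ∀ a b → (a +ᶻ b) - b ≡ a
          alg = solve-∀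

    Z-formula : ∀ k → Z P M₀ k ≡ Sup ⊥ (λ F → term F (+ k) (+ n - + k))
    Z-formula k = trans (Z≡Zq palindromic k) (trans (Zq≡Sup ⊥ k)
        (cong (λ z → Sup ⊥ (λ F → term F (+ z) (+ n - + z))) (trans (cong (_+_ k) r-⊥) (ℕₚ.+-identityʳ k))))

-- Graphs with a hub

nthd : ∀ {k} → Bool → Vec Bool k → ℕ → Bool
nthd d []      p       = d
nthd d (x ∷ v) zero    = x
nthd d (x ∷ v) (suc p) = nthd d v p

nth : ∀ {k} → Vec Bool k → ℕ → Bool
nth = nthd false

lookup-nth : ∀ {k} (v : Vec Bool k) i → lookup v i ≡ nth v (toℕ i)
lookup-nth (x ∷ v) zero    = refl
lookup-nth (x ∷ v) (suc i) = lookup-nth v i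

nth-⊥ : ∀ k p → nth (⊥ {k}) p ≡ false
nth-⊥ zero    p       = refl
nth-⊥ (suc k) zero    = refl
nth-⊥ (suc k) (suc p) = nth-⊥ k p

firsts : ∀ {k} → ℕ → Vec Bool k → Vec Bool k
firsts t       []      = []
firsts zero    (x ∷ v) = false ∷ firsts zero v
firsts (suc t) (x ∷ v) = x ∷ firsts t v

firsts-zero : ∀ {k} (v : Vec Bool k) → firsts zero v ≡ ⊥
firsts-zero []      = refl
firsts-zero (x ∷ v) = cong (false ∷_) (firsts-zero v)

firsts-all : ∀ {k} (v : Vec Bool k) → firsts k v ≡ v
firsts-all []      = refl
firsts-all (x ∷ v) = cong (x ∷_) (firsts-all v)

nth-firsts : ∀ {k} t (v : Vec Bool k) p → nth (firsts t v) p ≡ true → p < t × nth v p ≡ true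
nth-firsts {k} zero v p h rewrite firsts-zero v = true≢false h (nth-⊥ k p)
nth-firsts (suc t) (x ∷ v) zero    h = s≤s z≤n , h
nth-firsts (suc t) (x ∷ v) (suc p) h with nth-firsts t v p h
... | lt , e = s≤s lt , e

nth-firsts⁺ : ∀ {k} t (v : Vec Bool k) p → p < t → nth v p ≡ true → nth (firsts t v) p ≡ true
nth-firsts⁺ (suc t) (x ∷ v) zero    lt h = h
nth-firsts⁺ (suc t) (x ∷ v) (suc p) lt h = nth-firsts⁺ t v p (ℕₚ.≤-pred lt) h

nthd-in : ∀ {k} d (v : Vec Bool k) p → p < k → nthd d v p ≡ nth v p
nthd-in d (x ∷ v) zero    lt = refl
nthd-in d (x ∷ v) (suc p) lt = nthd-in d v p (ℕₚ.≤-pred lt)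

nthd-out : ∀ {k} d (v : Vec Bool k) p → k ≤ p → nthd d v p ≡ d
nthd-out d []      p       le = refl
nthd-out d (x ∷ v) (suc p) le = nthd-out d v p (ℕₚ.≤-pred le)

nth-all : ∀ {k} b (v : Vec Bool k) → (∀ p → p < k → nth v p ≡ b) → v ≡ replicate k b
nth-all b []      h = refl
nth-all b (x ∷ v) h = cong₂ _∷_ (h 0 (s≤s z≤n)) (nth-all b v (λ p lt → h (suc p) (s≤s lt)))

nth-⊤ : ∀ k p → p < k → nth (⊤ {k}) p ≡ true
nth-⊤ (suc k) zero    lt = refl
nth-⊤ (suc k) (suc p) lt = nth-⊤ k p (ℕₚ.≤-pred lt)

firsts-suc-false : ∀ {k} t (v : Vec Bool k) → nth v t ≡ false → firsts (suc t) v ≡ firsts t v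
firsts-suc-false t       []      h = refl
firsts-suc-false zero    (x ∷ v) h = cong (_∷ firsts zero v) h
firsts-suc-false (suc t) (x ∷ v) h = cong (x ∷_) (firsts-suc-false t v h)

firsts-suc-true : ∀ {k} t (v : Vec Bool k) (t<k : t < k) → nth v t ≡ true → firsts
    (suc t) v ≡ firsts t v ∪ ⁅ fromℕ< t<k ⁆
firsts-suc-true zero    (x ∷ v) t<k h = cong₂ _∷_ h (sym (Sₚ.∪-identityʳ (firsts zero v)))
firsts-suc-true (suc t) (x ∷ v) t<k h = cong₂ _∷_ (sym (𝔹ₚ.∨-identityʳ x))
    (firsts-suc-true t v (ℕₚ.≤-pred t<k) h)

ok-eq : ∀ s s′ → ok s true s′ ≡ true → s ≡ s′
ok-eq true  true  h = refl
ok-eq false false h = refl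

≡ᵇ-≢ : ∀ {a b} → a ≢ b → (a ≡ᵇ b) ≡ false
≡ᵇ-≢ h = ≢true⇒≡false (λ t → h (≡ᵇ⇒≡ t))

<ᵇ-true : ∀ {a b} → a < b → (a <ᵇ b) ≡ true
<ᵇ-true h = T⇒≡ (ℕₚ.<⇒<ᵇ h)

<ᵇ-false : ∀ {a b} → b ≤ a → (a <ᵇ b) ≡ false
<ᵇ-false {a} {b} h = ≢true⇒≡false (λ t → ℕₚ.<⇒≱ (ℕₚ.<ᵇ⇒< a b (≡⇒T t)) h)

-- Wheels and fans have the hub 0 and the outer vertices suc p for p ≤ n′; the edge
-- rim p joins the positions p and jx n′ p.  A fan lacks the last rim edge.

jx : ℕ → ℕ → ℕ
jx n′ p = if p ≡ᵇ n′ then 0 else suc p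

jx-last : ∀ n′ → jx n′ n′ ≡ 0
jx-last n′ rewrite ≡ᵇ-refl n′ = refl

jx-path : ∀ {n′ p} → p ≢ n′ → jx n′ p ≡ suc p
jx-path h rewrite ≡ᵇ-≢ h = refl

module Spoked (n′ a m : ℕ) (a≤ : a ≤ suc n′)
  (rimᴱ : Fin a → Fin m) (spoke : Fin (suc n′) → Fin m) (ed : Fin m → ℕ × ℕ)
  (ed-rim   : ∀ i → ed (rimᴱ i) ≡ (suc (toℕ i) , suc (jx n′ (toℕ i))))
  (ed-spoke : ∀ i → ed (spoke i) ≡ (0 , suc (toℕ i)))
  (cover : ∀ x → (∃ λ i → x ≡ rimᴱ i) ⊎ (∃ λ i → x ≡ spoke i))
  (mk : Vec Bool (suc n′) → Vec Bool a → Subset m)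
  (mk-⊥ : mk ⊥ ⊥ ≡ ⊥)
  (mk-rim   : ∀ s e i → mk s (e ∪ ⁅ i ⁆) ≡ mk s e ∪ ⁅ rimᴱ i ⁆)
  (mk-spoke : ∀ s e i → mk (s ∪ ⁅ i ⁆) e ≡ mk s e ∪ ⁅ spoke i ⁆)
  (lookup-rim   : ∀ s e i → lookup (mk s e) (rimᴱ i) ≡ lookup e i)
  (lookup-spoke : ∀ s e i → lookup (mk s e) (spoke i) ≡ lookup s i)
  (simple : a ≤ n′ ⊎ 1 ≤ n′) where

  open Edges (suc (suc n′)) ed public

  jx-< : ∀ {p} → p < suc n′ → jx n′ p < suc n′
  jx-< {p} h with p Data.Nat.≟ n′
  ... | yes refl rewrite ≡ᵇ-refl n′ = s≤s z≤n
  ... | no  p≢   rewrite ≡ᵇ-≢ p≢ = s≤s (ℕₚ.≤∧≢⇒< (ℕₚ.≤-pred h) p≢)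

  rim<n : (i : Fin a) → toℕ i < suc n′
  rim<n i = ℕₚ.<-≤-trans (Finₚ.toℕ<n i) a≤

  jx-≢ : (i : Fin a) → toℕ i ≢ jx n′ (toℕ i)
  jx-≢ i e with toℕ i Data.Nat.≟ n′
  ... | no p≢ rewrite ≡ᵇ-≢ p≢ = ℕₚ.1+n≢n (sym e)
  ... | yes p≡ = case simple of λ
    { (inj₁ a≤n′) → ℕₚ.<-irrefl p≡ (ℕₚ.<-≤-trans (Finₚ.toℕ<n i) a≤n′)
    ; (inj₂ 1≤n′) → ℕₚ.<-irrefl (trans (sym (trans (cong (jx n′) p≡) (jx-last n′))) (trans (sym e) p≡)) 1≤n′ }

  src< : ∀ x → src x < suc (suc n′)
  src< x with cover x
  ... | inj₁ (i , refl) rewrite ed-rim i   = s≤s (rim<n i)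
  ... | inj₂ (i , refl) rewrite ed-spoke i = s≤s z≤n

  tgt< : ∀ x → tgt x < suc (suc n′)
  tgt< x with cover x
  ... | inj₁ (i , refl) rewrite ed-rim i   = s≤s (jx-< (rim<n i))
  ... | inj₂ (i , refl) rewrite ed-spoke i = s≤s (Finₚ.toℕ<n i)

  src≢tgt : ∀ x → src x ≢ tgt x
  src≢tgt x with cover x
  ... | inj₁ (i , refl) rewrite ed-rim i   = λ e → jx-≢ i (ℕₚ.suc-injective e)
  ... | inj₂ (i , refl) rewrite ed-spoke i = λ ()

  open Rank src< tgt< src≢tgt public

  rim-conn : ∀ s e {p} → p < a → nth e p ≡ true → Conn (mk s e) (suc p) (suc (jx n′ p))
  rim-conn s e {p} p<a h = subst₂ (Conn (mk s e)) (trans (cong proj₁ (ed-rim i)) (cong suc toℕ≡))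
      (trans (cong proj₂ (ed-rim i)) (cong (λ z → suc (jx n′ z)) toℕ≡))
      (fwd (rimᴱ i) (lookup⇒∈ (trans (lookup-rim s e i) (trans (lookup-nth e i) (trans (cong (nth e) toℕ≡) h))))
          stop)
    where
    i = fromℕ< p<a
    toℕ≡ = Finₚ.toℕ-fromℕ< p<a

  spoke-conn : ∀ s e {p} → p < suc n′ → nth s p ≡ true → Conn (mk s e) 0 (suc p)
  spoke-conn s e {p} p<n h = subst₂ (Conn (mk s e)) (cong proj₁ (ed-spoke i))
      (trans (cong proj₂ (ed-spoke i)) (cong suc toℕ≡))
      (fwd (spoke i) (lookup⇒∈ (trans (lookup-spoke s e i)
          (trans (lookup-nth s i) (trans (cong (nth s) toℕ≡) h)))) stop)
    where
    i = fromℕ< p<n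
    toℕ≡ = Finₚ.toℕ-fromℕ< p<n

  Respects : Vec Bool (suc n′) → Vec Bool a → (ℕ → Bool) → Set
  Respects s e ℓ = (∀ p → p < a → nth e p ≡ true → ℓ (suc p) ≡ ℓ (suc (jx n′ p)))
                 × (∀ p → p < suc n′ → nth s p ≡ true → ℓ 0 ≡ ℓ (suc p))

  separate : ∀ s e ℓ → Respects s e ℓ → ∀ {u v} → ℓ u ≢ ℓ v → ¬ Conn (mk s e) u v
  separate s e ℓ (hr , hs) n c = n (Conn-label ℓ edge-ok c)
    where
    edge-ok : ∀ x → x ∈ mk s e → ℓ (src x) ≡ ℓ (tgt x)
    edge-ok x x∈ with cover x
    ... | inj₁ (i , refl) rewrite ed-rim i   = hr (toℕ i) (Finₚ.toℕ<n i)
        (trans (sym (lookup-nth e i)) (trans (sym (lookup-rim s e i)) (∈⇒lookup x∈)))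
    ... | inj₂ (i , refl) rewrite ed-spoke i = hs (toℕ i) (Finₚ.toℕ<n i)
        (trans (sym (lookup-nth s i)) (trans (sym (lookup-spoke s e i)) (∈⇒lookup x∈)))

  Closed : Subset m → Set
  Closed F = ∀ x → x ∉ F → ¬ Conn F (src x) (tgt x)

  Triples : Vec Bool (suc n′) → Vec Bool a → Set
  Triples s e = ∀ p → p < a → ok (nth s p) (nth e p) (nth s (jx n′ p)) ≡ true

  rim-∉ : ∀ s e {p} (p<a : p < a) → nth e p ≡ false → rimᴱ (fromℕ< p<a) ∉ mk s e
  rim-∉ s e p<a h = lookup⇒∉ (trans (lookup-rim s e _)
      (trans (lookup-nth e _) (trans (cong (nth e) (Finₚ.toℕ-fromℕ< p<a)) h)))

  spoke-∉ : ∀ s e {p} (p<n : p < suc n′) → nth s p ≡ false → spoke (fromℕ< p<n) ∉ mk s e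
  spoke-∉ s e p<n h = lookup⇒∉ (trans (lookup-spoke s e _)
      (trans (lookup-nth s _) (trans (cong (nth s) (Finₚ.toℕ-fromℕ< p<n)) h)))

  closed-spoke : ∀ s e → Closed (mk s e) → ∀ {p} → p < suc n′ → nth s p ≡ false → ¬ Conn (mk s e) 0 (suc p)
  closed-spoke s e c p<n h k = c (spoke (fromℕ< p<n)) (spoke-∉ s e p<n h)
    (subst₂ (Conn (mk s e)) (sym (cong proj₁ (ed-spoke _)))
        (sym (trans (cong proj₂ (ed-spoke _)) (cong suc (Finₚ.toℕ-fromℕ< p<n)))) k)

  closed-rim : ∀ s e → Closed (mk s e) → ∀ {p} → p < a → nth e p ≡ false → ¬ Conn (mk s e) (suc p)
      (suc (jx n′ p))
  closed-rim s e c p<a h k = c (rimᴱ (fromℕ< p<a)) (rim-∉ s e p<a h)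
    (subst₂ (Conn (mk s e)) (sym (trans (cong proj₁ (ed-rim _)) (cong suc (Finₚ.toℕ-fromℕ< p<a))))
        (sym (trans (cong proj₂ (ed-rim _)) (cong (λ z → suc (jx n′ z)) (Finₚ.toℕ-fromℕ< p<a)))) k)

  -- Two edges of a triangle connect the ends of the third.
  closed⇒triples : ∀ s e → Closed (mk s e) → Triples s e
  closed⇒triples s e c p p<a with nth s p in sp | nth e p in ep | nth s (jx n′ p) in sj
  ... | true  | true  | true  = refl
  ... | true  | true  | false = ⊥-elim (closed-spoke s e c (jx-< p<n) sj
      (Conn-trans (spoke-conn s e p<n sp) (rim-conn s e p<a ep)))
    where p<n = ℕₚ.<-≤-trans p<a a≤
  ... | true  | false | true  = ⊥-elim (closed-rim s e c p<a ep
      (Conn-trans (Conn-sym (spoke-conn s e p<n sp)) (spoke-conn s e (jx-< p<n) sj)))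
    where p<n = ℕₚ.<-≤-trans p<a a≤
  ... | true  | false | false = refl
  ... | false | true  | true  = ⊥-elim (closed-spoke s e c p<n sp
      (Conn-trans (spoke-conn s e (jx-< p<n) sj) (Conn-sym (rim-conn s e p<a ep))))
    where p<n = ℕₚ.<-≤-trans p<a a≤
  ... | false | true  | false = refl
  ... | false | false | _     = refl

  -- The labelling by membership in the component of the hub; the triangle condition makes it
  -- constant along rim edges.
  status : Vec Bool (suc n′) → ℕ → Bool
  status s zero    = true
  status s (suc p) = nth s p

  status-respects : ∀ s e → Triples s e → Respects s e (status s)
  status-respects s e t = (λ p p<a ep → ok-eq _ _ (subst (λ b → ok (nth s p) b (nth s (jx n′ p)) ≡ true) ep
      (t p p<a))) , (λ p _ sp → sym sp)

  -- Separates the positions in [lo , hi) that are not joined to the hub.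
  interval : Vec Bool (suc n′) → ℕ → ℕ → ℕ → Bool
  interval s lo hi zero    = false
  interval s lo hi (suc p) = ((lo ≤ᵇ p) ∧ (p <ᵇ hi)) ∧ not (nth s p)

  interval-in : ∀ s {lo hi p} → lo ≤ p → p < hi → nth s p ≡ false → interval s lo hi (suc p) ≡ true
  interval-in s h k e rewrite ≤ᵇ-true h | <ᵇ-true k | e = refl

  interval-below : ∀ s {lo hi p} → p < lo → interval s lo hi (suc p) ≡ false
  interval-below s h rewrite ≤ᵇ-false h = refl

  interval-above : ∀ s {lo hi p} → hi ≤ p → interval s lo hi (suc p) ≡ false
  interval-above s {lo} {hi} {p} h rewrite <ᵇ-false h | 𝔹ₚ.∧-zeroʳ (lo ≤ᵇ p) = refl

  interval-path : ∀ s {lo hi p} → suc p ≢ lo → suc p ≢ hi → nth s p ≡ nth s (suc p) → interval s lo hi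
      (suc p) ≡ interval s lo hi (suc (suc p))
  interval-path s {lo} {hi} {p} nl nh e rewrite e = cong (_∧ not (nth s (suc p))) (cong₂ _∧_ left right)
    where
    left : (lo ≤ᵇ p) ≡ (lo ≤ᵇ suc p)
    left = true⇔⇒≡ (λ h → ≤ᵇ-true (ℕₚ.m≤n⇒m≤1+n (ℕₚ.≤ᵇ⇒≤ lo p (≡⇒T h))))
                   (λ h → ≤ᵇ-true (ℕₚ.≤-pred (ℕₚ.≤∧≢⇒< (ℕₚ.≤ᵇ⇒≤ lo (suc p) (≡⇒T h)) (λ q → nl (sym q)))))
    right : (p <ᵇ hi) ≡ (suc p <ᵇ hi)
    right = true⇔⇒≡ (λ h → <ᵇ-true (ℕₚ.≤∧≢⇒< (ℕₚ.<ᵇ⇒< p hi (≡⇒T h)) nh))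
                    (λ h → <ᵇ-true (ℕₚ.<-trans ℕₚ.≤-refl (ℕₚ.<ᵇ⇒< (suc p) hi (≡⇒T h))))

  interval-spokes : ∀ s {lo hi} p → p < suc n′ → nth s p ≡ true → interval s lo hi 0 ≡ interval s lo hi (suc p)
  interval-spokes s {lo} {hi} p _ sp rewrite sp = sym (𝔹ₚ.∧-zeroʳ ((lo ≤ᵇ p) ∧ (p <ᵇ hi)))

  triple-eq : ∀ s e → Triples s e → ∀ {p} → p < a → nth e p ≡ true → nth s p ≡ nth s (jx n′ p)
  triple-eq s e t {p} p<a ep = ok-eq _ _ (subst (λ b → ok (nth s p) b (nth s (jx n′ p)) ≡ true) ep (t p p<a))

  triples⇒spokes : ∀ s e → Triples s e → ∀ {p} → nth s p ≡ false → ¬ Conn (mk s e) 0 (suc p)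
  triples⇒spokes s e t sp = separate s e (status s) (status-respects s e t) (λ q → true≢false (sym q) sp)

  Gap : Vec Bool (suc n′) → Vec Bool a → ℕ → Set
  Gap s e p = nth e p ≡ false × nth s p ≡ false × nth s (jx n′ p) ≡ false × Conn (mk s e) (suc p)
      (suc (jx n′ p))

  -- `status` rules out missing spokes and missing rim edges with one joined end, and the triangle
  -- condition those with two. Only a rim edge bypassed along the rim itself can remain.
  triples⇒gap : ∀ s e → Triples s e → ∀ x → x ∉ mk s e → Conn (mk s e) (src x)
      (tgt x) → ∃ λ i → x ≡ rimᴱ i × Gap s e (toℕ i)
  triples⇒gap s e t x x∉ c with cover x
  ... | inj₂ (i , refl) rewrite ed-spoke i = ⊥-elim
      (triples⇒spokes s e t (trans (sym (trans (lookup-spoke s e i) (lookup-nth s i))) (∉⇒lookup x∉)) c)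
  ... | inj₁ (i , refl) rewrite ed-rim i = go (nth s p) (nth s (jx n′ p)) refl refl
    where
    p = toℕ i
    p<a = Finₚ.toℕ<n i
    ep : nth e p ≡ false
    ep = trans (sym (trans (lookup-rim s e i) (lookup-nth e i))) (∉⇒lookup x∉)
    go : ∀ b b′ → nth s p ≡ b → nth s (jx n′ p) ≡ b′ → ∃ λ j → rimᴱ i ≡ rimᴱ j × Gap s e (toℕ j)
    go false false q q′ = i , refl , ep , q , q′ , c
    go false true  q q′ = ⊥-elim (separate s e (status s) (status-respects s e t)
        (λ z → true≢false (trans z q′) q) c)
    go true  false q q′ = ⊥-elim (separate s e (status s) (status-respects s e t)
        (λ z → true≢false q (trans z q′)) c)
    go true  true  q q′ = case subst₂ (λ b b′ → ok b false b′ ≡ true) q q′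
        (subst (λ b → ok (nth s p) b (nth s (jx n′ p)) ≡ true) ep (t p p<a)) of λ ()

  flat⇒closed : ∀ {F} → (∀ x → x ∉ F → ρ F < ρ (F ∪ ⁅ x ⁆)) → Closed F
  flat⇒closed {F} f x x∉ c = ℕₚ.<-irrefl (sym (trans (ρ-add F x)
      (trans (cong (_+_ (ρ F)) (gain-yes c)) (ℕₚ.+-identityʳ _)))) (f x x∉)

  ρ-spokes : ∀ s t → t ≤ suc n′ → ρ (mk (firsts t s) ⊥) ≡ count (nth s) t
  ρ-spokes s zero    _  = trans (cong ρ (trans (cong (λ v → mk v ⊥) (firsts-zero s)) mk-⊥)) ρ-⊥
  ρ-spokes s (suc t) t< = go (nth s t) refl
    where
    ih = ρ-spokes s t (ℕₚ.<⇒≤ t<)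
    go : ∀ b → nth s t ≡ b → ρ (mk (firsts (suc t) s) ⊥) ≡ bit b + count (nth s) t
    go false h = trans (cong (λ v → ρ (mk v ⊥)) (firsts-suc-false t s h)) ih
    go true  h = trans (cong (λ v → ρ (mk v ⊥)) (firsts-suc-true t s t< h))
      (trans (cong ρ (mk-spoke (firsts t s) ⊥ (fromℕ< t<)))
      (trans (ρ-add (mk (firsts t s) ⊥) (spoke (fromℕ< t<)))
      (trans (cong₂ _+_ ih (gain-no fresh)) (ℕₚ.+-comm _ 1))))
      where
      ℓ : ℕ → Bool
      ℓ w = w ≡ᵇ suc t
      fresh : ¬ Conn (mk (firsts t s) ⊥) (src (spoke (fromℕ< t<))) (tgt (spoke (fromℕ< t<)))
      fresh rewrite ed-spoke (fromℕ< t<) | Finₚ.toℕ-fromℕ< t< = separate (firsts t s) ⊥ ℓ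
        ((λ p _ h → true≢false h (nth-⊥ a p)) ,
         (λ p _ h → sym (≡ᵇ-≢ {suc p} {suc t} (λ { refl → ℕₚ.<-irrefl refl (proj₁ (nth-firsts t s p h)) }))))
        (λ q → true≢false (trans q (≡ᵇ-refl t)) refl)

  rimBit : Vec Bool (suc n′) → Vec Bool a → ℕ → Bool
  rimBit s e p = nth e p ∧ not (nth s (jx n′ p))

  -- Adding rim edges in path order, the far end of each edge is new unless it is joined to the hub,
  -- and then the near end is joined too. `t ≤ n′` leaves out the edge that closes the cycle.
  ρ-rims : ∀ s e → (∀ p → p < a → nth e p ≡ true → nth s (jx n′ p) ≡ true → nth s p ≡ true) →
           ∀ t → t ≤ a → t ≤ n′ → ρ (mk s (firsts t e)) ≡ count (nth s) (suc n′) + count (rimBit s e) t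
  ρ-rims s e h zero _ _ = trans (cong (λ v → ρ (mk s v)) (firsts-zero e))
      (trans (trans (cong (λ v → ρ (mk v ⊥)) (sym (firsts-all s))) (ρ-spokes s (suc n′) ℕₚ.≤-refl))
      (sym (ℕₚ.+-identityʳ _)))
  ρ-rims s e h (suc t) t<a t<n′ = go (nth e t) refl
    where
    ih = ρ-rims s e h t (ℕₚ.<⇒≤ t<a) (ℕₚ.<⇒≤ t<n′)
    c₀ = count (nth s) (suc n′)
    x = rimᴱ (fromℕ< t<a)
    jt : jx n′ t ≡ suc t
    jt = jx-path (λ q → ℕₚ.<-irrefl q t<n′)
    ed≡ : ed x ≡ (suc t , suc (suc t))
    ed≡ = trans (ed-rim (fromℕ< t<a)) (cong₂ _,_ (cong suc tt) (cong suc (trans (cong (jx n′) tt) jt)))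
      where tt = Finₚ.toℕ-fromℕ< t<a
    A = mk s (firsts t e)
    go : ∀ b → nth e t ≡ b → ρ (mk s (firsts (suc t) e)) ≡ c₀ + (bit (rimBit s e t) + count (rimBit s e) t)
    go false h′ = trans (cong (λ v → ρ (mk s v)) (firsts-suc-false t e h′))
        (trans ih (cong (λ b → c₀ + (bit (b ∧ not (nth s (jx n′ t))) + count (rimBit s e) t)) (sym h′)))
    go true  h′ = trans (cong (λ v → ρ (mk s v)) (firsts-suc-true t e t<a h′))
      (trans (cong ρ (mk-rim s (firsts t e) (fromℕ< t<a)))
      (trans (ρ-add A x)
      (trans (cong₂ _+_ ih (new (nth s (jx n′ t)) refl)) (arith c₀ _ _))))
      where
      arith : ∀ a b c → (a + b) + c ≡ a + (c + b)
      arith = solveℕ-∀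
      new : ∀ b → nth s (jx n′ t) ≡ b → gain K A x ≡ bit (rimBit s e t)
      new true q = trans (gain-yes {A} {x} (subst₂ (Conn A) (sym (cong proj₁ ed≡)) (sym (cong proj₂ ed≡))
                     (Conn-trans (Conn-sym (spoke-conn s (firsts t e) (ℕₚ.<-trans t<n′ ℕₚ.≤-refl)
                         (h t t<a h′ q))) (spoke-conn s (firsts t e) (s≤s t<n′)
                         (subst (λ z → nth s z ≡ true) jt q)))))
                   (sym (trans (cong₂ (λ b b′ → bit (b ∧ not b′)) h′ q) refl))
      new false q = trans (gain-no {A} {x} (subst₂ (λ u v → ¬ Conn A u v) (sym (cong proj₁ ed≡))
          (sym (cong proj₂ ed≡)) fresh))
                   (sym (cong₂ (λ b b′ → bit (b ∧ not b′)) h′ q))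
        where
        ℓ : ℕ → Bool
        ℓ w = w ≡ᵇ suc (suc t)
        fresh : ¬ Conn A (suc t) (suc (suc t))
        fresh = separate s (firsts t e) ℓ
          ((λ p p<a hp → let p<t = proj₁ (nth-firsts t e p hp) in
              trans (≡ᵇ-≢ {suc p} {suc (suc t)} (λ { refl → ℕₚ.<⇒≱ p<t (ℕₚ.n≤1+n t) }))
                    (sym (trans (cong (λ z → suc z ≡ᵇ suc (suc t))
                        (jx-path (λ q → ℕₚ.<-irrefl q (ℕₚ.<-trans p<t t<n′))))
                        (≡ᵇ-≢ {suc (suc p)} {suc (suc t)} (λ { refl → ℕₚ.<-irrefl refl p<t }))))) ,
           (λ p _ sp → sym (≡ᵇ-≢ {suc p} {suc (suc t)}
               (λ { refl → true≢false sp (subst (λ z → nth s z ≡ false) jt q) }))))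
          (λ z → true≢false (trans z (≡ᵇ-refl (suc (suc t)))) (≡ᵇ-≢ {suc t} {suc (suc t)} (λ ())))

-- Weights of the flats of wheels and whirls

nxt-word : ∀ {k} (e s : Vec Bool k) fin → nxt (word e s) fin ≡ nthd fin s 0
nxt-word []      []      fin = refl
nxt-word (e ∷ _) (s ∷ _) fin = refl

okc⁺ : ∀ {k} (e s : Vec Bool k) fin → (∀ p → p < k → ok (nth s p) (nth e p) (nthd fin s (suc p)) ≡ true) → okc
    (word e s) fin ≡ true
okc⁺ []       []       fin h = refl
okc⁺ (e ∷ es) (s ∷ ss) fin h = ∧-true (trans (cong (ok s e) (nxt-word es ss fin)) (h 0 (s≤s z≤n)))
    (okc⁺ es ss fin (λ p lt → h (suc p) (s≤s lt)))

okc⁻ : ∀ {k} (e s : Vec Bool k) fin → okc (word e s) fin ≡ true → ∀ p → p < k → ok (nth s p) (nth e p)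
    (nthd fin s (suc p)) ≡ true
okc⁻ (e ∷ es) (s ∷ ss) fin h zero    lt = trans (cong (ok s e) (sym (nxt-word es ss fin))) (∧-trueˡ h)
okc⁻ (e ∷ es) (s ∷ ss) fin h (suc p) lt = okc⁻ es ss fin (∧-trueʳ {ok s e (nxt (word es ss) fin)} h) p
    (ℕₚ.≤-pred lt)

count-shift : ∀ f n → count f (suc n) ≡ bit (f 0) + count (f ∘ suc) n
count-shift f zero    = refl
count-shift f (suc n) = trans (cong (_+_ (bit (f (suc n)))) (count-shift f n))
    (swap (bit (f (suc n))) (bit (f 0)) (count (f ∘ suc) n))
  where
  swap : ∀ a b c → a + (b + c) ≡ b + (a + c)
  swap = solveℕ-∀

count-cong : ∀ {f g} n → (∀ p → p < n → f p ≡ g p) → count f n ≡ count g n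
count-cong zero    h = refl
count-cong (suc n) h = cong₂ _+_ (cong bit (h n ℕₚ.≤-refl)) (count-cong n (λ p lt → h p (ℕₚ.m≤n⇒m≤1+n lt)))

-- The two boundary bits compensate for charging each spoke to the preceding letter. They cancel for
-- a cycle, where `fin` is the first spoke bit.
cnt-count : ∀ {k} (e s : Vec Bool k) fin →
  cnt (word e s) fin + bit (nthd fin s 0) ≡ (count (nth s) k + count
      (λ p → nth e p ∧ not (nthd fin s (suc p))) k) + bit fin
cnt-count []       []       fin = refl
cnt-count {suc k} (e ∷ es) (s ∷ ss) fin =
  trans (cong (λ x → (bit (e ∨ x) + cnt (word es ss) fin) + bit s) (nxt-word es ss fin))
  (trans (cong (λ z → (z + cnt (word es ss) fin) + bit s) (split e x))
  (trans (re₁ (bit x) (bit (e ∧ not x)) (cnt (word es ss) fin) (bit s))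
  (trans (cong (λ z → (bit s + bit (e ∧ not x)) + z) (cnt-count es ss fin))
  (trans (re₂ (bit s) (bit (e ∧ not x)) _ _ (bit fin))
         (cong (λ z → z + bit fin) (sym (cong₂ _+_ (count-shift (nth (s ∷ ss)) k)
             (count-shift (λ p → nth (e ∷ es) p ∧ not (nthd fin (s ∷ ss) (suc p))) k))))))))
  where
  x = nthd fin ss 0
  split : ∀ e x → bit (e ∨ x) ≡ bit x + bit (e ∧ not x)
  split true  true  = refl
  split true  false = refl
  split false true  = refl
  split false false = refl
  re₁ : ∀ a b c d → ((a + b) + c) + d ≡ (d + b) + (c + a)
  re₁ = solveℕ-∀
  re₂ : ∀ a b c d f → (a + b) + ((c + d) + f) ≡ ((a + c) + (b + d)) + f
  re₂ = solveℕ-∀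

length-word : ∀ {k} (e s : Vec Bool k) → Data.List.length (word e s) ≡ k
length-word []       []       = refl
length-word (e ∷ es) (s ∷ ss) = cong suc (length-word es ss)

anyS-word : ∀ {k} (e s : Vec Bool k) → s ⊑ ⊥ ≡ false → anyS (word e s) ≡ true
anyS-word (e ∷ es) (true ∷ ss)  h = refl
anyS-word (e ∷ es) (false ∷ ss) h = anyS-word es ss h

okc-++ : ∀ u v fin → okc (u ++ v) fin ≡ okc u (nxt v fin) ∧ okc v fin
nxt-++ : ∀ u v fin → nxt (u ++ v) fin ≡ nxt u (nxt v fin)
okc-++ []            v fin = refl
okc-++ ((e , s) ∷ u) v fin = trans (cong₂ _∧_ (cong (ok s e) (nxt-++ u v fin)) (okc-++ u v fin))
    (sym (𝔹ₚ.∧-assoc (ok s e (nxt u (nxt v fin))) _ _))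
nxt-++ []            v fin = refl
nxt-++ ((e , s) ∷ u) v fin = refl

cnt-++ : ∀ u v fin → cnt (u ++ v) fin ≡ cnt u (nxt v fin) + cnt v fin
cnt-++ []            v fin = refl
cnt-++ ((e , s) ∷ u) v fin = trans (cong₂ _+_ (cong (λ x → bit (e ∨ x)) (nxt-++ u v fin)) (cnt-++ u v fin))
    (sym (ℕₚ.+-assoc (bit (e ∨ nxt u (nxt v fin))) _ _))

okc⇒admissible : ∀ w fin → okc w fin ≡ true → Admissible w fin
okc⇒admissible []            fin h = _
okc⇒admissible ((e , s) ∷ w) fin h = (λ { refl n → back s n (∧-trueˡ h) }) , okc⇒admissible w fin
    (∧-trueʳ {ok s e (nxt w fin)} h)
  where
  back : ∀ s {s′} → s′ ≡ true → ok s true s′ ≡ true → s ≡ true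
  back true  refl _ = refl
  back false refl ()

split-hub : ∀ w → anyS w ≡ true → ∃ λ u → ∃ λ e → ∃ λ v → w ≡ u ++ (e , true) ∷ v
split-hub ((e , true) ∷ w)  h = [] , e , w , refl
split-hub ((e , false) ∷ w) h with split-hub w h
... | u , e′ , v , eq = (e , false) ∷ u , e′ , v , cong ((e , false) ∷_) eq

hub-run : ∀ e v → Admissible ((e , true) ∷ v) true →
  ∃ λ p → Symmetric p × (runG ((e , true) ∷ v) (at 0 𝟏) 0 ≈ αs (cnt ((e , true) ∷ v) true) p)
hub-run e v adm with hub-to-hub ((e , true) ∷ v) true adm refl 0 𝟏 𝟏-symmetric (λ _ → refl)
... | p , sp , h = p , sp , λ i j → trans (cong≋ (∘-linear (runG-linear v) (U-linear false e))
    (λ { zero i j → refl ; (suc h) i j → refl }) 0 i j) (h i j)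

-- The cycle is cut at a joined position, where `hub-to-hub` applies. The triangle condition and
-- `cnt` split over concatenation, so the rotation preserves them.
cyclic-symmetric : ∀ H w fin → okc w (nxt w fin) ≡ true → anyS w ≡ true → Data.List.length w ≤ H →
  ∃ λ p → Symmetric p × (tr H (runG w) ≈ αs (cnt w (nxt w fin)) p)
cyclic-symmetric H w fin o a len with split-hub w a
... | u , e , v , refl with hub-run e (v ++ u) adm
  where
  v′ = (e , true) ∷ v
  fin₀ : nxt (u ++ v′) fin ≡ nxt u true
  fin₀ = nxt-++ u v′ fin
  parts : okc u true ∧ okc v′ (nxt u true) ≡ true
  parts = trans (sym (okc-++ u v′ (nxt u true))) (subst (λ b → okc (u ++ v′) b ≡ true) fin₀ o)
  adm : Admissible (v′ ++ u) true
  adm = okc⇒admissible (v′ ++ u) true (trans (okc-++ v′ u true)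
      (∧-true (∧-trueʳ {okc u true} parts) (∧-trueˡ parts)))
... | p , sp , h = p , sp , λ i j →
    trans (rotate H u e v len′ i j) (trans (h i j) (cong (λ z → αs z p i j) cnt≡))
  where
  v′ = (e , true) ∷ v
  len′ : Data.List.length v′ ≤ H
  len′ = ℕₚ.≤-trans (subst (Data.List.length v′ ≤_) (sym (Lₚ.length-++ u)) (ℕₚ.m≤n+m _ (Data.List.length u)))
      len
  cnt≡ : cnt (v′ ++ u) true ≡ cnt (u ++ v′) (nxt (u ++ v′) fin)
  cnt≡ = trans (cnt-++ v′ u true) (trans (ℕₚ.+-comm (cnt v′ (nxt u true)) (cnt u true))
      (trans (sym (cnt-++ u v′ (nxt u true))) (cong (cnt (u ++ v′)) (sym (nxt-++ u v′ fin)))))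

module CyclicWords {n′ : ℕ} where

  private
    n = suc n′
    Bits = Vec Bool n

  okW : Bits → Bits → Bool
  okW e s = okc (word e s) (nth s 0)

  cntW : Bits → Bits → ℕ
  cntW e s = cnt (word e s) (nth s 0)

  cntW-rim : ∀ (e : Bits) → cntW e ⊥ ≡ onesV e
  cntW-rim e = cnt-rim e

  okW-rim : ∀ (e : Bits) → okW e ⊥ ≡ true
  okW-rim e = okc-rim e

  whirl-spokes : ∀ (e s : Bits) → s ⊑ ⊥ ≡ false → whirl-term e s ≈ tr n (run (word e s))
  whirl-spokes e s h i j rewrite h = ℤₚ.+-identityʳ _

  whirl-rim : ∀ (e : Bits) i j → whirl-term e ⊥ i j ≡ tr n (runL true e) i j - tr n (runL false e) i j
  whirl-rim (e ∷ es) i j = trans (cong (λ b → tr n (run (word (e ∷ es) ⊥)) i j +ᶻ ind b (D n (e ∷ es) i j))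
      (⊆⇒⊑ {A = ⊥ {n}} {⊥} id)) (rim-term n′ e es i j)

  whirl-bad : ∀ (e s : Bits) → okW e s ≡ false → whirl-term e s ≈ 𝟎
  whirl-bad e s bad i j with s ⊑ ⊥ in eq
  ... | true  = true≢false (subst (λ z → okW e z ≡ true) (sym (⊑⊥⇒≡ s eq)) (okW-rim e)) bad
  whirl-bad (e ∷ es) (s ∷ ss) bad i j | false = trans (ℤₚ.+-identityʳ _) (tr-bad n e s (word es ss) bad i j)

  whirl-low : ∀ (e s : Bits) → Low (cntW e s) (whirl-term e s)
  whirl-low e s = go (s ⊑ ⊥) refl
    where
    spokes : ∀ (e s : Bits) → Low (cntW e s) (tr n (run (word e s)))
    spokes (e ∷ es) (s ∷ ss) = tr-low n e s (word es ss)
    go : ∀ b → s ⊑ ⊥ ≡ b → Low (cntW e s) (whirl-term e s)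
    go true  eq rewrite ⊑⊥⇒≡ s eq = λ i j lt → trans (whirl-rim e i j)
        (rim-low n e i j (subst (λ c → i <ᶻ + c) (cntW-rim e) lt))
    go false eq i j lt = trans (whirl-spokes e s eq i j) (spokes e s i j lt)

  whirl-high : ∀ (e s : Bits) → okW e s ≡ true → cntW e s < n → ∀ i j → j +ᶻ + cntW e s ≤ᶻ i → whirl-term e s i
      j ≡ + 0
  whirl-high e s o lt i j = go (s ⊑ ⊥) refl
    where
    strict : ∀ (e s : Bits) → okW e s ≡ true → s ⊑ ⊥ ≡ false → cntW e s < n → ones (word e s) < cntW e s
    strict (e ∷ es) (s ∷ ss) o h lt = cyclic-strict e s (word es ss) o (anyS-word (e ∷ es) (s ∷ ss) h)
        (subst (cntW (e ∷ es) (s ∷ ss) <_) (sym (length-word (e ∷ es) (s ∷ ss))) lt)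
    go : ∀ b → s ⊑ ⊥ ≡ b → j +ᶻ + cntW e s ≤ᶻ i → whirl-term e s i j ≡ + 0
    go true  eq le rewrite ⊑⊥⇒≡ s eq = trans (whirl-rim e i j)
        (rim-high n e i j (subst (λ c → j +ᶻ + c ≤ᶻ i) (cntW-rim e) le))
    go false eq le = trans (whirl-spokes e s eq i j)
        (tr-bnd n (word e s) i j (ℤₚ.<-≤-trans (ℤₚ.+-monoʳ-< j (Data.Integer.+<+ (strict e s o eq lt))) le))

  all-ones : ∀ {k} (e : Vec Bool k) → zerosV e ≡ 0 → e ≡ ⊤
  all-ones []          _ = refl
  all-ones (true ∷ e)  h = cong (true ∷_) (all-ones e h)

  runL-pow : ∀ {k} b (e : Vec Bool k) x → runL b e x ≋ (λ h → αs (onesV e) (pow (J b) (zerosV e) x h))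
  runL-pow b []          x = ≋-refl
  runL-pow b (true ∷ e)  x = ≋-trans (scalar (runL-linear b e) α-scalar x)
      (λ h i j → runL-pow b e x h (predᶻ i) j)
  runL-pow b (false ∷ e) x h i j = trans (runL-pow b e (J b x) h i j)
      (cong (λ y → αs (onesV e) (y h) i j) (pow-comm (J b) (zerosV e) x))

  Σ≤-αs : ∀ H o (f : ℕ → Bi) → Σ≤ H (λ h → αs o (f h)) ≈ αs o (Σ≤ H f)
  Σ≤-αs zero    o f i j = refl
  Σ≤-αs (suc H) o f i j = trans (cong (_+ᶻ αs o (f (suc H)) i j) (Σ≤-αs H o f i j))
      (sym (Scalar.φ-⊕ (αs-scalar o) (Σ≤ H f) (f (suc H)) i j))

  tr-J : ∀ H → tr H (J true) ≈ tr H (J false) ⊕ β 𝟏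
  tr-J zero    i j = ℤₚ.+-comm (𝟏 i (predᶻ j)) (+ 0)
  tr-J (suc H) i j = trans (cong (_+ᶻ x) (tr-J H i j)) (swap (tr H (J false) i j) (𝟏 i (predᶻ j)) x)
    where
    x = J true (at (suc H) 𝟏) (suc H) i j
    swap : ∀ a b c → (a +ᶻ b) +ᶻ c ≡ (a +ᶻ c) +ᶻ b
    swap = solve-∀

  whirl-pow : ∀ (e : Bits) i j → whirl-term e ⊥ i j ≡ αs (onesV e) (tr n (pow (J true) (zerosV e))) i j - αs
      (onesV e) (tr n (pow (J false) (zerosV e))) i j
  whirl-pow e i j = trans (whirl-rim e i j) (cong₂ _-_ (one true) (one false))
    where
    one : ∀ b → tr n (runL b e) i j ≡ αs (onesV e) (tr n (pow (J b) (zerosV e))) i j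
    one b = trans (Σ≤-cong n i j (λ h → runL-pow b e (at h 𝟏) h i j))
        (Σ≤-αs n (onesV e) (λ h → pow (J b) (zerosV e) (at h 𝟏) h) i j)

  -- Without a missing edge no step is taken and the two traces coincide; accordingly the rim is not
  -- a flat of the whirl.
  whirl-full : ∀ (e : Bits) → zerosV e ≡ 0 → whirl-term e ⊥ ≈ 𝟎
  whirl-full e z i j = trans (whirl-pow e i j) (subst
      (λ k → αs (onesV e) (tr n (pow (J true) k)) i j - αs (onesV e) (tr n (pow (J false) k)) i j ≡ + 0) (sym z)
      (ℤₚ.+-inverseʳ (αs (onesV e) (tr n (λ x → x)) i j)))

  wheel-rim : ∀ (e : Bits) i j → wheel-term e ⊥ i j ≡ whirl-term e ⊥ i j +ᶻ Kterm e i j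
  wheel-rim e i j = cong (λ b → whirl-term e ⊥ i j +ᶻ ind b (Kterm e i j)) (⊆⇒⊑ {A = ⊥ {n}} {⊥} id)

  wheel-spokes : ∀ (e s : Bits) → s ⊑ ⊥ ≡ false → wheel-term e s ≈ whirl-term e s
  wheel-spokes e s h i j = trans (cong (λ b → whirl-term e s i j +ᶻ ind b (Kterm e i j)) h) (ℤₚ.+-identityʳ _)

  wheel-full : ∀ (e : Bits) → zerosV e ≡ 0 → wheel-term e ⊥ ≈ αs n′ (β 𝟏)
  wheel-full e z i j = trans (wheel-rim e i j) (trans (cong₂ _+ᶻ_ (whirl-full e z i j)
    (subst (λ k → αs (onesV e) (κ k) i j +ᶻ ind (k ≡ᵇ 0) (αs n′ (β 𝟏) i j) ≡ αs n′ (β 𝟏) i j) (sym z)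
        (trans (cong (_+ᶻ αs n′ (β 𝟏) i j) (Scalar.φ-𝟎 (αs-scalar (onesV e)) i j)) (ℤₚ.+-identityˡ _))))
    (ℤₚ.+-identityˡ _))

  -- The difference of traces is the one level step β at 0, and `κ 1` is -β. The weight must vanish
  -- because the rim is a circuit of the wheel, so the rim minus one edge is not closed.
  wheel-one : ∀ (e : Bits) → zerosV e ≡ 1 → wheel-term e ⊥ ≈ 𝟎
  wheel-one e z i j = trans (wheel-rim e i j) (trans (cong (_+ᶻ Kterm e i j) (whirl-pow e i j))
    (subst (λ k → (αs o (tr n (pow (J true) k)) i j - αs o (tr n (pow (J false) k)) i j) +ᶻ
        (αs o (κ k) i j +ᶻ ind (k ≡ᵇ 0) (αs n′ (β 𝟏) i j)) ≡ + 0) (sym z)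
      (trans (cong₂ (λ a b → (a - αs o (tr n (J false)) i j) +ᶻ (b +ᶻ + 0))
                (trans (φ-cong (tr-J n) i j) (φ-⊕ (tr n (J false)) (β 𝟏) i j))
                (trans (φ-cong {κ 1} {λ i j → - β 𝟏 i j}
                    (λ i j → cong -_ (trans (ℤₚ.+-identityʳ _) (ℤₚ.+-identityˡ (𝟏 i (predᶻ j))))) i j)
                    (αs-neg o (β 𝟏) i j)))
             (alg (αs o (tr n (J false)) i j) (αs o (β 𝟏) i j)))))
    where
    o = onesV e
    open Scalar (αs-scalar o)
    alg : ∀ x y → ((x +ᶻ y) - x) +ᶻ (- y +ᶻ + 0) ≡ + 0
    alg = solve-∀

  wheel-bad : ∀ (e s : Bits) → okW e s ≡ false → wheel-term e s ≈ 𝟎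
  wheel-bad e s bad i j = go (s ⊑ ⊥) refl
    where
    go : ∀ b → s ⊑ ⊥ ≡ b → wheel-term e s i j ≡ + 0
    go true  eq = true≢false (subst (λ z → okW e z ≡ true) (sym (⊑⊥⇒≡ s eq)) (okW-rim e)) bad
    go false eq = trans (wheel-spokes e s eq i j) (whirl-bad e s bad i j)

  -- Singles out the rim, the set whose rank in the wheel is one less than `cntW`.
  Full : Bits → Bits → Bool
  Full e s = (s ⊑ ⊥) ∧ (zerosV e ≡ᵇ 0)

  Kterm-low : ∀ (e : Bits) {z} → zerosV e ≡ suc z → Low (onesV e) (Kterm e)
  Kterm-low e {z} h i j lt = cong₂ _+ᶻ_ (subst (λ c → Low c (αs (onesV e) (κ (zerosV e))))
      (ℕₚ.+-identityʳ (onesV e)) (αs-low (onesV e) (κ-low (zerosV e))) i j lt)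
      (cong (λ k → ind (k ≡ᵇ 0) (αs n′ (β 𝟏) i j)) h)

  nonzero : ∀ (e s : Bits) → s ⊑ ⊥ ≡ true → Full e s ≡ false → ∃ λ z → zerosV e ≡ suc z
  nonzero e s a h rewrite a with zerosV e
  ... | suc z = z , refl

  wheel-low : ∀ (e s : Bits) → Full e s ≡ false → Low (cntW e s) (wheel-term e s)
  wheel-low e s nf i j lt = go (s ⊑ ⊥) refl
    where
    go : ∀ b → s ⊑ ⊥ ≡ b → wheel-term e s i j ≡ + 0
    go false eq = trans (wheel-spokes e s eq i j) (whirl-low e s i j lt)
    go true  eq = trans (cong (λ b → whirl-term e s i j +ᶻ ind b (Kterm e i j)) eq)
        (cong₂ _+ᶻ_ (whirl-low e s i j lt)
      (Kterm-low e (proj₂ (nonzero e s eq nf)) i j (subst (λ c → i <ᶻ + c)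
          (trans (cong (cntW e) (⊑⊥⇒≡ s eq)) (cntW-rim e)) lt)))

  αs-high : ∀ o {f : Bi} → (∀ i j → j ≤ᶻ i → f i j ≡ + 0) → ∀ i j → j +ᶻ + o ≤ᶻ i → αs o f i j ≡ + 0
  αs-high zero    h i j le = h i j (subst (_≤ᶻ i) (ℤₚ.+-identityʳ j) le)
  αs-high (suc o) h i j le = αs-high o h (predᶻ i) j
      (subst (_≤ᶻ predᶻ i) (eq j (+ o)) (ℤₚ.+-monoʳ-≤ (- + 1) le))
    where
    eq : ∀ j d → (- + 1) +ᶻ (j +ᶻ (+ 1 +ᶻ d)) ≡ j +ᶻ d
    eq = solve-∀

  wheel-high : ∀ (e s : Bits) → okW e s ≡ true → Full e s ≡ false → cntW e s < n → ∀ i j → j +ᶻ + cntW e s ≤ᶻ i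
      → wheel-term e s i j ≡ + 0
  wheel-high e s o nf lt i j le = go (s ⊑ ⊥) refl
    where
    go : ∀ b → s ⊑ ⊥ ≡ b → wheel-term e s i j ≡ + 0
    go false eq = trans (wheel-spokes e s eq i j) (whirl-high e s o lt i j le)
    go true  eq = by-zeros (zerosV e) refl
      where
      by-zeros : ∀ z → zerosV e ≡ z → wheel-term e s i j ≡ + 0
      by-zeros zero          z = true≢false {Full e s} (∧-true eq (cong (_≡ᵇ 0) z)) nf
      by-zeros (suc zero)    z = trans (cong (λ v → wheel-term e v i j) (⊑⊥⇒≡ s eq)) (wheel-one e z i j)
      by-zeros (suc (suc k)) z = trans (cong (λ b → whirl-term e s i j +ᶻ ind b (Kterm e i j)) eq)
          (cong₂ _+ᶻ_ (whirl-high e s o lt i j le)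
        (trans (cong (λ m → αs (onesV e) (κ m) i j +ᶻ ind (m ≡ᵇ 0) (αs n′ (β 𝟏) i j)) z)
        (trans (ℤₚ.+-identityʳ _) (αs-high (onesV e) (κ-high k) i j
            (subst (λ c → j +ᶻ + c ≤ᶻ i) (trans (cong (cntW e) (⊑⊥⇒≡ s eq)) (cntW-rim e)) le)))))

  wheel-full-low : ∀ (e : Bits) → zerosV e ≡ 0 → Low n′ (wheel-term e ⊥)
  wheel-full-low e z i j lt = trans (wheel-full e z i j)
      (subst (λ c → Low c (αs n′ (β 𝟏))) (ℕₚ.+-identityʳ n′) (αs-low n′ (λ i j → Low-𝟏 i (predᶻ j))) i j lt)

  wheel-full-high : ∀ (e : Bits) → zerosV e ≡ 0 → ∀ i j → j +ᶻ + n′ ≤ᶻ i → wheel-term e ⊥ i j ≡ + 0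
  wheel-full-high e z i j le = trans (wheel-full e z i j) (αs-high n′ β-high i j le)
    where
    β-high : ∀ i j → j ≤ᶻ i → β 𝟏 i j ≡ + 0
    β-high i j le = 𝟏-bnd i (predᶻ j) (ℤₚ.<-≤-trans
        (ℤₚ.+-monoˡ-< (+ 0) (ℤₚ.i≤pred[j]⇒i<j {predᶻ j} {j} ℤₚ.≤-refl))
        (subst (_≤ᶻ i) (sym (ℤₚ.+-identityʳ j)) le))

  run-ones : ∀ k x → run (word (⊤ {k}) ⊤) x 0 ≈ αs k (x 0)
  run-ones zero    x i j = refl
  run-ones (suc k) x i j = trans (run-ones k (αˢ (π true x)) i j) (Scalar.φ-α (αs-scalar k) (x 0) i j)

  whirl-⊤ : whirl-term (⊤ {n}) ⊤ ≈ αs n 𝟏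
  whirl-⊤ i j = trans (whirl-spokes ⊤ ⊤ refl i j) (trans (only-hub n) (run-ones n (at 0 𝟏) i j))
    where
    w = word (⊤ {n}) ⊤
    rest : ∀ h → run w (at (suc h) 𝟏) (suc h) i j ≡ + 0
    rest h = run-read true true (word (⊤ {n′}) ⊤) (suc h) i j
    only-hub : ∀ H → tr H (run w) i j ≡ run w (at 0 𝟏) 0 i j
    only-hub zero    = refl
    only-hub (suc H) = trans (cong₂ _+ᶻ_ (only-hub H) (rest H)) (ℤₚ.+-identityʳ _)

  wheel-⊤ : wheel-term (⊤ {n}) ⊤ ≈ αs n 𝟏
  wheel-⊤ i j = trans (wheel-spokes ⊤ ⊤ refl i j) (whirl-⊤ i j)

  SupW : (Bits → Bits → Bi) → Bits → Bits → Bi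
  SupW f e s i j = Sup e (λ e′ → Sup s (λ s′ → f e′ s′ i j))

  SymmetricUpTo : ℕ → Bi → Set
  SymmetricUpTo c f = ∃ λ p → Symmetric p × (f ≈ αs c p)

  whirl-sym : ∀ (e s : Bits) → okW e s ≡ true → SymmetricUpTo (cntW e s) (SupW whirl-term e s)
  whirl-sym e s o = go (s ⊑ ⊥) refl
    where
    go : ∀ b → s ⊑ ⊥ ≡ b → SymmetricUpTo (cntW e s) (SupW whirl-term e s)
    go true eq = pow 𝐒 (zerosV e) (at n 𝟏) n , pow-𝐒-symmetric (zerosV e)
        (at-symmetric n 𝟏-symmetric) n , λ i j →
      trans (Sup-whirl e s i j) (trans (cong (λ b → if b then runU true e (at n 𝟏) n i j else tr n
          (runG (word e s)) i j) eq)
      (trans (runU-pow true e (at n 𝟏) n i j) (cong (λ c → αs c (pow 𝐒 (zerosV e) (at n 𝟏) n) i j)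
          (sym (trans (cong (cntW e) (⊑⊥⇒≡ s eq)) (cntW-rim e))))))
    go false eq with cyclic-symmetric n (word e s) false
        (subst (λ b → okc (word e s) b ≡ true) (sym (nxt-word e s false)) o) (anyS-word e s eq)
        (ℕₚ.≤-reflexive (length-word e s))
    ... | p , sp , h = p , sp , λ i j → trans (Sup-whirl e s i j)
        (trans (cong (λ b → if b then runU true e (at n 𝟏) n i j else tr n (runG (word e s)) i j) eq)
          (trans (h i j) (cong (λ b → αs (cnt (word e s) b) p i j) (nxt-word e s false))))

  Sup-wheel : ∀ (e s : Bits) i j → SupW wheel-term e s i j ≡ SupW whirl-term e s i j +ᶻ ind (s ⊑ ⊥)
      (Sup e (λ e′ → Kterm e′ i j))
  Sup-wheel e s i j =
    trans (Sup-cong e (λ e′ → Sup-+ s (λ s′ → whirl-term e′ s′ i j) (λ s′ → ind (s′ ⊑ ⊥) (Kterm e′ i j))))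
    (trans (Sup-+ e (λ e′ → Sup s (λ s′ → whirl-term e′ s′ i j))
        (λ e′ → Sup s (λ s′ → ind (s′ ⊑ ⊥) (Kterm e′ i j))))
    (cong (SupW whirl-term e s i j +ᶻ_) (trans (Sup-cong e (λ e′ → Sup-⊥ s (Kterm e′ i j)))
        (Sup-ind e (s ⊑ ⊥) (λ e′ → Kterm e′ i j)))))

  wheel-sym : ∀ (e s : Bits) → okW e s ≡ true → Full e s ≡ false → SymmetricUpTo (cntW e s)
      (SupW wheel-term e s)
  wheel-sym e s o nf with whirl-sym e s o
  ... | p , sp , h = go (s ⊑ ⊥) refl
    where
    go : ∀ b → s ⊑ ⊥ ≡ b → SymmetricUpTo (cntW e s) (SupW wheel-term e s)
    go false eq = p , sp , λ i j → trans (Sup-wheel e s i j)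
        (trans (cong (λ b → SupW whirl-term e s i j +ᶻ ind b (Sup e (λ e′ → Kterm e′ i j))) eq)
        (trans (ℤₚ.+-identityʳ _) (h i j)))
    go true eq with nonzero e s eq nf
    ... | K , z = (λ i j → p i j - c i j) , (λ i j → cong₂ _-_ (sp i j) (csym i j)) , λ i j →
          trans (Sup-wheel e s i j)
          (trans (cong (λ b → SupW whirl-term e s i j +ᶻ ind b (Sup e (λ e′ → Kterm e′ i j))) eq)
          (trans (cong₂ _+ᶻ_ (h i j) (trans (Sup-Kterm e K z i j)
              (cong (λ o → - αs o c i j) (sym (trans (cong (cntW e) (⊑⊥⇒≡ s eq)) (cntW-rim e))))))
                 (minus (cntW e s) i j)))
      where
      c : Bi
      c = α (β (pow 𝐒 K (at 0 𝟏) 1))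
      csym : Symmetric c
      csym i j = pow-𝐒-symmetric K (at-symmetric 0 𝟏-symmetric) 1 (predᶻ i) (predᶻ j)
      minus : ∀ o i j → αs o p i j - αs o c i j ≡ αs o (λ i j → p i j - c i j) i j
      minus zero    i j = refl
      minus (suc o) i j = minus o (predᶻ i) j

  -- Above the rim lie only the rim, of weight α^n′ β, and the whole ground set, of weight α^(n′+1);
  -- together they give α^n′ (α + β).
  wheel-sym-full : ∀ (e : Bits) → zerosV e ≡ 0 → SymmetricUpTo n′ (SupW wheel-term e ⊥)
  wheel-sym-full e z = α 𝟏 ⊕ β 𝟏 , sym-αβ , λ i j →
    trans (Sup-wheel e ⊥ i j)
    (trans (cong (λ b → SupW whirl-term e ⊥ i j +ᶻ ind b (Sup e (λ e′ → Kterm e′ i j))) ⊥⊑)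
    (trans (cong₂ _+ᶻ_ (trans (Sup-whirl e ⊥ i j) (trans
        (cong (λ b → if b then runU true e (at n 𝟏) n i j else tr n (runG (word e ⊥)) i j) ⊥⊑)
                         (trans (runU-pow true e (at n 𝟏) n i j)
                             (trans (cong₂ (λ a b → αs a (pow 𝐒 b (at n 𝟏) n) i j) ones≡ z)
                             (Scalar.φ-cong (αs-scalar n) (at-diag n 𝟏) i j)))))
                       (Sup-Kterm-full e z i j))
    (trans (cong (_+ᶻ αs n′ (β 𝟏) i j) (sym (Scalar.φ-α (αs-scalar n′) 𝟏 i j)))
        (sym (Scalar.φ-⊕ (αs-scalar n′) (α 𝟏) (β 𝟏) i j)))))
    where
    ⊥⊑ = ⊆⇒⊑ {A = ⊥ {n}} {⊥} id
    ones≡ : onesV e ≡ n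
    ones≡ = trans (sym (ℕₚ.+-identityʳ _)) (trans (cong (_+_ (onesV e)) (sym z)) (ones+zeros e))
    sym-αβ : Symmetric (α 𝟏 ⊕ β 𝟏)
    sym-αβ i j = trans (cong₂ _+ᶻ_ (𝟏-symmetric (predᶻ i) j) (𝟏-symmetric i (predᶻ j)))
        (ℤₚ.+-comm (𝟏 j (predᶻ i)) _)

open CyclicWords

-- Wheels and whirls

++-∪ˡ : ∀ {a b} (e : Subset a) (s : Subset b) i → (e ∪ ⁅ i ⁆) ++ⱽ s ≡ (e ++ⱽ s) ∪ ⁅ i ↑ˡ b ⁆
++-∪ˡ (x ∷ e) s zero    = cong ((x ∨ true) ∷_) (trans (cong (_++ⱽ s) (Sₚ.∪-identityʳ e))
    (sym (Sₚ.∪-identityʳ (e ++ⱽ s))))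
++-∪ˡ (x ∷ e) s (suc i) = cong ((x ∨ false) ∷_) (++-∪ˡ e s i)

++-∪ʳ : ∀ {a b} (e : Subset a) (s : Subset b) i → e ++ⱽ (s ∪ ⁅ i ⁆) ≡ (e ++ⱽ s) ∪ ⁅ a ↑ʳ i ⁆
++-∪ʳ []      s i = refl
++-∪ʳ (x ∷ e) s i = cong₂ _∷_ (sym (𝔹ₚ.∨-identityʳ x)) (++-∪ʳ e s i)

replicate-++ : ∀ a {b} (x : Bool) → replicate a x ++ⱽ replicate b x ≡ replicate (a + b) x
replicate-++ zero    x = refl
replicate-++ (suc a) x = cong (x ∷_) (replicate-++ a x)

take-++ : ∀ {a b} (e : Subset a) (s : Subset b) → take a (e ++ⱽ s) ≡ e
take-++ []      s = refl
take-++ (x ∷ e) s = cong (x ∷_) (take-++ e s)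

drop-++ : ∀ {a b} (e : Subset a) (s : Subset b) → drop a (e ++ⱽ s) ≡ s
drop-++ []      s = refl
drop-++ (x ∷ e) s = drop-++ e s

↑-cover : ∀ a b (x : Fin (a + b)) → (∃ λ i → x ≡ i ↑ˡ b) ⊎ (∃ λ i → x ≡ a ↑ʳ i)
↑-cover zero    b x       = inj₂ (x , refl)
↑-cover (suc a) b zero    = inj₁ (zero , refl)
↑-cover (suc a) b (suc x) with ↑-cover a b x
... | inj₁ (i , refl) = inj₁ (suc i , refl)
... | inj₂ (i , refl) = inj₂ (i , refl)

RankFunction-≗ : ∀ {m} {r r′ : Subset m → ℕ} → (∀ A → r A ≡ r′ A) → RankFunction r′ → RankFunction r
RankFunction-≗ e R = record
  { bound  = λ A → subst (_≤ ∣ A ∣) (sym (e A)) (bound A)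
  ; mono   = λ {A} {B} h → subst₂ _≤_ (sym (e A)) (sym (e B)) (mono h)
  ; submod = λ A B → subst₂ _≤_ (cong₂ _+_ (sym (e (A ∪ B))) (sym (e (A ∩ B))))
      (cong₂ _+_ (sym (e A)) (sym (e B))) (submod A B) }
  where open RankFunction R

count-none : ∀ n {f} → (∀ p → p < n → f p ≡ false) → count f n ≡ 0
count-none zero    h = refl
count-none (suc n) h rewrite h n ℕₚ.≤-refl = count-none n (λ p lt → h p (ℕₚ.m≤n⇒m≤1+n lt))

count-every : ∀ n {f} → (∀ p → p < n → f p ≡ true) → count f n ≡ n
count-every zero    h = refl
count-every (suc n) h rewrite h n ℕₚ.≤-refl = cong suc (count-every n (λ p lt → h p (ℕₚ.m≤n⇒m≤1+n lt)))

zeros-none : ∀ {k} (e : Vec Bool k) → (∀ p → p < k → nth e p ≡ true) → zerosV e ≡ 0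
zeros-none []      h = refl
zeros-none (x ∷ e) h rewrite h 0 (s≤s z≤n) = zeros-none e (λ p lt → h (suc p) (s≤s lt))

zeros-one : ∀ {k} (e : Vec Bool k) p → p < k → nth e p ≡ false →
    (∀ q → q < k → q ≢ p → nth e q ≡ true) → zerosV e ≡ 1
zeros-one (x ∷ e) zero    lt h o rewrite h = cong suc (zeros-none e (λ q q< → o (suc q) (s≤s q<) (λ ())))
zeros-one (x ∷ e) (suc p) lt h o rewrite o 0 (s≤s z≤n) (λ ()) = zeros-one e p (ℕₚ.≤-pred lt) h
    (λ q q< q≢ → o (suc q) (s≤s q<) (λ eq → q≢ (ℕₚ.suc-injective eq)))

zerosV-⊥ : ∀ k → zerosV (⊥ {k}) ≡ k
zerosV-⊥ zero    = refl
zerosV-⊥ (suc k) = cong suc (zerosV-⊥ k)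

zerosV-⊤ : ∀ k → zerosV (⊤ {k}) ≡ 0
zerosV-⊤ zero    = refl
zerosV-⊤ (suc k) = zerosV-⊤ k

onesV-⊥ : ∀ k → onesV (⊥ {k}) ≡ 0
onesV-⊥ zero    = refl
onesV-⊥ (suc k) = onesV-⊥ k

module WheelGraph (n′ : ℕ) (1≤n′ : 1 ≤ n′) (ed : Fin (suc n′ + suc n′) → ℕ × ℕ)
  (ed-rim   : ∀ (i : Fin (suc n′)) → ed (i ↑ˡ suc n′) ≡ (suc (toℕ i) , suc (jx n′ (toℕ i))))
  (ed-spoke : ∀ (i : Fin (suc n′)) → ed (suc n′ ↑ʳ i) ≡ (0 , suc (toℕ i))) where

  private
    n = suc n′
    Bits = Vec Bool n

  mk : Bits → Bits → Subset (n + n)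
  mk s e = e ++ⱽ s

  open Spoked n′ n (n + n) ℕₚ.≤-refl (_↑ˡ n) (n ↑ʳ_) ed ed-rim ed-spoke (↑-cover n n) mk (replicate-++ n false)
    (λ s e i → ++-∪ˡ e s i) (λ s e i → ++-∪ʳ e s i) (λ s e i → Vₚ.lookup-++ˡ e s i)
        (λ s e i → Vₚ.lookup-++ʳ e s i) (inj₂ 1≤n′) public

  nthd-wrap : ∀ (s : Bits) p → p < n → nthd (nth s 0) s (suc p) ≡ nth s (jx n′ p)
  nthd-wrap s p p<n with p Data.Nat.≟ n′
  ... | yes refl rewrite ≡ᵇ-refl p = nthd-out (nth s 0) s (suc p) ℕₚ.≤-refl
  ... | no  p≢   rewrite ≡ᵇ-≢ p≢ = nthd-in (nth s 0) s (suc p) (s≤s (ℕₚ.≤∧≢⇒< (ℕₚ.≤-pred p<n) p≢))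

  triples⇒okW : ∀ s e → Triples s e → okW e s ≡ true
  triples⇒okW s e t = okc⁺ e s (nth s 0) (λ p p<n → trans (cong (ok (nth s p) (nth e p)) (nthd-wrap s p p<n))
      (t p p<n))

  okW⇒triples : ∀ s e → okW e s ≡ true → Triples s e
  okW⇒triples s e o p p<n = trans (cong (ok (nth s p) (nth e p)) (sym (nthd-wrap s p p<n)))
      (okc⁻ e s (nth s 0) o p p<n)

  cntW≡count : ∀ s e → cntW e s ≡ count (nth s) n + count (rimBit s e) n
  cntW≡count s@(_ ∷ _) e = ℕₚ.+-cancelʳ-≡ (bit (nth s 0)) _ _ (trans (cnt-count e s (nth s 0))
    (cong (λ c → (count (nth s) n + c) + bit (nth s 0))
        (count-cong n (λ p p<n → cong (λ b → nth e p ∧ not b) (nthd-wrap s p p<n)))))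

  last : Fin n
  last = fromℕ< (ℕₚ.≤-refl {n})

  ed-last : ed (last ↑ˡ n) ≡ (n , 1)
  ed-last = trans (ed-rim last) (cong₂ _,_ (cong suc t) (cong suc (trans (cong (jx n′) t) (jx-last n′))))
    where t = Finₚ.toℕ-fromℕ< (ℕₚ.≤-refl {n})

  spokes-along : ∀ s e → Triples s e → ∀ b → (∀ p → p < n′ → nth e p ≡ true) → nth s 0 ≡ b → ∀ p → p < n → nth s
      p ≡ b
  spokes-along s e t b h s0 zero    _  = s0
  spokes-along s e t b h s0 (suc p) lt = trans (sym
      (trans (triple-eq s e t (ℕₚ.<-trans ℕₚ.≤-refl lt) (h p (ℕₚ.≤-pred lt)))
      (cong (nth s) (jx-path (λ q → ℕₚ.<-irrefl q (ℕₚ.≤-pred lt))))))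
                                               (spokes-along s e t b h s0 p (ℕₚ.<-trans ℕₚ.≤-refl lt))

  path-conn : ∀ s e q → q < n → (∀ p → p < q → nth e p ≡ true) → Conn (mk s e) 1 (suc q)
  path-conn s e zero    lt h = stop
  path-conn s e (suc q) lt h = Conn-trans (path-conn s e q (ℕₚ.<-trans ℕₚ.≤-refl lt)
      (λ p p< → h p (ℕₚ.m≤n⇒m≤1+n p<)))
    (subst (λ z → Conn (mk s e) (suc q) (suc z)) (jx-path (λ eq → ℕₚ.<-irrefl eq (ℕₚ.≤-pred lt)))
        (rim-conn s e (ℕₚ.<-trans ℕₚ.≤-refl lt) (h q ℕₚ.≤-refl)))

  back : ∀ s e → Triples s e → ∀ p → p < n → nth e p ≡ true → nth s (jx n′ p) ≡ true → nth s p ≡ true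
  back s e t p p<n ep sj = trans (triple-eq s e t p<n ep) sj

  ρ-path : ∀ s e → Triples s e → ρ (mk s (firsts n′ e)) ≡ count (nth s) n + count (rimBit s e) n′
  ρ-path s e t = ρ-rims s e (back s e t) n′ (ℕₚ.n≤1+n n′) ℕₚ.≤-refl

  ρ-last-true : ∀ s e → nth e n′ ≡ true → ρ (mk s e) ≡ ρ (mk s (firsts n′ e)) + gain K (mk s (firsts n′ e))
      (last ↑ˡ n)
  ρ-last-true s e h = trans (cong (λ v → ρ (mk s v))
      (trans (sym (firsts-all e)) (firsts-suc-true n′ e ℕₚ.≤-refl h)))
    (trans (cong ρ (mk-last (firsts n′ e))) (ρ-add (mk s (firsts n′ e)) (last ↑ˡ n)))
    where
    mk-last : ∀ e → mk s (e ∪ ⁅ last ⁆) ≡ mk s e ∪ ⁅ last ↑ˡ n ⁆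
    mk-last e = ++-∪ˡ e s last

  full⇒Full : ∀ s e → (∀ p → p < n → nth e p ≡ true) → (∀ p → p < n → nth s p ≡ false) → Full e s ≡ true
  full⇒Full s e he hs = ∧-true (subst (λ v → v ⊑ ⊥ ≡ true) (sym (nth-all false s hs)) (⊆⇒⊑ {A = ⊥ {n}} {⊥} id))
      (cong (_≡ᵇ 0) (zeros-none e he))

  -- After `ρ-path` only the closing edge is in question. If position 0 is joined to the hub, so is
  -- the other end. Otherwise some rim edge `j` is missing, since the set is not the rim, and
  -- cutting after `j` separates the ends.
  rank-wheel : ∀ s e → Triples s e → Full e s ≡ false → ρ (mk s e) ≡ cntW e s
  rank-wheel s e t nf = trans (go (nth e n′) refl) (sym (cntW≡count s e))
    where
    c₀ = count (nth s) n
    A = mk s (firsts n′ e)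
    x = last ↑ˡ n
    arith : ∀ a b c → (a + b) + c ≡ a + (c + b)
    arith = solveℕ-∀
    go : ∀ b → nth e n′ ≡ b → ρ (mk s e) ≡ c₀ + (bit (rimBit s e n′) + count (rimBit s e) n′)
    go false h = trans (cong (λ v → ρ (mk s v)) (trans (sym (firsts-all e)) (firsts-suc-false n′ e h)))
        (trans (ρ-path s e t) (cong (λ b → c₀ + (bit (b ∧ not (nth s (jx n′ n′))) + count (rimBit s e) n′))
        (sym h)))
    go true  h = trans (ρ-last-true s e h) (trans (cong₂ _+_ (ρ-path s e t) (new (nth s 0) refl))
        (arith c₀ _ _))
      where
      bit≡ : ∀ {b} → nth s 0 ≡ b → bit (rimBit s e n′) ≡ bit (not b)
      bit≡ q = cong₂ (λ a b → bit (a ∧ not b)) h (trans (cong (nth s) (jx-last n′)) q)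
      new : ∀ b → nth s 0 ≡ b → gain K A x ≡ bit (rimBit s e n′)
      new true q = trans (gain-yes {A} {x} (subst₂ (Conn A) (sym (cong proj₁ ed-last))
          (sym (cong proj₂ ed-last))
          (Conn-trans (Conn-sym (spoke-conn s (firsts n′ e) ℕₚ.≤-refl
              (back s e t n′ ℕₚ.≤-refl h (trans (cong (nth s) (jx-last n′)) q))))
              (spoke-conn s (firsts n′ e) (s≤s z≤n) q)))) (sym (bit≡ q))
      new false q with search (nth e) (λ _ → true) n′
      ... | inj₁ every = true≢false (full⇒Full s e every′
          (spokes-along s e t false (λ p lt → every p lt refl) q)) nf
        where
        every′ : ∀ p → p < n → nth e p ≡ true
        every′ p lt with p Data.Nat.≟ n′
        ... | yes refl = h
        ... | no p≢    = every p (ℕₚ.≤∧≢⇒< (ℕₚ.≤-pred lt) p≢) refl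
      ... | inj₂ (j , j< , ej , _) = trans (gain-no {A} {x}
          (subst₂ (λ u v → ¬ Conn A u v) (sym (cong proj₁ ed-last)) (sym (cong proj₂ ed-last)) apart))
          (sym (bit≡ q))
        where
        apart : ¬ Conn A n 1
        apart = separate s (firsts n′ e) (interval s 0 (suc j))
          ((λ p p<n hp → let p<n′ , ep = nth-firsts n′ e p hp
                             jp = jx-path (λ eq → ℕₚ.<-irrefl eq p<n′) in
              trans (interval-path s {0} {suc j} {p} (λ ())
                  (λ eq → true≢false ep (subst (λ z → nth e z ≡ false) (sym (ℕₚ.suc-injective eq)) ej))
                  (trans (triple-eq s e t p<n ep) (cong (nth s) jp)))
                    (cong (λ z → interval s 0 (suc j) (suc z)) (sym jp))) ,
           interval-spokes s {0} {suc j})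
          (λ z → true≢false (trans z (interval-in s {0} {suc j} {0} z≤n (s≤s z≤n) q))
              (interval-above s {0} {suc j} {n′} j<))

  rank-full : ∀ e → zerosV e ≡ 0 → ρ (mk ⊥ e) ≡ n′
  rank-full e z = trans (ρ-last-true ⊥ e (filled n′ ℕₚ.≤-refl))
      (trans (cong₂ _+_ path (gain-yes {A} {last ↑ˡ n} around)) (ℕₚ.+-identityʳ n′))
    where
    A = mk ⊥ (firsts n′ e)
    filled : ∀ p → p < n → nth e p ≡ true
    filled p lt rewrite all-ones {n′} e z = nth-⊤ n p lt
    path : ρ A ≡ n′
    path = trans (ρ-path ⊥ e (okW⇒triples ⊥ e (okW-rim e)))
        (cong₂ _+_ (count-none n (λ p _ → nth-⊥ n p))
        (count-every n′ (λ p lt → ∧-true (filled p (ℕₚ.m≤n⇒m≤1+n lt)) (cong not (nth-⊥ n (jx n′ p))))))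
    around : Conn A (src (last ↑ˡ n)) (tgt (last ↑ˡ n))
    around = subst₂ (Conn A) (sym (cong proj₁ ed-last)) (sym (cong proj₂ ed-last))
        (Conn-sym (path-conn ⊥ (firsts n′ e) n′ ℕₚ.≤-refl
        (λ p lt → nth-firsts⁺ n′ e p lt (filled p (ℕₚ.m≤n⇒m≤1+n lt)))))

  -- A second missing rim edge would, with `p`, cut the rim into two arcs that are joined at most
  -- through the hub. If there is none, equality of spoke bits along present edges spreads from the
  -- two ends of `p` to every position.
  gap⇒exception : ∀ s e → Triples s e → ∀ p → p < n → Gap s e p → (∀ q → q < n → q ≢ p → nth e q ≡ true) ×
      (∀ q → q < n → nth s q ≡ false)
  gap⇒exception s e t p p<n (ep , sp , sj , c) with search (λ q → nth e q ∨ (q ≡ᵇ p)) (λ _ → true) n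
  ... | inj₂ (j , j<n , ej′ , _) = ⊥-elim (apart (ℕₚ.<-cmp j p))
    where
    ej : nth e j ≡ false
    ej with nth e j
    ... | false = refl
    j≢p : j ≢ p
    j≢p refl rewrite ≡ᵇ-refl j = true≢false (𝔹ₚ.∨-zeroʳ (nth e j)) ej′
    respects : ∀ lo hi → lo < hi → nth e lo ≡ false → nth e hi ≡ false → hi < n → Respects s e
        (interval s (suc lo) (suc hi))
    respects lo hi lo<hi el eh hi<n = rims , interval-spokes s {suc lo} {suc hi}
      where
      rims : ∀ q → q < n → nth e q ≡ true → interval s (suc lo) (suc hi) (suc q) ≡ interval s (suc lo) (suc hi)
          (suc (jx n′ q))
      rims q q<n eq with q Data.Nat.≟ n′
      ... | yes refl = trans (interval-above s {suc lo} {suc hi} {q}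
          (ℕₚ.≤∧≢⇒< (ℕₚ.≤-pred hi<n) (λ { refl → true≢false eq eh })))
          (sym (trans (cong (λ z → interval s (suc lo) (suc hi) (suc z)) (jx-last n′))
          (interval-below s {suc lo} {suc hi} {0} (s≤s z≤n))))
      ... | no q≢ = trans (interval-path s {suc lo} {suc hi} {q} (λ { refl → true≢false eq el })
          (λ { refl → true≢false eq eh }) (trans (triple-eq s e t q<n eq) (cong (nth s) (jx-path q≢))))
          (cong (λ z → interval s (suc lo) (suc hi) (suc z)) (sym (jx-path q≢)))
    apart : Tri (j < p) (j ≡ p) (p < j) → Empty
    apart (tri≈ _ j≡p _) = j≢p j≡p
    apart (tri< j<p _ _) = separate s e (interval s (suc j) (suc p)) (respects j p j<p ej ep p<n)
      (λ z → true≢false (trans (sym z) (interval-in s {suc j} {suc p} {p} j<p ℕₚ.≤-refl sp)) outside) c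
      where
      outside : interval s (suc j) (suc p) (suc (jx n′ p)) ≡ false
      outside with p Data.Nat.≟ n′
      ... | yes refl rewrite ≡ᵇ-refl p = interval-below s {suc j} {suc p} {0} (s≤s z≤n)
      ... | no p≢ rewrite ≡ᵇ-≢ p≢ = interval-above s {suc j} {suc p} {suc p} ℕₚ.≤-refl
    apart (tri> _ _ p<j) = separate s e (interval s (suc p) (suc j)) (respects p j p<j ep ej j<n)
      (λ z → true≢false (trans z inside) (interval-below s {suc p} {suc j} {p} ℕₚ.≤-refl)) c
      where
      jp : jx n′ p ≡ suc p
      jp = jx-path (λ eq → ℕₚ.<-irrefl eq (ℕₚ.<-≤-trans p<j (ℕₚ.≤-pred j<n)))
      inside : interval s (suc p) (suc j) (suc (jx n′ p)) ≡ true
      inside = trans (cong (λ z → interval s (suc p) (suc j) (suc z)) jp)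
          (interval-in s {suc p} {suc j} {suc p} ℕₚ.≤-refl (s≤s p<j) (subst (λ z → nth s z ≡ false) jp sj))
  ... | inj₁ every = others , empty
    where
    others : ∀ q → q < n → q ≢ p → nth e q ≡ true
    others q q<n q≢p = trans (sym (𝔹ₚ.∨-identityʳ (nth e q)))
        (trans (cong (nth e q ∨_) (sym (≡ᵇ-≢ q≢p))) (every q q<n refl))
    step-eq : ∀ q → q < n′ → q ≢ p → nth s q ≡ nth s (suc q)
    step-eq q q<n′ q≢p = trans (triple-eq s e t (ℕₚ.m≤n⇒m≤1+n q<n′) (others q (ℕₚ.m≤n⇒m≤1+n q<n′) q≢p))
        (cong (nth s) (jx-path (λ eq → ℕₚ.<-irrefl eq q<n′)))
    below : ∀ d q → q + d ≡ p → nth s q ≡ false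
    below zero    q eq = subst (λ z → nth s z ≡ false) (sym (trans (sym (ℕₚ.+-identityʳ q)) eq)) sp
    below (suc d) q eq = trans (step-eq q (ℕₚ.<-≤-trans q<p (ℕₚ.≤-pred p<n))
        (λ { refl → ℕₚ.<-irrefl refl q<p })) (below d (suc q) (trans (sym (ℕₚ.+-suc q d)) eq))
      where
      q<p : q < p
      q<p = subst (q <_) eq (subst (q <_) (sym (ℕₚ.+-suc q d)) (s≤s (ℕₚ.m≤m+n q d)))
    above : ∀ d → suc p + d < n → nth s (suc p + d) ≡ false
    above zero    lt = subst (λ z → nth s z ≡ false)
        (trans (jx-path (λ { refl → ℕₚ.<⇒≱ lt (s≤s (ℕₚ.m≤m+n p 0)) })) (sym (ℕₚ.+-identityʳ (suc p)))) sj
    above (suc d) lt = subst (λ z → nth s z ≡ false) (sym (ℕₚ.+-suc (suc p) d))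
      (trans (sym (step-eq (suc p + d) (ℕₚ.≤-pred lt′) (λ eq → ℕₚ.<-irrefl (sym eq) (s≤s (ℕₚ.m≤m+n p d)))))
          (above d (ℕₚ.<-trans ℕₚ.≤-refl lt′)))
      where
      lt′ : suc (suc p + d) < n
      lt′ = subst (_< n) (ℕₚ.+-suc (suc p) d) lt
    empty : ∀ q → q < n → nth s q ≡ false
    empty q q<n with q Data.Nat.≤? p
    ... | yes q≤p = below (p ∸ q) q (ℕₚ.m+[n∸m]≡n q≤p)
    ... | no q≰p = subst (λ z → nth s z ≡ false) (ℕₚ.m+[n∸m]≡n (ℕₚ.≰⇒> q≰p))
        (above (q ∸ suc p) (subst (_< n) (sym (ℕₚ.m+[n∸m]≡n (ℕₚ.≰⇒> q≰p))) q<n))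

  triples-⊤ : Triples ⊤ ⊤
  triples-⊤ p p<n rewrite nth-⊤ n p p<n | nth-⊤ n (jx n′ p) (jx-< p<n) = refl

  ρ-⊤ : ρ ⊤ ≡ n
  ρ-⊤ = trans (cong ρ (sym (replicate-++ n true))) (trans (rank-wheel ⊤ ⊤ triples-⊤ refl)
    (trans (cntW≡count ⊤ ⊤) (trans (cong₂ _+_ (count-every n (λ p lt → nth-⊤ n p lt))
        (count-none n (λ p lt → trans (cong (nth (⊤ {n}) p ∧_) (cong not (nth-⊤ n (jx n′ p) (jx-< lt))))
        (𝔹ₚ.∧-zeroʳ _)))) (ℕₚ.+-identityʳ n))))

  bits : ∀ {Q : Subset (n + n) → Set} → (∀ s e → Q (mk s e)) → ∀ F → Q F
  bits {Q} h F = subst Q (Vₚ.take++drop≡id n F) (h (drop n F) (take n F))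

∣++∣ : ∀ {a b} (e : Subset a) (s : Subset b) → ∣ e ++ⱽ s ∣ ≡ ∣ e ∣ + ∣ s ∣
∣++∣ []          s = refl
∣++∣ (true ∷ e)  s = cong suc (∣++∣ e s)
∣++∣ (false ∷ e) s = ∣++∣ e s

∣∪∣+∣∩∣ : ∀ {m} (A B : Subset m) → ∣ A ∪ B ∣ + ∣ A ∩ B ∣ ≡ ∣ A ∣ + ∣ B ∣
∣∪∣+∣∩∣ []          []          = refl
∣∪∣+∣∩∣ (true ∷ A)  (true ∷ B)  = cong suc (trans (ℕₚ.+-suc _ _)
    (trans (cong suc (∣∪∣+∣∩∣ A B)) (sym (ℕₚ.+-suc _ _))))
∣∪∣+∣∩∣ (true ∷ A)  (false ∷ B) = cong suc (∣∪∣+∣∩∣ A B)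
∣∪∣+∣∩∣ (false ∷ A) (true ∷ B)  = trans (cong suc (∣∪∣+∣∩∣ A B)) (sym (ℕₚ.+-suc _ _))
∣∪∣+∣∩∣ (false ∷ A) (false ∷ B) = ∣∪∣+∣∩∣ A B

==ˢ⇒≡ : ∀ {m} (A B : Subset m) → (A ==ˢ B) ≡ true → A ≡ B
==ˢ⇒≡ A B h = Sₚ.⊆-antisym (⊆ᵇ⇒⊆ (∧-trueˡ h)) (⊆ᵇ⇒⊆ (∧-trueʳ {A ⊆ᵇ B} h))

==ˢ-refl : ∀ {m} (A : Subset m) → (A ==ˢ A) ≡ true
==ˢ-refl A = ∧-true (⊆⇒⊆ᵇ {A = A} {A} id) (⊆⇒⊆ᵇ {A = A} {A} id)

==ˢ-≢ : ∀ {m} (A B : Subset m) → A ≢ B → (A ==ˢ B) ≡ false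
==ˢ-≢ A B h = ≢true⇒≡false (λ t → h (==ˢ⇒≡ A B t))

onesV≡∣∣ : ∀ {k} (e : Vec Bool k) → onesV e ≡ ∣ e ∣
onesV≡∣∣ []          = refl
onesV≡∣∣ (true ∷ e)  = cong suc (onesV≡∣∣ e)
onesV≡∣∣ (false ∷ e) = onesV≡∣∣ e

module WheelZ (n′ : ℕ) (1≤n′ : 1 ≤ n′) (ed : Fin (suc n′ + suc n′) → ℕ × ℕ)
  (ed-rim   : ∀ (i : Fin (suc n′)) → ed (i ↑ˡ suc n′) ≡ (suc (toℕ i) , suc (jx n′ (toℕ i))))
  (ed-spoke : ∀ (i : Fin (suc n′)) → ed (suc n′ ↑ʳ i) ≡ (0 , suc (toℕ i)))
  (P : Matroid → Poly) (kl : IsKL P) where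

  open WheelGraph n′ 1≤n′ ed ed-rim ed-spoke

  private
    n = suc n′
    Bits = Vec Bool n

  conn-if : ∀ {F} x → ρ (F ∪ ⁅ x ⁆) ≤ ρ F → Conn F (src x) (tgt x)
  conn-if {F} x h with K F x in eq
  ... | true  = K⇒Conn x eq
  ... | false = ⊥-elim (ℕₚ.<⇒≱ (subst (ρ F <_) (sym
      (trans (ρ-add F x) (trans (cong (λ b → ρ F + (if b then 0 else 1)) eq) (ℕₚ.+-comm (ρ F) 1)))) ℕₚ.≤-refl)
      h)

  exception : ∀ (s e : Bits) → Triples s e → ∀ x → x ∉ mk s e → Conn (mk s e) (src x)
      (tgt x) → s ≡ ⊥ × zerosV e ≡ 1 × mk s e ∪ ⁅ x ⁆ ≡ mk ⊥ ⊤
  exception s e t x x∉ c with triples⇒gap s e t x x∉ c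
  ... | i , refl , g with gap⇒exception s e t (toℕ i) (Finₚ.toℕ<n i) g
  ...   | others , empty = s≡ , zeros-one e (toℕ i) (Finₚ.toℕ<n i) (proj₁ g) others ,
          trans (sym (++-∪ˡ e s i)) (cong₂ _++ⱽ_ filled s≡)
    where
    s≡ : s ≡ ⊥
    s≡ = nth-all false s empty
    filled : e ∪ ⁅ i ⁆ ≡ ⊤
    filled = Sₚ.⊆-antisym Sₚ.⊆⊤ (λ {j} _ → case j Finₚ.≟ i of λ
      { (yes refl) → Sₚ.q⊆p∪q e ⁅ j ⁆ (Sₚ.x∈⁅x⁆ j)
      ; (no j≢i)   → Sₚ.p⊆p∪q ⁅ i ⁆ (lookup⇒∈ (trans (lookup-nth e j)
          (others (toℕ j) (Finₚ.toℕ<n j) (λ eq → j≢i (Finₚ.toℕ-injective eq))))) })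

  Full⇒ : ∀ (s e : Bits) → Full e s ≡ true → s ≡ ⊥ × zerosV e ≡ 0
  Full⇒ s e h = ⊑⊥⇒≡ s (∧-trueˡ h) , ≡ᵇ⇒≡ (∧-trueʳ {s ⊑ ⊥} h)

  Sup-mk : ∀ (f : Bits → Bits → Bi) s e i j → Sup (mk s e) (λ F → f (take n F) (drop n F) i j) ≡ SupW f e s i j
  Sup-mk f s e i j = trans (Sup-++ e s (λ F → f (take n F) (drop n F) i j))
      (Sup-cong e (λ e′ → Sup-cong s (λ s′ → cong₂ (λ a b → f a b i j) (take-++ e′ s′) (drop-++ e′ s′))))

  Sup-⊥-mk : ∀ (f : Bits → Bits → Bi) i j → Sup (⊥ {n + n}) (λ F → f (take n F) (drop n F) i j) ≡ SupW f ⊥ ⊥ i j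
  Sup-⊥-mk f i j = trans (cong (λ G → Sup G (λ F → f (take n F) (drop n F) i j))
      (sym (replicate-++ n {n} false))) (Sup-mk f ⊥ ⊥ i j)

  whirl-value : ∀ k → SupW whirl-term (⊥ {n}) ⊥ (+ k) (+ n - + k) ≡ Γ n (+ k) (+ n - + k)
  whirl-value k = trans (Sup-whirl (⊥ {n}) ⊥ (+ k) (+ n - + k))
    (trans (cong (λ b → if b then runU true (⊥ {n}) (at n 𝟏) n (+ k) (+ n - + k) else tr n
        (runG (word (⊥ {n}) ⊥)) (+ k) (+ n - + k)) (⊆⇒⊑ {A = ⊥ {n}} {⊥} id))
    (trans (runU-pow true (⊥ {n}) (at n 𝟏) n (+ k) (+ n - + k))
    (trans (cong₂ (λ a b → αs a (pow 𝐒 b (at n 𝟏) n) (+ k) (+ n - + k)) (onesV-⊥ n) (zerosV-⊥ n))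
           (walk-high n (+ k) (+ n - + k) (alg (+ n) (+ k))))))
    where
    alg : ∀ n k → k +ᶻ (n - k) ≡ n
    alg = solve-∀

  module Wheel where
    r : Subset (n + n) → ℕ
    r = rkFromIndep forest

    R : RankFunction r
    R = RankFunction-≗ rank≡ρ ρ-rankFunction

    loopless : ∀ e → r ⁅ e ⁆ ≡ 1
    loopless e = trans (rank≡ρ ⁅ e ⁆) (ρ-loopless e)

    open Contractions r R loopless

    term : Subset (n + n) → Bi
    term F = wheel-term (take n F) (drop n F)

    term-mk : ∀ (s e : Bits) → term (mk s e) ≡ wheel-term e s
    term-mk s e = cong₂ wheel-term (take-++ e s) (drop-++ e s)

    r-⊤ : r ⊤ ≡ n
    r-⊤ = trans (rank≡ρ ⊤) ρ-⊤

    triples : ∀ (s e : Bits) → Flat (mk s e) → Triples s e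
    triples s e f = closed⇒triples s e (flat⇒closed (λ x x∉ → subst₂ _<_ (rank≡ρ _) (rank≡ρ _) (f x x∉)))

    rank-of : ∀ (s e : Bits) → Flat (mk s e) → Full e s ≡ false → r (mk s e) ≡ cntW e s
    rank-of s e f nf = trans (rank≡ρ (mk s e)) (rank-wheel s e (triples s e f) nf)

    rank-of-full : ∀ (s e : Bits) → Full e s ≡ true → r (mk s e) ≡ n′
    rank-of-full s e h = trans (rank≡ρ (mk s e)) (trans (cong (λ v → ρ (mk v e)) (proj₁ (Full⇒ s e h)))
        (rank-full e (proj₂ (Full⇒ s e h))))

    -- The triangle condition overlooks only the rim minus one edge, whose weight is 0 by
    -- `wheel-one`.
    t-bad : ∀ F → fl F ≡ false → term F ≈ 𝟎
    t-bad = bits λ s e h i j → trans (cong (λ f → f i j) (term-mk s e)) (go s e h i j (okW e s) refl)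
      where
      go : ∀ (s e : Bits) → fl (mk s e) ≡ false → ∀ i j b → okW e s ≡ b → wheel-term e s i j ≡ + 0
      go s e h i j false o = wheel-bad e s o i j
      go s e h i j true  o = found (isFlat-false M₀ (mk s e) Sₚ.⊆⊤ h)
        where
        found : (∃ λ x → x ∈ ⊤ × x ∉ mk s e × r (mk s e ∪ ⁅ x ⁆) ≤ r (mk s e)) → wheel-term e s i j ≡ + 0
        found (x , _ , x∉ , le) =
          let s≡ , z , _ = exception s e (okW⇒triples s e o) x x∉ (conn-if x (subst₂ _≤_ (rank≡ρ _) (rank≡ρ _) le))
          in trans (cong (λ v → wheel-term e v i j) s≡) (wheel-one e z i j)

    t-low : ∀ F → Flat F → Low (r F) (term F)
    t-low = bits λ s e f → subst (Low (r (mk s e))) (sym (term-mk s e)) (go s e f (Full e s) refl)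
      where
      go : ∀ (s e : Bits) → Flat (mk s e) → ∀ b → Full e s ≡ b → Low (r (mk s e)) (wheel-term e s)
      go s e f false nf = subst (λ c → Low c (wheel-term e s)) (sym (rank-of s e f nf)) (wheel-low e s nf)
      go s e f true  h = subst₂ (λ c v → Low c (wheel-term e v)) (sym (rank-of-full s e h))
          (sym (proj₁ (Full⇒ s e h))) (wheel-full-low e (proj₂ (Full⇒ s e h)))

    t-high : ∀ F → Flat F → 0 < co F → ∀ i j → j +ᶻ + r F ≤ᶻ i → term F i j ≡ + 0
    t-high = bits λ s e f pos i j le → trans (cong (λ g → g i j) (term-mk s e))
        (go s e f pos i j le (Full e s) refl)
      where
      go : ∀ (s e : Bits) → Flat (mk s e) → 0 < co (mk s e) → ∀ i j → j +ᶻ + r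
          (mk s e) ≤ᶻ i → ∀ b → Full e s ≡ b → wheel-term e s i j ≡ + 0
      go s e f pos i j le false nf = wheel-high e s (triples⇒okW s e (triples s e f)) nf
        (subst₂ _<_ (rank-of s e f nf) r-⊤ (ℕₚ.m∸n≢0⇒n<m (λ z → ℕₚ.<-irrefl (sym z) pos))) i j
            (subst (λ c → j +ᶻ + c ≤ᶻ i) (rank-of s e f nf) le)
      go s e f pos i j le true h = trans (cong (λ v → wheel-term e v i j) (proj₁ (Full⇒ s e h)))
        (wheel-full-high e (proj₂ (Full⇒ s e h)) i j (subst (λ c → j +ᶻ + c ≤ᶻ i) (rank-of-full s e h) le))

    t-⊤ : term ⊤ ≈ αs (r ⊤) 𝟏
    t-⊤ i j = trans (cong (λ F → term F i j) (sym (replicate-++ n {n} true)))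
        (trans (cong (λ f → f i j) (term-mk ⊤ ⊤)) (trans (wheel-⊤ {n′} i j)
        (cong (λ c → αs c 𝟏 i j) (sym r-⊤))))

    t-sym : ∀ G → Flat G → ∃ λ p → Symmetric p × (∀ i j → Sup G (λ F → term F i j) ≡ αs (r G) p i j)
    t-sym = bits λ s e f → go s e f (Full e s) refl
      where
      conclude : ∀ (s e : Bits) c → r (mk s e) ≡ c → SymmetricUpTo {n′} c
          (SupW wheel-term e s) → ∃ λ p → Symmetric p ×
          (∀ i j → Sup (mk s e) (λ F → term F i j) ≡ αs (r (mk s e)) p i j)
      conclude s e c eq (p , sp , h) = p , sp , λ i j → trans (Sup-mk wheel-term s e i j)
          (trans (h i j) (cong (λ z → αs z p i j) (sym eq)))
      go : ∀ (s e : Bits) → Flat (mk s e) → ∀ b → Full e s ≡ b → ∃ λ p → Symmetric p ×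
          (∀ i j → Sup (mk s e) (λ F → term F i j) ≡ αs (r (mk s e)) p i j)
      go s e f false nf = conclude s e (cntW e s) (rank-of s e f nf)
          (wheel-sym e s (triples⇒okW s e (triples s e f)) nf)
      go s e f true  h = conclude s e n′ (rank-of-full s e h)
          (subst (λ v → SymmetricUpTo {n′} n′ (SupW wheel-term e v)) (sym (proj₁ (Full⇒ s e h)))
          (wheel-sym-full e (proj₂ (Full⇒ s e h))))

    Z-wheel : ∀ k → Z P M₀ k ≡ Γ n (+ k) (+ n - + k) - Λ n′ (predᶻ (+ k)) (predᶻ (+ n - + k))
    Z-wheel k = trans (Assembly.Z-formula r R loopless P kl term t-bad t-low t-high t-⊤ t-sym k)
      (trans (cong (λ N → Sup (⊥ {n + n}) (λ F → term F (+ k) (+ N - + k))) r-⊤)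
      (trans (Sup-⊥-mk wheel-term (+ k) (+ n - + k))
      (trans (Sup-wheel {n′} ⊥ ⊥ (+ k) (+ n - + k))
      (cong₂ _+ᶻ_ (whirl-value k)
        (trans (cong (λ b → ind b (Sup (⊥ {n}) (λ e′ → Kterm e′ (+ k) (+ n - + k)))) (⊆⇒⊑ {A = ⊥ {n}} {⊥} id))
        (trans (Sup-Kterm (⊥ {n}) n′ (zerosV-⊥ n) (+ k) (+ n - + k))
        (cong -_ (trans (cong (λ o → αs o (α (β (pow 𝐒 n′ (at 0 𝟏) 1))) (+ k) (+ n - + k)) (onesV-⊥ n))
                        (walk-from-0 n′ 1 (predᶻ (+ k)) (predᶻ (+ n - + k)) (alg (+ n′) (+ k)))))))))))
      where
      alg : ∀ n k → ((- + 1 +ᶻ k) +ᶻ (- + 1 +ᶻ ((+ 1 +ᶻ n) - k))) +ᶻ + 1 ≡ n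
      alg = solve-∀

  module Whirl where
    Rim : Subset (n + n)
    Rim = mk ⊥ ⊤

    isRim : Subset (n + n) → Bool
    isRim A = A ==ˢ Rim

    ∣Rim∣ : ∣ Rim ∣ ≡ n
    ∣Rim∣ = trans (∣++∣ (⊤ {n}) ⊥) (trans (cong₂ _+_ (Sₚ.∣⊤∣≡n n) (Sₚ.∣⊥∣≡0 n)) (ℕₚ.+-identityʳ n))

    ρ-Rim : ρ Rim ≡ n′
    ρ-Rim = rank-full ⊤ (zerosV-⊤ n)

    Rim-closed : Closed Rim
    Rim-closed x x∉ c = let i , _ , ep , _ = triples⇒gap ⊥ ⊤ (okW⇒triples ⊥ ⊤ (okW-rim {n′} ⊤)) x x∉ c
                        in true≢false (nth-⊤ n (toℕ i) (Finₚ.toℕ<n i)) ep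

    above-Rim : ∀ {A} → Rim ⊆ A → A ≢ Rim → n ≤ ρ A
    above-Rim {A} h ne with Finₚ.any? (λ x → (x Sₚ.∈? A) ×-dec (¬? (x Sₚ.∈? Rim)))
    ... | yes (x , x∈A , x∉) = ℕₚ.≤-trans (ℕₚ.≤-reflexive
        (sym (trans (ρ-add Rim x) (trans (cong₂ _+_ ρ-Rim (gain-no (Rim-closed x x∉))) (ℕₚ.+-comm n′ 1)))))
                                          (RankFunction.mono ρ-rankFunction λ y → Data.Sum.[ h ,
                                              (λ z → subst (_∈ A) (sym (Sₚ.x∈⁅y⁆⇒x≡y x z)) x∈A) ]′
                                              (Sₚ.x∈p∪q⁻ Rim ⁅ x ⁆ y))
    ... | no none = ⊥-elim (ne (Sₚ.⊆-antisym (λ {x} x∈A → case x Sₚ.∈? Rim of λ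
        { (yes p) → p ; (no ¬p) → ⊥-elim (none (x , x∈A , ¬p)) }) h))

    -- The rim is a circuit of the wheel, so its proper subsets are independent.
    below-Rim : ∀ A → A ⊆ Rim → A ≢ Rim → ρ A ≡ ∣ A ∣
    below-Rim = bits go
      where
      go : ∀ (s e : Bits) → mk s e ⊆ Rim → mk s e ≢ Rim → ρ (mk s e) ≡ ∣ mk s e ∣
      go s e h ne = trans (cong (λ v → ρ (mk v e)) s≡) (trans (rank-wheel ⊥ e (okW⇒triples ⊥ e (okW-rim e)) nf)
        (trans (cntW-rim e) (trans (onesV≡∣∣ e) (sym
            (trans (∣++∣ e s) (trans (cong (_+_ ∣ e ∣) (trans (cong ∣_∣ s≡) (Sₚ.∣⊥∣≡0 n)))
            (ℕₚ.+-identityʳ _)))))))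
        where
        s≡ : s ≡ ⊥
        s≡ = Sₚ.⊆-antisym (λ {i} i∈s → ⊥-elim (true≢false
            (∈⇒lookup (h (lookup⇒∈ (trans (Vₚ.lookup-++ʳ e s i) (∈⇒lookup i∈s)))))
            (trans (Vₚ.lookup-++ʳ (⊤ {n}) ⊥ i) (∉⇒lookup {A = ⊥ {n}} {i} Sₚ.∉⊥)))) Sₚ.⊥⊆
        nf : Full e ⊥ ≡ false
        nf = ≢true⇒≡false (λ t → ne (cong₂ _++ⱽ_ (all-ones {n′} e (proj₂ (Full⇒ ⊥ e t))) s≡))

    -- Relaxation of a circuit-hyperplane: the rank of the rim goes up by 1 and all other ranks
    -- stay.
    σ : Subset (n + n) → ℕ
    σ A = ρ A + bit (isRim A)

    σ-Rim : ∀ A → A ≡ Rim → σ A ≡ n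
    σ-Rim A e = trans (cong₂ (λ a b → a + bit b) (trans (cong ρ e) ρ-Rim) (trans (cong isRim e) (==ˢ-refl Rim)))
        (ℕₚ.+-comm n′ 1)

    σ-other : ∀ A → A ≢ Rim → σ A ≡ ρ A
    σ-other A ne = trans (cong (λ b → ρ A + bit b) (==ˢ-≢ A Rim ne)) (ℕₚ.+-identityʳ _)

    Rim? : ∀ A → A ≡ Rim ⊎ A ≢ Rim
    Rim? A with isRim A in eq
    ... | true  = inj₁ (==ˢ⇒≡ A Rim eq)
    ... | false = inj₂ (λ e → true≢false (trans (cong isRim e) (==ˢ-refl Rim)) eq)

    σ≤n : ∀ A → σ A ≤ n
    σ≤n A with Rim? A
    ... | inj₁ e  = ℕₚ.≤-reflexive (σ-Rim A e)
    ... | inj₂ ne = ℕₚ.≤-trans (ℕₚ.≤-reflexive (σ-other A ne))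
        (ℕₚ.≤-trans (RankFunction.mono ρ-rankFunction {A} {⊤} Sₚ.⊆⊤) (ℕₚ.≤-reflexive ρ-⊤))

    ρ≤σ : ∀ A → ρ A ≤ σ A
    ρ≤σ A = ℕₚ.m≤m+n (ρ A) _

    σ-rankFunction : RankFunction σ
    σ-rankFunction = record { bound = bound′ ; mono = mono′ ; submod = submod′ }
      where
      open RankFunction ρ-rankFunction
      bound′ : ∀ A → σ A ≤ ∣ A ∣
      bound′ A with Rim? A
      ... | inj₁ e  = ℕₚ.≤-reflexive (trans (σ-Rim A e) (sym (trans (cong ∣_∣ e) ∣Rim∣)))
      ... | inj₂ ne = subst (_≤ ∣ A ∣) (sym (σ-other A ne)) (bound A)
      mono′ : ∀ {A B} → A ⊆ B → σ A ≤ σ B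
      mono′ {A} {B} h with Rim? A | Rim? B
      ... | inj₂ a | _      = ℕₚ.≤-trans (ℕₚ.≤-reflexive (σ-other A a)) (ℕₚ.≤-trans (mono {A} {B} h) (ρ≤σ B))
      ... | inj₁ a | inj₁ b = ℕₚ.≤-reflexive (cong σ (trans a (sym b)))
      ... | inj₁ a | inj₂ b = ℕₚ.≤-trans (σ≤n A) (ℕₚ.≤-trans
          (above-Rim {B} (λ x → h (subst (_ ∈_) (sym a) x)) b) (ρ≤σ B))
      submod′ : ∀ A B → σ (A ∪ B) + σ (A ∩ B) ≤ σ A + σ B
      submod′ A B = go (isRim (A ∪ B)) (isRim (A ∩ B)) (isRim A) (isRim B) refl refl refl refl
        where
        ρ∪ = ρ (A ∪ B)
        ρ∩ = ρ (A ∩ B)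
        isRim⇒≢ : ∀ X → isRim X ≡ false → X ≢ Rim
        isRim⇒≢ X h e = true≢false (trans (cong isRim e) (==ˢ-refl Rim)) h
        shuffle : ∀ x y z w → (x + y) + (z + w) ≡ (x + z) + (y + w)
        shuffle = solveℕ-∀
        add : ∀ u i a b → bit u + bit i ≤ bit a + bit b → (ρ∪ + bit u) + (ρ∩ + bit i) ≤ (ρ A + bit a) +
            (ρ B + bit b)
        add u i a b h = subst₂ _≤_ (sym (shuffle ρ∪ (bit u) ρ∩ (bit i)))
            (sym (shuffle (ρ A) (bit a) (ρ B) (bit b))) (ℕₚ.+-mono-≤ (submod A B) h)
        go : ∀ u i a b → isRim (A ∪ B) ≡ u → isRim (A ∩ B) ≡ i → isRim A ≡ a → isRim B ≡ b →
             (ρ∪ + bit u) + (ρ∩ + bit i) ≤ (ρ A + bit a) + (ρ B + bit b)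
        go false false a     b     _ _ _ _ = add false false a b z≤n
        go true  false true  b     _ _ _ _ = add true false true b (s≤s z≤n)
        go true  false false true  _ _ _ _ = add true false false true (s≤s z≤n)
        go false true  true  b     _ _ _ _ = add false true true b (s≤s z≤n)
        go false true  false true  _ _ _ _ = add false true false true (s≤s z≤n)
        go true  true  true  true  _ _ _ _ = add true true true true ℕₚ.≤-refl
        go true  true  false b     p q x _ = ⊥-elim
            (isRim⇒≢ A x (Sₚ.⊆-antisym (λ y → subst (_ ∈_) (==ˢ⇒≡ (A ∪ B) Rim p) (Sₚ.p⊆p∪q B y))
            (λ y → Sₚ.p∩q⊆p A B (subst (_ ∈_) (sym (==ˢ⇒≡ (A ∩ B) Rim q)) y))))
        go true  true  true  false p q _ x = ⊥-elim
            (isRim⇒≢ B x (Sₚ.⊆-antisym (λ y → subst (_ ∈_) (==ˢ⇒≡ (A ∪ B) Rim p) (Sₚ.q⊆p∪q A B y))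
            (λ y → Sₚ.p∩q⊆q A B (subst (_ ∈_) (sym (==ˢ⇒≡ (A ∩ B) Rim q)) y))))
        -- Both sets are proper subsets of a circuit, hence independent, and cardinality is modular;
        -- this absorbs the extra 1 of the union.
        go true  false false false p q x y = begin
            (ρ∪ + 1) + (ρ∩ + 0)      ≡⟨ cong₂ _+_ (trans (cong (λ X → ρ X + 1) u≡)
                (trans (cong (λ c → c + 1) ρ-Rim) (trans (ℕₚ.+-comm n′ 1) (sym (trans (cong ∣_∣ u≡) ∣Rim∣)))))
                (ℕₚ.+-identityʳ ρ∩) ⟩
            ∣ A ∪ B ∣ + ρ∩           ≤⟨ ℕₚ.+-monoʳ-≤ ∣ A ∪ B ∣ (bound (A ∩ B)) ⟩
            ∣ A ∪ B ∣ + ∣ A ∩ B ∣    ≡⟨ ∣∪∣+∣∩∣ A B ⟩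
            ∣ A ∣ + ∣ B ∣            ≡⟨ sym (cong₂ _+_
                (trans (ℕₚ.+-identityʳ _) (below-Rim A (λ z → subst (_ ∈_) u≡ (Sₚ.p⊆p∪q B z)) (isRim⇒≢ A x)))
                (trans (ℕₚ.+-identityʳ _) (below-Rim B (λ z → subst (_ ∈_) u≡ (Sₚ.q⊆p∪q A B z)) (isRim⇒≢ B y))))
                ⟩
            (ρ A + 0) + (ρ B + 0)    ∎
          where
          open ℕₚ.≤-Reasoning
          u≡ = ==ˢ⇒≡ (A ∪ B) Rim p
        -- Both sets properly contain a hyperplane, so both have full rank and bound the two terms
        -- on the left separately.
        go false true  false false p q x y = ℕₚ.+-mono-≤
            (ℕₚ.≤-trans (ℕₚ.≤-reflexive (ℕₚ.+-identityʳ _))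
                (ℕₚ.≤-trans (mono {A ∪ B} {⊤} Sₚ.⊆⊤)
                (ℕₚ.≤-trans (ℕₚ.≤-reflexive ρ-⊤) (ℕₚ.≤-trans
                (above-Rim {A} (λ z → Sₚ.p∩q⊆p A B (subst (_ ∈_) (sym i≡) z)) (isRim⇒≢ A x)) (ℕₚ.m≤m+n _ 0)))))
            (ℕₚ.≤-trans (ℕₚ.≤-reflexive (trans (cong (λ X → ρ X + 1) i≡)
                (trans (cong (λ c → c + 1) ρ-Rim) (ℕₚ.+-comm n′ 1))))
                (ℕₚ.≤-trans (above-Rim {B} (λ z → Sₚ.p∩q⊆q A B (subst (_ ∈_) (sym i≡) z)) (isRim⇒≢ B y))
                (ℕₚ.m≤m+n _ 0)))
          where
          i≡ = ==ˢ⇒≡ (A ∩ B) Rim q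

    indep : Subset (n + n) → Bool
    indep A = forest A ∨ (A ==ˢ Rim)

    r : Subset (n + n) → ℕ
    r = rkFromIndep indep

    r≡σ : ∀ A → r A ≡ σ A
    r≡σ A = rkFromIndep-unique indep A up low
      where
      ∨-true : ∀ {a b} → a ∨ b ≡ true → a ≡ true ⊎ b ≡ true
      ∨-true {true}  h = inj₁ refl
      ∨-true {false} h = inj₂ h
      up : ∀ B → B ⊆ A → indep B ≡ true → ∣ B ∣ ≤ σ A
      up B h i with ∨-true {forest B} i
      ... | inj₁ f = ℕₚ.≤-trans (ℕₚ.≤-reflexive (sym
          (ρ-independent ∣ B ∣ B ℕₚ.≤-refl (forest-independent B f))))
          (ℕₚ.≤-trans (RankFunction.mono ρ-rankFunction {B} {A} h) (ρ≤σ A))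
      ... | inj₂ e = ℕₚ.≤-trans (ℕₚ.≤-reflexive (trans (cong ∣_∣ (==ˢ⇒≡ B Rim e))
          (trans ∣Rim∣ (sym (σ-Rim B (==ˢ⇒≡ B Rim e)))))) (RankFunction.mono σ-rankFunction {B} {A} h)
      choice : (A ≡ Rim ⊎ A ≢ Rim) → (∃ λ B → B ⊆ A × forest B ≡ true × ∣ B ∣ ≡ ρ A) → ∃ λ B → B ⊆ A × indep B ≡
          true × ∣ B ∣ ≡ σ A
      choice (inj₁ e)  _ = A , id , trans (cong (forest A ∨_) (trans (cong isRim e) (==ˢ-refl Rim)))
          (𝔹ₚ.∨-zeroʳ _) , trans (cong ∣_∣ e) (trans ∣Rim∣ (sym (σ-Rim A e)))
      choice (inj₂ ne) (B , B⊆A , f , c) = B , B⊆A , cong (_∨ (B ==ˢ Rim)) f , trans c (sym (σ-other A ne))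
      low : ∃ λ B → B ⊆ A × indep B ≡ true × ∣ B ∣ ≡ σ A
      low = choice (Rim? A) (ρ-basis forest forest-dependent forest-independent ∣ A ∣ A ℕₚ.≤-refl)

    R : RankFunction r
    R = RankFunction-≗ r≡σ σ-rankFunction

    loopless : ∀ e → r ⁅ e ⁆ ≡ 1
    loopless e = trans (r≡σ ⁅ e ⁆) (trans (σ-other ⁅ e ⁆
        (λ q → ℕₚ.<-irrefl (trans (sym (Sₚ.∣⁅x⁆∣≡1 e)) (trans (cong ∣_∣ q) ∣Rim∣)) (s≤s 1≤n′))) (ρ-loopless e))

    open Contractions r R loopless

    term : Subset (n + n) → Bi
    term F = whirl-term (take n F) (drop n F)

    term-mk : ∀ (s e : Bits) → term (mk s e) ≡ whirl-term e s
    term-mk s e = cong₂ whirl-term (take-++ e s) (drop-++ e s)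

    spoke₀ : Fin (n + n)
    spoke₀ = n ↑ʳ zero

    spoke∉Rim : ∀ i → (n ↑ʳ i) ∉ Rim
    spoke∉Rim i = lookup⇒∉ (trans (Vₚ.lookup-++ʳ (⊤ {n}) ⊥ i) (∉⇒lookup {A = ⊥ {n}} {i} Sₚ.∉⊥))

    flat⇒≢Rim : ∀ F → Flat F → F ≢ Rim
    flat⇒≢Rim F f e = ℕₚ.<⇒≱ (f spoke₀ (λ x → spoke∉Rim zero (subst (spoke₀ ∈_) e x)))
      (subst₂ _≤_ (sym (r≡σ (F ∪ ⁅ spoke₀ ⁆))) (sym (trans (r≡σ F) (σ-Rim F e))) (σ≤n (F ∪ ⁅ spoke₀ ⁆)))

    ⊤≢Rim : ⊤ ≢ Rim
    ⊤≢Rim e = spoke∉Rim zero (subst (spoke₀ ∈_) e Sₚ.∈⊤)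

    r-⊤ : r ⊤ ≡ n
    r-⊤ = trans (r≡σ ⊤) (trans (σ-other ⊤ ⊤≢Rim) ρ-⊤)

    spoke-in : ∀ (s : Bits) → s ⊑ ⊥ ≡ false → ∃ λ i → i ∈ s
    spoke-in s h with Sₚ.nonempty? s
    ... | yes p = p
    ... | no ¬p = true≢false (subst (λ v → v ⊑ ⊥ ≡ true) (sym (Sₚ.Empty-unique ¬p)) (⊆⇒⊑ {A = ⊥ {n}} {⊥} id)) h

    triples : ∀ (s e : Bits) → Flat (mk s e) → Triples s e
    triples s e f = go (s ⊑ ⊥) refl
      where
      F≢ = flat⇒≢Rim (mk s e) f
      go : ∀ b → s ⊑ ⊥ ≡ b → Triples s e
      go true  h = okW⇒triples s e (subst (λ v → okW e v ≡ true) (sym (⊑⊥⇒≡ s h)) (okW-rim e))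
      go false h = closed⇒triples s e (flat⇒closed λ x x∉ → subst₂ _<_
          (trans (r≡σ (mk s e)) (σ-other (mk s e) F≢))
          (trans (r≡σ (mk s e ∪ ⁅ x ⁆)) (σ-other (mk s e ∪ ⁅ x ⁆) (F+x≢ x))) (f x x∉))
        where
        i = proj₁ (spoke-in s h)
        F+x≢ : ∀ x → mk s e ∪ ⁅ x ⁆ ≢ Rim
        F+x≢ x q = spoke∉Rim i (subst ((n ↑ʳ i) ∈_) q
            (Sₚ.p⊆p∪q ⁅ x ⁆ (lookup⇒∈ (trans (Vₚ.lookup-++ʳ e s i) (∈⇒lookup (proj₂ (spoke-in s h)))))))

    rank-of : ∀ (s e : Bits) → Flat (mk s e) → r (mk s e) ≡ cntW e s
    rank-of s e f = trans (r≡σ (mk s e)) (trans (σ-other (mk s e) F≢)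
        (rank-wheel s e (triples s e f) (≢true⇒≡false λ h →
        F≢ (cong₂ _++ⱽ_ (all-ones {n′} e (proj₂ (Full⇒ s e h))) (proj₁ (Full⇒ s e h))))))
      where F≢ = flat⇒≢Rim (mk s e) f

    -- The overlooked non-flat is now the rim itself, of weight 0. The rim minus one edge is a flat
    -- here, since restoring the edge reaches the relaxed rank of the rim.
    t-bad : ∀ F → fl F ≡ false → term F ≈ 𝟎
    t-bad = bits λ s e h i j → trans (cong (λ f → f i j) (term-mk s e)) (go s e h i j (okW e s) refl)
      where
      go : ∀ (s e : Bits) → fl (mk s e) ≡ false → ∀ i j b → okW e s ≡ b → whirl-term e s i j ≡ + 0
      go s e h i j false o = whirl-bad e s o i j
      go s e h i j true  o = found (isFlat-false M₀ (mk s e) Sₚ.⊆⊤ h) (Rim? (mk s e))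
        where
        found : (∃ λ x → x ∈ ⊤ × x ∉ mk s e × r (mk s e ∪ ⁅ x ⁆) ≤ r (mk s e)) →
            (mk s e ≡ Rim ⊎ mk s e ≢ Rim) → whirl-term e s i j ≡ + 0
        found _ (inj₁ q) = trans (cong (λ f → f i j)
            (trans (sym (term-mk s e)) (trans (cong term q) (term-mk ⊥ ⊤))))
            (whirl-full (⊤ {n}) (zerosV-⊤ n) i j)
        found (x , _ , x∉ , le) (inj₂ ne) = ⊥-elim (ℕₚ.<⇒≱
            (subst (λ c → ρ (mk s e) < c) (sym (ℕₚ.+-comm (ρ (mk s e)) 1)) ℕₚ.≤-refl)
            (ℕₚ.≤-trans (ℕₚ.+-monoˡ-≤ 1 (RankFunction.mono ρ-rankFunction {mk s e} {mk s e ∪ ⁅ x ⁆}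
            (Sₚ.p⊆p∪q ⁅ x ⁆))) (subst₂ _≤_ (trans (r≡σ (mk s e ∪ ⁅ x ⁆))
            (cong (λ b → ρ (mk s e ∪ ⁅ x ⁆) + bit b) is)) (trans (r≡σ (mk s e)) (σ-other (mk s e) ne)) le)))
          where
          le′ : ρ (mk s e ∪ ⁅ x ⁆) ≤ ρ (mk s e)
          le′ = ℕₚ.≤-trans (ρ≤σ (mk s e ∪ ⁅ x ⁆)) (subst₂ _≤_ (r≡σ (mk s e ∪ ⁅ x ⁆))
              (trans (r≡σ (mk s e)) (σ-other (mk s e) ne)) le)
          is : isRim (mk s e ∪ ⁅ x ⁆) ≡ true
          is = trans (cong isRim (proj₂ (proj₂ (exception s e (okW⇒triples s e o) x x∉
              (conn-if {mk s e} x le′))))) (==ˢ-refl Rim)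

    t-low : ∀ F → Flat F → Low (r F) (term F)
    t-low = bits λ s e f → subst (Low (r (mk s e))) (sym (term-mk s e))
        (subst (λ c → Low c (whirl-term e s)) (sym (rank-of s e f)) (whirl-low e s))

    t-high : ∀ F → Flat F → 0 < co F → ∀ i j → j +ᶻ + r F ≤ᶻ i → term F i j ≡ + 0
    t-high = bits λ s e f pos i j le → trans (cong (λ g → g i j) (term-mk s e))
        (whirl-high e s (triples⇒okW s e (triples s e f))
      (subst₂ _<_ (rank-of s e f) r-⊤ (ℕₚ.m∸n≢0⇒n<m (λ z → ℕₚ.<-irrefl (sym z) pos))) i j
          (subst (λ c → j +ᶻ + c ≤ᶻ i) (rank-of s e f) le))

    t-⊤ : term ⊤ ≈ αs (r ⊤) 𝟏
    t-⊤ i j = trans (cong (λ F → term F i j) (sym (replicate-++ n {n} true)))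
        (trans (cong (λ f → f i j) (term-mk ⊤ ⊤)) (trans (whirl-⊤ {n′} i j)
        (cong (λ c → αs c 𝟏 i j) (sym r-⊤))))

    t-sym : ∀ G → Flat G → ∃ λ p → Symmetric p × (∀ i j → Sup G (λ F → term F i j) ≡ αs (r G) p i j)
    t-sym = bits λ s e f → conclude s e (rank-of s e f) (whirl-sym e s (triples⇒okW s e (triples s e f)))
      where
      conclude : ∀ (s e : Bits) → r (mk s e) ≡ cntW e s → SymmetricUpTo {n′} (cntW e s)
          (SupW whirl-term e s) → ∃ λ p → Symmetric p ×
          (∀ i j → Sup (mk s e) (λ F → term F i j) ≡ αs (r (mk s e)) p i j)
      conclude s e eq (p , sp , h) = p , sp , λ i j → trans (Sup-mk whirl-term s e i j)
          (trans (h i j) (cong (λ z → αs z p i j) (sym eq)))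

    Z-whirl : ∀ k → Z P M₀ k ≡ Γ n (+ k) (+ n - + k)
    Z-whirl k = trans (Assembly.Z-formula r R loopless P kl term t-bad t-low t-high t-⊤ t-sym k)
      (trans (cong (λ N → Sup (⊥ {n + n}) (λ F → term F (+ k) (+ N - + k))) r-⊤)
      (trans (Sup-⊥-mk whirl-term (+ k) (+ n - + k)) (whirl-value k)))

-- Fans

nth-∷ʳ : ∀ {k} (v : Vec Bool k) y p → p ≤ k → nth (v ∷ʳ y) p ≡ nthd y v p
nth-∷ʳ []      y zero    le = refl
nth-∷ʳ (x ∷ v) y zero    le = refl
nth-∷ʳ (x ∷ v) y (suc p) le = nth-∷ʳ v y p (ℕₚ.≤-pred le)

replicate-∷ʳ : ∀ k (b : Bool) → replicate k b ∷ʳ b ≡ replicate (suc k) b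
replicate-∷ʳ zero    b = refl
replicate-∷ʳ (suc k) b = cong (b ∷_) (replicate-∷ʳ k b)

Sup-∷ʳ : ∀ {k} (g : Vec Bool k) b f → Sup (g ∷ʳ b) f ≡ Sup g (λ e → SupB b (λ y → f (e ∷ʳ y)))
Sup-∷ʳ []      b f = refl
Sup-∷ʳ (x ∷ g) b f = SupB-cong x (λ c → Sup-∷ʳ g b (f ∘ (c ∷_)))

Sup-swap : ∀ {k l} (g : Vec Bool k) (g′ : Vec Bool l) (f : Vec Bool k → Vec Bool l → ℤ) → Sup g
    (λ e → Sup g′ (λ s → f e s)) ≡ Sup g′ (λ s → Sup g (λ e → f e s))
Sup-swap []      g′ f = refl
Sup-swap (x ∷ g) g′ f = trans (SupB-cong x (λ b → Sup-swap g g′ (f ∘ (b ∷_))))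
    (sym (Sup-SupB g′ x (λ s b → Sup g (λ e → f (b ∷ e) s))))

admissible⁺ : ∀ {k} (e s : Vec Bool k) fin → (∀ p → p < k → nth e p ≡ true → nthd fin s
    (suc p) ≡ true → nth s p ≡ true) → Admissible (word e s) fin
admissible⁺ []       []       fin h = _
admissible⁺ (e ∷ es) (s ∷ ss) fin h = (λ a b → h 0 (s≤s z≤n) a (trans (sym (nxt-word es ss fin)) b)) ,
    admissible⁺ es ss fin (λ p lt → h (suc p) (s≤s lt))

sucpred : ∀ i → - + 1 +ᶻ (+ 1 +ᶻ i) ≡ i
sucpred = solve-∀

module FanZ (n′ : ℕ) (ed : Fin (suc n′ + n′) → ℕ × ℕ)
  (ed-rim   : ∀ (i : Fin n′) → ed (suc n′ ↑ʳ i) ≡ (suc (toℕ i) , suc (jx n′ (toℕ i))))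
  (ed-spoke : ∀ (i : Fin (suc n′)) → ed (i ↑ˡ n′) ≡ (0 , suc (toℕ i)))
  (P : Matroid → Poly) (kl : IsKL P) where

  private
    n = suc n′
    Bits = Vec Bool n
    Rims = Vec Bool n′

  mk : Bits → Rims → Subset (n + n′)
  mk s e = s ++ⱽ e

  open Spoked n′ n′ (n + n′) (ℕₚ.n≤1+n n′) (n ↑ʳ_) (_↑ˡ n′) ed ed-rim ed-spoke
    (λ x → Data.Sum.swap (↑-cover n n′ x)) mk (replicate-++ n false)
    (λ s e i → ++-∪ʳ s e i) (λ s e i → ++-∪ˡ s e i) (λ s e i → Vₚ.lookup-++ʳ s e i)
        (λ s e i → Vₚ.lookup-++ˡ s e i) (inj₁ ℕₚ.≤-refl)

  -- On a path, a missing rim edge cuts later positions from earlier ones except through the hub, so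
  -- the fan has no analogue of the rim minus one edge.
  no-gap : ∀ (s : Bits) (e : Rims) → Triples s e → ∀ p → p < n′ → ¬ Gap s e p
  no-gap s e t p p<n′ (ep , sp , sj , c) = separate s e (interval s (suc p) n)
      (rims , interval-spokes s {suc p} {n})
    (λ z → true≢false (trans z inside) (interval-below s {suc p} {n} {p} ℕₚ.≤-refl)) c
    where
    path : ∀ {q} → q < n′ → jx n′ q ≡ suc q
    path q<n′ = jx-path (λ eq → ℕₚ.<-irrefl eq q<n′)
    rims : ∀ q → q < n′ → nth e q ≡ true → interval s (suc p) n (suc q) ≡ interval s (suc p) n (suc (jx n′ q))
    rims q q<n′ eq = trans (interval-path s {suc p} {n} {q} (λ { refl → true≢false eq ep })
        (λ { refl → ℕₚ.<-irrefl refl q<n′ }) (trans (triple-eq s e t q<n′ eq) (cong (nth s) (path q<n′))))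
        (cong (λ z → interval s (suc p) n (suc z)) (sym (path q<n′)))
    inside : interval s (suc p) n (suc (jx n′ p)) ≡ true
    inside = trans (cong (λ z → interval s (suc p) n (suc z)) (path p<n′))
        (interval-in s {suc p} {n} {suc p} ℕₚ.≤-refl (s≤s p<n′) (subst (λ z → nth s z ≡ false) (path p<n′) sj))

  -- The hub is added as a further position with s = 1; the two rim edges x and y at it
  -- are summed over, but for a flat only x = s₀ and y = s_{n′} contribute.
  fanWord : Rims → Bits → Bool → Bool → Word
  fanWord e s x y = word (x ∷ (e ∷ʳ y)) (true ∷ s)

  entry : Word → Bi
  entry w = run w (at 0 𝟏) 0

  fan-term : Rims → Bits → Bi
  fan-term e s i j = SupB false (λ x → SupB false (λ y → entry (fanWord e s x y) i j))

  inner-e : ∀ (e : Rims) y q → q < n′ → nth (e ∷ʳ y) q ≡ nth e q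
  inner-e e y q q<n′ = trans (nth-∷ʳ e y q (ℕₚ.<⇒≤ q<n′)) (nthd-in y e q q<n′)

  last-e : ∀ (e : Rims) y → nth (e ∷ʳ y) n′ ≡ y
  last-e e y = trans (nth-∷ʳ e y n′ ℕₚ.≤-refl) (nthd-out y e n′ ℕₚ.≤-refl)

  inner-s : ∀ (s : Bits) q → q < n′ → nthd true s (suc q) ≡ nth s (jx n′ q)
  inner-s s q q<n′ = trans (nthd-in true s (suc q) (s≤s q<n′))
      (cong (nth s) (sym (jx-path (λ eq → ℕₚ.<-irrefl eq q<n′))))

  ok-hubˡ : ∀ x s → ok true x s ≡ true → x ≡ s
  ok-hubˡ true  true  h = refl
  ok-hubˡ false false h = refl

  ok-hubʳ : ∀ s y → ok s y true ≡ true → y ≡ s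
  ok-hubʳ true  true  h = refl
  ok-hubʳ false false h = refl

  okc⇒ : ∀ e s x y → okc (fanWord e s x y) true ≡ true → x ≡ nth s 0 × y ≡ nth s n′ × Triples s e
  okc⇒ e s@(_ ∷ _) x y h = ok-hubˡ x (nth s 0) (at-p 0 (s≤s z≤n)) ,
    ok-hubʳ (nth s n′) y (subst₂ (λ a b → ok (nth s n′) a b ≡ true) (last-e e y) (nthd-out true s n ℕₚ.≤-refl)
        (at-p n ℕₚ.≤-refl)) ,
    λ p p<n′ → subst₂ (λ a b → ok (nth s p) a b ≡ true) (inner-e e y p p<n′) (inner-s s p p<n′)
        (at-p (suc p) (s≤s (ℕₚ.m≤n⇒m≤1+n p<n′)))
    where at-p = okc⁻ (x ∷ (e ∷ʳ y)) (true ∷ s) true h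

  okc⇐ : ∀ e s → Triples s e → okc (fanWord e s (nth s 0) (nth s n′)) true ≡ true
  okc⇐ e s@(_ ∷ _) t = okc⁺ (nth s 0 ∷ (e ∷ʳ nth s n′)) (true ∷ s) true go
    where
    refl-hubˡ : ∀ s → ok true s s ≡ true
    refl-hubˡ true  = refl
    refl-hubˡ false = refl
    refl-hubʳ : ∀ s → ok s s true ≡ true
    refl-hubʳ true  = refl
    refl-hubʳ false = refl
    go : ∀ p → p < suc n → ok (nth (true ∷ s) p) (nth (nth s 0 ∷ (e ∷ʳ nth s n′)) p)
        (nthd true (true ∷ s) (suc p)) ≡ true
    go zero    _  = refl-hubˡ (nth s 0)
    go (suc p) lt with p Data.Nat.≟ n′
    ... | yes refl = subst₂ (λ a b → ok (nth s p) a b ≡ true) (sym (last-e e (nth s p)))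
        (sym (nthd-out true s (suc p) ℕₚ.≤-refl)) (refl-hubʳ (nth s p))
    ... | no p≢ = subst₂ (λ a b → ok (nth s p) a b ≡ true) (sym (inner-e e _ p p<)) (sym (inner-s s p p<))
        (t p p<)
      where p< = ℕₚ.≤∧≢⇒< (ℕₚ.≤-pred (ℕₚ.≤-pred lt)) p≢

  entry-bad : ∀ e s x y → okc (fanWord e s x y) true ≡ false → entry (fanWord e s x y) ≈ 𝟎
  entry-bad e s x y bad i j = run-bad (fanWord e s x y) true (at 0 𝟏) bad 0 i j

  fan-bad : ∀ e s → ¬ Triples s e → fan-term e s ≈ 𝟎
  fan-bad e s ¬t i j = cong₂ _+ᶻ_ (cong₂ _+ᶻ_ (z true true) (z true false))
      (cong₂ _+ᶻ_ (z false true) (z false false))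
    where
    z : ∀ x y → entry (fanWord e s x y) i j ≡ + 0
    z x y = entry-bad e s x y (≢true⇒≡false (λ h → ¬t (proj₂ (proj₂ (okc⇒ e s x y h))))) i j

  fan-flat : ∀ e s → fan-term e s ≈ entry (fanWord e s (nth s 0) (nth s n′))
  fan-flat e s i j = trans (pick (nth s 0) (λ x → SupB false (λ y → f x y))
      (λ x x≢ → cong₂ _+ᶻ_ (wrongˣ x true x≢) (wrongˣ x false x≢)))
      (pick (nth s n′) (f (nth s 0)) (wrongʸ (nth s 0)))
    where
    f : Bool → Bool → ℤ
    f x y = entry (fanWord e s x y) i j
    wrongˣ : ∀ x y → x ≢ nth s 0 → f x y ≡ + 0
    wrongˣ x y ne = entry-bad e s x y (≢true⇒≡false (λ h → ne (proj₁ (okc⇒ e s x y h)))) i j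
    wrongʸ : ∀ x y → y ≢ nth s n′ → f x y ≡ + 0
    wrongʸ x y ne = entry-bad e s x y (≢true⇒≡false (λ h → ne (proj₁ (proj₂ (okc⇒ e s x y h))))) i j
    pick : ∀ b (g : Bool → ℤ) → (∀ x → x ≢ b → g x ≡ + 0) → SupB false g ≡ g b
    pick true  g h = trans (cong (g true +ᶻ_) (h false (λ ()))) (ℤₚ.+-identityʳ _)
    pick false g h = trans (cong (_+ᶻ g false) (h true (λ ()))) (ℤₚ.+-identityˡ _)

  ρ-fan : ∀ s e → (∀ p → p < n′ → nth e p ≡ true → nth s (jx n′ p) ≡ true → nth s p ≡ true) → ρ (mk s e) ≡ count
      (nth s) n + count (rimBit s e) n′
  ρ-fan s e h = trans (cong (λ v → ρ (mk s v)) (sym (firsts-all e))) (ρ-rims s e h n′ ℕₚ.≤-refl ℕₚ.≤-refl)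

  -- The extra 1 belongs to the added hub position, whose letter counts whatever `y` is.
  cnt-fan : ∀ s e x y → x ∧ not (nth s 0) ≡ false → cnt (fanWord e s x y) true ≡ suc
      (count (nth s) n + count (rimBit s e) n′)
  cnt-fan s@(_ ∷ _) e x y hx = ℕₚ.+-cancelʳ-≡ 1 _ _
      (trans (cnt-count (x ∷ (e ∷ʳ y)) (true ∷ s) true) (cong (_+ 1)
    (cong₂ _+_ (count-shift (nth (true ∷ s)) n) (trans (count-shift g n)
        (cong₂ _+_ (cong bit hx) (cong₂ _+_ (cong bit last) (count-cong n′ inner)))))))
    where
    g : ℕ → Bool
    g p = nth (x ∷ (e ∷ʳ y)) p ∧ not (nthd true (true ∷ s) (suc p))
    last : g (suc n′) ≡ false
    last = trans (cong (nth (e ∷ʳ y) n′ ∧_) (cong not (nthd-out true s n ℕₚ.≤-refl))) (𝔹ₚ.∧-zeroʳ _)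
    inner : ∀ p → p < n′ → g (suc p) ≡ rimBit s e p
    inner p lt = cong₂ (λ a b → a ∧ not b) (inner-e e y p lt) (inner-s s p lt)

  r : Subset (n + n′) → ℕ
  r = rkFromIndep forest

  R : RankFunction r
  R = RankFunction-≗ rank≡ρ ρ-rankFunction

  loopless : ∀ e → r ⁅ e ⁆ ≡ 1
  loopless e = trans (rank≡ρ ⁅ e ⁆) (ρ-loopless e)

  open Contractions r R loopless

  bits : ∀ {Q : Subset (n + n′) → Set} → (∀ s e → Q (mk s e)) → ∀ F → Q F
  bits {Q} h F = subst Q (Vₚ.take++drop≡id n F) (h (take n F) (drop n F))

  -- The index shift divides by the factor α of the added hub position.
  term : Subset (n + n′) → Bi
  term F i j = fan-term (drop n F) (take n F) (+ 1 +ᶻ i) j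

  term-mk : ∀ s e i j → term (mk s e) i j ≡ fan-term e s (+ 1 +ᶻ i) j
  term-mk s e i j = cong₂ (λ a b → fan-term a b (+ 1 +ᶻ i) j) (drop-++ s e) (take-++ s e)

  triples : ∀ s e → Flat (mk s e) → Triples s e
  triples s e f = closed⇒triples s e (flat⇒closed (λ x x∉ → subst₂ _<_ (rank≡ρ _) (rank≡ρ _) (f x x∉)))

  rank-of : ∀ s e → Triples s e → ∀ x y → x ∧ not (nth s 0) ≡ false → cnt (fanWord e s x y) true ≡ suc
      (r (mk s e))
  rank-of s e t x y hx = trans (cnt-fan s e x y hx)
      (cong suc (sym (trans (rank≡ρ (mk s e)) (ρ-fan s e
      (λ p p<n′ ep sj → trans (triple-eq s e t p<n′ ep) sj)))))

  hub-bit : ∀ b → b ∧ not b ≡ false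
  hub-bit true  = refl
  hub-bit false = refl

  triples-⊤ : Triples ⊤ ⊤
  triples-⊤ p p<n′ rewrite nth-⊤ n p (ℕₚ.m≤n⇒m≤1+n p<n′) | nth-⊤ n′ p p<n′ | nth-⊤ n (jx n′ p)
      (jx-< (ℕₚ.m≤n⇒m≤1+n p<n′)) = refl

  r-⊤ : r ⊤ ≡ n
  r-⊤ = trans (cong r (sym (replicate-++ n {n′} true)))
      (trans (rank≡ρ _) (trans (ρ-fan ⊤ ⊤ (λ p p<n′ _ _ → nth-⊤ n p (ℕₚ.m≤n⇒m≤1+n p<n′)))
    (trans (cong₂ _+_ (count-every n (λ p lt → nth-⊤ n p lt))
        (count-none n′ (λ p lt → trans (cong (nth (⊤ {n′}) p ∧_)
        (cong not (nth-⊤ n (jx n′ p) (jx-< (ℕₚ.m≤n⇒m≤1+n lt))))) (𝔹ₚ.∧-zeroʳ _)))) (ℕₚ.+-identityʳ n))))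

  t-bad : ∀ F → fl F ≡ false → term F ≈ 𝟎
  t-bad = bits λ s e h i j → trans (term-mk s e i j)
      (fan-bad e s (λ t → found s e t (isFlat-false M₀ (mk s e) Sₚ.⊆⊤ h)) (+ 1 +ᶻ i) j)
    where
    found : ∀ s e → Triples s e → (∃ λ x → x ∈ ⊤ × x ∉ mk s e × r (mk s e ∪ ⁅ x ⁆) ≤ r (mk s e)) → Empty
    found s e t (x , _ , x∉ , le) = conn (K (mk s e) x) refl
      where
      le′ : ρ (mk s e ∪ ⁅ x ⁆) ≤ ρ (mk s e)
      le′ = subst₂ _≤_ (rank≡ρ _) (rank≡ρ _) le
      conn : ∀ b → K (mk s e) x ≡ b → Empty
      conn true  k = let i , _ , g = triples⇒gap s e t x x∉ (K⇒Conn {mk s e} x k) in no-gap s e t (toℕ i) (Finₚ.toℕ<n i) g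
      conn false k = ℕₚ.<⇒≱ (subst (ρ (mk s e) <_) (sym
          (trans (ρ-add (mk s e) x) (trans (cong (λ b → ρ (mk s e) + (if b then 0 else 1)) k)
          (ℕₚ.+-comm (ρ (mk s e)) 1)))) ℕₚ.≤-refl) le′

  t-low : ∀ F → Flat F → Low (r F) (term F)
  t-low = bits λ s e f i j lt → trans (term-mk s e i j)
      (trans (fan-flat e s (+ 1 +ᶻ i) j) (low s e (triples s e f) (+ 1 +ᶻ i) j (ℤₚ.+-monoʳ-< (+ 1) lt)))
    where
    low : ∀ s e → Triples s e → Low (suc (r (mk s e))) (entry (fanWord e s (nth s 0) (nth s n′)))
    low s e t = subst (λ c → Low c (entry w)) (rank-of s e t (nth s 0) (nth s n′) (hub-bit (nth s 0)))
        (run-low w true 0 (at 0 𝟏) (λ h → Low-at true h 0) 0)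
      where w = fanWord e s (nth s 0) (nth s n′)

  t-high : ∀ F → Flat F → 0 < co F → ∀ i j → j +ᶻ + r F ≤ᶻ i → term F i j ≡ + 0
  t-high = bits λ s e f pos i j le → trans (term-mk s e i j)
      (trans (fan-flat e s (+ 1 +ᶻ i) j) (high s e (triples s e f) pos i j le))
    where
    high : ∀ s e → Triples s e → 0 < co (mk s e) → ∀ i j → j +ᶻ + r (mk s e) ≤ᶻ i → entry
        (fanWord e s (nth s 0) (nth s n′)) (+ 1 +ᶻ i) j ≡ + 0
    high s e t pos i j le = subst (λ d → BndS d (run w (at 0 𝟏))) (ℕₚ.+-identityʳ (ones w))
        (run-bnd w (at-bnd 0)) 0 (+ 1 +ᶻ i) j
        (ℤₚ.≤-<-trans (ℤₚ.≤-trans (ℤₚ.+-monoʳ-≤ j (Data.Integer.+≤+ ones≤)) le)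
            (subst (_<ᶻ + 1 +ᶻ i) (ℤₚ.+-identityˡ i) (ℤₚ.+-monoˡ-< i {+ 0} {+ 1} (Data.Integer.+<+ (s≤s z≤n)))))
      where
      w = fanWord e s (nth s 0) (nth s n′)
      c≡ : cnt w true ≡ suc (r (mk s e))
      c≡ = rank-of s e t (nth s 0) (nth s n′) (hub-bit (nth s 0))
      cnt< : cnt w true < Data.List.length w
      cnt< = subst₂ _<_ (sym c≡) (sym (length-word (nth s 0 ∷ (e ∷ʳ nth s n′)) (true ∷ s)))
          (s≤s (subst (r (mk s e) <_) r-⊤ (ℕₚ.m∸n≢0⇒n<m (λ z → ℕₚ.<-irrefl (sym z) pos))))
      -- The word is cyclic, because the final bit `true` is the spoke bit of the added hub position
      -- at its head.
      ones≤ : ones w ≤ r (mk s e)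
      ones≤ = ℕₚ.≤-pred (subst (ones w <_) c≡ (cyclic-strict (nth s 0) true (word (e ∷ʳ nth s n′) s)
          (okc⇐ e s t) refl cnt<))

  shift-αs : ∀ c p i j → αs (suc c) p (+ 1 +ᶻ i) j ≡ αs c p i j
  shift-αs c p i j = cong (λ z → αs c p z j) (sucpred i)

  t-⊤ : term ⊤ ≈ αs (r ⊤) 𝟏
  t-⊤ i j = trans (cong (λ F → term F i j) (sym (replicate-++ n {n′} true)))
      (trans (term-mk ⊤ ⊤ i j) (trans (fan-flat ⊤ ⊤ (+ 1 +ᶻ i) j)
    (trans (cong (λ w → entry w (+ 1 +ᶻ i) j) word≡)
        (trans (run-ones {n′} (suc n) (at 0 𝟏) (+ 1 +ᶻ i) j)
        (trans (shift-αs n 𝟏 i j) (cong (λ c → αs c 𝟏 i j) (sym r-⊤)))))))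
    where
    word≡ : fanWord ⊤ ⊤ (nth (⊤ {n}) 0) (nth (⊤ {n}) n′) ≡ word (⊤ {suc n}) ⊤
    word≡ = cong (λ e → word (true ∷ e) (⊤ {suc n}))
        (trans (cong (⊤ {n′} ∷ʳ_) (nth-⊤ n n′ ℕₚ.≤-refl)) (replicate-∷ʳ n′ true))

  Sup-fan : ∀ s e i j → Sup (mk s e) (λ F → term F i j) ≡ runG (fanWord e s false false) (at 0 𝟏) 0 (+ 1 +ᶻ i) j
  Sup-fan s e i j =
    trans (Sup-++ s e (λ F → term F i j))
    (trans (Sup-cong s (λ s′ → Sup-cong e (λ e′ → term-mk s′ e′ i j)))
    (trans (Sup-swap s e (λ s′ e′ → fan-term e′ s′ i₁ j))
    (trans (Sup-cong e (λ e′ → Sup-SupB s false (λ s′ x → SupB false (λ y → f x e′ y s′))))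
    (trans (Sup-SupB e false (λ e′ x → Sup s (λ s′ → SupB false (λ y → f x e′ y s′))))
    (trans (SupB-cong false (λ x → trans (Sup-cong e (λ e′ → Sup-SupB s false (λ s′ y → f x e′ y s′)))
        (sym (Sup-∷ʳ e false (λ e″ → Sup s (λ s′ → run (word (x ∷ e″) (true ∷ s′)) (at 0 𝟏) 0 i₁ j))))))
           (Sup-run (false ∷ (e ∷ʳ false)) (true ∷ s) (at 0 𝟏) 0 i₁ j))))))
    where
    i₁ = + 1 +ᶻ i
    f : Bool → Rims → Bool → Bits → ℤ
    f x e′ y s′ = entry (fanWord e′ s′ x y) i₁ j

  -- The word already starts and ends at the hub, so no trace and no rotation are involved.
  t-sym : ∀ G → Flat G → ∃ λ p → Symmetric p × (∀ i j → Sup G (λ F → term F i j) ≡ αs (r G) p i j)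
  t-sym = bits λ s e f → conclude s e (triples s e f)
      (hub-run false (word (e ∷ʳ false) s) (adm s e (triples s e f)))
    where
    adm : ∀ s e → Triples s e → Admissible (fanWord e s false false) true
    adm s e t = (λ ()) , admissible⁺ (e ∷ʳ false) s true (λ p p<n ep sj → case p Data.Nat.≟ n′ of λ
      { (yes refl) → true≢false ep (last-e e false)
      ; (no p≢) → let p< = ℕₚ.≤∧≢⇒< (ℕₚ.≤-pred p<n) p≢ in
                  trans (triple-eq s e t p< (trans (sym (inner-e e false p p<)) ep))
                      (trans (sym (inner-s s p p<)) sj) })
    conclude : ∀ s e → Triples s e → (∃ λ p → Symmetric p ×
        (runG (fanWord e s false false) (at 0 𝟏) 0 ≈ αs (cnt (fanWord e s false false) true) p)) →
               ∃ λ p → Symmetric p × (∀ i j → Sup (mk s e) (λ F → term F i j) ≡ αs (r (mk s e)) p i j)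
    conclude s e t (p , sp , h) = p , sp , λ i j → trans (Sup-fan s e i j) (trans (h (+ 1 +ᶻ i) j)
      (trans (cong (λ c → αs c p (+ 1 +ᶻ i) j) (rank-of s e t false false refl)) (shift-αs (r (mk s e)) p i j)))

  Z-fan : ∀ k → Z P M₀ k ≡ Λ n (+ k) (+ n - + k)
  Z-fan k = trans (Assembly.Z-formula r R loopless P kl term t-bad t-low t-high t-⊤ t-sym k)
    (trans (cong (λ N → Sup (⊥ {n + n′}) (λ F → term F (+ k) (+ N - + k))) r-⊤)
    (trans (cong (λ G → Sup G (λ F → term F (+ k) j)) (sym (replicate-++ n {n′} false)))
    (trans (Sup-fan ⊥ ⊥ (+ k) j)
    (trans (cong (λ e → runG (word (false ∷ e) (true ∷ ⊥ {n})) (at 0 𝟏) 0 (+ suc k) j) (replicate-∷ʳ n′ false))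
    (trans (cong≋ (runG-linear (word (⊥ {n}) ⊥)) (cong≋ (U-linear false false)
        (λ { zero i j → refl ; (suc h) i j → refl })) 0 (+ suc k) j)
    (trans (runG-rim (⊥ {n}) (𝐓 (at 0 𝟏)) 0 (+ suc k) j)
    (trans (runU-pow false (⊥ {n}) (𝐓 (at 0 𝟏)) 0 (+ suc k) j)
    (trans (cong₂ (λ a b → αs a (pow 𝐓 b (𝐓 (at 0 𝟏)) 0) (+ suc k) j) (onesV-⊥ n) (zerosV-⊥ n))
    (trans (cong (λ y → y 0 (+ suc k) j) (pow-comm 𝐓 n (at 0 𝟏)))
    -- The α from `hub₀` absorbs the index shift in `term`, and walks from 0 to 0 remain.
    (trans (hub₀ n 𝟏 (+ suc k) j)
           (walk-from-0 n 0 (+ k) j (alg (+ n) (+ k)))))))))))))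
    where
    j = + n - + k
    alg : ∀ n k → (k +ᶻ (n - k)) +ᶻ + 0 ≡ n
    alg = solve-∀

-- The edge lists of fans and wheels

data _at_is_ {X : Set} : List X → ℕ → X → Set where
  first : ∀ {x l} → (x ∷ l) at 0 is x
  later : ∀ {x y l p} → l at p is y → (x ∷ l) at suc p is y

at-++ˡ : ∀ {X : Set} {l l′ : List X} {p x} → l at p is x → (l ++ l′) at p is x
at-++ˡ first     = first
at-++ˡ (later h) = later (at-++ˡ h)

at-++ʳ : ∀ {X : Set} (l : List X) {l′ p x} → l′ at p is x → (l ++ l′) at (length l + p) is x
at-++ʳ []      h = h
at-++ʳ (y ∷ l) h = later (at-++ʳ l h)

at-applyUpTo : ∀ {X : Set} (f : ℕ → X) {n p} → p < n → applyUpTo f n at p is f p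
at-applyUpTo f {suc n} {zero}  lt = first
at-applyUpTo f {suc n} {suc p} lt = later (at-applyUpTo (f ∘ suc) (ℕₚ.≤-pred lt))

at-upTo : ∀ {X : Set} (f : ℕ → X) {n p} → p < n → map f (upTo n) at p is f p
at-upTo f {n} lt = subst (λ l → l at _ is _) (sym (Lₚ.map-applyUpTo id f n)) (at-applyUpTo f lt)

length-upTo : ∀ {X : Set} (f : ℕ → X) n → length (map f (upTo n)) ≡ n
length-upTo f n = trans (Lₚ.length-map f (upTo n)) (Lₚ.length-upTo n)

Fun : ℕ → Set
Fun m = Fin m → ℕ × ℕ

-- The length of an edge list is only propositionally a sum, so the edge function is transported to
-- the index type expected by the graph modules.
reindex : ∀ (l : List (ℕ × ℕ)) {m} → length l ≡ m → Fun m
reindex l eq = subst Fun eq (Data.List.lookup l)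

reindex-at : ∀ (l : List (ℕ × ℕ)) {m} (eq : length l ≡ m)
    (i : Fin m) {p x} → toℕ i ≡ p → l at p is x → reindex l eq i ≡ x
reindex-at l refl i refl h = go l i h
  where
  go : ∀ (l : List (ℕ × ℕ)) (i : Fin (length l)) {x} → l at toℕ i is x → Data.List.lookup l i ≡ x
  go (x ∷ l) zero    first     = refl
  go (x ∷ l) (suc i) (later h) = go l i h

rimOf : ∀ {m} → Fun m → Subset m
rimOf ed = Data.Vec.tabulate (λ e → not (proj₁ (ed e) ≡ᵇ 0) ∧ not (proj₂ (ed e) ≡ᵇ 0))

graphicᴱ whirlᴱ : ∀ m → ℕ → Fun m → Matroid
graphicᴱ m nv ed = mkMatroid m ⊤ (rkFromIndep (Edges.forest nv ed))
whirlᴱ m nv ed = mkMatroid m ⊤ (rkFromIndep (λ A → Edges.forest nv ed A ∨ (A ==ˢ rimOf ed)))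

reindex-matroid : ∀ (F : ∀ m → ℕ → Fun m → Matroid) nv l {m} (eq : length l ≡ m) → F (length l) nv
    (Data.List.lookup l) ≡ F m nv (reindex l eq)
reindex-matroid F nv l refl = refl

module _ (P : Matroid → Poly) (kl : IsKL P) where

  Z-fan-graph : ∀ n′ k → Z P (graphic (fan (suc n′))) k ≡ Λ (suc n′) (+ k) (+ suc n′ - + k)
  Z-fan-graph n′ k = trans (cong (λ M → Z P M k) (reindex-matroid graphicᴱ (suc n) l eq))
      (FanZ.Z-fan n′ (reindex l eq) ed-rim ed-spoke P kl k)
    where
    n = suc n′
    spokes = map (λ i → (0 , suc i)) (upTo n)
    path = map (λ i → (suc i , suc (suc i))) (upTo n′)
    l = spokes ++ path
    eq : length l ≡ n + n′
    eq = trans (Lₚ.length-++ spokes) (cong₂ _+_ (length-upTo (λ i → (0 , suc i)) n)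
        (length-upTo (λ i → (suc i , suc (suc i))) n′))
    ed-rim : ∀ i → reindex l eq (n ↑ʳ i) ≡ (suc (toℕ i) , suc (jx n′ (toℕ i)))
    ed-rim i = trans (reindex-at l eq (n ↑ʳ i) (trans (Finₚ.toℕ-↑ʳ n i)
        (cong (λ z → z + toℕ i) (sym (length-upTo (λ i → (0 , suc i)) n))))
        (at-++ʳ spokes (at-upTo (λ i → (suc i , suc (suc i))) (Finₚ.toℕ<n i))))
                     (cong (λ z → (suc (toℕ i) , suc z)) (sym (jx-path (λ e → ℕₚ.<-irrefl e (Finₚ.toℕ<n i)))))
    ed-spoke : ∀ i → reindex l eq (i ↑ˡ n′) ≡ (0 , suc (toℕ i))
    ed-spoke i = reindex-at l eq (i ↑ˡ n′) (Finₚ.toℕ-↑ˡ i n′)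
        (at-++ˡ (at-upTo (λ i → (0 , suc i)) (Finₚ.toℕ<n i)))

  module WheelEdges (n′ : ℕ) where
    n = suc n′
    path spokes l : List (ℕ × ℕ)
    path = map (λ i → (suc i , suc (suc i))) (upTo n′)
    spokes = map (λ i → (0 , suc i)) (upTo n)
    l = path ++ (n , 1) ∷ spokes

    len : length path ≡ n′
    len = length-upTo (λ i → (suc i , suc (suc i))) n′

    eq : length l ≡ n + n
    eq = trans (Lₚ.length-++ path) (trans (cong₂ (λ a b → a + suc b) len (length-upTo (λ i → (0 , suc i)) n))
        (ℕₚ.+-suc n′ n))

    ed : Fun (n + n)
    ed = reindex l eq

    ed-rim : ∀ i → ed (i ↑ˡ n) ≡ (suc (toℕ i) , suc (jx n′ (toℕ i)))
    ed-rim i with toℕ i Data.Nat.≟ n′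
    ... | yes e = trans (reindex-at l eq (i ↑ˡ n) (trans (Finₚ.toℕ-↑ˡ i n)
        (trans e (trans (sym len) (sym (ℕₚ.+-identityʳ _))))) (at-++ʳ path first))
                        (cong₂ _,_ (cong suc (sym e)) (cong suc (sym (trans (cong (jx n′) e) (jx-last n′)))))
    ... | no ne = trans (reindex-at l eq (i ↑ˡ n) (Finₚ.toℕ-↑ˡ i n)
        (at-++ˡ (at-upTo (λ i → (suc i , suc (suc i))) (ℕₚ.≤∧≢⇒< (ℕₚ.≤-pred (Finₚ.toℕ<n i)) ne))))
                        (cong (λ z → (suc (toℕ i) , suc z)) (sym (jx-path ne)))

    ed-spoke : ∀ i → ed (n ↑ʳ i) ≡ (0 , suc (toℕ i))
    ed-spoke i = reindex-at l eq (n ↑ʳ i) (trans (Finₚ.toℕ-↑ʳ n i)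
        (trans (sym (ℕₚ.+-suc n′ (toℕ i))) (cong (λ z → z + suc (toℕ i)) (sym len))))
        (at-++ʳ path (later (at-upTo (λ i → (0 , suc i)) (Finₚ.toℕ<n i))))

    rim≡ : rimOf ed ≡ (⊤ {n}) ++ⱽ ⊥
    rim≡ = trans (Vₚ.tabulate-cong bit≡) (Vₚ.tabulate∘lookup ((⊤ {n}) ++ⱽ ⊥))
      where
      bit≡ : ∀ x → not (proj₁ (ed x) ≡ᵇ 0) ∧ not (proj₂ (ed x) ≡ᵇ 0) ≡ lookup ((⊤ {n}) ++ⱽ ⊥) x
      bit≡ x with ↑-cover n n x
      ... | inj₁ (i , refl) = trans (cong (λ e → not (proj₁ e ≡ᵇ 0) ∧ not (proj₂ e ≡ᵇ 0)) (ed-rim i))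
          (sym (trans (Vₚ.lookup-++ˡ (⊤ {n}) ⊥ i) (∈⇒lookup (Sₚ.∈⊤ {x = i}))))
      ... | inj₂ (i , refl) = trans (cong (λ e → not (proj₁ e ≡ᵇ 0) ∧ not (proj₂ e ≡ᵇ 0)) (ed-spoke i))
          (sym (trans (Vₚ.lookup-++ʳ (⊤ {n}) ⊥ i) (∉⇒lookup {A = ⊥ {n}} {i} Sₚ.∉⊥)))

  Z-wheel-graph : ∀ n′ → 1 ≤ n′ → ∀ k → Z P (graphic (wheel (suc n′))) k ≡ Γ (suc n′) (+ k)
      (+ suc n′ - + k) - Λ n′ (predᶻ (+ k)) (predᶻ (+ suc n′ - + k))
  Z-wheel-graph n′ 1≤ k = trans (cong (λ M → Z P M k) (reindex-matroid graphicᴱ (suc (suc n′)) l eq))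
      (WheelZ.Wheel.Z-wheel n′ 1≤ ed ed-rim ed-spoke P kl k)
    where open WheelEdges n′

  Z-whirl-matroid : ∀ n′ → 1 ≤ n′ → ∀ k → Z P (whirl (suc n′)) k ≡ Γ (suc n′) (+ k) (+ suc n′ - + k)
  Z-whirl-matroid n′ 1≤ k =
    trans (cong (λ M → Z P M k) (trans (reindex-matroid whirlᴱ (suc n) l eq)
             (cong (λ X → mkMatroid (n + n) ⊤ (rkFromIndep (λ A → Edges.forest (suc n) ed A ∨ (A ==ˢ X))))
                 rim≡)))
          (WheelZ.Whirl.Z-whirl n′ 1≤ ed ed-rim ed-spoke P kl k)
    where open WheelEdges n′

theorem1p6 : (P : Matroid → Poly) → IsKL P →
    ((n : ℕ) → 1 ≤ n → (k : ℕ) →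
    + (suc n) * Z P (graphic (fan n)) k ≡ + ((suc n C suc k) *ℕ (suc n C k)))
    × ((n : ℕ) → 3 ≤ n → (k : ℕ) →
    + n * Z P (graphic (wheel n)) k
    ≡ + n * (choose n (+ k) * choose n (+ k)) - + 2 * (choose n (+ suc k) * choose n (+ k - + 1)))
    × ((n : ℕ) → 3 ≤ n → (k : ℕ) →
    Z P (whirl n) k ≡ choose n (+ k) * choose n (+ k))
theorem1p6 P kl = fans , wheels , whirls
  where
  fans : (n : ℕ) → 1 ≤ n → (k : ℕ) → + (suc n) * Z P (graphic (fan n)) k ≡ + ((suc n C suc k) *ℕ (suc n C k))
  fans (suc n′) _ k = trans (cong (+ suc (suc n′) *_) (Z-fan-graph P kl n′ k)) (fan-closed (suc n′) k)

  wheels : (n : ℕ) → 3 ≤ n → (k : ℕ) → + n * Z P (graphic (wheel n)) k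
           ≡ + n * (choose n (+ k) * choose n (+ k)) - + 2 * (choose n (+ suc k) * choose n (+ k - + 1))
  wheels (suc n′) (s≤s 2≤n′) k =
    trans (cong (+ n *_) (Z-wheel-graph P kl n′ (ℕₚ.≤-trans (s≤s z≤n) 2≤n′) k))
    (trans (alg (+ n) (Γ n (+ k) (+ n - + k)) (Λ n′ (predᶻ (+ k)) (predᶻ (+ n - + k))))
    (cong₂ _-_ (cong (+ n *_) (Γ-square n k))
               (trans (rim-closed n′ k) (cong (λ i → + 2 * (choose n (+ suc k) * choose n i))
                   (ℤₚ.+-comm (- + 1) (+ k))))))
    where
    n = suc n′
    alg : ∀ n a b → n * (a - b) ≡ n * a - n * b
    alg = solve-∀

  whirls : (n : ℕ) → 3 ≤ n → (k : ℕ) → Z P (whirl n) k ≡ choose n (+ k) * choose n (+ k)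
  whirls (suc n′) (s≤s 2≤n′) k = trans (Z-whirl-matroid P kl n′ (ℕₚ.≤-trans (s≤s z≤n) 2≤n′) k)
      (Γ-square (suc n′) k)
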